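{- Let $k$ be an even positive integer and $t \ge 2$ an integer. Then for every integer $r$ satisfying $r \ge t+(k^3 \cdot t!)^{1/t}$, the limit $\lim_{n \to \infty} n^{ -t} f^{(r)}(n;k(r-t)+t,k)$ exists and equals $\frac{1}{t!} \binom{r}{t}^{ -1}$.
   Context: An $r$-graph is an $r$-uniform hypergraph. An $(s,k)$-configuration in an $r$-graph is a collection of $k$ edges spanning at most $s$ vertices. $f^{(r)}(n;s,k)$ denotes the maximum number of edges in an $n$-vertex $r$-graph containing no $(s,k)$-configuration. -}

module Defs where

open import Data.Nat using (ℕ; zero; suc; _≤_; _^_; _*_; _+_; _∸_; _!)
open import Data.Nat.Combinatorics using (_C_)
open import Data.Integer using (+_)
open import Data.Rational using (ℚ; 0ℚ; _/_; _-_; ∣_∣; _<_)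
open import Data.Fin.Subset using (Subset; ⋃) renaming (∣_∣ to size)
open import Data.List using (List; length)
open import Data.List.Relation.Unary.All using (All)
open import Data.List.Relation.Unary.Unique.Propositional using (Unique)
open import Data.List.Membership.Propositional using (_∈_)
open import Data.Product using (Σ; _×_; ∃)
open import Relation.Nullary using (¬_)
open import Relation.Binary.PropositionalEquality using (_≡_)

record RGraph (r n : ℕ) : Set where
  field
    edges   : List (Subset n)
    distinct : Unique edges
    uniform : All (λ e → size e ≡ r) edges
open RGraph public

e : ∀ {r n} → RGraph r n → ℕ
e H = length (edges H)

IsConfig : ∀ {r n} → (s k : ℕ) → RGraph r n → List (Subset n) → Set
IsConfig s k H C =
  Unique C × All (λ x → x ∈ edges H) C × length C ≡ k × size (⋃ C) ≤ s

ConfigFree : ∀ {r n} → (s k : ℕ) → RGraph r n → Set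
ConfigFree s k H = ¬ Σ (List _) (λ C → IsConfig s k H C)

IsF : (r n s k m : ℕ) → Set
IsF r n s k m =
  Σ (RGraph r n) (λ H → ConfigFree s k H × e H ≡ m)
  × ((H : RGraph r n) → ConfigFree s k H → e H ≤ m)

-- a / b as a rational; only used with b ≥ 1 (b = 0 gives 0 by convention).
_÷ℕ_ : ℕ → ℕ → ℚ
a ÷ℕ zero = 0ℚ
a ÷ℕ suc b = (+ a) / suc b

Pos : ℚ → Set
Pos q = 0ℚ < q

ConvergesTo : (ℕ → ℚ) → ℚ → Set
ConvergesTo a L = (ε : ℚ) → Pos ε → ∃ λ N → (n : ℕ) → N ≤ n → ∣ a n - L ∣ < ε

{-# OPTIONS --safe #-}
-- Write d = r - t and q = C(r, t); a list of j edges is dense if it spans at most j d + t vertices.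
--
-- Upper bound. Call two or three edges a gadget if they span fewer vertices than a chain of edges each of which meets
-- the union of the previous ones in t vertices. Gadgets through a common (t - 1)-set concatenate to a configuration, so
-- deleting a maximal disjoint family of gadgets costs O(n^(t-1)) edges. In the rest, a t-set T lying in at least two
-- edges e, e' is charged to the t-subsets of e ∪ e' contained in neither. Since d^t ≥ k^3 t!, at least k^2 of these lie
-- in no edge, and since k is even no t-set is charged more than k times. Hence e(H) q ≤ C(n, t) + O(n^(t-1)).
--
-- Lower bound. Run a random greedy process in which an edge o carries a weight W o and is accepted with probability
-- proportional to it. Accepting o kills the edges that share t vertices with o or complete a dense list of at most k
-- edges, and the weight of a surviving edge is multiplied by 1 + κ, where κ was its probability of dying. So the total
-- weight is a martingale up to edges that are dropped, either because they were endangered too often by dense lists or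
-- because the weight Y T of the edges through some t-set T exceeds its trajectory ŷ, which grows like a solution
-- of y' = y². The drops are controlled by a quadratic potential of Y - ŷ. Its variance, and the correlation between the
-- edges of a dense list, are governed by lists in which one edge kills two others; by submodularity of the number of
-- spanned vertices these are rarer by a factor n. Expectations are finite sums over the outcomes of each step.
module Submission where

open import Data.Bool using (Bool; true; false; _∧_; _∨_; not)
open import Data.Empty using (⊥-elim)
open import Data.List using (List; []; _∷_; _++_; length; map; concat; take; filter)
open import Data.List.Membership.Propositional using (_∈_)
open import Data.List.Membership.Propositional.Properties using (∈-++⁺ˡ; ∈-++⁺ʳ; ∈-++⁻; ∈-map⁺; ∈-map⁻; ∈-filter⁺; ∈-filter⁻)
open import Data.List.Properties using (length-++)
open import Data.List.Relation.Unary.All as All using (All; []; _∷_)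
open import Data.List.Relation.Unary.AllPairs using (AllPairs; []; _∷_)
open import Data.List.Relation.Unary.Any using (here; there)
open import Data.List.Relation.Unary.Unique.Propositional using (Unique)
open import Data.Maybe using (Maybe; just; nothing)
open import Data.Nat as ℕ using (ℕ; zero; suc)
import Data.Nat.Properties as ℕ
open import Data.Nat.Tactic.RingSolver using (solve-∀)
open import Data.Product using (_×_; _,_; proj₁; proj₂; ∃; Σ)
open import Data.Rational using (ℚ; 0ℚ; 1ℚ)
open import Data.Sum using (_⊎_; inj₁; inj₂)
open import Relation.Binary.Definitions using (DecidableEquality)
open import Relation.Binary.PropositionalEquality
open import Relation.Nullary using (¬_; Dec; yes; no)
open import Relation.Nullary.Decidable using (⌊_⌋; _×-dec_)

-- The count is right because the total weight stays near N, the number of all r-sets, while the `I`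
-- steps of rate ρ accept about τ N edges with τ = θ / D, where D is the degree of a t-set; and N /
-- D = C(n, t) / q. But τ cannot be pushed to 1 / D, where the solution of y' = y² starting from D
-- blows up: θ = p / (p + 2) keeps degrees below (p + 2) D and all weights below a constant K.
--
-- The weight lost to dense lists is of the same order N as the main term. So each edge gets a
-- budget `cap` of such risk, and the loss is only a fraction of order 1 / `cap`. As K is
-- exponential in `cap`, the leading coefficient of this loss must be free of K; hence the detour
-- through expectations of products of weights instead of bounding each weight by K. The constants
-- are chosen in the order p, `cap`, K, L, n.
--
-- In the upper bound k² arises as k times k: degrees are at most k and each t-set is charged at
-- most k times, so k² uncovered targets for every t-set of degree at least two cancel its excess.

-- Rational arithmetic and finite weighted sums.

module Q where
  open import Level using (0ℓ)
  open import Algebra.Bundles using (CommutativeRing; RawRing)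
  open import Algebra.Structures using (IsCommutativeRing)
  import Algebra.Solver.Ring as RingSolver
  import Algebra.Solver.Ring.AlmostCommutativeRing as ACR
  open import Data.Rational as ℚ using (_≤_; _<_; _≤?_; positive; nonNegative)
  import Data.Rational.Properties as ℚ
  open import Data.Rational.Properties using (≤-refl; ≤-reflexive; ≤-trans; ≤-antisym; ≤-total; <⇒≤; ≰⇒>; <-irrefl; <-≤-trans; _≟_)
  open import Function using (_∘_)
  open import Relation.Nullary using (isYes)

  infixl 7 _*_
  infixl 6 _+_ _-_
  infix 8 -_

  -- The operations are opaque so that unification treats them as rigid.
  opaque
    _+_ : ℚ → ℚ → ℚ
    _+_ = ℚ._+_

    _*_ : ℚ → ℚ → ℚ
    _*_ = ℚ._*_

    -_ : ℚ → ℚ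
    -_ = ℚ.-_

  _-_ : ℚ → ℚ → ℚ
  a - b = a + (- b)

  private variable
    a b c x y z : ℚ

  opaque
    unfolding _+_ _*_ -_

    +≡ : ∀ a b → a + b ≡ a ℚ.+ b
    +≡ a b = refl

    *≡ : ∀ a b → a * b ≡ a ℚ.* b
    *≡ a b = refl

    -≡ : ∀ a → - a ≡ ℚ.- a
    -≡ a = refl

    isCR : IsCommutativeRing _≡_ _+_ _*_ -_ 0ℚ 1ℚ
    isCR = ℚ.+-*-isCommutativeRing

    +-mono-≤ : a ≤ b → x ≤ y → a + x ≤ b + y
    +-mono-≤ = ℚ.+-mono-≤

    *-monoˡ : 0ℚ ≤ c → a ≤ b → c * a ≤ c * b
    *-monoˡ {c} p q = ℚ.*-monoˡ-≤-nonNeg c {{nonNegative p}} q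

    *-monoˡ-< : 0ℚ < c → a < b → c * a < c * b
    *-monoˡ-< {c} p q = ℚ.*-monoʳ-<-pos c {{positive p}} q

    neg-antimono : a ≤ b → - b ≤ - a
    neg-antimono = ℚ.neg-antimono-≤

  CR : CommutativeRing 0ℓ 0ℓ
  CR = record { isCommutativeRing = isCR }

  open CommutativeRing CR public using (+-comm; +-assoc; *-comm; *-assoc; +-identityˡ; +-identityʳ; *-identityˡ; *-identityʳ)
    renaming (zeroˡ to *-zeroˡ; zeroʳ to *-zeroʳ; distribˡ to *-distribˡ-+; distribʳ to *-distribʳ-+; -‿inverseʳ to +-inverseʳ)

  private
    raw : RawRing 0ℓ 0ℓ
    raw = record { _≈_ = _≡_ ; _+_ = ℚ._+_ ; _*_ = ℚ._*_ ; -_ = ℚ.-_ ; 0# = 0ℚ ; 1# = 1ℚ }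

    hom : raw ACR.-Raw-AlmostCommutative⟶ ACR.fromCommutativeRing CR
    hom = record { ⟦_⟧ = λ x → x ; +-homo = λ a b → sym (+≡ a b) ; *-homo = λ a b → sym (*≡ a b) ; -‿homo = λ a → sym (-≡ a) ; 0-homo = refl ; 1-homo = refl }

    coeff≟ : ∀ (a b : ℚ) → Maybe (a ≡ b)
    coeff≟ a b with a ≟ b
    ... | yes p = just p
    ... | no _ = nothing

  open RingSolver raw (ACR.fromCommutativeRing CR) hom coeff≟ public using (solve; _:=_; _:+_; _:*_; _:-_; :-_; con; Polynomial)

  𝟙 : ∀ {n} → Polynomial n
  𝟙 = con 1ℚ

  𝟘 : ∀ {n} → Polynomial n
  𝟘 = con 0ℚ

  opaque
    _≤ᵇ_ : ℚ → ℚ → Bool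
    a ≤ᵇ b = isYes (a ≤? b)

    ≤ᵇ-true : (a ≤ᵇ b) ≡ true → a ≤ b
    ≤ᵇ-true {a} {b} e with a ≤? b
    ... | yes p = p

    ≤ᵇ-false : (a ≤ᵇ b) ≡ false → b ≤ a
    ≤ᵇ-false {a} {b} e with a ≤? b
    ... | no p = <⇒≤ (≰⇒> p)

    ≤ᵇ-⊥ : ∀ {X : Set} → a ≤ b → (a ≤ᵇ b) ≡ false → X
    ≤ᵇ-⊥ {a} {b} p e with a ≤? b
    ... | no q = ⊥-elim (q p)

  +-monoʳ-≤ : ∀ c → a ≤ b → c + a ≤ c + b
  +-monoʳ-≤ c = +-mono-≤ (≤-refl {c})

  +-monoˡ-≤ : ∀ c → a ≤ b → a + c ≤ b + c
  +-monoˡ-≤ c p = +-mono-≤ p (≤-refl {c})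

  *-monoʳ : 0ℚ ≤ c → a ≤ b → a * c ≤ b * c
  *-monoʳ {c} {a} {b} p q = subst₂ _≤_ (*-comm c a) (*-comm c b) (*-monoˡ p q)

  0≤1 : 0ℚ ≤ 1ℚ
  0≤1 = ℚ.nonNegative⁻¹ 1ℚ

  +-nn : 0ℚ ≤ a → 0ℚ ≤ b → 0ℚ ≤ a + b
  +-nn {a} {b} p q = subst (_≤ a + b) (+-identityˡ 0ℚ) (+-mono-≤ p q)

  *-mono : 0ℚ ≤ a → a ≤ b → 0ℚ ≤ x → x ≤ y → a * x ≤ b * y
  *-mono 0≤a a≤b 0≤x x≤y = ≤-trans (*-monoʳ 0≤x a≤b) (*-monoˡ (≤-trans 0≤a a≤b) x≤y)

  *-nn : 0ℚ ≤ a → 0ℚ ≤ b → 0ℚ ≤ a * b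
  *-nn {a} {b} p q = subst (_≤ a * b) (*-zeroʳ a) (*-monoˡ p q)

  sq-nn : ∀ a → 0ℚ ≤ a * a
  sq-nn a with ≤-total 0ℚ a
  ... | inj₁ p = *-nn p p
  ... | inj₂ p = subst (0ℚ ≤_) (solve 1 (λ a → (:- a) :* (:- a) := a :* a) refl a) (*-nn n n)
    where n : 0ℚ ≤ - a
          n = subst (_≤ - a) (-≡ 0ℚ) (neg-antimono p)

  ≤-by : 0ℚ ≤ c → b ≡ a + c → a ≤ b
  ≤-by {c} {b} {a} p e = subst₂ _≤_ (+-identityʳ a) (sym e) (+-monoʳ-≤ a p)

  ≤⇒0≤ : a ≤ b → 0ℚ ≤ b - a
  ≤⇒0≤ {a} {b} p = subst (_≤ b - a) (+-inverseʳ a) (+-monoˡ-≤ (- a) p)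

  -- Inequalities between polynomials are reduced to a ring identity exhibiting the difference as a sum of nonnegative terms.
  diff : 0ℚ ≤ c → b - a ≡ c → a ≤ b
  diff {c} {b} {a} p e = ≤-by p (trans (solve 2 (λ a b → b := a :+ (b :- a)) refl a b) (cong (a +_) e))

  0≤⇒≤ : 0ℚ ≤ b - a → a ≤ b
  0≤⇒≤ p = diff p refl

  infixr 8 _^_
  _^_ : ℚ → ℕ → ℚ
  a ^ zero = 1ℚ
  a ^ suc n = a * a ^ n

  ^-nn : 0ℚ ≤ a → ∀ n → 0ℚ ≤ a ^ n
  ^-nn p zero = 0≤1
  ^-nn p (suc n) = *-nn p (^-nn p n)

  ^-mono : 0ℚ ≤ a → a ≤ b → ∀ n → a ^ n ≤ b ^ n
  ^-mono p q zero = ≤-refl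
  ^-mono p q (suc n) = *-mono p q (^-nn p n) (^-mono p q n)

  ^-≥1 : 1ℚ ≤ a → ∀ n → 1ℚ ≤ a ^ n
  ^-≥1 p zero = ≤-refl
  ^-≥1 {a} p (suc n) = ≤-trans p (≤-trans (≤-reflexive (sym (*-identityʳ a))) (*-monoˡ (≤-trans 0≤1 p) (^-≥1 p n)))

  ^-up : 1ℚ ≤ a → ∀ {m n} → m ℕ.≤ n → a ^ m ≤ a ^ n
  ^-up p {n = n} ℕ.z≤n = ^-≥1 p n
  ^-up p (ℕ.s≤s l) = *-monoˡ (≤-trans 0≤1 p) (^-up p l)

  ^-+ : ∀ a m n → a ^ (m ℕ.+ n) ≡ a ^ m * a ^ n
  ^-+ a zero n = sym (*-identityˡ _)
  ^-+ a (suc m) n = trans (cong (a *_) (^-+ a m n)) (sym (*-assoc a _ _))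

  ^-* : ∀ a b n → (a * b) ^ n ≡ a ^ n * b ^ n
  ^-* a b zero = sym (*-identityˡ 1ℚ)
  ^-* a b (suc n) = trans (cong (a * b *_) (^-* a b n)) (solve 4 (λ a b x y → a :* b :* (x :* y) := a :* x :* (b :* y)) refl a b (a ^ n) (b ^ n))

  1^ : ∀ n → 1ℚ ^ n ≡ 1ℚ
  1^ zero = refl
  1^ (suc n) = trans (*-identityˡ _) (1^ n)

  ^-inv : a * b ≡ 1ℚ → ∀ n → a ^ n * b ^ n ≡ 1ℚ
  ^-inv {a} {b} e n = trans (sym (^-* a b n)) (trans (cong (_^ n) e) (1^ n))

  ι : ℕ → ℚ
  ι zero = 0ℚ
  ι (suc n) = 1ℚ + ι n

  ι1 : ι 1 ≡ 1ℚ
  ι1 = +-identityʳ 1ℚ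

  ι-nn : ∀ n → 0ℚ ≤ ι n
  ι-nn zero = ≤-refl
  ι-nn (suc n) = +-nn 0≤1 (ι-nn n)

  ι-+ : ∀ m n → ι (m ℕ.+ n) ≡ ι m + ι n
  ι-+ zero n = sym (+-identityˡ _)
  ι-+ (suc m) n = trans (cong (1ℚ +_) (ι-+ m n)) (sym (+-assoc 1ℚ (ι m) (ι n)))

  ι-* : ∀ m n → ι (m ℕ.* n) ≡ ι m * ι n
  ι-* zero n = sym (*-zeroˡ (ι n))
  ι-* (suc m) n = trans (ι-+ n (m ℕ.* n)) (trans (cong (ι n +_) (ι-* m n)) (solve 2 (λ a b → a :+ b :* a := (𝟙 :+ b) :* a) refl (ι n) (ι m)))

  ι-^ : ∀ m n → ι (m ℕ.^ n) ≡ ι m ^ n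
  ι-^ m zero = ι1
  ι-^ m (suc n) = trans (ι-* m (m ℕ.^ n)) (cong (ι m *_) (ι-^ m n))

  ι-mono : ∀ {m n} → m ℕ.≤ n → ι m ≤ ι n
  ι-mono {n = n} ℕ.z≤n = ι-nn n
  ι-mono (ℕ.s≤s p) = +-monoʳ-≤ 1ℚ (ι-mono p)

  bool : Bool → ℚ
  bool true = 1ℚ
  bool false = 0ℚ

  bool-nn : ∀ b → 0ℚ ≤ bool b
  bool-nn true = 0≤1
  bool-nn false = ≤-refl

  bool-≤1 : ∀ b → bool b ≤ 1ℚ
  bool-≤1 true = ≤-refl
  bool-≤1 false = 0≤1

  bool-∧ : ∀ x y → bool (x ∧ y) ≡ bool x * bool y
  bool-∧ true y = sym (*-identityˡ _)
  bool-∧ false y = sym (*-zeroˡ (bool y))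

  bool-∨ : ∀ x y → bool (x ∨ y) ≤ bool x + bool y
  bool-∨ true y = ≤-by (bool-nn y) refl
  bool-∨ false y = ≤-reflexive (sym (+-identityˡ _))

  bool-idem : ∀ x → bool x * bool x ≡ bool x
  bool-idem true = *-identityˡ 1ℚ
  bool-idem false = *-zeroˡ 0ℚ

  -- This is 1 + m y ≤ (1 - y)^(-m) without inverses. In the process it lets a reserve raised to the
  -- power m pay for a weight that grew by the factor 1 + m y.
  bernoulli : ∀ m → 0ℚ ≤ y → y ≤ 1ℚ → (1ℚ - y) ^ m * (1ℚ + ι m * y) ≤ 1ℚ
  bernoulli {y} zero p q = ≤-reflexive (solve 1 (λ y → 𝟙 :* (𝟙 :+ 𝟘 :* y) := 𝟙) refl y)
  bernoulli {y} (suc m) p q = ≤-trans (diff (*-nn (^-nn (≤⇒0≤ q) m) (*-nn (ι-nn (suc m)) (*-nn p p))) (solve 3 (λ y x m → x :* (𝟙 :+ m :* y) :- (𝟙 :- y) :* x :* (𝟙 :+ (𝟙 :+ m) :* y) := x :* ((𝟙 :+ m) :* (y :* y))) refl y ((1ℚ - y) ^ m) (ι m))) (bernoulli m p q)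

  private variable
    A B : Set

  ∑ : List A → (A → ℚ) → ℚ
  ∑ [] f = 0ℚ
  ∑ (x ∷ xs) f = f x + ∑ xs f

  ∑-cong : ∀ (xs : List A) {f g : A → ℚ} → (∀ x → f x ≡ g x) → ∑ xs f ≡ ∑ xs g
  ∑-cong [] h = refl
  ∑-cong (x ∷ xs) h = cong₂ _+_ (h x) (∑-cong xs h)

  ∑-cong∈ : ∀ (xs : List A) {f g : A → ℚ} → (∀ x → x ∈ xs → f x ≡ g x) → ∑ xs f ≡ ∑ xs g
  ∑-cong∈ [] h = refl
  ∑-cong∈ (x ∷ xs) h = cong₂ _+_ (h x (here refl)) (∑-cong∈ xs (λ y m → h y (there m)))

  ∑-mono∈ : ∀ (xs : List A) {f g : A → ℚ} → (∀ x → x ∈ xs → f x ≤ g x) → ∑ xs f ≤ ∑ xs g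
  ∑-mono∈ [] h = ≤-refl
  ∑-mono∈ (x ∷ xs) h = +-mono-≤ (h x (here refl)) (∑-mono∈ xs (λ y m → h y (there m)))

  ∑-mono : ∀ (xs : List A) {f g : A → ℚ} → (∀ x → f x ≤ g x) → ∑ xs f ≤ ∑ xs g
  ∑-mono xs h = ∑-mono∈ xs (λ x _ → h x)

  ∑-nn∈ : ∀ (xs : List A) {f : A → ℚ} → (∀ x → x ∈ xs → 0ℚ ≤ f x) → 0ℚ ≤ ∑ xs f
  ∑-nn∈ [] h = ≤-refl
  ∑-nn∈ (x ∷ xs) h = +-nn (h x (here refl)) (∑-nn∈ xs (λ y m → h y (there m)))

  ∑-nn : ∀ (xs : List A) {f : A → ℚ} → (∀ x → 0ℚ ≤ f x) → 0ℚ ≤ ∑ xs f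
  ∑-nn xs h = ∑-nn∈ xs (λ x _ → h x)

  ∑-+ : ∀ (xs : List A) (f g : A → ℚ) → ∑ xs (λ x → f x + g x) ≡ ∑ xs f + ∑ xs g
  ∑-+ [] f g = sym (+-identityˡ 0ℚ)
  ∑-+ (x ∷ xs) f g = trans (cong (f x + g x +_) (∑-+ xs f g)) (solve 4 (λ a b c d → a :+ b :+ (c :+ d) := a :+ c :+ (b :+ d)) refl (f x) (g x) (∑ xs f) (∑ xs g))

  ∑-minus : ∀ (xs : List A) (f g : A → ℚ) → ∑ xs (λ x → f x - g x) ≡ ∑ xs f - ∑ xs g
  ∑-minus [] f g = sym (+-inverseʳ 0ℚ)
  ∑-minus (x ∷ xs) f g = trans (cong (f x - g x +_) (∑-minus xs f g)) (solve 4 (λ a b c d → a :- b :+ (c :- d) := a :+ c :- (b :+ d)) refl (f x) (g x) (∑ xs f) (∑ xs g))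

  ∑-*ˡ : ∀ (xs : List A) c (f : A → ℚ) → ∑ xs (λ x → c * f x) ≡ c * ∑ xs f
  ∑-*ˡ [] c f = sym (*-zeroʳ c)
  ∑-*ˡ (x ∷ xs) c f = trans (cong (c * f x +_) (∑-*ˡ xs c f)) (sym (*-distribˡ-+ c _ _))

  ∑-*ʳ : ∀ (xs : List A) c (f : A → ℚ) → ∑ xs (λ x → f x * c) ≡ ∑ xs f * c
  ∑-*ʳ xs c f = trans (∑-cong xs (λ x → *-comm (f x) c)) (trans (∑-*ˡ xs c f) (*-comm c _))

  ∑-const : ∀ (xs : List A) c → ∑ xs (λ _ → c) ≡ ι (length xs) * c
  ∑-const [] c = sym (*-zeroˡ c)
  ∑-const (x ∷ xs) c = trans (cong (c +_) (∑-const xs c)) (solve 2 (λ c n → c :+ n :* c := (𝟙 :+ n) :* c) refl c (ι (length xs)))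

  ∑-zero : ∀ (xs : List A) {f : A → ℚ} → (∀ x → f x ≡ 0ℚ) → ∑ xs f ≡ 0ℚ
  ∑-zero [] h = refl
  ∑-zero (x ∷ xs) h = trans (cong₂ _+_ (h x) (∑-zero xs h)) (+-identityˡ 0ℚ)

  ∑-swap : ∀ (xs : List A) (ys : List B) (f : A → B → ℚ) → ∑ xs (λ x → ∑ ys (f x)) ≡ ∑ ys (λ y → ∑ xs (λ x → f x y))
  ∑-swap [] ys f = sym (∑-zero ys (λ _ → refl))
  ∑-swap (x ∷ xs) ys f = trans (cong (∑ ys (f x) +_) (∑-swap xs ys f)) (sym (∑-+ ys (f x) _))

  ∑-++ : ∀ (xs ys : List A) f → ∑ (xs ++ ys) f ≡ ∑ xs f + ∑ ys f
  ∑-++ [] ys f = sym (+-identityˡ _)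
  ∑-++ (x ∷ xs) ys f = trans (cong (f x +_) (∑-++ xs ys f)) (sym (+-assoc (f x) _ _))

  ∑-map : ∀ (g : A → B) (xs : List A) f → ∑ (map g xs) f ≡ ∑ xs (f ∘ g)
  ∑-map g [] f = refl
  ∑-map g (x ∷ xs) f = cong (f (g x) +_) (∑-map g xs f)

  ∑-single : ∀ {xs : List A} {f : A → ℚ} → (∀ x → 0ℚ ≤ f x) → ∀ {x} → x ∈ xs → f x ≤ ∑ xs f
  ∑-single {xs = x ∷ xs} nn (here refl) = ≤-by (∑-nn xs nn) refl
  ∑-single {xs = y ∷ xs} {f} nn (there m) = ≤-trans (∑-single nn m) (≤-by (nn y) (+-comm (f y) _))

  <⇒≱ : a < b → ¬ b ≤ a
  <⇒≱ p q = <-irrefl refl (<-≤-trans p q)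

  ∑-vanish : ∀ (xs : List A) {p : A → ℚ} → (∀ x → 0ℚ ≤ p x) → ∑ xs p ≡ 0ℚ → ∀ (g : A → ℚ) → ∑ xs (λ x → p x * g x) ≡ 0ℚ
  ∑-vanish [] nn z g = refl
  ∑-vanish (y ∷ ys) {p} nn z g = trans (cong₂ _+_ (trans (cong (_* g y) py) (*-zeroˡ (g y))) (∑-vanish ys nn pys g)) (+-identityˡ 0ℚ)
    where
    py : p y ≡ 0ℚ
    py = ≤-antisym (≤-trans (≤-by (∑-nn ys nn) refl) (≤-reflexive z)) (nn y)
    pys : ∑ ys p ≡ 0ℚ
    pys = trans (sym (+-identityˡ _)) (trans (cong (_+ ∑ ys p) (sym py)) z)

  -- First-moment method. Membership and nonzero mass are part of the result because the invariants
  -- of the process are only preserved along outcomes of nonzero probability.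
  ∑-avg : ∀ (xs : List A) (p f : A → ℚ) (c : ℚ) → (∀ x → 0ℚ ≤ p x) → ∑ xs p * c ≤ ∑ xs (λ x → p x * f x) → ¬ ∑ xs p ≡ 0ℚ →
    ∃ λ x → x ∈ xs × (¬ p x ≡ 0ℚ) × c ≤ f x
  ∑-avg [] p f c nn h ne = ⊥-elim (ne refl)
  ∑-avg {A} (x ∷ xs) p f c nn h ne = case (p x ≟ 0ℚ) (c ≤? f x) (∑ xs p ≟ 0ℚ)
    where
    Goal = ∃ λ y → y ∈ (x ∷ xs) × (¬ p y ≡ 0ℚ) × c ≤ f y
    P = ∑ xs p
    R = ∑ xs (λ x → p x * f x)
    rec : P * c ≤ R → ¬ P ≡ 0ℚ → Goal
    rec h ne = let (y , m , r) = ∑-avg xs p f c nn h ne in y , there m , r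
    e1 = solve 3 (λ P c p → (p :+ P) :* c :- p :* c := P :* c) refl
    e2 = solve 4 (λ R p f c → p :* f :+ R :- p :* c := R :+ p :* (f :- c)) refl
    e3 = solve 4 (λ R p f c → R :- (R :+ p :* (f :- c)) := p :* (c :- f)) refl
    case : Dec (p x ≡ 0ℚ) → Dec (c ≤ f x) → Dec (P ≡ 0ℚ) → Goal
    case (no q) (yes r) _ = x , here refl , q , r
    case (yes q) _ _ = rec (subst₂ _≤_ (cong (_* c) (trans (cong (_+ P) q) (+-identityˡ P))) (trans (cong (λ z → z * f x + R) q) (trans (cong (_+ R) (*-zeroˡ (f x))) (+-identityˡ R))) h)
      (λ z → ne (trans (cong (_+ P) q) (trans (+-identityˡ P) z)))
    case (no q) (no r) (no s) = rec (≤-trans (subst₂ _≤_ (e1 P c (p x)) (e2 R (p x) (f x) c) (+-monoˡ-≤ (- (p x * c)) h))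
        (diff (*-nn (nn x) (≤⇒0≤ (<⇒≤ (≰⇒> r)))) (e3 R (p x) (f x) c))) s
    case (no q) (no r) (yes s) = ⊥-elim (<⇒≱ lt h)
      where
      px>0 : 0ℚ < p x
      px>0 = ≰⇒> (λ l → q (≤-antisym l (nn x)))
      lt : p x * f x + R < (p x + P) * c
      lt = subst₂ _<_ (sym (trans (cong (p x * f x +_) (∑-vanish xs nn s f)) (+-identityʳ _))) (cong (_* c) (sym (trans (cong (p x +_) s) (+-identityʳ _))))
             (*-monoˡ-< px>0 (≰⇒> r))

-- Products and truncated inclusion-exclusion.

module Prod where
  open Q
  open import Data.Rational using (_≤_)
  open import Data.Rational.Properties using (≤-refl; ≤-reflexive; ≤-trans)
  open import Data.Unit using (⊤)

  private variable
    A B : Set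

  ∏ : List A → (A → ℚ) → ℚ
  ∏ [] f = 1ℚ
  ∏ (x ∷ xs) f = f x * ∏ xs f

  ∏-nn : ∀ (xs : List A) {f} → (∀ x → 0ℚ ≤ f x) → 0ℚ ≤ ∏ xs f
  ∏-nn [] h = 0≤1
  ∏-nn (x ∷ xs) h = *-nn (h x) (∏-nn xs h)

  ∏-mono∈ : ∀ (xs : List A) {f g} → (∀ x → x ∈ xs → 0ℚ ≤ f x) → (∀ x → x ∈ xs → f x ≤ g x) → ∏ xs f ≤ ∏ xs g
  ∏-mono∈ [] nn h = ≤-refl
  ∏-mono∈ (x ∷ xs) {f} nn h = *-mono (nn x (here refl)) (h x (here refl)) (nn' xs (λ y m → nn y (there m))) (∏-mono∈ xs (λ y m → nn y (there m)) (λ y m → h y (there m)))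
    where nn' : ∀ xs → (∀ y → y ∈ xs → 0ℚ ≤ f y) → 0ℚ ≤ ∏ xs f
          nn' [] _ = 0≤1
          nn' (y ∷ ys) k = *-nn (k y (here refl)) (nn' ys (λ z m → k z (there m)))

  ∏-mono : ∀ (xs : List A) {f g} → (∀ x → 0ℚ ≤ f x) → (∀ x → f x ≤ g x) → ∏ xs f ≤ ∏ xs g
  ∏-mono xs nn h = ∏-mono∈ xs (λ x _ → nn x) (λ x _ → h x)

  ∏-cong : ∀ (xs : List A) {f g : A → ℚ} → (∀ x → f x ≡ g x) → ∏ xs f ≡ ∏ xs g
  ∏-cong [] h = refl
  ∏-cong (x ∷ xs) h = cong₂ _*_ (h x) (∏-cong xs h)

  ∏-++ : ∀ (xs ys : List A) f → ∏ (xs ++ ys) f ≡ ∏ xs f * ∏ ys f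
  ∏-++ [] ys f = sym (*-identityˡ _)
  ∏-++ (x ∷ xs) ys f = trans (cong (f x *_) (∏-++ xs ys f)) (sym (*-assoc (f x) _ _))

  ∏-* : ∀ (xs : List A) f g → ∏ xs (λ x → f x * g x) ≡ ∏ xs f * ∏ xs g
  ∏-* [] f g = sym (*-identityˡ _)
  ∏-* (x ∷ xs) f g = trans (cong (f x * g x *_) (∏-* xs f g)) (solve 4 (λ a b c d → a :* b :* (c :* d) := a :* c :* (b :* d)) refl (f x) (g x) (∏ xs f) (∏ xs g))

  ∏-const : ∀ (xs : List A) c → ∏ xs (λ _ → c) ≡ c ^ length xs
  ∏-const [] c = refl
  ∏-const (x ∷ xs) c = cong (c *_) (∏-const xs c)

  -- δ∏ xs α h is the derivative of ∏ xs α in the direction h, and δ²∏ the sum over unordered pairs.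
  δ∏ : List A → (A → ℚ) → (A → ℚ) → ℚ
  δ∏ [] α h = 0ℚ
  δ∏ (x ∷ xs) α h = h x * ∏ xs α + α x * δ∏ xs α h

  δ²∏ : List A → (A → ℚ) → (A → ℚ) → ℚ
  δ²∏ [] α h = 0ℚ
  δ²∏ (x ∷ xs) α h = h x * δ∏ xs α h + α x * δ²∏ xs α h

  δ∏-nn : ∀ (xs : List A) {α h} → (∀ x → 0ℚ ≤ α x) → (∀ x → 0ℚ ≤ h x) → 0ℚ ≤ δ∏ xs α h
  δ∏-nn [] a b = ≤-refl
  δ∏-nn (x ∷ xs) a b = +-nn (*-nn (b x) (∏-nn xs a)) (*-nn (a x) (δ∏-nn xs a b))

  δ²∏-nn : ∀ (xs : List A) {α h} → (∀ x → 0ℚ ≤ α x) → (∀ x → 0ℚ ≤ h x) → 0ℚ ≤ δ²∏ xs α h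
  δ²∏-nn [] a b = ≤-refl
  δ²∏-nn (x ∷ xs) a b = +-nn (*-nn (b x) (δ∏-nn xs a b)) (*-nn (a x) (δ²∏-nn xs a b))

  δ∏-zero : ∀ (xs : List A) {α h} → All (λ x → h x ≡ 0ℚ) xs → δ∏ xs α h ≡ 0ℚ
  δ∏-zero [] [] = refl
  δ∏-zero (x ∷ xs) {α} {h} (p ∷ ps) = trans (cong₂ _+_ (trans (cong (_* ∏ xs α) p) (*-zeroˡ (∏ xs α))) (trans (cong (α x *_) (δ∏-zero xs ps)) (*-zeroʳ (α x)))) (+-identityˡ 0ℚ)

  δ∏-mono : ∀ (xs : List A) {α h g} → (∀ x → 0ℚ ≤ α x) → (∀ x → x ∈ xs → h x ≤ g x) → δ∏ xs α h ≤ δ∏ xs α g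
  δ∏-mono [] a b = ≤-refl
  δ∏-mono (x ∷ xs) a b = +-mono-≤ (*-monoʳ (∏-nn xs a) (b x (here refl))) (*-monoˡ (a x) (δ∏-mono xs a (λ y m → b y (there m))))

  δ∏-*ˡ : ∀ (xs : List A) {α} c h → δ∏ xs α (λ x → c * h x) ≡ c * δ∏ xs α h
  δ∏-*ˡ [] c h = sym (*-zeroʳ c)
  δ∏-*ˡ (x ∷ xs) {α} c h = trans (cong (λ z → c * h x * ∏ xs α + α x * z) (δ∏-*ˡ xs c h))
    (solve 5 (λ c h p a d → c :* h :* p :+ a :* (c :* d) := c :* (h :* p :+ a :* d)) refl c (h x) (∏ xs α) (α x) (δ∏ xs α h))

  δ∏-+ : ∀ (xs : List A) {α} h g → δ∏ xs α (λ x → h x + g x) ≡ δ∏ xs α h + δ∏ xs α g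
  δ∏-+ [] h g = sym (+-identityˡ 0ℚ)
  δ∏-+ (x ∷ xs) {α} h g = trans (cong (λ z → (h x + g x) * ∏ xs α + α x * z) (δ∏-+ xs h g))
    (solve 6 (λ h g p a d e → (h :+ g) :* p :+ a :* (d :+ e) := (h :* p :+ a :* d) :+ (g :* p :+ a :* e)) refl (h x) (g x) (∏ xs α) (α x) (δ∏ xs α h) (δ∏ xs α g))

  δ∏-0 : ∀ (xs : List A) {α} → δ∏ xs α (λ _ → 0ℚ) ≡ 0ℚ
  δ∏-0 [] = refl
  δ∏-0 (x ∷ xs) {α} = trans (cong₂ _+_ (*-zeroˡ (∏ xs α)) (trans (cong (α x *_) (δ∏-0 xs)) (*-zeroʳ (α x)))) (+-identityˡ 0ℚ)

  δ∏-∑ : ∀ (xs : List A) {α} (os : List B) (p : B → ℚ) (h : B → A → ℚ) → δ∏ xs α (λ x → ∑ os (λ o → p o * h o x)) ≡ ∑ os (λ o → p o * δ∏ xs α (h o))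
  δ∏-∑ xs [] p h = δ∏-0 xs
  δ∏-∑ xs (o ∷ os) p h = trans (δ∏-+ xs (λ x → p o * h o x) _) (cong₂ _+_ (δ∏-*ˡ xs (p o) (h o)) (δ∏-∑ xs os p h))

  δ∏-≤ : ∀ (xs : List A) {α h} → (∀ x → 0ℚ ≤ α x) → (∀ x → h x ≤ α x) → δ∏ xs α h ≤ ι (length xs) * ∏ xs α
  δ∏-≤ [] a b = ≤-reflexive (sym (*-zeroˡ 1ℚ))
  δ∏-≤ (x ∷ xs) {α} {h} a b = ≤-trans (+-mono-≤ (*-monoʳ (∏-nn xs a) (b x)) (*-monoˡ (a x) (δ∏-≤ xs a b)))
    (≤-reflexive (solve 3 (λ a p n → a :* p :+ a :* (n :* p) := (𝟙 :+ n) :* (a :* p)) refl (α x) (∏ xs α) (ι (length xs))))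

  -- A step accepts at most one edge, so the increments caused by acceptance vanish at all but one
  -- entry of a duplicate-free list.
  AtMostOne : (A → ℚ) → List A → Set
  AtMostOne g [] = ⊤
  AtMostOne g (x ∷ xs) = (g x ≡ 0ℚ ⊎ All (λ y → g y ≡ 0ℚ) xs) × AtMostOne g xs

  -- When the product is expanded, every term with two increments vanishes, so the linear term is
  -- the whole change.
  ∏-add : ∀ (xs : List A) {α g : A → ℚ} → (∀ x → 0ℚ ≤ α x) → (∀ x → 0ℚ ≤ g x) → AtMostOne g xs → ∏ xs (λ x → α x + g x) ≤ ∏ xs α + δ∏ xs α g
  ∏-add [] a b _ = ≤-reflexive (sym (+-identityʳ 1ℚ))
  ∏-add (x ∷ xs) {α} {g} a b (c , amo) = ≤-trans (≤-reflexive (*-distribʳ-+ _ (α x) (g x)))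
      (≤-trans (+-mono-≤ (*-monoˡ (a x) (∏-add xs a b amo)) (gpart c))
        (≤-reflexive (solve 4 (λ a p d g → a :* (p :+ d) :+ g :* p := a :* p :+ (g :* p :+ a :* d)) refl (α x) (∏ xs α) (δ∏ xs α g) (g x))))
    where
    same : ∀ ys → All (λ y → g y ≡ 0ℚ) ys → ∏ ys (λ x → α x + g x) ≡ ∏ ys α
    same [] [] = refl
    same (y ∷ ys) (p ∷ ps) = cong₂ _*_ (trans (cong (α y +_) p) (+-identityʳ _)) (same ys ps)
    gpart : g x ≡ 0ℚ ⊎ All (λ y → g y ≡ 0ℚ) xs → g x * ∏ xs (λ x → α x + g x) ≤ g x * ∏ xs α
    gpart (inj₁ p) = ≤-reflexive (trans (cong (_* ∏ xs (λ x → α x + g x)) p) (trans (*-zeroˡ (∏ xs (λ x → α x + g x))) (sym (trans (cong (_* ∏ xs α) p) (*-zeroˡ (∏ xs α))))))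
    gpart (inj₂ q) = ≤-reflexive (cong (g x *_) (same xs q))

  module _ {A : Set} {α h : A → ℚ} (h≥0 : ∀ x → 0ℚ ≤ h x) (h≤α : ∀ x → h x ≤ α x) where
    private
      α≥0 : ∀ x → 0ℚ ≤ α x
      α≥0 x = ≤-trans (h≥0 x) (h≤α x)

    -- Bonferroni's inequality stopped after the first order; 0 ≤ h ≤ α gives the omitted remainder
    -- the right sign.
    ∏-lower : ∀ xs → ∏ xs α - δ∏ xs α h ≤ ∏ xs (λ x → α x - h x)
    ∏-lower [] = ≤-reflexive (solve 0 (𝟙 :- 𝟘 := 𝟙) refl)
    ∏-lower (x ∷ xs) = ≤-trans (≤-by (*-nn (h≥0 x) (δ∏-nn xs α≥0 h≥0))
        (solve 4 (λ a b p d → (a :- b) :* (p :- d) := a :* p :- (b :* p :+ a :* d) :+ b :* d) refl (α x) (h x) (∏ xs α) (δ∏ xs α h)))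
      (*-monoˡ (≤⇒0≤ (h≤α x)) (∏-lower xs))

    private
      shift : ∀ {g : A → ℚ} x → g x ≡ 0ℚ → α x - h x + g x ≡ α x - h x
      shift x p = trans (cong (α x - h x +_) p) (+-identityʳ _)

    ∏-nn-shift : ∀ xs {g : A → ℚ} → All (λ y → g y ≡ 0ℚ) xs → 0ℚ ≤ ∏ xs (λ x → α x - h x + g x)
    ∏-nn-shift [] [] = 0≤1
    ∏-nn-shift (x ∷ xs) {g} (p ∷ ps) = *-nn (≤-trans (≤⇒0≤ (h≤α x)) (≤-reflexive (sym (shift {g} x p)))) (∏-nn-shift xs {g} ps)

    ∏-≤-shift : ∀ xs {g : A → ℚ} → All (λ y → g y ≡ 0ℚ) xs → ∏ xs (λ x → α x - h x + g x) ≤ ∏ xs α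
    ∏-≤-shift [] [] = ≤-refl
    ∏-≤-shift (x ∷ xs) {g} (p ∷ ps) = *-mono (≤-trans (≤⇒0≤ (h≤α x)) (≤-reflexive (sym (shift {g} x p))))
        (≤-trans (≤-reflexive (shift {g} x p)) (diff (h≥0 x) (solve 2 (λ a h → a :- (a :- h) := h) refl (α x) (h x))))
        (∏-nn-shift xs {g} ps) (∏-≤-shift xs {g} ps)

    -- Bonferroni's inequality stopped after the second order in the losses h and the first order in
    -- the gains g. An entry that gains multiplies factors without gain, and these are at most the
    -- undiminished α.
    ∏-upper : ∀ xs {g : A → ℚ} → (∀ x → 0ℚ ≤ g x) → AtMostOne g xs →
      ∏ xs (λ x → α x - h x + g x) ≤ ∏ xs α - δ∏ xs α h + δ²∏ xs α h + δ∏ xs α g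
    ∏-upper [] g≥0 _ = ≤-reflexive (solve 0 (𝟙 := 𝟙 :- 𝟘 :+ 𝟘 :+ 𝟘) refl)
    ∏-upper (x ∷ xs) {g} g≥0 (c , amo) = ≤-trans
        (≤-trans (≤-reflexive (solve 3 (λ a g p → (a :+ g) :* p := a :* p :+ g :* p) refl (α x - h x) (g x) (∏ xs (λ x → α x - h x + g x))))
          (+-mono-≤ (*-monoˡ (≤⇒0≤ (h≤α x)) (∏-upper xs {g} g≥0 amo)) (gpart c)))
        (diff (+-nn (*-nn (h≥0 x) (δ²∏-nn xs α≥0 h≥0)) (*-nn (h≥0 x) (δ∏-nn xs α≥0 g≥0)))
          (solve 7 (λ a h g p d e f → a :* p :- (h :* p :+ a :* d) :+ (h :* d :+ a :* e) :+ (g :* p :+ a :* f) :- ((a :- h) :* (p :- d :+ e :+ f) :+ g :* p)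
             := h :* e :+ h :* f) refl (α x) (h x) (g x) (∏ xs α) (δ∏ xs α h) (δ²∏ xs α h) (δ∏ xs α g)))
      where
      gpart : g x ≡ 0ℚ ⊎ All (λ y → g y ≡ 0ℚ) xs → g x * ∏ xs (λ x → α x - h x + g x) ≤ g x * ∏ xs α
      gpart (inj₁ p) = ≤-reflexive (trans (cong (_* ∏ xs (λ x → α x - h x + g x)) p) (trans (*-zeroˡ (∏ xs (λ x → α x - h x + g x))) (sym (trans (cong (_* ∏ xs α) p) (*-zeroˡ (∏ xs α))))))
      gpart (inj₂ q) = *-monoˡ (g≥0 x) (∏-≤-shift xs {g} q)

  two : (A → Bool) → List A → Bool
  one : (A → Bool) → List A → Bool
  one k [] = false
  one k (x ∷ xs) = k x ∨ one k xs
  two k [] = false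
  two k (x ∷ xs) = (k x ∧ one k xs) ∨ two k xs

  module _ {A : Set} {α h : A → ℚ} (k : A → Bool) (h≥0 : ∀ x → 0ℚ ≤ h x) (h≤α : ∀ x → h x ≤ α x) (kh : ∀ x → k x ≡ false → h x ≡ 0ℚ) where
    private
      α≥0 : ∀ x → 0ℚ ≤ α x
      α≥0 x = ≤-trans (h≥0 x) (h≤α x)

      none : ∀ xs → one k xs ≡ false → All (λ x → h x ≡ 0ℚ) xs
      none [] e = []
      none (x ∷ xs) e with k x in kx
      ... | false = kh x kx ∷ none xs e

    δ∏-one : ∀ xs → δ∏ xs α h ≤ bool (one k xs) * (ι (length xs) * ∏ xs α)
    δ∏-one xs with one k xs in e
    ... | true = ≤-trans (δ∏-≤ xs α≥0 h≤α) (≤-reflexive (sym (*-identityˡ _)))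
    ... | false = ≤-reflexive (trans (δ∏-zero xs (none xs e)) (sym (*-zeroˡ (ι (length xs) * ∏ xs α))))

    -- Each second-order term needs two entries with h nonzero, hence two marked entries. This turns
    -- the correlation between deaths into the event that one outcome kills twice.
    δ²∏-two : ∀ xs → δ²∏ xs α h ≤ bool (two k xs) * (ι (length xs) * ι (length xs) * ∏ xs α)
    δ²∏-two [] = ≤-reflexive (sym (*-zeroˡ _))
    δ²∏-two (x ∷ xs) = ≤-trans (+-mono-≤ first (*-monoˡ (α≥0 x) (δ²∏-two xs))) final
      where
      n = ι (length xs)
      P = ∏ xs α
      b₁ = bool (k x ∧ one k xs)
      b₂ = bool (two k xs)
      b = bool ((k x ∧ one k xs) ∨ two k xs)
      X = α x * (n * P)
      X≥0 : 0ℚ ≤ X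
      X≥0 = *-nn (α≥0 x) (*-nn (ι-nn (length xs)) (∏-nn xs α≥0))
      hk : h x ≤ bool (k x) * α x
      hk with k x in kx
      ... | true = ≤-trans (h≤α x) (≤-reflexive (sym (*-identityˡ _)))
      ... | false = ≤-reflexive (trans (kh x kx) (sym (*-zeroˡ (α x))))
      first : h x * δ∏ xs α h ≤ b₁ * X
      first = ≤-trans (*-mono (h≥0 x) hk (δ∏-nn xs α≥0 h≥0) (δ∏-one xs))
        (≤-reflexive (trans (solve 5 (λ k a o n p → k :* a :* (o :* (n :* p)) := k :* o :* (a :* (n :* p))) refl (bool (k x)) (α x) (bool (one k xs)) n P)
          (cong (_* X) (sym (bool-∧ (k x) (one k xs))))))
      ∨₁ : ∀ u v → bool u ≤ bool (u ∨ v)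
      ∨₁ true v = ≤-refl
      ∨₁ false v = bool-nn v
      ∨₂ : ∀ u v → bool v ≤ bool (u ∨ v)
      ∨₂ true v = bool-≤1 v
      ∨₂ false v = ≤-refl
      aP≥0 = *-nn (α≥0 x) (∏-nn xs α≥0)
      final : b₁ * X + α x * (b₂ * (n * n * P)) ≤ b * ((1ℚ + n) * (1ℚ + n) * (α x * P))
      final = ≤-trans (+-mono-≤ (*-monoʳ X≥0 (∨₁ (k x ∧ one k xs) (two k xs)))
          (≤-trans (≤-reflexive (solve 4 (λ a b n p → a :* (b :* (n :* n :* p)) := b :* (n :* (a :* (n :* p)))) refl (α x) b₂ n P))
             (*-monoʳ (*-nn (ι-nn (length xs)) X≥0) (∨₂ (k x ∧ one k xs) (two k xs)))))
        (diff (*-nn (bool-nn ((k x ∧ one k xs) ∨ two k xs)) (+-nn X≥0 aP≥0))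
          (solve 4 (λ a b n p → b :* ((𝟙 :+ n) :* (𝟙 :+ n) :* (a :* p)) :- (b :* (a :* (n :* p)) :+ b :* (n :* (a :* (n :* p)))) := b :* (a :* (n :* p) :+ a :* p)) refl (α x) b n P))

-- The random greedy process and its invariants.

module Proc where
  open Q
  open Prod
  open import Data.Rational using (_≤_)
  open import Data.Rational.Properties using (≤-refl; ≤-reflexive; ≤-trans)

  ⌊⌋-false : ∀ {A : Set} {d : Dec A} → ⌊ d ⌋ ≡ false → ¬ A
  ⌊⌋-false {d = no q} _ = q

  ⌊⌋-true : ∀ {A : Set} {d : Dec A} → ⌊ d ⌋ ≡ true → A
  ⌊⌋-true {d = yes q} _ = q

  ∧-true : ∀ {x y} → x ∧ y ≡ true → x ≡ true × y ≡ true
  ∧-true {true} {true} _ = refl , refl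

  not-false : ∀ {b} → not b ≡ false → b ≡ true
  not-false {true} _ = refl

  not-true : ∀ {b} → not b ≡ true → b ≡ false
  not-true {false} _ = refl

  any : ∀ {A : Set} → (A → Bool) → List A → Bool
  any f [] = false
  any f (x ∷ xs) = f x ∨ any f xs

  any-true : ∀ {A : Set} (f : A → Bool) {xs x} → x ∈ xs → f x ≡ true → any f xs ≡ true
  any-true f (here refl) e rewrite e = refl
  any-true f {y ∷ ys} (there m) e with f y
  ... | true = refl
  ... | false = any-true f m e

  -- One step of the random greedy process: o is accepted with probability ρ W o; the weight of an edge that survives
  -- is multiplied by 1 + κ, which compensates its probability of dying.
  module Process {E P : Set} (_≟E_ : DecidableEquality E) (es : List E) (ps : List P)
    (inc : P → E → Bool) (kT : E → E → Bool) (conf : List E → E → E → Bool)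
    (ρ cap D : ℚ) (ŷ : ℕ → ℚ) where

    record State : Set where
      constructor st
      field
        clk : ℕ
        acc : List E
        W : E → ℚ
        Λ : E → ℚ
    open State public

    mem : E → List E → Bool
    mem x [] = false
    mem x (y ∷ ys) = ⌊ x ≟E y ⌋ ∨ mem x ys

    kill : List E → E → E → Bool
    kill A o R = kT o R ∨ conf A o R

    -- `κc` is the part of the death probability due to dense lists. It varies from edge to edge and
    -- is charged to the budget `cap`; the rest, due to shared t-sets, is bounded uniformly by β
    -- through the degrees.
    κ κc : State → E → ℚ
    κ s R = ρ * ∑ es (λ o → W s o * bool (kill (acc s) o R))
    κc s R = ρ * ∑ es (λ o → W s o * bool (conf (acc s) o R))

    Y : State → P → ℚ
    Y s T = ∑ es (λ R → bool (inc T R) * W s R)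

    hit : State → Maybe E → E → Bool
    hit s nothing R = false
    hit s (just o) R = kill (acc s) o R

    V : State → E → ℚ
    V s R = W s R * (1ℚ + κ s R)

    W1 : State → Maybe E → E → ℚ
    W1 s mo R = (1ℚ - bool (hit s mo R)) * V s R

    acc1 : State → Maybe E → List E
    acc1 s nothing = acc s
    acc1 s (just o) = o ∷ acc s

    Λ1 : State → E → ℚ
    Λ1 s R = Λ s R + κc s R

    Y1 : State → Maybe E → P → ℚ
    Y1 s mo T = ∑ es (λ R → bool (inc T R) * W1 s mo R)

    over : State → Maybe E → P → Bool
    over s mo T = not (Y1 s mo T ≤ᵇ (ŷ (suc (clk s)) + D))

    dropT : State → Maybe E → E → Bool
    dropT s mo R = any (λ T → inc T R ∧ over s mo T) ps

    keep : State → Maybe E → E → Bool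
    keep s mo R = (Λ1 s R ≤ᵇ cap) ∧ not (dropT s mo R)

    next : State → Maybe E → State
    next s mo = st (suc (clk s)) (acc1 s mo) (λ R → bool (keep s mo R) * W1 s mo R) (Λ1 s)

    outcomes : List (Maybe E)
    outcomes = nothing ∷ map just es

    pr : State → Maybe E → ℚ
    pr s nothing = 1ℚ - ρ * ∑ es (W s)
    pr s (just o) = ρ * W s o

    init : State
    init = st 0 [] (λ _ → 1ℚ) (λ _ → 0ℚ)

    ∑pr : ∀ s → ∑ outcomes (pr s) ≡ 1ℚ
    ∑pr s = trans (cong (pr s nothing +_) (trans (∑-map just es (pr s)) (∑-*ˡ es ρ (W s))))
      (solve 1 (λ x → 𝟙 :- x :+ x := 𝟙) refl (ρ * ∑ es (W s)))

    Es : (State → ℚ) → State → ℚ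
    Es F s = ∑ outcomes (λ mo → pr s mo * F (next s mo))

    -- With μ = 1 / m, the power (1 - z μ)^m plays the part of exp(-z), so no exponential function
    -- is needed. At most `cap` + I β of risk is accumulated in `I` steps, which leaves the reserve
    -- h; K = h^(-m) then bounds every weight.
    record Hyp (Good : List E → Set) (K lam μ β q thr h : ℚ) (m I : ℕ) : Set where
      field
        es! : Unique es
        ρ≥0 : 0ℚ ≤ ρ
        cap≥0 : 0ℚ ≤ cap
        D≥0 : 0ℚ ≤ D
        K≥1 : 1ℚ ≤ K
        ρKN : ρ * (K * ι (length es)) ≤ lam
        lam≤1 : lam ≤ 1ℚ
        kT-inc : ∀ {o R} → o ∈ es → R ∈ es → kT o R ≡ true → 1ℚ ≤ ∑ ps (λ T → bool (inc T o) * bool (inc T R))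
        inc-kT : ∀ {T o R} → T ∈ ps → inc T o ≡ true → inc T R ≡ true → kT o R ≡ true
        inc≤q : ∀ {R} → R ∈ es → ∑ ps (λ T → bool (inc T R)) ≤ q
        degD : ∀ {T} → T ∈ ps → ∑ es (λ R → bool (inc T R)) ≡ D
        β≡ : β ≡ q * (ρ * thr)
        β≥0 : 0ℚ ≤ β
        thr≥0 : 0ℚ ≤ thr
        ŷ≥0 : ∀ n → 0ℚ ≤ ŷ n
        ŷ0 : ŷ 0 ≡ D
        ŷ≤thr : ∀ n → n ℕ.≤ I → ŷ n + D ≤ thr
        μ≥0 : 0ℚ ≤ μ
        mμ : ι m * μ ≡ 1ℚ
        h≡ : h ≡ 1ℚ - (cap + ι I * β) * μ
        h≥0 : 0ℚ ≤ h
        Kh : K * h ^ m ≡ 1ℚ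
        good[] : Good []
        good1 : ∀ {R} → R ∈ es → Good (R ∷ [])
        good∉ : ∀ {R A} → Good (R ∷ A) → mem R A ≡ false
        good-step : ∀ {R o A} → Good (R ∷ A) → Good (o ∷ A) → kill A o R ≡ false → Good (R ∷ o ∷ A)

    module WithHyp {Good : List E → Set} {K lam μ β q thr h : ℚ} {m I : ℕ} (H : Hyp Good K lam μ β q thr h m I) where
      open Hyp H public

      -- In `alive` the reserve (1 - (Λ + n β) μ)^m shrinks in each step at least by the factor by
      -- which the weight grows, so their product never exceeds its initial value one.
      record Inv (n : ℕ) (s : State) : Set where
        field
          clk≡ : clk s ≡ n
          W≥0 : ∀ R → 0ℚ ≤ W s R
          Λ≥0 : ∀ R → 0ℚ ≤ Λ s R
          alive : ∀ R → R ∈ es → W s R ≡ 0ℚ ⊎ (Λ s R ≤ cap × W s R * (1ℚ - (Λ s R + ι n * β) * μ) ^ m ≤ 1ℚ × Good (R ∷ acc s))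
          Y≤ : ∀ T → T ∈ ps → Y s T ≤ ŷ n + D
          good : Good (acc s)

      K≥0 : 0ℚ ≤ K
      K≥0 = ≤-trans 0≤1 K≥1

      lam≥0 : 0ℚ ≤ lam
      lam≥0 = ≤-trans (*-nn ρ≥0 (*-nn K≥0 (ι-nn (length es)))) ρKN

      budget : ∀ {n} → n ℕ.≤ I → ∀ {z} → z ≤ cap → h ≤ 1ℚ - (z + ι n * β) * μ
      budget {n} n≤I {z} z≤ = ≤-trans (≤-reflexive h≡) (diff (*-nn (+-nn (≤⇒0≤ z≤) (*-nn (≤⇒0≤ (ι-mono n≤I)) β≥0)) μ≥0)
        (solve 6 (λ c I b z n m → 𝟙 :- (z :+ n :* b) :* m :- (𝟙 :- (c :+ I :* b) :* m) := (c :- z :+ (I :- n) :* b) :* m) refl cap (ι I) β z (ι n) μ))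

      module _ {n s} (iv : Inv n s) where
        open Inv iv

        κc≥0 : ∀ R → 0ℚ ≤ κc s R
        κc≥0 R = *-nn ρ≥0 (∑-nn es (λ o → *-nn (W≥0 o) (bool-nn (conf (acc s) o R))))

        κ≥0 : ∀ R → 0ℚ ≤ κ s R
        κ≥0 R = *-nn ρ≥0 (∑-nn es (λ o → *-nn (W≥0 o) (bool-nn (kill (acc s) o R))))

        V≥0 : ∀ R → 0ℚ ≤ V s R
        V≥0 R = *-nn (W≥0 R) (+-nn 0≤1 (κ≥0 R))

        W1≥0 : ∀ mo R → 0ℚ ≤ W1 s mo R
        W1≥0 mo R = *-nn (≤⇒0≤ (bool-≤1 (hit s mo R))) (V≥0 R)

        next≤W1 : ∀ mo R → W (next s mo) R ≤ W1 s mo R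
        next≤W1 mo R = ≤-trans (*-monoʳ (W1≥0 mo R) (bool-≤1 (keep s mo R))) (≤-reflexive (*-identityˡ _))

        W≤K : n ℕ.≤ I → ∀ R → R ∈ es → W s R ≤ K
        W≤K n≤I R m∈ with alive R m∈
        ... | inj₁ e = ≤-trans (≤-reflexive e) K≥0
        ... | inj₂ (l , b , _) = ≤-trans (≤-reflexive (trans (sym (*-identityʳ (W s R))) (trans (cong (W s R *_) (sym Kh))
              (solve 3 (λ w k x → w :* (k :* x) := k :* (w :* x)) refl (W s R) K (h ^ m)))))
            (≤-trans (*-monoˡ K≥0 (≤-trans (*-monoˡ (W≥0 R) (^-mono h≥0 (budget n≤I l) m)) b)) (≤-reflexive (*-identityʳ K)))

        ∑W≤ : n ℕ.≤ I → ∑ es (W s) ≤ K * ι (length es)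
        ∑W≤ n≤I = ≤-trans (∑-mono∈ es (W≤K n≤I)) (≤-reflexive (trans (∑-const es K) (*-comm _ K)))

        κ≤lam : n ℕ.≤ I → ∀ R → κ s R ≤ lam
        κ≤lam n≤I R = ≤-trans (*-monoˡ ρ≥0 (≤-trans (∑-mono es (λ o → ≤-trans (*-monoˡ (W≥0 o) (bool-≤1 (kill (acc s) o R))) (≤-reflexive (*-identityʳ _)))) (∑W≤ n≤I))) ρKN

        pr≥0 : n ℕ.≤ I → ∀ mo → 0ℚ ≤ pr s mo
        pr≥0 n≤I nothing = ≤⇒0≤ (≤-trans (*-monoˡ ρ≥0 (∑W≤ n≤I)) (≤-trans ρKN lam≤1))
        pr≥0 n≤I (just o) = *-nn ρ≥0 (W≥0 o)

        -- Union bound: an edge that kills R by sharing t vertices contains a common t-set T, and is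
        -- counted in the weight `Y s T`.
        κ≤κc+ : ∀ R → R ∈ es → κ s R ≤ κc s R + ρ * ∑ ps (λ T → bool (inc T R) * Y s T)
        κ≤κc+ R R∈ = ≤-trans (*-monoˡ ρ≥0 (≤-trans (∑-mono∈ es step) (≤-reflexive (trans (∑-+ es _ _) (cong (∑ es (λ o → W s o * bool (conf (acc s) o R)) +_) swap)))))
            (≤-reflexive (*-distribˡ-+ ρ _ _))
          where
          f : E → P → ℚ
          f o T = bool (inc T R) * (bool (inc T o) * W s o)
          inner : ∀ o → o ∈ es → W s o * bool (kT o R) ≤ ∑ ps (f o)
          inner o o∈ with kT o R in e
          ... | false = ≤-trans (≤-reflexive (*-zeroʳ (W s o))) (∑-nn ps (λ T → *-nn (bool-nn (inc T R)) (*-nn (bool-nn (inc T o)) (W≥0 o))))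
          ... | true = ≤-trans (*-monoˡ (W≥0 o) (kT-inc o∈ R∈ e)) (≤-reflexive (trans (sym (∑-*ˡ ps (W s o) _)) (∑-cong ps (λ T → solve 3 (λ w a b → w :* (a :* b) := b :* (a :* w)) refl (W s o) (bool (inc T o)) (bool (inc T R))))))
          step : ∀ o → o ∈ es → W s o * bool (kill (acc s) o R) ≤ W s o * bool (conf (acc s) o R) + ∑ ps (f o)
          step o o∈ = ≤-trans (*-monoˡ (W≥0 o) (bool-∨ (kT o R) (conf (acc s) o R)))
            (≤-trans (≤-reflexive (solve 3 (λ w a b → w :* (a :+ b) := w :* b :+ w :* a) refl (W s o) (bool (kT o R)) (bool (conf (acc s) o R)))) (+-monoʳ-≤ _ (inner o o∈)))
          swap : ∑ es (λ o → ∑ ps (f o)) ≡ ∑ ps (λ T → bool (inc T R) * Y s T)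
          swap = trans (∑-swap es ps f) (∑-cong ps (λ T → ∑-*ˡ es (bool (inc T R)) _))

        Y≥0 : ∀ T → 0ℚ ≤ Y s T
        Y≥0 T = ∑-nn es (λ R → *-nn (bool-nn (inc T R)) (W≥0 R))

        κ≤κc+β : n ℕ.≤ I → ∀ R → R ∈ es → κ s R ≤ κc s R + β
        κ≤κc+β n≤I R R∈ = ≤-trans (κ≤κc+ R R∈) (+-monoʳ-≤ _ (≤-trans (*-monoˡ ρ≥0 (≤-trans (∑-mono∈ ps (λ T T∈ → *-monoˡ (bool-nn (inc T R)) (≤-trans (Y≤ T T∈) (ŷ≤thr n n≤I))))
            (≤-trans (≤-reflexive (∑-*ʳ ps thr _)) (*-monoʳ thr≥0 (inc≤q R∈)))))
          (≤-reflexive (trans (solve 3 (λ r q t → r :* (q :* t) := q :* (r :* t)) refl ρ q thr) (sym β≡)))))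

      -- The reserve after spending x' is at most the old one times 1 - x' μ in each of the m
      -- factors, and `bernoulli` compares this loss with the gain 1 + x. The last hypothesis keeps
      -- the reserve nonnegative.
      grow : ∀ {z x x'} → 0ℚ ≤ z → 0ℚ ≤ x → x ≤ x' → (z + x') * μ ≤ 1ℚ → (1ℚ + x) * (1ℚ - (z + x') * μ) ^ m ≤ (1ℚ - z * μ) ^ m
      grow {z} {x} {x'} z≥0 x≥0 x≤ b = ≤-trans (*-mono (+-nn 0≤1 x≥0) (+-monoʳ-≤ 1ℚ x≤) (^-nn (≤⇒0≤ b) m) (^-mono (≤⇒0≤ b) le m))
          (≤-trans (≤-reflexive (trans (cong ((1ℚ + x') *_) (^-* (1ℚ - z * μ) (1ℚ - x' * μ) m)) (solve 3 (λ a b c → a :* (b :* c) := b :* (c :* a)) refl (1ℚ + x') _ _)))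
            (≤-trans (*-monoˡ (^-nn zle m) bern) (≤-reflexive (*-identityʳ _))))
        where
        x'≥0 = ≤-trans x≥0 x≤
        y≤ : x' * μ ≤ 1ℚ
        y≤ = ≤-trans (*-monoʳ μ≥0 (≤-by z≥0 (+-comm z x'))) b
        zle : 0ℚ ≤ 1ℚ - z * μ
        zle = ≤⇒0≤ (≤-trans (*-monoʳ μ≥0 (≤-by x'≥0 refl)) b)
        le : 1ℚ - (z + x') * μ ≤ (1ℚ - z * μ) * (1ℚ - x' * μ)
        le = diff (*-nn (*-nn z≥0 μ≥0) (*-nn x'≥0 μ≥0)) (solve 3 (λ z x m → (𝟙 :- z :* m) :* (𝟙 :- x :* m) :- (𝟙 :- (z :+ x) :* m) := z :* m :* (x :* m)) refl z x' μ)
        bern : (1ℚ - x' * μ) ^ m * (1ℚ + x') ≤ 1ℚ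
        bern = ≤-trans (≤-reflexive (cong (λ w → (1ℚ - x' * μ) ^ m * (1ℚ + w)) (trans (sym (*-identityˡ x')) (trans (cong (_* x') (sym mμ)) (solve 3 (λ a b c → a :* b :* c := a :* (c :* b)) refl (ι m) μ x')))))
          (bernoulli m (*-nn x'≥0 μ≥0) y≤)

      inv-init : Inv 0 init
      inv-init = record { clk≡ = refl ; W≥0 = λ _ → 0≤1 ; Λ≥0 = λ _ → ≤-refl
        ; alive = λ R R∈ → inj₂ (cap≥0 , ≤-reflexive (trans (cong (λ z → 1ℚ * (1ℚ - z) ^ m) (solve 2 (λ b m → (𝟘 :+ 𝟘 :* b) :* m := 𝟘) refl β μ)) (trans (*-identityˡ _) (trans (cong (_^ m) (solve 0 (𝟙 :- 𝟘 := 𝟙) refl)) (1^ m)))) , good1 R∈)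
        ; Y≤ = λ T T∈ → ≤-trans (≤-reflexive (trans (∑-cong es (λ R → *-identityʳ (bool (inc T R)))) (degD T∈))) (≤-by (ŷ≥0 0) (+-comm (ŷ 0) D))
        ; good = good[] }

      -- Nonzero probability is essential: an accepted edge then has nonzero weight, so it is alive
      -- and compatible with the accepted list.
      inv-next : ∀ {n s} → Inv n s → suc n ℕ.≤ I → ∀ mo → mo ∈ outcomes → ¬ pr s mo ≡ 0ℚ → Inv (suc n) (next s mo)
      inv-next {n} {s} iv n<I mo mo∈ ne = record
        { clk≡ = cong suc clk≡
        ; W≥0 = λ R → *-nn (bool-nn (keep s mo R)) (W1≥0 iv mo R)
        ; Λ≥0 = λ R → +-nn (Λ≥0 R) (κc≥0 iv R)
        ; alive = al
        ; Y≤ = yl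
        ; good = gA mo mo∈ ne }
        where
        open Inv iv
        n≤I = ℕ.≤-trans (ℕ.n≤1+n n) n<I
        Wo≠0 : ∀ {o} → ¬ pr s (just o) ≡ 0ℚ → ¬ W s o ≡ 0ℚ
        Wo≠0 {o} ne z = ne (trans (cong (ρ *_) z) (*-zeroʳ ρ))
        goodo : ∀ {o} → just o ∈ outcomes → ¬ pr s (just o) ≡ 0ℚ → Good (o ∷ acc s)
        goodo {o} (there m∈) ne with ∈-map⁻ just m∈
        ... | _ , o∈ , refl with alive o o∈
        ...   | inj₁ e = ⊥-elim (Wo≠0 ne e)
        ...   | inj₂ (_ , _ , g) = g
        gA : ∀ mo → mo ∈ outcomes → ¬ pr s mo ≡ 0ℚ → Good (acc1 s mo)
        gA nothing _ _ = good
        gA (just o) m∈ ne = goodo m∈ ne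
        gR : ∀ mo {R} → mo ∈ outcomes → ¬ pr s mo ≡ 0ℚ → Good (R ∷ acc s) → hit s mo R ≡ false → Good (R ∷ acc1 s mo)
        gR nothing m∈ ne g e = g
        gR (just o) m∈ ne g e = good-step g (goodo m∈ ne) e
        al : ∀ R → R ∈ es → W (next s mo) R ≡ 0ℚ ⊎ (Λ1 s R ≤ cap × W (next s mo) R * (1ℚ - (Λ1 s R + ι (suc n) * β) * μ) ^ m ≤ 1ℚ × Good (R ∷ acc1 s mo))
        al R R∈ with keep s mo R in ek | hit s mo R in eh | alive R R∈
        ... | false | _ | _ = inj₁ (*-zeroˡ (_ * _))
        ... | true | true | _ = inj₁ (trans (*-identityˡ _) (solve 1 (λ v → (𝟙 :- 𝟙) :* v := 𝟘) refl (V s R)))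
        ... | true | false | inj₁ e = inj₁ (trans (cong (λ w → 1ℚ * ((1ℚ - 0ℚ) * (w * (1ℚ + κ s R)))) e) (solve 1 (λ v → 𝟙 :* ((𝟙 :- 𝟘) :* (𝟘 :* v)) := 𝟘) refl (1ℚ + κ s R)))
        ... | true | false | inj₂ (l , b , g) = inj₂ (Λ≤ , ≤-trans (≤-reflexive (solve 3 (λ w k p → 𝟙 :* ((𝟙 :- 𝟘) :* (w :* (𝟙 :+ k))) :* p := w :* ((𝟙 :+ k) :* p)) refl (W s R) (κ s R) _))
              (≤-trans (*-monoˡ (W≥0 R) grown) b) , gR mo mo∈ ne g eh)
          where
          Λ≤ : Λ1 s R ≤ cap
          Λ≤ = ≤ᵇ-true (proj₁ (∧-true ek))
          z = Λ s R + ι n * β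
          regroup : Λ1 s R + ι (suc n) * β ≡ z + (κc s R + β)
          regroup = solve 4 (λ L k i b → L :+ k :+ (𝟙 :+ i) :* b := L :+ i :* b :+ (k :+ b)) refl (Λ s R) (κc s R) (ι n) β
          fits : (z + (κc s R + β)) * μ ≤ 1ℚ
          fits = subst (λ w → w * μ ≤ 1ℚ) regroup (0≤⇒≤ (≤-trans h≥0 (budget n<I Λ≤)))
          grown : (1ℚ + κ s R) * (1ℚ - (Λ1 s R + ι (suc n) * β) * μ) ^ m ≤ (1ℚ - z * μ) ^ m
          grown = subst (λ w → (1ℚ + κ s R) * (1ℚ - w * μ) ^ m ≤ (1ℚ - z * μ) ^ m) (sym regroup)
            (grow (+-nn (Λ≥0 R) (*-nn (ι-nn n) β≥0)) (κ≥0 iv R) (κ≤κc+β iv n≤I R R∈) fits)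
        yl : ∀ T → T ∈ ps → Y (next s mo) T ≤ ŷ (suc n) + D
        yl T T∈ with over s mo T in e
        ... | false = ≤-trans (∑-mono es (λ R → *-monoˡ (bool-nn (inc T R)) (next≤W1 iv mo R))) (subst (λ c → Y1 s mo T ≤ ŷ (suc c) + D) clk≡ (≤ᵇ-true (not-false e)))
        -- All edges through an overshooting t-set are dropped, so its weight becomes zero and the
        -- bound is trivial.
        ... | true = ≤-trans (≤-reflexive (∑-zero es gone)) (+-nn (ŷ≥0 (suc n)) D≥0)
          where
          gone : ∀ R → bool (inc T R) * W (next s mo) R ≡ 0ℚ
          gone R with inc T R in ei
          ... | false = *-zeroˡ (W (next s mo) R)
          ... | true = trans (*-identityˡ _) (trans (cong (λ b → bool b * W1 s mo R) kf) (*-zeroˡ (W1 s mo R)))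
            where
            ∧-false : ∀ b → b ∧ false ≡ false
            ∧-false true = refl
            ∧-false false = refl
            kf : keep s mo R ≡ false
            kf = trans (cong (λ b → (Λ1 s R ≤ᵇ cap) ∧ not b) (any-true (λ T → inc T R ∧ over s mo T) T∈ (trans (cong (_∧ over s mo T) ei) e))) (∧-false (Λ1 s R ≤ᵇ cap))

-- Expectations as iterated operators.

module Exp where
  open Q
  open Prod
  open Proc
  open import Data.Rational using (_≤_)
  open import Data.Rational.Properties using (≤-refl; ≤-reflexive; ≤-trans; _≟_)
  open import Data.Unit using (tt)

  ∑< : ℕ → (ℕ → ℚ) → ℚ
  ∑< zero f = 0ℚ
  ∑< (suc n) f = ∑< n f + f n

  ∑<-nn : ∀ n {f} → (∀ i → i ℕ.< n → 0ℚ ≤ f i) → 0ℚ ≤ ∑< n f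
  ∑<-nn zero h = ≤-refl
  ∑<-nn (suc n) h = +-nn (∑<-nn n (λ i p → h i (ℕ.m≤n⇒m≤1+n p))) (h n ℕ.≤-refl)

  ∑<-mono : ∀ n {f g} → (∀ i → i ℕ.< n → f i ≤ g i) → ∑< n f ≤ ∑< n g
  ∑<-mono zero h = ≤-refl
  ∑<-mono (suc n) h = +-mono-≤ (∑<-mono n (λ i p → h i (ℕ.m≤n⇒m≤1+n p))) (h n ℕ.≤-refl)

  ∑<-const : ∀ n c → ∑< n (λ _ → c) ≡ ι n * c
  ∑<-const zero c = sym (*-zeroˡ c)
  ∑<-const (suc n) c = trans (cong (_+ c) (∑<-const n c)) (solve 2 (λ n c → n :* c :+ c := (𝟙 :+ n) :* c) refl (ι n) c)

  ∑<-+ : ∀ n f g → ∑< n (λ i → f i + g i) ≡ ∑< n f + ∑< n g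
  ∑<-+ zero f g = sym (+-identityˡ 0ℚ)
  ∑<-+ (suc n) f g = trans (cong (_+ (f n + g n)) (∑<-+ n f g)) (solve 4 (λ a b c d → a :+ b :+ (c :+ d) := a :+ c :+ (b :+ d)) refl (∑< n f) (∑< n g) (f n) (g n))

  ∑<-* : ∀ n c f → ∑< n (λ i → c * f i) ≡ c * ∑< n f
  ∑<-* zero c f = sym (*-zeroʳ c)
  ∑<-* (suc n) c f = trans (cong (_+ c * f n) (∑<-* n c f)) (sym (*-distribˡ-+ c _ _))

  ∑<-up : ∀ {m n f} → m ℕ.≤ n → (∀ i → i ℕ.< n → 0ℚ ≤ f i) → ∑< m f ≤ ∑< n f
  ∑<-up {zero} {n} ℕ.z≤n h = ∑<-nn n h
  ∑<-up {suc m} {suc n} {f} p h with m ℕ.≟ n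
  ... | yes refl = ≤-refl
  ... | no q = ≤-trans (∑<-up {suc m} {n} (ℕ.≤∧≢⇒< (ℕ.s≤s⁻¹ p) q) (λ i l → h i (ℕ.m≤n⇒m≤1+n l))) (≤-by (h n ℕ.≤-refl) refl)

  ∑T : ∀ {A : Set} → List A → ℕ → (List A → ℚ) → ℚ
  ∑T es zero f = f []
  ∑T es (suc n) f = ∑ es (λ x → ∑T es n (λ l → f (x ∷ l)))

  module _ {A : Set} (es : List A) where
    ∑T-mono : ∀ n {f g} → (∀ l → All (_∈ es) l → length l ≡ n → f l ≤ g l) → ∑T es n f ≤ ∑T es n g
    ∑T-mono zero h = h [] [] refl
    ∑T-mono (suc n) h = ∑-mono∈ es (λ x x∈ → ∑T-mono n (λ l a e → h (x ∷ l) (x∈ ∷ a) (cong suc e)))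

    ∑T-nn : ∀ n {f} → (∀ l → 0ℚ ≤ f l) → 0ℚ ≤ ∑T es n f
    ∑T-nn zero h = h []
    ∑T-nn (suc n) h = ∑-nn es (λ x → ∑T-nn n (λ l → h (x ∷ l)))

    ∑T-*ˡ : ∀ n c f → ∑T es n (λ l → c * f l) ≡ c * ∑T es n f
    ∑T-*ˡ zero c f = refl
    ∑T-*ˡ (suc n) c f = trans (∑-cong es (λ x → ∑T-*ˡ n c (λ l → f (x ∷ l)))) (∑-*ˡ es c _)

    ∑T-+ : ∀ n f g → ∑T es n (λ l → f l + g l) ≡ ∑T es n f + ∑T es n g
    ∑T-+ zero f g = refl
    ∑T-+ (suc n) f g = trans (∑-cong es (λ x → ∑T-+ n (λ l → f (x ∷ l)) (λ l → g (x ∷ l)))) (∑-+ es _ _)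

    ∑T-cong : ∀ n {f g} → (∀ l → f l ≡ g l) → ∑T es n f ≡ ∑T es n g
    ∑T-cong zero h = h []
    ∑T-cong (suc n) h = ∑-cong es (λ x → ∑T-cong n (λ l → h (x ∷ l)))

    ∑T-single : ∀ {f} → (∀ l → 0ℚ ≤ f l) → ∀ l → All (_∈ es) l → f l ≤ ∑T es (length l) f
    ∑T-single nn [] [] = ≤-refl
    ∑T-single nn (x ∷ l) (p ∷ ps) = ≤-trans (∑T-single (λ l → nn (x ∷ l)) l ps) (∑-single (λ y → ∑T-nn (length l) (λ l → nn (y ∷ l))) p)

  ∑<-single : ∀ {n i f} → i ℕ.< n → (∀ j → j ℕ.< n → 0ℚ ≤ f j) → f i ≤ ∑< n f
  ∑<-single {n} {i} {f} p h = ≤-trans (≤-by (∑<-nn i (λ j l → h j (ℕ.<-trans l p))) (+-comm _ _)) (∑<-up p h)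

  module Expect {E P : Set} (_≟E_ : DecidableEquality E) (es : List E) (ps : List P)
    (inc : P → E → Bool) (kT : E → E → Bool) (conf : List E → E → E → Bool)
    (ρ cap D : ℚ) (ŷ : ℕ → ℚ) where

    open Process _≟E_ es ps inc kT conf ρ cap D ŷ

    Es-cong : ∀ {F G} → (∀ s → F s ≡ G s) → ∀ s → Es F s ≡ Es G s
    Es-cong h s = ∑-cong outcomes (λ mo → cong (pr s mo *_) (h (next s mo)))

    Es-+ : ∀ F G s → Es (λ s → F s + G s) s ≡ Es F s + Es G s
    Es-+ F G s = trans (∑-cong outcomes (λ mo → *-distribˡ-+ (pr s mo) _ _)) (∑-+ outcomes _ _)

    Es-* : ∀ c F s → Es (λ s → c * F s) s ≡ c * Es F s
    Es-* c F s = trans (∑-cong outcomes (λ mo → solve 3 (λ p c f → p :* (c :* f) := c :* (p :* f)) refl (pr s mo) c (F (next s mo)))) (∑-*ˡ outcomes c _)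

    Es-const : ∀ c s → Es (λ _ → c) s ≡ c
    Es-const c s = trans (∑-*ʳ outcomes c (pr s)) (trans (cong (_* c) (∑pr s)) (*-identityˡ c))

    -- The last step is averaged innermost, so a one-step estimate valid at time n can be applied
    -- directly under `Eₙ n`, and no probability space of trajectories is built.
    Eₙ : ℕ → (State → ℚ) → State → ℚ
    Eₙ zero F = F
    Eₙ (suc n) F = Eₙ n (Es F)

    Eₙ-cong : ∀ n {F G} → (∀ s → F s ≡ G s) → ∀ s → Eₙ n F s ≡ Eₙ n G s
    Eₙ-cong zero h = h
    Eₙ-cong (suc n) h = Eₙ-cong n (Es-cong h)

    Eₙ-+ : ∀ n F G s → Eₙ n (λ s → F s + G s) s ≡ Eₙ n F s + Eₙ n G s
    Eₙ-+ zero F G s = refl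
    Eₙ-+ (suc n) F G s = trans (Eₙ-cong n (Es-+ F G) s) (Eₙ-+ n (Es F) (Es G) s)

    Eₙ-* : ∀ n c F s → Eₙ n (λ s → c * F s) s ≡ c * Eₙ n F s
    Eₙ-* zero c F s = refl
    Eₙ-* (suc n) c F s = trans (Eₙ-cong n (Es-* c F) s) (Eₙ-* n c (Es F) s)

    Eₙ-const : ∀ n c s → Eₙ n (λ _ → c) s ≡ c
    Eₙ-const zero c s = refl
    Eₙ-const (suc n) c s = trans (Eₙ-cong n (Es-const c) s) (Eₙ-const n c s)

    Eₙ-∑ : ∀ {A : Set} n (xs : List A) (F : A → State → ℚ) s → Eₙ n (λ s → ∑ xs (λ x → F x s)) s ≡ ∑ xs (λ x → Eₙ n (F x) s)
    Eₙ-∑ n [] F s = Eₙ-const n 0ℚ s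
    Eₙ-∑ n (x ∷ xs) F s = trans (Eₙ-+ n (F x) _ s) (cong (Eₙ n (F x) s +_) (Eₙ-∑ n xs F s))

    Eₙ-∑T : ∀ n j (F : List E → State → ℚ) s → Eₙ n (λ s → ∑T es j (λ l → F l s)) s ≡ ∑T es j (λ l → Eₙ n (F l) s)
    Eₙ-∑T n zero F s = refl
    Eₙ-∑T n (suc j) F s = trans (Eₙ-∑ n es (λ x s → ∑T es j (λ l → F (x ∷ l) s)) s) (∑-cong es (λ x → Eₙ-∑T n j (λ l → F (x ∷ l)) s))

    Eₙ-∑< : ∀ n j (F : ℕ → State → ℚ) s → Eₙ n (λ s → ∑< j (λ i → F i s)) s ≡ ∑< j (λ i → Eₙ n (F i) s)
    Eₙ-∑< n zero F s = Eₙ-const n 0ℚ s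
    Eₙ-∑< n (suc j) F s = trans (Eₙ-+ n _ (F j) s) (cong (_+ Eₙ n (F j) s) (Eₙ-∑< n j F s))

    𝔼 : ℕ → (State → ℚ) → ℚ
    𝔼 n F = Eₙ n F init

    -- An edge gets accepted with probability of order 1 / D, so scaling the indicator by D keeps
    -- each factor bounded in mean. Such products bound the probability that given edges are all
    -- accepted.
    accProd : List E → State → ℚ
    accProd L s = ∏ L (λ x → 1ℚ + D * bool (mem x (acc s)))

    -- Acceptance has probability ρ W and adds D, hence ρ D W in mean. As I ρ D is at most one in
    -- the application, `ω` is a martingale up to a constant factor over the whole process, with no
    -- appeal to the bound K.
    ω : State → E → ℚ
    ω s x = W s x + D * bool (mem x (acc s))

    Ω : List E → State → ℚ
    Ω c s = ∏ c (ω s)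

    live : State → E → Bool
    live s x = not (W s x ≤ᵇ 0ℚ)

    killLive : State → E → E → Bool
    killLive s o x = kill (acc s) o x ∧ live s x

    module _ {Good : List E → Set} {K lam μ β q thr h : ℚ} {m I : ℕ} (H : Hyp Good K lam μ β q thr h m I) where
      open WithHyp H

      -- An outcome of probability zero may violate the invariant; its term vanishes on both sides,
      -- so F and G need comparing only on states with `Inv`.
      Es-mono : ∀ {n s F G} → Inv n s → suc n ℕ.≤ I → (∀ s' → Inv (suc n) s' → F s' ≤ G s') → Es F s ≤ Es G s
      Es-mono {n} {s} {F} {G} iv l f = ∑-mono∈ outcomes step
        where
        step : ∀ mo → mo ∈ outcomes → pr s mo * F (next s mo) ≤ pr s mo * G (next s mo)
        step mo mo∈ with pr s mo ≟ 0ℚ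
        ... | yes z = ≤-reflexive (trans (cong (_* F (next s mo)) z) (trans (*-zeroˡ (F (next s mo))) (sym (trans (cong (_* G (next s mo)) z) (*-zeroˡ (G (next s mo)))))))
        ... | no z = *-monoˡ (pr≥0 iv (ℕ.≤-trans (ℕ.n≤1+n n) l) mo) (f (next s mo) (inv-next iv l mo mo∈ z))

      𝔼-mono : ∀ n {F G} → n ℕ.≤ I → (∀ s → Inv n s → F s ≤ G s) → 𝔼 n F ≤ 𝔼 n G
      𝔼-mono zero l f = f init inv-init
      𝔼-mono (suc n) l f = 𝔼-mono n (ℕ.≤-trans (ℕ.n≤1+n n) l) (λ s iv → Es-mono iv l f)

      𝔼-nn : ∀ n {F} → n ℕ.≤ I → (∀ s → Inv n s → 0ℚ ≤ F s) → 0ℚ ≤ 𝔼 n F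
      𝔼-nn n {F} l f = subst (_≤ 𝔼 n F) (Eₙ-const n 0ℚ init) (𝔼-mono n l f)

      -- Method of conditional expectations: each step picks an outcome at least as good as the
      -- average of what follows.
      𝔼-exists : ∀ n c {F} → n ℕ.≤ I → c ≤ 𝔼 n F → ∃ λ s → Inv n s × c ≤ F s
      𝔼-exists zero c l le = init , inv-init , le
      𝔼-exists (suc n) c {F} l le = advance (𝔼-exists n c {Es F} l' le)
        where
        l' : n ℕ.≤ I
        l' = ℕ.≤-trans (ℕ.n≤1+n n) l
        1≢0 : ¬ 1ℚ ≡ 0ℚ
        1≢0 ()
        advance : (∃ λ s → Inv n s × c ≤ Es F s) → ∃ λ s → Inv (suc n) s × c ≤ F s
        advance (s , iv , le') = let (mo , mo∈ , ne , r) = ∑-avg outcomes (pr s) (λ mo → F (next s mo)) c (pr≥0 iv l')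
                                       (≤-trans (≤-reflexive (trans (cong (_* c) (∑pr s)) (*-identityˡ c))) le') (λ z → 1≢0 (trans (sym (∑pr s)) z))
                                 in next s mo , inv-next iv l mo mo∈ ne , r

      -- Discrete Gronwall inequality. As g ≥ 1, every error may be amplified by the full g^n, which
      -- leaves a plain sum of errors.
      𝔼-growth : ∀ {F err} g → 1ℚ ≤ g → (∀ n s → Inv n s → suc n ℕ.≤ I → Es F s ≤ g * F s + err s) →
        (∀ n s → n ℕ.≤ I → Inv n s → 0ℚ ≤ err s) → ∀ n → n ℕ.≤ I → 𝔼 n F ≤ g ^ n * (F init + ∑< n (λ i → 𝔼 i err))
      𝔼-growth {F} {err} g g≥1 f e≥0 zero l = ≤-reflexive (solve 1 (λ x → x := 𝟙 :* (x :+ 𝟘)) refl (F init))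
      𝔼-growth {F} {err} g g≥1 f e≥0 (suc n) l = ≤-trans (𝔼-mono n l' (λ s iv → f n s iv l))
          (≤-trans (≤-reflexive (trans (Eₙ-+ n (λ s → g * F s) err init) (cong (_+ 𝔼 n err) (Eₙ-* n g F init))))
            (≤-trans (+-mono-≤ (*-monoˡ g≥0 (𝔼-growth g g≥1 f e≥0 n l')) (≤-trans (≤-reflexive (sym (*-identityˡ _))) (*-monoʳ (𝔼-nn n l' (λ s → e≥0 n s l')) (^-≥1 g≥1 (suc n)))))
              (≤-reflexive (solve 5 (λ g p x s e → g :* (p :* (x :+ s)) :+ g :* p :* e := g :* p :* (x :+ (s :+ e))) refl g (g ^ n) (F init) (∑< n (λ i → 𝔼 i err)) (𝔼 n err)))))
        where
        l' = ℕ.≤-trans (ℕ.n≤1+n n) l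
        g≥0 = ≤-trans 0≤1 g≥1

      pick : State → Maybe E → E → ℚ
      pick s nothing x = 0ℚ
      pick s (just o) x = D * bool ⌊ x ≟E o ⌋

      pick≥0 : ∀ s mo x → 0ℚ ≤ pick s mo x
      pick≥0 s nothing x = ≤-refl
      pick≥0 s (just o) x = *-nn D≥0 (bool-nn ⌊ x ≟E o ⌋)

      pick-amo : ∀ s mo {c} → Unique c → AtMostOne (pick s mo) c
      pick-amo s mo [] = tt
      pick-amo s nothing (_ ∷ u) = inj₁ refl , pick-amo s nothing u
      pick-amo s (just o) {x ∷ c} (a ∷ u) with x ≟E o
      ... | no _ = inj₁ (*-zeroʳ D) , pick-amo s (just o) u
      ... | yes refl = inj₂ (All.map zero' a) , pick-amo s (just o) u
        where
        zero' : ∀ {y} → ¬ x ≡ y → pick s (just x) y ≡ 0ℚ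
        zero' {y} ne with y ≟E x
        ... | yes e = ⊥-elim (ne (sym e))
        ... | no _ = *-zeroʳ D

      ∑-≟ : ∀ {f : E → ℚ} → (∀ x → 0ℚ ≤ f x) → ∀ {xs} → Unique xs → ∀ x → ∑ xs (λ o → f o * bool ⌊ x ≟E o ⌋) ≤ f x
      ∑-≟ nn [] x = nn x
      ∑-≟ {f} nn {o ∷ xs} (a ∷ u) x with x ≟E o
      ... | no _ = ≤-trans (≤-reflexive (trans (cong (_+ ∑ xs (λ o → f o * bool ⌊ x ≟E o ⌋)) (*-zeroʳ (f o))) (+-identityˡ _))) (∑-≟ nn u x)
      ... | yes refl = ≤-reflexive (trans (cong (f x * 1ℚ +_) (gone xs a)) (solve 1 (λ a → a :* 𝟙 :+ 𝟘 := a) refl (f x)))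
        where
        gone : ∀ xs → All (λ y → ¬ x ≡ y) xs → ∑ xs (λ o → f o * bool ⌊ x ≟E o ⌋) ≡ 0ℚ
        gone [] [] = refl
        gone (y ∷ ys) (n ∷ ns) with x ≟E y
        ... | yes e = ⊥-elim (n e)
        ... | no _ = trans (cong₂ _+_ (*-zeroʳ (f y)) (gone ys ns)) (+-identityˡ 0ℚ)

      ∑pr-pick : ∀ {n s} → Inv n s → ∀ x → ∑ outcomes (λ mo → pr s mo * pick s mo x) ≤ ρ * D * W s x
      ∑pr-pick {n} {s} iv x = ≤-trans (≤-reflexive (trans (cong₂ _+_ (*-zeroʳ (pr s nothing)) (∑-map just es _)) (trans (+-identityˡ _)
          (trans (∑-cong es (λ o → solve 4 (λ r w d b → r :* w :* (d :* b) := r :* d :* (w :* b)) refl ρ (W s o) D (bool ⌊ x ≟E o ⌋))) (∑-*ˡ es (ρ * D) _)))))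
        (*-monoˡ (*-nn ρ≥0 D≥0) (∑-≟ (Inv.W≥0 iv) es! x))

      mem-acc1 : ∀ s mo x → D * bool (mem x (acc1 s mo)) ≤ D * bool (mem x (acc s)) + pick s mo x
      mem-acc1 s nothing x = ≤-reflexive (sym (+-identityʳ _))
      mem-acc1 s (just o) x = ≤-trans (*-monoˡ D≥0 (bool-∨ ⌊ x ≟E o ⌋ (mem x (acc s)))) (≤-reflexive (trans (*-distribˡ-+ D _ _) (+-comm _ _)))

      accfac : State → E → ℚ
      accfac s x = 1ℚ + D * bool (mem x (acc s))

      accfac≥1 : ∀ s x → 1ℚ ≤ accfac s x
      accfac≥1 s x = ≤-by (*-nn D≥0 (bool-nn (mem x (acc s)))) refl

      accfac≥0 : ∀ s x → 0ℚ ≤ accfac s x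
      accfac≥0 s x = ≤-trans 0≤1 (accfac≥1 s x)

      -- At most one factor changes in a step, and the increment of a given factor has mean at most
      -- ρ D K.
      accProd-step : ∀ {L} → Unique L → All (_∈ es) L → ∀ {n s} → Inv n s → suc n ℕ.≤ I →
        Es (accProd L) s ≤ (1ℚ + ι (length L) * (ρ * D * K)) * accProd L s
      accProd-step {L} u L∈ {n} {s} iv l = ≤-trans (∑-mono outcomes (λ mo → *-monoˡ (pr≥0 iv l' mo) (pt mo)))
          (≤-trans (≤-reflexive expand) (≤-trans (+-monoʳ-≤ _ tail) (≤-reflexive (solve 3 (λ p n r → p :+ r :* (n :* p) := (𝟙 :+ n :* r) :* p) refl (accProd L s) (ι (length L)) (ρ * D * K)))))
        where
        l' = ℕ.≤-trans (ℕ.n≤1+n n) l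
        α = accfac s
        pt : ∀ mo → accProd L (next s mo) ≤ ∏ L α + δ∏ L α (pick s mo)
        pt mo = ≤-trans (∏-mono L (accfac≥0 (next s mo)) (λ x → ≤-trans (+-monoʳ-≤ 1ℚ (mem-acc1 s mo x)) (≤-reflexive (sym (+-assoc 1ℚ _ _)))))
          (∏-add L (accfac≥0 s) (pick≥0 s mo) (pick-amo s mo u))
        expand : ∑ outcomes (λ mo → pr s mo * (∏ L α + δ∏ L α (pick s mo))) ≡ ∏ L α + δ∏ L α (λ x → ∑ outcomes (λ mo → pr s mo * pick s mo x))
        expand = trans (∑-cong outcomes (λ mo → *-distribˡ-+ (pr s mo) _ _)) (trans (∑-+ outcomes _ _)
          (cong₂ _+_ (Es-const (∏ L α) s) (sym (δ∏-∑ L outcomes (pr s) (pick s)))))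
        tail : δ∏ L α (λ x → ∑ outcomes (λ mo → pr s mo * pick s mo x)) ≤ ρ * D * K * (ι (length L) * ∏ L α)
        tail = ≤-trans (δ∏-mono L (accfac≥0 s) (λ x x∈ → ≤-trans (∑pr-pick iv x) (≤-trans (*-monoˡ (*-nn ρ≥0 D≥0) (W≤K iv l' x (All.lookup L∈ x∈)))
              (≤-trans (≤-reflexive (sym (*-identityʳ _))) (*-monoˡ (*-nn (*-nn ρ≥0 D≥0) K≥0) (accfac≥1 s x))))))
            (≤-trans (≤-reflexive (δ∏-*ˡ L (ρ * D * K) α)) (*-monoˡ (*-nn (*-nn ρ≥0 D≥0) K≥0) (δ∏-≤ L (accfac≥0 s) (λ x → ≤-refl))))

      accProd-bound : ∀ {L} → Unique L → All (_∈ es) L → ∀ n → n ℕ.≤ I → 𝔼 n (accProd L) ≤ (1ℚ + ι (length L) * (ρ * D * K)) ^ n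
      accProd-bound {L} u L∈ n l = ≤-trans (𝔼-growth {accProd L} {λ _ → 0ℚ} g g≥1 (λ n s iv l → ≤-trans (accProd-step u L∈ iv l) (≤-reflexive (sym (+-identityʳ _)))) (λ _ _ _ _ → ≤-refl) n l)
          (≤-reflexive (trans (cong (g ^ n *_) (cong₂ _+_ init1 (trans (∑<-cong0 n) refl))) (solve 1 (λ x → x :* (𝟙 :+ 𝟘) := x) refl (g ^ n))))
        where
        g = 1ℚ + ι (length L) * (ρ * D * K)
        g≥1 : 1ℚ ≤ g
        g≥1 = ≤-by (*-nn (ι-nn (length L)) (*-nn (*-nn ρ≥0 D≥0) K≥0)) refl
        init1 : accProd L init ≡ 1ℚ
        init1 = trans (∏-cong L (λ x → trans (cong (1ℚ +_) (*-zeroʳ D)) (+-identityʳ 1ℚ))) (trans (∏-const L 1ℚ) (1^ (length L)))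
        ∑<-cong0 : ∀ n → ∑< n (λ i → 𝔼 i (λ _ → 0ℚ)) ≡ 0ℚ
        ∑<-cong0 zero = refl
        ∑<-cong0 (suc n) = trans (cong₂ _+_ (∑<-cong0 n) (Eₙ-const n 0ℚ init)) (+-identityˡ 0ℚ)

-- Correlation between the edges of a list.

module Omega where
  open Q
  open Prod
  open Proc
  open Exp
  open import Data.Rational using (_≤_)
  open import Data.Rational.Properties using (≤-refl; ≤-reflexive; ≤-trans; ≤-antisym)
  open import Data.List.Relation.Unary.All.Properties using (++⁺)

  module Weights {E P : Set} (_≟E_ : DecidableEquality E) (es : List E) (ps : List P)
    (inc : P → E → Bool) (kT : E → E → Bool) (conf : List E → E → E → Bool)
    (ρ cap D : ℚ) (ŷ : ℕ → ℚ) where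

    open Process _≟E_ es ps inc kT conf ρ cap D ŷ
    open Expect _≟E_ es ps inc kT conf ρ cap D ŷ

    sub : List E → List E → Bool
    sub [] A = true
    sub (x ∷ X) A = mem x A ∧ sub X A

    -- `bad c o X` marks the dense structures that must be present when one edge o kills two live edges of c.
    record Sparse (Good : List E → Set) (K : ℚ) (I : ℕ) : Set₁ where
      field
        Base : List E → E → Set
        bad : List E → E → List E → Bool
        xm ℓm : ℕ
        δ CK : ℚ
        δ≥0 : 0ℚ ≤ δ
        δD : δ * D ≡ 1ℚ
        CK≥0 : 0ℚ ≤ CK
        CK-bound : (1ℚ + ι ℓm * (ρ * D * K)) ^ I ≤ CK
        bad-unique : ∀ c o X → bad c o X ≡ true → Unique (c ++ X)
        struct : ∀ {A c o} (k : E → Bool) → Base c o → (∀ z → z ∈ c → k z ≡ true → kill A o z ≡ true × Good (z ∷ A)) → Good (o ∷ A) →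
          o ∈ es → All (_∈ es) c → two k c ≡ true → ∃ λ X → All (_∈ es) X × length X ℕ.< xm × sub X A ≡ true × bad c o X ≡ true

    module _ {Good : List E → Set} {K lam μ β q thr h : ℚ} {m I : ℕ} (H : Hyp Good K lam μ β q thr h m I) (Sp : Sparse Good K I) where
      open WithHyp H
      open Sparse Sp

      live-good : ∀ {n s} → Inv n s → ∀ x → x ∈ es → live s x ≡ true → Good (x ∷ acc s)
      live-good {n} {s} iv x x∈ e with Inv.alive iv x x∈
      ... | inj₂ (_ , _ , g) = g
      ... | inj₁ z = ⊥-elim (contra z (W s x ≤ᵇ 0ℚ) refl e)
        where
        contra : W s x ≡ 0ℚ → ∀ b → (W s x ≤ᵇ 0ℚ) ≡ b → not b ≡ true → _
        contra z false p _ = ≤ᵇ-⊥ (≤-reflexive z) p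

      dead-zero : ∀ {n s} → Inv n s → ∀ x → live s x ≡ false → W s x ≡ 0ℚ
      dead-zero {n} {s} iv x e = ≤-antisym (≤ᵇ-true (not-false e)) (Inv.W≥0 iv x)

      structAt : List E → E → ℚ
      structAt c o = ∑< xm (λ x → ∑T es x (λ X → bool (bad c o X) * δ ^ x))

      structSum : List E → ℚ
      structSum c = ∑ es (structAt c)

      structAt≥0 : ∀ c o → 0ℚ ≤ structAt c o
      structAt≥0 c o = ∑<-nn xm (λ x _ → ∑T-nn es x (λ X → *-nn (bool-nn (bad c o X)) (^-nn δ≥0 x)))

      present : List E → E → State → ℚ
      present c o s = ∑< xm (λ x → ∑T es x (λ X → bool (bad c o X) * (bool (sub X (acc s)) * accProd c s)))

      -- Markov's inequality in product form: an accepted edge has a factor at least D = 1 / δ in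
      -- `accProd`.
      sub-δ : ∀ X s → bool (sub X (acc s)) ≤ δ ^ length X * accProd X s
      sub-δ [] s = ≤-reflexive (sym (*-identityˡ 1ℚ))
      sub-δ (x ∷ X) s = ≤-trans (≤-reflexive (bool-∧ (mem x (acc s)) (sub X (acc s))))
        (≤-trans (*-mono (bool-nn (mem x (acc s))) one' (bool-nn (sub X (acc s))) (sub-δ X s))
          (≤-reflexive (solve 4 (λ a b c d → a :* b :* (c :* d) := a :* c :* (b :* d)) refl δ (accfac H s x) (δ ^ length X) (accProd X s))))
        where
        one' : bool (mem x (acc s)) ≤ δ * accfac H s x
        one' = ≤-by δ≥0 (trans (*-distribˡ-+ δ 1ℚ _) (trans (cong₂ _+_ (*-identityʳ δ) (trans (sym (*-assoc δ D _)) (trans (cong (_* bool (mem x (acc s))) δD) (*-identityˡ _)))) (+-comm δ _)))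

      pow-CK : ∀ ℓ n → ℓ ℕ.≤ ℓm → n ℕ.≤ I → (1ℚ + ι ℓ * (ρ * D * K)) ^ n ≤ CK
      pow-CK ℓ n lℓ ln = ≤-trans (^-mono (≤-trans 0≤1 (≤-by (*-nn (ι-nn ℓ) r≥0) refl)) (+-monoʳ-≤ 1ℚ (*-monoʳ r≥0 (ι-mono lℓ))) n)
          (≤-trans (^-up (≤-by (*-nn (ι-nn ℓm) r≥0) refl) ln) CK-bound)
        where
        r≥0 = *-nn (*-nn ρ≥0 D≥0) K≥0

      -- A bad X is disjoint from c, so a single bound for `accProd (c ++ X)` covers both the
      -- presence of X and the factors of c.
      𝔼-sub : ∀ {c o X} → All (_∈ es) c → All (_∈ es) X → bad c o X ≡ true → length c ℕ.+ length X ℕ.≤ ℓm → ∀ n → n ℕ.≤ I →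
        𝔼 n (λ s → bool (sub X (acc s)) * accProd c s) ≤ δ ^ length X * CK
      𝔼-sub {c} {o} {X} c∈ X∈ b lℓ n l = ≤-trans (𝔼-mono H n l (λ s iv → ≤-trans (*-monoʳ (∏-nn c (accfac≥0 H s)) (sub-δ X s))
            (≤-reflexive (trans (*-assoc (δ ^ length X) (accProd X s) (accProd c s)) (cong (δ ^ length X *_) (trans (*-comm (accProd X s) (accProd c s)) (sym (∏-++ c X (accfac H s)))))))))
          (≤-trans (≤-reflexive (Eₙ-* n (δ ^ length X) (accProd (c ++ X)) init))
            (*-monoˡ (^-nn δ≥0 (length X)) (≤-trans (accProd-bound H (bad-unique c o X b) (++⁺ c∈ X∈) n l)
              (≤-trans (≤-reflexive (cong (λ w → (1ℚ + ι w * (ρ * D * K)) ^ n) (length-++ c {X}))) (pow-CK _ n lℓ l)))))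

      𝔼-presentAt : ∀ c o → All (_∈ es) c → length c ℕ.+ xm ℕ.≤ ℓm → ∀ n → n ℕ.≤ I → 𝔼 n (present c o) ≤ CK * structAt c o
      𝔼-presentAt c o c∈ lℓ n l = ≤-trans (≤-reflexive (Eₙ-∑< n xm _ init)) (≤-trans (∑<-mono xm (λ x x< → ≤-trans (≤-reflexive (Eₙ-∑T n x _ init))
            (≤-trans (∑T-mono es x (λ X X∈ e → term X X∈ x e x<)) (≤-reflexive (∑T-*ˡ es x CK _))))) (≤-reflexive (∑<-* xm CK _)))
        where
        term : ∀ X → All (_∈ es) X → ∀ x → length X ≡ x → x ℕ.< xm →
          𝔼 n (λ s → bool (bad c o X) * (bool (sub X (acc s)) * accProd c s)) ≤ CK * (bool (bad c o X) * δ ^ x)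
        term X X∈ x refl x< with bad c o X in e
        ... | false = ≤-reflexive (trans (Eₙ-* n 0ℚ (λ s → bool (sub X (acc s)) * accProd c s) init) (trans (*-zeroˡ _) (solve 2 (λ c d → 𝟘 := c :* (𝟘 :* d)) refl CK (δ ^ length X))))
        ... | true = ≤-trans (≤-reflexive (Eₙ-* n 1ℚ (λ s → bool (sub X (acc s)) * accProd c s) init))
          (≤-trans (*-monoˡ 0≤1 (𝔼-sub {o = o} c∈ X∈ e (ℕ.≤-trans (ℕ.+-monoʳ-≤ (length c) (ℕ.<⇒≤ x<)) lℓ) n l)) (≤-reflexive (solve 2 (λ d c → 𝟙 :* (d :* c) := c :* (𝟙 :* d)) refl (δ ^ length X) CK)))

      𝔼-present : ∀ c → All (_∈ es) c → length c ℕ.+ xm ℕ.≤ ℓm → ∀ n → n ℕ.≤ I → 𝔼 n (λ s → ∑ es (λ o → present c o s)) ≤ CK * structSum c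
      𝔼-present c c∈ lℓ n l = ≤-trans (≤-reflexive (Eₙ-∑ n es (present c) init))
        (≤-trans (∑-mono es (λ o → 𝔼-presentAt c o c∈ lℓ n l)) (≤-reflexive (∑-*ˡ es CK _)))

      present≥0 : ∀ c o s → 0ℚ ≤ present c o s
      present≥0 c o s = ∑<-nn xm (λ x _ → ∑T-nn es x (λ X → *-nn (bool-nn (bad c o X)) (*-nn (bool-nn (sub X (acc s))) (∏-nn c (accfac≥0 H s)))))

      -- An o that kills two live entries of c forces, by `struct`, a bad list of accepted edges,
      -- which is one of the summands of `present`.
      two-present : ∀ {c} → All (_∈ es) c → ∀ {n s} → Inv n s → n ℕ.≤ I → ∀ o → o ∈ es → Base c o →
        W s o * bool (two (killLive s o) c) * accProd c s ≤ K * present c o s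
      two-present {c} c∈ {n} {s} iv l o o∈ bs with live s o in el | two (killLive s o) c in et
      ... | false | t = ≤-trans (≤-reflexive (trans (cong (λ w → w * bool t * accProd c s) (dead-zero iv o el)) (solve 2 (λ b a → 𝟘 :* b :* a := 𝟘) refl (bool t) (accProd c s)))) (*-nn K≥0 (present≥0 c o s))
      ... | true | false = ≤-trans (≤-reflexive (solve 2 (λ w a → w :* 𝟘 :* a := 𝟘) refl (W s o) (accProd c s))) (*-nn K≥0 (present≥0 c o s))
      ... | true | true with struct {acc s} {c} {o} (killLive s o) bs good-k (live-good iv o o∈ el) o∈ c∈ et
        where
        good-k : ∀ z → z ∈ c → killLive s o z ≡ true → kill (acc s) o z ≡ true × Good (z ∷ acc s)
        good-k z z∈ e = let (a , b) = ∧-true e in a , live-good iv z (All.lookup c∈ z∈) b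
      ...   | X , X∈ , X< , sb , bd = ≤-trans (≤-reflexive (cong (_* accProd c s) (*-identityʳ (W s o)))) (*-mono (Inv.W≥0 iv o) (W≤K iv l o o∈) (∏-nn c (accfac≥0 H s)) found)
        where
        fX : List E → ℚ
        fX X = bool (bad c o X) * (bool (sub X (acc s)) * accProd c s)
        fX≥0 : ∀ X → 0ℚ ≤ fX X
        fX≥0 X = *-nn (bool-nn (bad c o X)) (*-nn (bool-nn (sub X (acc s))) (∏-nn c (accfac≥0 H s)))
        found : accProd c s ≤ present c o s
        found = ≤-trans (≤-reflexive (trans (solve 1 (λ a → a := 𝟙 :* (𝟙 :* a)) refl (accProd c s)) (cong₂ (λ u v → bool u * (bool v * accProd c s)) (sym bd) (sym sb))))
          (≤-trans (∑T-single es fX≥0 X X∈) (∑<-single {f = λ x → ∑T es x fX} X< (λ j _ → ∑T-nn es j fX≥0)))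

      -- The value of `ω` after the reweighting by 1 + κ and before the death or acceptance of the
      -- same step.
      α : State → E → ℚ
      α s x = V s x + D * bool (mem x (acc s))

      2ℚ : ℚ
      2ℚ = 1ℚ + 1ℚ

      module _ {n s} (iv : Inv n s) (l : n ℕ.≤ I) where
        open Inv iv

        memD≥0 : ∀ x → 0ℚ ≤ D * bool (mem x (acc s))
        memD≥0 x = *-nn D≥0 (bool-nn (mem x (acc s)))

        V≤α : ∀ x → V s x ≤ α s x
        V≤α x = ≤-by (memD≥0 x) refl

        V≤2W : ∀ x → V s x ≤ 2ℚ * W s x
        V≤2W x = ≤-trans (*-monoˡ (W≥0 x) (+-monoʳ-≤ 1ℚ (≤-trans (κ≤lam iv l x) lam≤1))) (≤-reflexive (*-comm (W s x) 2ℚ))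

        2≥1 : 1ℚ ≤ 2ℚ
        2≥1 = ≤-by 0≤1 refl

        α≤2ω : ∀ x → α s x ≤ 2ℚ * ω s x
        α≤2ω x = ≤-trans (+-mono-≤ (V≤2W x) (≤-trans (≤-reflexive (sym (*-identityˡ _))) (*-monoʳ (memD≥0 x) 2≥1))) (≤-reflexive (sym (*-distribˡ-+ 2ℚ _ _)))

        ∏α≤ : ∀ c → ∏ c (α s) ≤ 2ℚ ^ length c * Ω c s
        ∏α≤ c = ≤-trans (∏-mono c (λ x → +-nn (V≥0 iv x) (memD≥0 x)) α≤2ω) (≤-reflexive (trans (∏-* c (λ _ → 2ℚ) (ω s)) (cong (_* Ω c s) (∏-const c 2ℚ))))

        ∏α≤K : ∀ {c} → All (_∈ es) c → ∏ c (α s) ≤ (2ℚ * K) ^ length c * accProd c s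
        ∏α≤K {c} c∈ = ≤-trans (∏-mono∈ c (λ x _ → +-nn (V≥0 iv x) (memD≥0 x)) (λ x x∈ →
              ≤-trans (+-mono-≤ (≤-trans (V≤2W x) (*-monoˡ (≤-trans 0≤1 2≥1) (W≤K iv l x (All.lookup c∈ x∈))))
                  (≤-trans (≤-reflexive (sym (*-identityˡ _))) (*-monoʳ (memD≥0 x) (≤-trans 2≥1 (≤-trans (≤-reflexive (sym (*-identityʳ 2ℚ))) (*-monoˡ (≤-trans 0≤1 2≥1) K≥1))))))
                (≤-reflexive (solve 2 (λ k d → k :+ k :* d := k :* (𝟙 :+ d)) refl (2ℚ * K) (D * bool (mem x (acc s)))))))
            (≤-reflexive (trans (∏-* c (λ _ → 2ℚ * K) (accfac H s)) (cong (_* accProd c s) (∏-const c (2ℚ * K)))))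

      hitV : State → Maybe E → E → ℚ
      hitV s mo x = bool (hit s mo x) * V s x

      com : List E → State → ℚ
      com c s = ∑ outcomes (λ mo → pr s mo * δ²∏ c (α s) (hitV s mo))

      -- The first-order losses have mean κ V, and (1 + κ)(1 - κ) ≤ 1 cancels them against the
      -- reweighting. Left over are the double deaths `com` and the acceptances, whose total effect
      -- is a factor 1 + O(ρ D).
      Ω-step : ∀ {c} → Unique c → All (_∈ es) c → ∀ {n s} → Inv n s → suc n ℕ.≤ I →
        Es (Ω c) s ≤ (1ℚ + ι (length c) * (ρ * D * 2ℚ ^ length c)) * Ω c s + com c s
      Ω-step {c} u c∈ {n} {s} iv l = ≤-trans (∑-mono outcomes (λ mo → *-monoˡ (pr≥0 iv l' mo) (pt mo)))
          (≤-trans (≤-reflexive expand) (≤-trans (+-mono-≤ (+-monoˡ-≤ (com c s) main) tail)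
            (≤-reflexive (solve 5 (λ w e i r p → w :+ e :+ i :* r :* (p :* w) := (𝟙 :+ i :* (r :* p)) :* w :+ e) refl (Ω c s) (com c s) (ι (length c)) (ρ * D) (2ℚ ^ length c)))))
        where
        open Inv iv
        l' = ℕ.≤-trans (ℕ.n≤1+n n) l
        αs = α s
        α≥0 : ∀ x → 0ℚ ≤ αs x
        α≥0 x = +-nn (V≥0 iv x) (memD≥0 iv l' x)
        h≥0' : ∀ mo x → 0ℚ ≤ hitV s mo x
        h≥0' mo x = *-nn (bool-nn (hit s mo x)) (V≥0 iv x)
        h≤α : ∀ mo x → hitV s mo x ≤ αs x
        h≤α mo x = ≤-trans (*-monoʳ (V≥0 iv x) (bool-≤1 (hit s mo x))) (≤-trans (≤-reflexive (*-identityˡ _)) (V≤α iv l' x))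
        ω≥0 : ∀ mo x → 0ℚ ≤ ω (next s mo) x
        ω≥0 mo x = +-nn (*-nn (bool-nn (keep s mo x)) (W1≥0 iv mo x)) (*-nn D≥0 (bool-nn (mem x (acc1 s mo))))
        pt : ∀ mo → Ω c (next s mo) ≤ ∏ c αs - δ∏ c αs (hitV s mo) + δ²∏ c αs (hitV s mo) + δ∏ c αs (pick H s mo)
        pt mo = ≤-trans (∏-mono c (ω≥0 mo) (λ x → ≤-trans (+-mono-≤ (next≤W1 iv mo x) (mem-acc1 H s mo x))
            (≤-reflexive (solve 4 (λ b v d g → (𝟙 :- b) :* v :+ (d :+ g) := v :+ d :- b :* v :+ g) refl (bool (hit s mo x)) (V s x) (D * bool (mem x (acc s))) (pick H s mo x)))))
          (∏-upper (h≥0' mo) (h≤α mo) c (pick≥0 H s mo) (pick-amo H s mo u))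
        κV : E → ℚ
        κV x = κ s x * V s x
        pickE : E → ℚ
        pickE x = ∑ outcomes (λ mo → pr s mo * pick H s mo x)
        hitE : ∀ x → ∑ outcomes (λ mo → pr s mo * hitV s mo x) ≡ κV x
        hitE x = trans (cong₂ _+_ (solve 2 (λ p v → p :* (𝟘 :* v) := 𝟘) refl (pr s nothing) (V s x)) (∑-map just es _))
          (trans (+-identityˡ _) (trans (∑-cong es (λ o → solve 4 (λ r w b v → r :* w :* (b :* v) := r :* (w :* b) :* v) refl ρ (W s o) (bool (kill (acc s) o x)) (V s x)))
            (trans (∑-*ʳ es (V s x) _) (cong (_* V s x) (∑-*ˡ es ρ _)))))
        δ∏-cong : ∀ (c : List E) {h g} → (∀ x → h x ≡ g x) → δ∏ c αs h ≡ δ∏ c αs g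
        δ∏-cong [] e = refl
        δ∏-cong (x ∷ c) e = cong₂ _+_ (cong (_* ∏ c αs) (e x)) (cong (αs x *_) (δ∏-cong c e))
        expand : ∑ outcomes (λ mo → pr s mo * (∏ c αs - δ∏ c αs (hitV s mo) + δ²∏ c αs (hitV s mo) + δ∏ c αs (pick H s mo)))
          ≡ ∏ c αs - δ∏ c αs κV + com c s + δ∏ c αs pickE
        expand = trans (∑-cong outcomes (λ mo → solve 5 (λ p a b d e → p :* (a :- b :+ d :+ e) := (p :* a :- p :* b) :+ p :* d :+ p :* e) refl (pr s mo) (∏ c αs) (δ∏ c αs (hitV s mo)) (δ²∏ c αs (hitV s mo)) (δ∏ c αs (pick H s mo))))
          (trans (∑-+ outcomes _ _) (cong₂ _+_ (trans (∑-+ outcomes _ _) (cong (_+ com c s) (trans (∑-minus outcomes _ _)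
              (cong₂ _-_ (Es-const (∏ c αs) s) (trans (sym (δ∏-∑ c outcomes (pr s) (hitV s))) (δ∏-cong c hitE))))))
            (sym (δ∏-∑ c outcomes (pr s) (pick H s)))))
        κV≥0 : ∀ x → 0ℚ ≤ κV x
        κV≥0 x = *-nn (κ≥0 iv x) (V≥0 iv x)
        κV≤α : ∀ x → κV x ≤ αs x
        κV≤α x = ≤-trans (*-monoʳ (V≥0 iv x) (≤-trans (κ≤lam iv l' x) lam≤1)) (≤-trans (≤-reflexive (*-identityˡ _)) (V≤α iv l' x))
        main : ∏ c αs - δ∏ c αs κV ≤ Ω c s
        main = ≤-trans (∏-lower κV≥0 κV≤α c) (∏-mono c (λ x → ≤⇒0≤ (κV≤α x)) (λ x → diff (*-nn (W≥0 x) (*-nn (κ≥0 iv x) (κ≥0 iv x)))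
          (solve 3 (λ w k d → w :+ d :- (w :* (𝟙 :+ k) :+ d :- k :* (w :* (𝟙 :+ k))) := w :* (k :* k)) refl (W s x) (κ s x) (D * bool (mem x (acc s))))))
        tail : δ∏ c αs pickE ≤ ι (length c) * (ρ * D) * (2ℚ ^ length c * Ω c s)
        tail = ≤-trans (δ∏-mono c α≥0 (λ x _ → ≤-trans (∑pr-pick H iv x) (*-monoˡ (*-nn ρ≥0 D≥0) (≤-trans (diff (*-nn (W≥0 x) (κ≥0 iv x)) (solve 2 (λ w k → w :* (𝟙 :+ k) :- w := w :* k) refl (W s x) (κ s x))) (V≤α iv l' x)))))
          (≤-trans (≤-reflexive (δ∏-*ˡ c (ρ * D) αs)) (≤-trans (*-monoˡ (*-nn ρ≥0 D≥0) (δ∏-≤ c α≥0 (λ x → ≤-refl)))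
            (≤-trans (≤-reflexive (solve 3 (λ r i p → r :* (i :* p) := i :* r :* p) refl (ρ * D) (ι (length c)) (∏ c αs))) (*-monoˡ (*-nn (ι-nn (length c)) (*-nn ρ≥0 D≥0)) (∏α≤ iv l' c)))))

      comC : ℕ → ℚ
      comC j = ι j * ι j * (2ℚ * K) ^ j

      comC≥0 : ∀ j → 0ℚ ≤ comC j
      comC≥0 j = *-nn (*-nn (ι-nn j) (ι-nn j)) (^-nn (*-nn (+-nn 0≤1 0≤1) K≥0) j)

      -- Weights may be bounded crudely by K here: bad structures will be fewer by a factor n, so
      -- the constant does not matter.
      com-bound : ∀ {c} → All (_∈ es) c → (∀ o → o ∈ es → Base c o) → ∀ {n s} → Inv n s → n ℕ.≤ I →
        com c s ≤ ρ * K * comC (length c) * ∑ es (λ o → present c o s)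
      com-bound {c} c∈ bs {n} {s} iv l = ≤-trans (≤-reflexive (trans (cong₂ _+_ (trans (cong (pr s nothing *_) none) (*-zeroʳ (pr s nothing))) (∑-map just es _)) (+-identityˡ _)))
          (≤-trans (∑-mono∈ es step) (≤-reflexive (∑-*ˡ es _ _)))
        where
        open Inv iv
        α≥0 : ∀ x → 0ℚ ≤ α s x
        α≥0 x = +-nn (V≥0 iv x) (memD≥0 iv l x)
        none : δ²∏ c (α s) (hitV s nothing) ≡ 0ℚ
        none = z2 c
          where
          hz : ∀ x → hitV s nothing x ≡ 0ℚ
          hz x = *-zeroˡ (V s x)
          z2 : ∀ c → δ²∏ c (α s) (hitV s nothing) ≡ 0ℚ
          z2 [] = refl
          z2 (x ∷ c) = trans (cong₂ _+_ (trans (cong (_* δ∏ c (α s) (hitV s nothing)) (hz x)) (*-zeroˡ (δ∏ c (α s) (hitV s nothing)))) (trans (cong (α s x *_) (z2 c)) (*-zeroʳ (α s x)))) (+-identityˡ 0ℚ)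
        kh : ∀ o x → killLive s o x ≡ false → hitV s (just o) x ≡ 0ℚ
        kh o x e with kill (acc s) o x | live s x in el
        ... | false | _ = *-zeroˡ (V s x)
        ... | true | false = trans (cong (λ w → 1ℚ * (w * (1ℚ + κ s x))) (dead-zero iv x el)) (solve 1 (λ k → 𝟙 :* (𝟘 :* k) := 𝟘) refl (1ℚ + κ s x))
        step : ∀ o → o ∈ es → ρ * W s o * δ²∏ c (α s) (hitV s (just o)) ≤ ρ * K * comC (length c) * present c o s
        step o o∈ = ≤-trans (*-monoˡ (*-nn ρ≥0 (W≥0 o)) (≤-trans
              (δ²∏-two (killLive s o) (λ x → *-nn (bool-nn (hit s (just o) x)) (V≥0 iv x))
                (λ x → ≤-trans (*-monoʳ (V≥0 iv x) (bool-≤1 (hit s (just o) x))) (≤-trans (≤-reflexive (*-identityˡ _)) (V≤α iv l x))) (kh o) c)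
              (*-monoˡ (bool-nn (two (killLive s o) c)) (*-monoˡ (*-nn (ι-nn (length c)) (ι-nn (length c))) (∏α≤K iv l c∈)))))
          (≤-trans (≤-reflexive (solve 6 (λ r w b i k p → r :* w :* (b :* (i :* (k :* p))) := r :* (i :* k) :* (w :* b :* p)) refl ρ (W s o) (bool (two (killLive s o) c)) (ι (length c) * ι (length c)) ((2ℚ * K) ^ length c) (accProd c s)))
            (≤-trans (*-monoˡ (*-nn ρ≥0 (comC≥0 (length c))) (two-present c∈ iv l o o∈ (bs o o∈)))
              (≤-reflexive (solve 4 (λ r c k p → r :* c :* (k :* p) := r :* k :* c :* p) refl ρ (comC (length c)) K (present c o s)))))

      Ω-bound : ∀ {c} → Unique c → All (_∈ es) c → (∀ o → o ∈ es → Base c o) → length c ℕ.+ xm ℕ.≤ ℓm → ∀ n → n ℕ.≤ I →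
        𝔼 n (Ω c) ≤ (1ℚ + ι (length c) * (ρ * D * 2ℚ ^ length c)) ^ n * (1ℚ + ι n * (ρ * K * comC (length c) * (CK * structSum c)))
      Ω-bound {c} u c∈ bs lℓ n l = ≤-trans (𝔼-growth H {Ω c} {err} g g≥1 (λ n s iv l → ≤-trans (Ω-step u c∈ iv l) (+-monoʳ-≤ _ (com-bound c∈ bs iv (ℕ.≤-trans (ℕ.n≤1+n n) l)))) err≥0 n l)
          (*-monoˡ (^-nn (≤-trans 0≤1 g≥1) n) (+-mono-≤ (≤-reflexive init1) (≤-trans (∑<-mono n (λ i i< → E-err i (ℕ.≤-trans (ℕ.<⇒≤ i<) l))) (≤-reflexive (∑<-const n _)))))
        where
        g = 1ℚ + ι (length c) * (ρ * D * 2ℚ ^ length c)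
        C = ρ * K * comC (length c)
        C≥0 : 0ℚ ≤ C
        C≥0 = *-nn (*-nn ρ≥0 K≥0) (comC≥0 (length c))
        err : State → ℚ
        err s = C * ∑ es (λ o → present c o s)
        g≥1 : 1ℚ ≤ g
        g≥1 = ≤-by (*-nn (ι-nn (length c)) (*-nn (*-nn ρ≥0 D≥0) (^-nn (+-nn 0≤1 0≤1) (length c)))) refl
        err≥0 : ∀ n s → n ℕ.≤ I → Inv n s → 0ℚ ≤ err s
        err≥0 n s _ _ = *-nn C≥0 (∑-nn es (λ o → present≥0 c o s))
        E-err : ∀ i → i ℕ.≤ I → 𝔼 i err ≤ C * (CK * structSum c)
        E-err i li = ≤-trans (≤-reflexive (Eₙ-* i C _ init)) (*-monoˡ C≥0 (𝔼-present c c∈ lℓ i li))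
        init1 : Ω c init ≡ 1ℚ
        init1 = trans (∏-cong c (λ x → trans (cong (1ℚ +_) (*-zeroʳ D)) (+-identityʳ 1ℚ))) (trans (∏-const c 1ℚ) (1^ (length c)))

-- The quadratic potential that controls the degrees.

module Phi where
  open Q
  open Prod
  open Proc
  open Exp
  open import Data.Rational using (_≤_)
  open import Data.Rational.Properties using (≤-refl; ≤-reflexive; ≤-trans; ≤-antisym; ≤-total)

  opaque
    pos : ℚ → ℚ
    pos a = bool (0ℚ ≤ᵇ a) * a

    pos-≥ : ∀ {a} → 0ℚ ≤ a → pos a ≡ a
    pos-≥ {a} p with 0ℚ ≤ᵇ a in e
    ... | true = *-identityˡ a
    ... | false = trans (*-zeroˡ a) (≤-antisym p (≤ᵇ-false e))

    pos-≤ : ∀ {a} → a ≤ 0ℚ → pos a ≡ 0ℚ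
    pos-≤ {a} p with 0ℚ ≤ᵇ a in e
    ... | true = trans (*-identityˡ a) (≤-antisym p (≤ᵇ-true e))
    ... | false = *-zeroˡ a

  pos-nn : ∀ a → 0ℚ ≤ pos a
  pos-nn a with ≤-total 0ℚ a
  ... | inj₁ p = subst (0ℚ ≤_) (sym (pos-≥ p)) p
  ... | inj₂ p = ≤-reflexive (sym (pos-≤ p))

  a≤pos : ∀ a → a ≤ pos a
  a≤pos a with ≤-total 0ℚ a
  ... | inj₁ p = ≤-reflexive (sym (pos-≥ p))
  ... | inj₂ p = ≤-trans p (pos-nn a)

  pos-mono : ∀ {a b} → a ≤ b → pos a ≤ pos b
  pos-mono {a} {b} l with ≤-total 0ℚ a
  ... | inj₁ p = ≤-trans (≤-reflexive (pos-≥ p)) (≤-trans l (a≤pos b))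
  ... | inj₂ p = ≤-trans (≤-reflexive (pos-≤ p)) (pos-nn b)

  -- One-sided, because only degrees above the trajectory are harmful.
  φ : ℚ → ℚ
  φ a = pos a * pos a

  φ-nn : ∀ a → 0ℚ ≤ φ a
  φ-nn a = sq-nn (pos a)

  φ-mono : ∀ {a b} → a ≤ b → φ a ≤ φ b
  φ-mono {a} l = *-mono (pos-nn a) (pos-mono l) (pos-nn a) (pos-mono l)

  φ-≤0 : ∀ {a} → a ≤ 0ℚ → φ a ≡ 0ℚ
  φ-≤0 {a} p = trans (cong (_* pos a) (pos-≤ p)) (*-zeroˡ (pos a))

  φ-≥0 : ∀ {a} → 0ℚ ≤ a → φ a ≡ a * a
  φ-≥0 p = cong₂ _*_ (pos-≥ p) (pos-≥ p)

  φ-≤sq : ∀ a → φ a ≤ a * a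
  φ-≤sq a with ≤-total 0ℚ a
  ... | inj₁ p = ≤-reflexive (φ-≥0 p)
  ... | inj₂ p = ≤-trans (≤-reflexive (φ-≤0 p)) (sq-nn a)

  -- The derivative of φ is 2 times the positive part and has Lipschitz constant 2, so the remainder
  -- is at most e².
  φ-taylor : ∀ a e → φ (a + e) ≤ φ a + (pos a + pos a) * e + e * e
  φ-taylor a e with ≤-total 0ℚ a
  ... | inj₁ p = ≤-trans (φ-≤sq (a + e)) (≤-reflexive (trans (solve 2 (λ a e → (a :+ e) :* (a :+ e) := a :* a :+ (a :+ a) :* e :+ e :* e) refl a e)
        (cong (λ w → w * w + (w + w) * e + e * e) (sym (pos-≥ p)))))
  ... | inj₂ p = ≤-trans (≤-trans (φ-mono (≤-trans (+-monoˡ-≤ e p) (≤-reflexive (+-identityˡ e)))) (φ-≤sq e))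
        (≤-reflexive (trans (solve 1 (λ e → e :* e := 𝟘 :* 𝟘 :+ (𝟘 :+ 𝟘) :* e :+ e :* e) refl e) (cong (λ w → w * w + (w + w) * e + e * e) (sym (pos-≤ p)))))

  φ-* : ∀ a {c} → 0ℚ ≤ c → φ (a * c) ≡ c * c * φ a
  φ-* a {c} c≥0 with ≤-total 0ℚ a
  ... | inj₁ p = trans (φ-≥0 (*-nn p c≥0)) (trans (solve 2 (λ a c → a :* c :* (a :* c) := c :* c :* (a :* a)) refl a c) (cong (c * c *_) (sym (φ-≥0 p))))
  ... | inj₂ p = trans (φ-≤0 (≤-trans (*-monoʳ c≥0 p) (≤-reflexive (*-zeroˡ c)))) (trans (sym (*-zeroʳ (c * c))) (cong (c * c *_) (sym (φ-≤0 p))))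

  bool-any : ∀ {A : Set} (f : A → Bool) xs → bool (any f xs) ≤ ∑ xs (λ x → bool (f x))
  bool-any f [] = ≤-refl
  bool-any f (x ∷ xs) = ≤-trans (bool-∨ (f x) (any f xs)) (+-monoʳ-≤ _ (bool-any f xs))

  module Potential {E P : Set} (_≟E_ : DecidableEquality E) (es : List E) (ps : List P)
    (inc : P → E → Bool) (kT : E → E → Bool) (conf : List E → E → E → Bool)
    (ρ cap D : ℚ) (ŷ : ℕ → ℚ) where

    open Process _≟E_ es ps inc kT conf ρ cap D ŷ
    open Expect _≟E_ es ps inc kT conf ρ cap D ŷ

    Φ : State → P → ℚ
    Φ s T = φ (Y s T - ŷ (clk s))

    Φ1 : State → Maybe E → P → ℚ
    Φ1 s mo T = φ (Y1 s mo T - ŷ (suc (clk s)))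

    ξ : State → P → E → ℚ
    ξ s T o = ∑ es (λ R → bool (inc T R) * (bool (kill (acc s) o R) * V s R))

    -- Only outcomes avoiding T enter: an accepted edge through T kills every edge through T, after
    -- which the potential of T is zero.
    var : State → P → ℚ
    var s T = ∑ es (λ o → ρ * W s o * (bool (not (inc T o)) * (ξ s T o * ξ s T o)))

    -- The total weight with its unused conflict budget, minus a penalty for t-sets whose degree exceeds the trajectory ŷ.
    pot : (ℕ → ℚ) → State → ℚ
    pot C s = ∑ es (λ R → W s R * (cap - Λ s R)) - C (clk s) * ∑ ps (Φ s)

    -- The summands are the budget consumed by dense lists, the defect κ² left by (1 + κ)(1 - κ),
    -- and the variance added to the potential.
    loss : (ℕ → ℚ) → State → ℚ
    loss C s = ∑ es (λ R → W s R * κc s R) + cap * ∑ es (λ R → W s R * (κ s R * κ s R)) + C (suc (clk s)) * ∑ ps (var s)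

    module _ {Good : List E → Set} {K lam μ β q thr h : ℚ} {m I : ℕ} (H : Hyp Good K lam μ β q thr h m I)
      (ŷ-rec : ∀ n → ŷ (suc n) ≡ ŷ n + (1ℚ + lam) * ρ * (ŷ n * ŷ n)) where
      open WithHyp H

      -- The square of the Lipschitz constant of y ↦ y + (1 + lam) ρ y² on [0, thr]: one step of the
      -- trajectory stretches deviations by at most this constant.
      g : ℚ
      g = (1ℚ + (1ℚ + lam) * ρ * (thr + thr)) * (1ℚ + (1ℚ + lam) * ρ * (thr + thr))

      module _ {n s} (iv : Inv n s) (l : n ℕ.< I) where
        open Inv iv
        private
          l' = ℕ.<⇒≤ l

          clk≤ : clk s ℕ.≤ I
          clk≤ = subst (ℕ._≤ I) (sym clk≡) l'

          lρ≥0 : 0ℚ ≤ (1ℚ + lam) * ρ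
          lρ≥0 = *-nn (+-nn 0≤1 lam≥0) ρ≥0

        module _ (T : P) (T∈ : T ∈ ps) where
          private
            S : ℚ
            S = ∑ es (λ R → bool (inc T R) * V s R)

            u : Maybe E → ℚ
            u nothing = 1ℚ
            u (just o) = bool (not (inc T o))

            ξ' : Maybe E → ℚ
            ξ' nothing = 0ℚ
            ξ' (just o) = ξ s T o

            u≥0 : ∀ mo → 0ℚ ≤ u mo
            u≥0 nothing = 0≤1
            u≥0 (just o) = bool-nn (not (inc T o))

            u≤1 : ∀ mo → u mo ≤ 1ℚ
            u≤1 nothing = ≤-refl
            u≤1 (just o) = bool-≤1 (not (inc T o))

            ξ≥0 : ∀ o → 0ℚ ≤ ξ s T o
            ξ≥0 o = ∑-nn es (λ R → *-nn (bool-nn (inc T R)) (*-nn (bool-nn (kill (acc s) o R)) (V≥0 iv R)))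

            ŷ' : ℚ
            ŷ' = ŷ (suc (clk s))

            Y1-eq : ∀ mo → Y1 s mo T ≡ S - ξ' mo
            Y1-eq nothing = trans (∑-cong es (λ R → solve 2 (λ i v → i :* ((𝟙 :- 𝟘) :* v) := i :* v) refl (bool (inc T R)) (V s R))) (solve 1 (λ x → x := x :- 𝟘) refl S)
            Y1-eq (just o) = trans (∑-cong es (λ R → solve 3 (λ i b v → i :* ((𝟙 :- b) :* v) := i :* v :- i :* (b :* v)) refl (bool (inc T R)) (bool (kill (acc s) o R)) (V s R))) (∑-minus es _ _)

            killed : ∀ {o R} → inc T o ≡ true → inc T R ≡ true → kill (acc s) o R ≡ true
            killed {o} {R} a b = cong (_∨ conf (acc s) o R) (inc-kT T∈ a b)

            Y1-0 : ∀ o → inc T o ≡ true → Y1 s (just o) T ≡ 0ℚ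
            Y1-0 o e = ∑-zero es zero'
              where
              zero' : ∀ R → bool (inc T R) * W1 s (just o) R ≡ 0ℚ
              zero' R with inc T R in er
              ... | false = *-zeroˡ (W1 s (just o) R)
              ... | true = trans (cong (λ b → 1ℚ * ((1ℚ - bool b) * V s R)) (killed e er)) (solve 1 (λ v → 𝟙 :* ((𝟙 :- 𝟙) :* v) := 𝟘) refl (V s R))

            ξ̄ : ℚ
            ξ̄ = ∑ outcomes (λ mo → pr s mo * (u mo * ξ' mo))

            -- Centre of the expansion. The mean ξ̄ over the outcomes avoiding T is not divided by
            -- their mass `P₀`; since `P₀` is at most one, the discrepancy has the favourable sign
            -- in `collect`.
            a' : ℚ
            a' = S - ŷ' - ξ̄

            bound : Maybe E → ℚ
            bound mo = φ a' + (pos a' + pos a') * (ξ̄ - ξ' mo) + (ξ̄ - ξ' mo) * (ξ̄ - ξ' mo)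

            taylor : ∀ mo → Φ1 s mo T ≤ bound mo
            taylor mo = ≤-trans (≤-reflexive (cong φ (trans (cong (_- ŷ') (Y1-eq mo)) (solve 4 (λ s x y b → s :- x :- y := s :- y :- b :+ (b :- x)) refl S (ξ' mo) ŷ' ξ̄)))) (φ-taylor a' (ξ̄ - ξ' mo))

            pt : ∀ mo → Φ1 s mo T ≤ u mo * bound mo
            pt nothing = ≤-trans (taylor nothing) (≤-reflexive (sym (*-identityˡ _)))
            pt (just o) with inc T o in e
            ... | false = ≤-trans (taylor (just o)) (≤-reflexive (sym (*-identityˡ _)))
            ... | true = ≤-reflexive (trans (φ-≤0 (≤-trans (≤-reflexive (cong (_- ŷ') (Y1-0 o e))) (diff (ŷ≥0 (suc (clk s))) (solve 1 (λ y → 𝟘 :- (𝟘 :- y) := y) refl ŷ')))) (sym (*-zeroˡ (bound (just o)))))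

            P₀ : ℚ
            P₀ = ∑ outcomes (λ mo → pr s mo * u mo)

            P₀≤1 : P₀ ≤ 1ℚ
            P₀≤1 = ≤-trans (∑-mono outcomes (λ mo → ≤-trans (*-monoˡ (pr≥0 iv l' mo) (u≤1 mo)) (≤-reflexive (*-identityʳ _)))) (≤-reflexive (∑pr s))

            ξ̄≥0 : 0ℚ ≤ ξ̄
            ξ̄≥0 = ∑-nn outcomes (λ mo → *-nn (pr≥0 iv l' mo) (*-nn (u≥0 mo) (ξ'≥0 mo)))
              where
              ξ'≥0 : ∀ mo → 0ℚ ≤ ξ' mo
              ξ'≥0 nothing = ≤-refl
              ξ'≥0 (just o) = ξ≥0 o

            V₂ : ℚ
            V₂ = ∑ outcomes (λ mo → pr s mo * (u mo * (ξ' mo * ξ' mo)))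

            V₂≡ : V₂ ≡ var s T
            V₂≡ = trans (cong₂ _+_ (solve 1 (λ p → p :* (𝟙 :* (𝟘 :* 𝟘)) := 𝟘) refl (pr s nothing)) (∑-map just es _)) (+-identityˡ _)

            total : ∑ outcomes (λ mo → pr s mo * (u mo * bound mo)) ≤ φ a' + var s T
            total = ≤-trans (≤-reflexive expand) (≤-trans collect (≤-reflexive (cong (φ a' +_) V₂≡)))
              where
              A = pos a' + pos a'
              expand : ∑ outcomes (λ mo → pr s mo * (u mo * bound mo)) ≡ (φ a' + A * ξ̄ + ξ̄ * ξ̄) * P₀ - (A + ξ̄ + ξ̄) * ξ̄ + V₂
              expand = trans (∑-cong outcomes (λ mo → solve 6 (λ p u f A b x → p :* (u :* (f :+ A :* (b :- x) :+ (b :- x) :* (b :- x))) :=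
                  (f :+ A :* b :+ b :* b) :* (p :* u) :- (A :+ b :+ b) :* (p :* (u :* x)) :+ p :* (u :* (x :* x))) refl (pr s mo) (u mo) (φ a') A ξ̄ (ξ' mo)))
                (trans (∑-+ outcomes _ _) (cong (_+ V₂) (trans (∑-minus outcomes _ _) (cong₂ _-_ (∑-*ˡ outcomes _ _) (∑-*ˡ outcomes _ _)))))
              A≥0 = +-nn (pos-nn a') (pos-nn a')
              collect : (φ a' + A * ξ̄ + ξ̄ * ξ̄) * P₀ - (A + ξ̄ + ξ̄) * ξ̄ + V₂ ≤ φ a' + V₂
              collect = diff (+-nn (*-nn (+-nn (+-nn (φ-nn a') (*-nn A≥0 ξ̄≥0)) (*-nn ξ̄≥0 ξ̄≥0)) (≤⇒0≤ P₀≤1)) (*-nn ξ̄≥0 ξ̄≥0))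
                (solve 5 (λ f A b p v → f :+ v :- ((f :+ A :* b :+ b :* b) :* p :- (A :+ b :+ b) :* b :+ v) := (f :+ A :* b :+ b :* b) :* (𝟙 :- p) :+ b :* b) refl (φ a') A ξ̄ P₀ V₂)

            inner : ∀ R → ∑ es (λ o → ρ * W s o * (bool (not (inc T o)) * (bool (inc T R) * (bool (kill (acc s) o R) * V s R)))) ≡ bool (inc T R) * (V s R * (κ s R - ρ * Y s T))
            inner R with inc T R in er
            ... | false = trans (∑-zero es (λ o → solve 3 (λ a b c → a :* (b :* (𝟘 :* c)) := 𝟘) refl (ρ * W s o) (bool (not (inc T o))) (bool (kill (acc s) o R) * V s R))) (sym (*-zeroˡ (V s R * (κ s R - ρ * Y s T))))
            ... | true = trans (∑-cong es eq) (trans (∑-minus es _ _) (trans (cong₂ _-_ (trans (∑-*ˡ es (V s R * ρ) _) refl) (∑-*ˡ es (V s R * ρ) _))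
                (solve 4 (λ v r k y → v :* r :* k :- v :* r :* y := 𝟙 :* (v :* (r :* k :- r :* y))) refl (V s R) ρ (∑ es (λ o → W s o * bool (kill (acc s) o R))) (Y s T))))
              where
              eq : ∀ o → ρ * W s o * (bool (not (inc T o)) * (1ℚ * (bool (kill (acc s) o R) * V s R))) ≡ V s R * ρ * (W s o * bool (kill (acc s) o R)) - V s R * ρ * (bool (inc T o) * W s o)
              eq o with inc T o in eo
              ... | true = trans (solve 3 (λ a b c → a :* (𝟘 :* b) := 𝟘) refl (ρ * W s o) (1ℚ * (bool (kill (acc s) o R) * V s R)) 0ℚ)
                    (trans (solve 3 (λ v r w → 𝟘 := v :* r :* (w :* 𝟙) :- v :* r :* (𝟙 :* w)) refl (V s R) ρ (W s o))
                      (cong (λ b → V s R * ρ * (W s o * bool b) - V s R * ρ * (1ℚ * W s o)) (sym (killed eo er))))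
              ... | false = solve 4 (λ r w b v → r :* w :* (𝟙 :* (𝟙 :* (b :* v))) := v :* r :* (w :* b) :- v :* r :* (𝟘 :* w)) refl ρ (W s o) (bool (kill (acc s) o R)) (V s R)

            ξ̄≡ : ξ̄ ≡ ∑ es (λ R → bool (inc T R) * (V s R * (κ s R - ρ * Y s T)))
            ξ̄≡ = trans (cong₂ _+_ (solve 1 (λ p → p :* (𝟙 :* 𝟘) := 𝟘) refl (pr s nothing)) (∑-map just es _)) (trans (+-identityˡ _)
              (trans (∑-cong es (λ o → trans (solve 3 (λ a b c → a :* (b :* c) := a :* b :* c) refl (ρ * W s o) (bool (not (inc T o))) (ξ s T o))
                  (trans (sym (∑-*ˡ es (ρ * W s o * bool (not (inc T o))) _)) (∑-cong es (λ R → *-assoc (ρ * W s o) _ _)))))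
                (trans (∑-swap es es _) (∑-cong es inner))))

            mean : S - ξ̄ ≤ Y s T + (1ℚ + lam) * ρ * (Y s T * Y s T)
            mean = ≤-trans (≤-reflexive (trans (cong (λ w → S - w) ξ̄≡) (sym (∑-minus es _ _)))) (≤-trans (∑-mono es step)
                (≤-reflexive (trans (∑-*ʳ es (1ℚ + (1ℚ + lam) * ρ * Y s T) _) (solve 2 (λ y r → y :* (𝟙 :+ r :* y) := y :+ r :* (y :* y)) refl (Y s T) ((1ℚ + lam) * ρ)))))
              where
              step : ∀ R → bool (inc T R) * V s R - bool (inc T R) * (V s R * (κ s R - ρ * Y s T)) ≤ bool (inc T R) * W s R * (1ℚ + (1ℚ + lam) * ρ * Y s T)
              step R = diff (*-nn (*-nn (bool-nn (inc T R)) (W≥0 R)) (+-nn (sq-nn (κ s R)) (*-nn (*-nn ρ≥0 (Y≥0 iv T)) (≤⇒0≤ (κ≤lam iv l' R)))))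
                (solve 6 (λ i w k r y m → i :* w :* (𝟙 :+ (𝟙 :+ m) :* r :* y) :- (i :* (w :* (𝟙 :+ k)) :- i :* (w :* (𝟙 :+ k) :* (k :- r :* y))) := i :* w :* (k :* k :+ r :* y :* (m :- k)))
                  refl (bool (inc T R)) (W s R) (κ s R) ρ (Y s T) lam)

            z c₀ : ℚ
            z = Y s T - ŷ (clk s)
            c₀ = (1ℚ + lam) * ρ * (thr + thr)

            ŷ≤ : ŷ (clk s) + D ≤ thr
            ŷ≤ = ŷ≤thr (clk s) clk≤

            Y≤thr : Y s T ≤ thr
            Y≤thr = ≤-trans (Y≤ T T∈) (subst (λ c → ŷ c + D ≤ thr) clk≡ ŷ≤)

            a'≤ : a' ≤ z * (1ℚ + (1ℚ + lam) * ρ * (Y s T + ŷ (clk s)))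
            a'≤ = ≤-trans (≤-reflexive (solve 3 (λ s y x → s :- y :- x := s :- x :- y) refl S ŷ' ξ̄)) (≤-trans (+-monoˡ-≤ (- ŷ') mean)
              (≤-reflexive (trans (cong (λ w → Y s T + (1ℚ + lam) * ρ * (Y s T * Y s T) - w) (ŷ-rec (clk s)))
                (solve 3 (λ y r q → y :+ r :* (y :* y) :- (q :+ r :* (q :* q)) := (y :- q) :* (𝟙 :+ r :* (y :+ q))) refl (Y s T) ((1ℚ + lam) * ρ) (ŷ (clk s))))))

            φa' : φ a' ≤ g * φ z
            φa' with ≤-total 0ℚ z
            ... | inj₂ p = ≤-trans (≤-reflexive (φ-≤0 (≤-trans a'≤ (≤-trans (*-monoʳ (+-nn 0≤1 (*-nn lρ≥0 (+-nn (Y≥0 iv T) (ŷ≥0 (clk s))))) p) (≤-reflexive (*-zeroˡ _))))))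
                    (*-nn (sq-nn (1ℚ + c₀)) (φ-nn z))
            ... | inj₁ p = ≤-trans (φ-mono (≤-trans a'≤ (*-monoˡ p (+-monoʳ-≤ 1ℚ (*-monoˡ lρ≥0 (+-mono-≤ Y≤thr (≤-trans (≤-by D≥0 refl) ŷ≤)))))))
                    (≤-reflexive (φ-* z (+-nn 0≤1 (*-nn lρ≥0 (+-nn thr≥0 thr≥0)))))

          Φ-step : ∑ outcomes (λ mo → pr s mo * Φ1 s mo T) ≤ g * Φ s T + var s T
          Φ-step = ≤-trans (∑-mono outcomes (λ mo → *-monoˡ (pr≥0 iv l' mo) (pt mo))) (≤-trans total (+-monoˡ-≤ _ φa'))

        module _ {C : ℕ → ℚ} {δ : ℚ} (C≥0 : ∀ n → 0ℚ ≤ C n) (C-dec : ∀ n → n ℕ.< I → C (suc n) * g ≤ C n) (δ≥0 : 0ℚ ≤ δ) (δD : δ * D ≡ 1ℚ)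
          (C-big : ∀ n → n ℕ.≤ I → cap * thr * (δ * δ) ≤ C n) where
          private
            C' : ℚ
            C' = C (suc (clk s))

            sl : suc (clk s) ℕ.≤ I
            sl = subst (λ c → suc c ℕ.≤ I) (sym clk≡) l

            -- The excess x of an overshooting T is at least D, so its weight y + x is at most thr
            -- x² δ². With C at least `cap` thr δ², the penalty released pays for all edges dropped
            -- at T.
            over-cost : ∀ mo T → over s mo T ≡ true → cap * Y1 s mo T ≤ C' * Φ1 s mo T
            over-cost mo T e = ≤-trans (≤-reflexive eq) (≤-trans (*-monoʳ (*-nn δ≥0 δ≥0) (*-monoˡ cap≥0 big)) (≤-trans (≤-reflexive (solve 4 (λ c t z d → c :* (t :* (z :* z)) :* (d :* d) := c :* t :* (d :* d) :* (z :* z)) refl cap thr x δ))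
                (≤-trans (*-monoʳ (sq-nn x) (C-big (suc (clk s)) sl)) (≤-reflexive (cong (C' *_) (sym (φ-≥0 x≥0)))))))
              where
              y = ŷ (suc (clk s))
              x = Y1 s mo T - y
              D≤x : D ≤ x
              D≤x = ≤-trans (≤-reflexive (solve 2 (λ d y → d := y :+ d :- y) refl D y)) (+-monoˡ-≤ (- y) (≤ᵇ-false (not-true e)))
              x≥0 = ≤-trans D≥0 D≤x
              eq : cap * Y1 s mo T ≡ cap * ((y + x) * (D * D)) * (δ * δ)
              eq = trans (cong (cap *_) (solve 2 (λ w y → w := (y :+ (w :- y)) :* (𝟙 :* 𝟙)) refl (Y1 s mo T) y)) (trans (cong (λ w → cap * ((y + x) * (w * w))) (sym δD))
                (solve 4 (λ c y d D → c :* (y :* (d :* D :* (d :* D))) := c :* (y :* (D :* D)) :* (d :* d)) refl cap (y + x) δ D))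
              big : (y + x) * (D * D) ≤ thr * (x * x)
              big = ≤-trans (diff (*-nn (*-nn (ŷ≥0 (suc (clk s))) D≥0) (≤⇒0≤ D≤x)) (solve 3 (λ y x d → (y :+ d) :* (x :* d) :- (y :+ x) :* (d :* d) := y :* d :* (x :- d)) refl y x D))
                (*-mono (+-nn (ŷ≥0 (suc (clk s))) D≥0) (ŷ≤thr (suc (clk s)) sl) (*-nn x≥0 D≥0) (*-monoˡ x≥0 D≤x))

            Y-next≤ : ∀ mo T → Y (next s mo) T ≤ Y1 s mo T
            Y-next≤ mo T = ∑-mono es (λ R → *-monoˡ (bool-nn (inc T R)) (next≤W1 iv mo R))

            Λ1≥0 : ∀ R → 0ℚ ≤ Λ1 s R
            Λ1≥0 R = +-nn (Λ≥0 R) (κc≥0 iv R)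

            over-gone : ∀ mo T → T ∈ ps → over s mo T ≡ true → Φ (next s mo) T ≡ 0ℚ
            over-gone mo T T∈ e = φ-≤0 (≤-trans (≤-reflexive (cong (_- ŷ (suc (clk s))) (∑-zero es gone))) (diff (ŷ≥0 (suc (clk s))) (solve 1 (λ y → 𝟘 :- (𝟘 :- y) := y) refl (ŷ (suc (clk s))))))
              where
              gone : ∀ R → bool (inc T R) * W (next s mo) R ≡ 0ℚ
              gone R with inc T R in ei
              ... | false = *-zeroˡ (W (next s mo) R)
              ... | true = trans (*-identityˡ _) (trans (cong (λ b → bool b * W1 s mo R) kf) (*-zeroˡ (W1 s mo R)))
                where
                ∧-false : ∀ b → b ∧ false ≡ false
                ∧-false true = refl
                ∧-false false = refl
                kf : keep s mo R ≡ false
                kf = trans (cong (λ b → (Λ1 s R ≤ᵇ cap) ∧ not b) (any-true (λ T → inc T R ∧ over s mo T) T∈ (trans (cong (_∧ over s mo T) ei) e))) (∧-false (Λ1 s R ≤ᵇ cap))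

            perT : ∀ mo T → T ∈ ps → bool (over s mo T) * (cap * Y1 s mo T) + C' * Φ (next s mo) T ≤ C' * Φ1 s mo T
            perT mo T T∈ with over s mo T in e
            ... | true = ≤-trans (≤-reflexive (trans (cong (λ w → 1ℚ * (cap * Y1 s mo T) + C' * w) (over-gone mo T T∈ e)) (solve 2 (λ a c → 𝟙 :* a :+ c :* 𝟘 := a) refl (cap * Y1 s mo T) C'))) (over-cost mo T e)
            ... | false = ≤-trans (≤-reflexive (solve 2 (λ a b → 𝟘 :* a :+ b := b) refl (cap * Y1 s mo T) (C' * Φ (next s mo) T)))
                  (*-monoˡ (C≥0 (suc (clk s))) (φ-mono (+-monoˡ-≤ (- ŷ (suc (clk s))) (Y-next≤ mo T))))

            perR : ∀ mo R → W1 s mo R * (cap - Λ1 s R) ≤ W (next s mo) R * (cap - Λ1 s R) + cap * ∑ ps (λ T → bool (over s mo T) * (bool (inc T R) * W1 s mo R))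
            perR mo R with Λ1 s R ≤ᵇ cap in ec | dropT s mo R in ed
            ... | true | false = ≤-trans (≤-reflexive (solve 2 (λ w c → w :* c := 𝟙 :* w :* c) refl (W1 s mo R) (cap - Λ1 s R)))
                  (≤-by (*-nn cap≥0 (∑-nn ps (λ T → *-nn (bool-nn (over s mo T)) (*-nn (bool-nn (inc T R)) (W1≥0 iv mo R))))) refl)
            ... | true | true = ≤-trans (≤-trans (*-monoˡ (W1≥0 iv mo R) (diff (Λ1≥0 R) (solve 2 (λ c k → c :- (c :- k) := k) refl cap (Λ1 s R))))
                    (≤-trans (≤-reflexive (*-comm (W1 s mo R) cap)) (*-monoˡ cap≥0 one')))
                  (≤-reflexive (solve 3 (λ w c x → x := 𝟘 :* w :* c :+ x) refl (W1 s mo R) (cap - Λ1 s R) _))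
                where
                one' : W1 s mo R ≤ ∑ ps (λ T → bool (over s mo T) * (bool (inc T R) * W1 s mo R))
                one' = ≤-trans (≤-reflexive (sym (*-identityˡ (W1 s mo R)))) (≤-trans (*-monoʳ (W1≥0 iv mo R) (≤-trans (≤-reflexive (cong bool (sym ed))) (bool-any (λ T → inc T R ∧ over s mo T) ps)))
                  (≤-reflexive (trans (sym (∑-*ʳ ps (W1 s mo R) _)) (∑-cong ps (λ T → trans (cong (_* W1 s mo R) (bool-∧ (inc T R) (over s mo T))) (solve 3 (λ a b w → a :* b :* w := b :* (a :* w)) refl (bool (inc T R)) (bool (over s mo T)) (W1 s mo R)))))))
            ... | false | d = ≤-trans (≤-trans (*-monoˡ (W1≥0 iv mo R) (≤-trans (+-monoˡ-≤ (- Λ1 s R) (≤ᵇ-false ec)) (≤-reflexive (+-inverseʳ (Λ1 s R))))) (≤-reflexive (*-zeroʳ (W1 s mo R))))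
                  (+-nn (≤-reflexive (solve 2 (λ w c → 𝟘 := 𝟘 :* w :* c) refl (W1 s mo R) (cap - Λ1 s R))) (*-nn cap≥0 (∑-nn ps (λ T → *-nn (bool-nn (over s mo T)) (*-nn (bool-nn (inc T R)) (W1≥0 iv mo R))))))

            G : Maybe E → ℚ
            G mo = ∑ es (λ R → W1 s mo R * (cap - Λ1 s R)) - C' * ∑ ps (Φ1 s mo)

            pt : ∀ mo → G mo ≤ pot C (next s mo)
            pt mo = 0≤⇒≤ (≤-trans (≤⇒0≤ both) (≤-reflexive (solve 4 (λ a b c d → a :+ b :- (c :+ d) := a :- d :- (c :- b)) refl A B C₁ D₁)))
              where
              A = ∑ es (λ R → W (next s mo) R * (cap - Λ1 s R))
              B = C' * ∑ ps (Φ1 s mo)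
              C₁ = ∑ es (λ R → W1 s mo R * (cap - Λ1 s R))
              D₁ = C' * ∑ ps (Φ (next s mo))
              X = ∑ ps (λ T → bool (over s mo T) * (cap * Y1 s mo T))
              rearr : cap * ∑ es (λ R → ∑ ps (λ T → bool (over s mo T) * (bool (inc T R) * W1 s mo R))) ≡ X
              rearr = trans (cong (cap *_) (trans (∑-swap es ps _) (∑-cong ps (λ T → ∑-*ˡ es (bool (over s mo T)) _)))) (trans (sym (∑-*ˡ ps cap _)) (∑-cong ps (λ T → solve 3 (λ c o y → c :* (o :* y) := o :* (c :* y)) refl cap (bool (over s mo T)) (Y1 s mo T))))
              both : C₁ + D₁ ≤ A + B
              both = ≤-trans (+-monoˡ-≤ D₁ (≤-trans (∑-mono es (perR mo)) (≤-reflexive (trans (∑-+ es _ _) (cong (A +_) (trans (∑-*ˡ es cap _) rearr))))))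
                (≤-trans (≤-reflexive (trans (+-assoc A X D₁) (cong (A +_) (trans (cong (X +_) (sym (∑-*ˡ ps C' _))) (sym (∑-+ ps _ _))))))
                  (+-monoʳ-≤ A (≤-trans (∑-mono∈ ps (perT mo)) (≤-reflexive (∑-*ˡ ps C' _)))))

            EW1 : ∀ R → ∑ outcomes (λ mo → pr s mo * W1 s mo R) ≡ (1ℚ - κ s R) * V s R
            EW1 R = trans (∑-cong outcomes (λ mo → solve 3 (λ p b v → p :* ((𝟙 :- b) :* v) := p :* v :- p :* b :* v) refl (pr s mo) (bool (hit s mo R)) (V s R)))
              (trans (∑-minus outcomes _ _) (trans (cong₂ _-_ (Es-const (V s R) s) (trans (∑-*ʳ outcomes (V s R) _) (cong (_* V s R) κeq))) (solve 2 (λ v k → v :- k :* v := (𝟙 :- k) :* v) refl (V s R) (κ s R))))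
              where
              κeq : ∑ outcomes (λ mo → pr s mo * bool (hit s mo R)) ≡ κ s R
              κeq = trans (cong₂ _+_ (*-zeroʳ (pr s nothing)) (∑-map just es _)) (trans (+-identityˡ _) (trans (∑-cong es (λ o → *-assoc ρ (W s o) _)) (∑-*ˡ es ρ _)))

            EG : ∑ outcomes (λ mo → pr s mo * G mo) ≡ ∑ es (λ R → (1ℚ - κ s R) * V s R * (cap - Λ1 s R)) - C' * ∑ ps (λ T → ∑ outcomes (λ mo → pr s mo * Φ1 s mo T))
            EG = trans (∑-cong outcomes (λ mo → solve 3 (λ p a b → p :* (a :- b) := p :* a :- p :* b) refl (pr s mo) _ _)) (trans (∑-minus outcomes _ _) (cong₂ _-_ left right))
              where
              left : ∑ outcomes (λ mo → pr s mo * ∑ es (λ R → W1 s mo R * (cap - Λ1 s R))) ≡ ∑ es (λ R → (1ℚ - κ s R) * V s R * (cap - Λ1 s R))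
              left = trans (∑-cong outcomes (λ mo → trans (sym (∑-*ˡ es (pr s mo) _)) (∑-cong es (λ R → sym (*-assoc (pr s mo) _ _)))))
                (trans (∑-swap outcomes es _) (∑-cong es (λ R → trans (∑-*ʳ outcomes (cap - Λ1 s R) _) (cong (_* (cap - Λ1 s R)) (EW1 R)))))
              right : ∑ outcomes (λ mo → pr s mo * (C' * ∑ ps (Φ1 s mo))) ≡ C' * ∑ ps (λ T → ∑ outcomes (λ mo → pr s mo * Φ1 s mo T))
              right = trans (∑-cong outcomes (λ mo → solve 3 (λ p c x → p :* (c :* x) := c :* (p :* x)) refl (pr s mo) C' _)) (trans (∑-*ˡ outcomes C' _)
                (cong (C' *_) (trans (∑-cong outcomes (λ mo → sym (∑-*ˡ ps (pr s mo) _))) (∑-swap outcomes ps _))))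

          pot-step : pot C s - loss C s ≤ Es (pot C) s
          pot-step = ≤-trans main (≤-trans (≤-reflexive (sym EG)) (∑-mono outcomes (λ mo → *-monoˡ (pr≥0 iv l' mo) (pt mo))))
            where
            w₁ = ∑ es (λ R → W s R * (cap - Λ s R))
            w₂ = ∑ es (λ R → W s R * κc s R)
            w₃ = ∑ es (λ R → W s R * (κ s R * κ s R))
            f₁ = ∑ ps (Φ s)
            v₁ = ∑ ps (var s)
            edge : w₁ - (w₂ + cap * w₃) ≤ ∑ es (λ R → (1ℚ - κ s R) * V s R * (cap - Λ1 s R))
            edge = ≤-trans (≤-reflexive (trans (cong (λ z → w₁ - (w₂ + z)) (sym (∑-*ˡ es cap _))) (trans (cong (λ w → w₁ - w) (sym (∑-+ es _ _))) (sym (∑-minus es _ _)))))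
              (∑-mono es (λ R → diff (*-nn (W≥0 R) (*-nn (sq-nn (κ s R)) (Λ1≥0 R)))
                (solve 5 (λ w k c L x → (𝟙 :- k) :* (w :* (𝟙 :+ k)) :* (c :- (L :+ x)) :- (w :* (c :- L) :- (w :* x :+ c :* (w :* (k :* k)))) := w :* (k :* k :* (L :+ x))) refl (W s R) (κ s R) cap (Λ s R) (κc s R))))
            point : C' * ∑ ps (λ T → ∑ outcomes (λ mo → pr s mo * Φ1 s mo T)) ≤ C (clk s) * f₁ + C' * v₁
            point = ≤-trans (*-monoˡ (C≥0 (suc (clk s))) (≤-trans (∑-mono∈ ps Φ-step) (≤-reflexive (trans (∑-+ ps _ _) (cong (_+ v₁) (∑-*ˡ ps g _))))))
              (≤-trans (≤-reflexive (solve 4 (λ c g f v → c :* (g :* f :+ v) := c :* g :* f :+ c :* v) refl C' g f₁ v₁))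
                (+-monoˡ-≤ (C' * v₁) (*-monoʳ (∑-nn ps (λ T → φ-nn (Y s T - ŷ (clk s)))) (C-dec (clk s) sl))))
            main : pot C s - loss C s ≤ ∑ es (λ R → (1ℚ - κ s R) * V s R * (cap - Λ1 s R)) - C' * ∑ ps (λ T → ∑ outcomes (λ mo → pr s mo * Φ1 s mo T))
            main = ≤-trans (≤-reflexive (solve 5 (λ a b c d e → a :- b :- (c :+ d :+ e) := a :- (c :+ d) :+ :- (b :+ e)) refl w₁ (C (clk s) * f₁) w₂ (cap * w₃) (C' * v₁)))
              (+-mono-≤ edge (neg-antimono point))

-- The total loss and the number of accepted edges.

module Greedy where
  open Q
  open Prod
  open Proc
  open Exp
  open Omega
  open Phi
  open import Data.Rational using (_≤_)
  open import Data.Rational.Properties using (≤-refl; ≤-reflexive; ≤-trans)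

  module Outcome {E P : Set} (_≟E_ : DecidableEquality E) (es : List E) (ps : List P)
    (inc : P → E → Bool) (kT : E → E → Bool) (conf : List E → E → E → Bool)
    (ρ cap D : ℚ) (ŷ : ℕ → ℚ) where

    open Process _≟E_ es ps inc kT conf ρ cap D ŷ
    open Expect _≟E_ es ps inc kT conf ρ cap D ŷ
    open Weights _≟E_ es ps inc kT conf ρ cap D ŷ
    open Potential _≟E_ es ps inc kT conf ρ cap D ŷ

    pairOK : E → E → E → Bool
    pairOK R R' o = any (λ T → inc T R ∧ (inc T R' ∧ not (inc T o))) ps ∧ not ⌊ R ≟E R' ⌋

    module _ {Good : List E → Set} {K lam μ β q thr h : ℚ} {m I : ℕ} (H : Hyp Good K lam μ β q thr h m I)
      (ŷ-rec : ∀ n → ŷ (suc n) ≡ ŷ n + (1ℚ + lam) * ρ * (ŷ n * ŷ n)) (Sp : Sparse Good K I) where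
      open WithHyp H
      open Sparse Sp

      -- `isConf` stands for the minimal dense lists: a conflict is replaced by a minimal one, since
      -- only these satisfy the conditions of `Base`. `C` is the decreasing penalty of the
      -- potential.
      record Final : Set where
        field
          isConf : List E → Bool
          conf-wit : ∀ {A o R} → Good (R ∷ A) → Good (o ∷ A) → conf A o R ≡ true →
            ∃ λ X → All (_∈ es) X × length X ℕ.< xm × sub X A ≡ true × isConf (R ∷ o ∷ X) ≡ true
          isConf-unique : ∀ c → isConf c ≡ true → Unique c
          isConf-base : ∀ c → isConf c ≡ true → ∀ o → o ∈ es → Base c o
          pair-base : ∀ R R' o → R ∈ es → R' ∈ es → o ∈ es → pairOK R R' o ≡ true → Base (R ∷ R' ∷ []) o
          GG CC Cmax : ℚ
          GG-bound : ∀ x → x ℕ.< xm → (1ℚ + ι (2 ℕ.+ x) * (ρ * D * 2ℚ H Sp ^ (2 ℕ.+ x))) ^ I ≤ GG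
          CC-bound : ∀ x → x ℕ.< xm → comC H Sp (2 ℕ.+ x) ≤ CC
          ℓm≥ : 2 ℕ.+ (xm ℕ.+ xm) ℕ.≤ ℓm
          C : ℕ → ℚ
          C≥0 : ∀ n → 0ℚ ≤ C n
          C-dec : ∀ n → n ℕ.< I → C (suc n) * g H ŷ-rec ≤ C n
          C-big : ∀ n → n ℕ.≤ I → cap * thr * (δ * δ) ≤ C n
          C≤ : ∀ n → C n ≤ Cmax

      module _ (Fn : Final) where
        open Final Fn

        N τ : ℚ
        N = ι (length es)
        τ = ι I * ρ

        -- Each sum weighs a structure by δ for every accepted edge in it: dense lists, bad
        -- structures attached to dense lists, and bad structures attached to pairs through a common
        -- t-set. `Sc`, `Sv` and `TL` bound the conflict mass, the variance and the loss over all
        -- steps.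
        confSum strSum pairSum Sc Sv TL : ℚ
        confSum = ∑< xm (λ x → ∑T es (2 ℕ.+ x) (λ c → bool (isConf c) * δ ^ x))
        strSum = ∑< xm (λ x → ∑T es (2 ℕ.+ x) (λ c → bool (isConf c) * (δ ^ x * structSum H Sp c)))
        pairSum = ∑ es (λ R → ∑ es (λ R' → ∑ es (λ o → bool (pairOK R R' o) * structAt H Sp (R ∷ R' ∷ []) o)))
        Sc = τ * (GG * (confSum + τ * K * CC * CK * strSum))
        Sv = τ * ((2ℚ H Sp * K) * (2ℚ H Sp * K) * q * K * CK * pairSum) + q * (2ℚ H Sp * 2ℚ H Sp * K) * (Sc + ι I * β * (K * N))
        TL = (1ℚ + cap * lam) * Sc + ι I * β * (cap * lam * (K * N)) + Cmax * Sv

        private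
          δ^≥0 : ∀ x → 0ℚ ≤ δ ^ x
          δ^≥0 = ^-nn δ≥0

          τ≥0 : 0ℚ ≤ τ
          τ≥0 = *-nn (ι-nn I) ρ≥0

          GG≥0 : ∀ x → x ℕ.< xm → 0ℚ ≤ GG
          GG≥0 x l = ≤-trans 0≤1 (≤-trans (^-≥1 (≤-by (*-nn (ι-nn (2 ℕ.+ x)) (*-nn (*-nn ρ≥0 D≥0) (^-nn (+-nn 0≤1 0≤1) (2 ℕ.+ x)))) refl) I) (GG-bound x l))

          CC≥0 : ∀ x → x ℕ.< xm → 0ℚ ≤ CC
          CC≥0 x l = ≤-trans (comC≥0 H Sp (2 ℕ.+ x)) (CC-bound x l)

          structSum≥0 : ∀ c → 0ℚ ≤ structSum H Sp c
          structSum≥0 c = ∑-nn es (structAt≥0 H Sp c)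

        confMass : State → ℚ
        confMass s = ∑ es (λ R → W s R * κc s R)

        confΩ : State → ℚ
        confΩ s = ∑< xm (λ x → ∑T es (2 ℕ.+ x) (λ c → bool (isConf c) * (δ ^ x * Ω c s)))

        sub-ω : ∀ {n s} → Inv n s → ∀ X → bool (sub X (acc s)) ≤ δ ^ length X * Ω X s
        sub-ω iv [] = ≤-reflexive (sym (*-identityˡ 1ℚ))
        sub-ω {n} {s} iv (x ∷ X) = ≤-trans (≤-reflexive (bool-∧ (mem x (acc s)) (sub X (acc s))))
          (≤-trans (*-mono (bool-nn (mem x (acc s))) one' (bool-nn (sub X (acc s))) (sub-ω iv X))
            (≤-reflexive (solve 4 (λ a b c d → a :* b :* (c :* d) := a :* c :* (b :* d)) refl δ (ω s x) (δ ^ length X) (Ω X s))))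
          where
          one' : bool (mem x (acc s)) ≤ δ * ω s x
          one' = ≤-by (*-nn δ≥0 (Inv.W≥0 iv x)) (trans (*-distribˡ-+ δ (W s x) _) (trans (cong (δ * W s x +_) (trans (sym (*-assoc δ D _)) (trans (cong (_* bool (mem x (acc s))) δD) (*-identityˡ _)))) (+-comm _ _)))

        ω≥0 : ∀ {n s} → Inv n s → ∀ x → 0ℚ ≤ ω s x
        ω≥0 {n} {s} iv x = +-nn (Inv.W≥0 iv x) (*-nn D≥0 (bool-nn (mem x (acc s))))

        W≤ω : ∀ s x → W s x ≤ ω s x
        W≤ω s x = ≤-by (*-nn D≥0 (bool-nn (mem x (acc s)))) refl

        -- `ω` dominates both W and D times the indicator of acceptance. Hence the weights of R and
        -- o together with the presence of X are at most δ^|X| times the product of `ω` over the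
        -- whole list.
        confMass≤ : ∀ {n s} → Inv n s → confMass s ≤ ρ * confΩ s
        confMass≤ {n} {s} iv = ≤-trans (≤-reflexive (trans (∑-cong es (λ R → trans (solve 3 (λ w r x → w :* (r :* x) := r :* (w :* x)) refl (W s R) ρ _) (cong (ρ *_) (sym (∑-*ˡ es (W s R) _))))) (∑-*ˡ es ρ _)))
            (*-monoˡ ρ≥0 (≤-trans (∑-mono∈ es (λ R R∈ → ∑-mono∈ es (λ o o∈ → step R R∈ o o∈))) (≤-reflexive regroup)))
          where
          f : List E → ℕ → ℚ
          f c x = bool (isConf c) * (δ ^ x * Ω c s)
          f≥0 : ∀ c x → 0ℚ ≤ f c x
          f≥0 c x = *-nn (bool-nn (isConf c)) (*-nn (δ^≥0 x) (∏-nn c (ω≥0 iv)))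
          step : ∀ R → R ∈ es → ∀ o → o ∈ es → W s R * (W s o * bool (conf (acc s) o R)) ≤ ∑< xm (λ x → ∑T es x (λ X → f (R ∷ o ∷ X) x))
          step R R∈ o o∈ with conf (acc s) o R in e | Inv.alive iv R R∈ | Inv.alive iv o o∈
          ... | false | _ | _ = ≤-trans (≤-reflexive (solve 2 (λ a b → a :* (b :* 𝟘) := 𝟘) refl (W s R) (W s o))) (∑<-nn xm (λ x _ → ∑T-nn es x (λ X → f≥0 (R ∷ o ∷ X) x)))
          ... | true | inj₁ z | _ = ≤-trans (≤-reflexive (trans (cong (_* (W s o * 1ℚ)) z) (*-zeroˡ (W s o * 1ℚ)))) (∑<-nn xm (λ x _ → ∑T-nn es x (λ X → f≥0 (R ∷ o ∷ X) x)))
          ... | true | inj₂ _ | inj₁ z = ≤-trans (≤-reflexive (trans (cong (λ w → W s R * (w * 1ℚ)) z) (solve 1 (λ a → a :* (𝟘 :* 𝟙) := 𝟘) refl (W s R)))) (∑<-nn xm (λ x _ → ∑T-nn es x (λ X → f≥0 (R ∷ o ∷ X) x)))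
          ... | true | inj₂ (_ , _ , gR) | inj₂ (_ , _ , go) with conf-wit gR go e
          ...   | X , X∈ , X< , sb , cf = ≤-trans here' (≤-trans (∑T-single es (λ X' → f≥0 (R ∷ o ∷ X') (length X)) X X∈) (∑<-single {f = λ x → ∑T es x (λ X → f (R ∷ o ∷ X) x)} X< (λ j _ → ∑T-nn es j (λ X → f≥0 (R ∷ o ∷ X) j))))
            where
            here' : W s R * (W s o * 1ℚ) ≤ f (R ∷ o ∷ X) (length X)
            here' = ≤-trans (*-mono (Inv.W≥0 iv R) (W≤ω s R) (*-nn (Inv.W≥0 iv o) 0≤1) (*-mono (Inv.W≥0 iv o) (W≤ω s o) 0≤1
                  (≤-trans (≤-reflexive (cong bool (sym sb))) (sub-ω iv X))))
                (≤-reflexive (trans (solve 4 (λ a b d w → a :* (b :* (d :* w)) := 𝟙 :* (d :* (a :* (b :* w)))) refl (ω s R) (ω s o) (δ ^ length X) (Ω X s)) (cong (λ b → bool b * (δ ^ length X * Ω (R ∷ o ∷ X) s)) (sym cf))))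
          sw : ∀ j (F : ℕ → E → ℚ) → ∑ es (λ o → ∑< j (λ x → F x o)) ≡ ∑< j (λ x → ∑ es (F x))
          sw zero F = ∑-zero es (λ _ → refl)
          sw (suc j) F = trans (∑-+ es _ _) (cong (_+ ∑ es (F j)) (sw j F))
          regroup : ∑ es (λ R → ∑ es (λ o → ∑< xm (λ x → ∑T es x (λ X → f (R ∷ o ∷ X) x)))) ≡ confΩ s
          regroup = trans (∑-cong es (λ R → sw xm (λ x o → ∑T es x (λ X → f (R ∷ o ∷ X) x)))) (sw xm (λ x R → ∑ es (λ o → ∑T es x (λ X → f (R ∷ o ∷ X) x))))

        -- The leading part GG · `confSum` contains no K. Bounding the weights by K here would make
        -- the choice of `cap` circular, as K depends on `cap`.
        𝔼-confMass : ∀ i → i ℕ.≤ I → 𝔼 i confMass ≤ ρ * (GG * (confSum + τ * K * CC * CK * strSum))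
        𝔼-confMass i l = ≤-trans (𝔼-mono H i l (λ s iv → confMass≤ iv)) (≤-trans (≤-reflexive (Eₙ-* i ρ confΩ init)) (*-monoˡ ρ≥0
            (≤-trans (≤-reflexive (Eₙ-∑< i xm _ init)) (≤-trans (∑<-mono xm perX) (≤-reflexive (trans (∑<-* xm GG _) (cong (GG *_) (trans (∑<-+ xm _ _) (cong (confSum +_) (∑<-* xm (τ * K * CC * CK) _))))))))))
          where
          B = τ * K * CC * CK
          perC : ∀ x → x ℕ.< xm → ∀ c → All (_∈ es) c → length c ≡ 2 ℕ.+ x → 𝔼 i (λ s → bool (isConf c) * (δ ^ x * Ω c s)) ≤ GG * (bool (isConf c) * δ ^ x + B * (bool (isConf c) * (δ ^ x * structSum H Sp c)))
          perC x x< c c∈ len with isConf c in e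
          ... | false = ≤-reflexive (trans (Eₙ-* i 0ℚ (λ s → δ ^ x * Ω c s) init) (trans (*-zeroˡ _) (solve 4 (λ g d b z → 𝟘 := g :* (𝟘 :* d :+ b :* (𝟘 :* z))) refl GG (δ ^ x) B (δ ^ x * structSum H Sp c))))
          ... | true = ≤-trans (≤-reflexive (trans (Eₙ-* i 1ℚ (λ s → δ ^ x * Ω c s) init) (trans (*-identityˡ _) (Eₙ-* i (δ ^ x) (Ω c) init))))
              (≤-trans (*-monoˡ (δ^≥0 x) (≤-trans (Ω-bound H Sp (isConf-unique c e) c∈ (isConf-base c e) lℓ i l) (*-mono (^-nn (≤-trans 0≤1 g₀≥1) i) gle (+-nn 0≤1 (*-nn (ι-nn i) inner≥0)) (+-monoʳ-≤ 1ℚ inner≤))))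
                (≤-reflexive (solve 4 (λ d g b s → d :* (g :* (𝟙 :+ b :* s)) := g :* (𝟙 :* d :+ b :* (𝟙 :* (d :* s)))) refl (δ ^ x) GG B (structSum H Sp c))))
            where
            g₀ = 1ℚ + ι (length c) * (ρ * D * 2ℚ H Sp ^ length c)
            g₀≥1 : 1ℚ ≤ g₀
            g₀≥1 = ≤-by (*-nn (ι-nn (length c)) (*-nn (*-nn ρ≥0 D≥0) (^-nn (+-nn 0≤1 0≤1) (length c)))) refl
            gle : g₀ ^ i ≤ GG
            gle = ≤-trans (^-up g₀≥1 l) (subst (λ j → (1ℚ + ι j * (ρ * D * 2ℚ H Sp ^ j)) ^ I ≤ GG) (sym len) (GG-bound x x<))
            lℓ : length c ℕ.+ xm ℕ.≤ ℓm
            lℓ = ℕ.≤-trans (ℕ.+-monoˡ-≤ xm (ℕ.≤-trans (ℕ.≤-reflexive len) (ℕ.+-monoʳ-≤ 2 (ℕ.<⇒≤ x<)))) ℓm≥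
            inner≥0 : 0ℚ ≤ ρ * K * comC H Sp (length c) * (CK * structSum H Sp c)
            inner≥0 = *-nn (*-nn (*-nn ρ≥0 K≥0) (comC≥0 H Sp (length c))) (*-nn CK≥0 (structSum≥0 c))
            inner≤ : ι i * (ρ * K * comC H Sp (length c) * (CK * structSum H Sp c)) ≤ B * structSum H Sp c
            inner≤ = ≤-trans (*-mono (ι-nn i) (ι-mono l) inner≥0 (*-monoʳ (*-nn CK≥0 (structSum≥0 c)) (*-monoˡ (*-nn ρ≥0 K≥0) (subst (λ j → comC H Sp j ≤ CC) (sym len) (CC-bound x x<)))))
              (≤-reflexive (solve 6 (λ i r k c e s → i :* (r :* k :* c :* (e :* s)) := i :* r :* k :* c :* e :* s) refl (ι I) ρ K CC CK (structSum H Sp c)))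
          perX : ∀ x → x ℕ.< xm → 𝔼 i (λ s → ∑T es (2 ℕ.+ x) (λ c → bool (isConf c) * (δ ^ x * Ω c s))) ≤
            GG * (∑T es (2 ℕ.+ x) (λ c → bool (isConf c) * δ ^ x) + B * ∑T es (2 ℕ.+ x) (λ c → bool (isConf c) * (δ ^ x * structSum H Sp c)))
          perX x x< = ≤-trans (≤-reflexive (Eₙ-∑T i (2 ℕ.+ x) (λ c s → bool (isConf c) * (δ ^ x * Ω c s)) init))
            (≤-trans (∑T-mono es (2 ℕ.+ x) (perC x x<)) (≤-reflexive (trans (∑T-*ˡ es (2 ℕ.+ x) GG (λ c → f₁ c + B * f₂ c)) (cong (GG *_) (trans (∑T-+ es (2 ℕ.+ x) f₁ (λ c → B * f₂ c)) (cong (∑T es (2 ℕ.+ x) f₁ +_) (∑T-*ˡ es (2 ℕ.+ x) B f₂)))))))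
            where
            f₁ f₂ : List E → ℚ
            f₁ c = bool (isConf c) * δ ^ x
            f₂ c = bool (isConf c) * (δ ^ x * structSum H Sp c)

        pairMass : State → ℚ
        pairMass s = ∑ es (λ R → ∑ es (λ R' → ∑ es (λ o → bool (pairOK R R' o) * present H Sp (R ∷ R' ∷ []) o s)))

        Kc : ℚ
        Kc = (2ℚ H Sp * K) * (2ℚ H Sp * K)

        Kc≥0 : 0ℚ ≤ Kc
        Kc≥0 = sq-nn (2ℚ H Sp * K)

        module _ {n s} (iv : Inv n s) (l : n ℕ.≤ I) where
          open Inv iv
          private
            a : E → P → E → ℚ
            a o T R = bool (inc T R) * (bool (kill (acc s) o R) * V s R)

            a≥0 : ∀ o T R → 0ℚ ≤ a o T R
            a≥0 o T R = *-nn (bool-nn (inc T R)) (*-nn (bool-nn (kill (acc s) o R)) (V≥0 iv R))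

            twice : E → E → E → ℚ
            twice o R R' = bool (two (killLive s o) (R ∷ R' ∷ []))

            V≤2K : ∀ R → R ∈ es → V s R ≤ 2ℚ H Sp * K
            V≤2K R R∈ = ≤-trans (V≤2W H Sp iv l R) (*-monoˡ (+-nn 0≤1 0≤1) (W≤K iv l R R∈))

            kV : ∀ o R → bool (kill (acc s) o R) * V s R ≡ bool (killLive s o R) * V s R
            kV o R with kill (acc s) o R | live s R in el
            ... | false | _ = refl
            ... | true | true = refl
            ... | true | false = trans (cong (λ w → 1ℚ * (w * (1ℚ + κ s R))) (dead-zero H Sp iv R el)) (solve 2 (λ k v → 𝟙 :* (𝟘 :* k) := 𝟘 :* v) refl (1ℚ + κ s R) (V s R))

            aa : ∀ o T R → R ∈ es → ∀ R' → R' ∈ es → a o T R * a o T R' ≤ bool (inc T R) * bool (inc T R') * (twice o R R' * Kc)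
            aa o T R R∈ R' R'∈ = ≤-trans (≤-reflexive (trans (cong₂ (λ u v → bool (inc T R) * u * (bool (inc T R') * v)) (kV o R) (kV o R'))
                  (solve 6 (λ i j k k' v v' → i :* (k :* v) :* (j :* (k' :* v')) := i :* j :* (k :* k' :* (v :* v'))) refl (bool (inc T R)) (bool (inc T R')) (bool (killLive s o R)) (bool (killLive s o R')) (V s R) (V s R'))))
                (*-monoˡ (*-nn (bool-nn (inc T R)) (bool-nn (inc T R'))) (*-mono (*-nn (bool-nn (killLive s o R)) (bool-nn (killLive s o R'))) kk (*-nn (V≥0 iv R) (V≥0 iv R')) (*-mono (V≥0 iv R) (V≤2K R R∈) (V≥0 iv R') (V≤2K R' R'∈))))
              where
              kk : bool (killLive s o R) * bool (killLive s o R') ≤ twice o R R'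
              kk with killLive s o R | killLive s o R'
              ... | true | true = ≤-reflexive (*-identityˡ 1ℚ)
              ... | true | false = ≤-reflexive (*-zeroʳ 1ℚ)
              ... | false | true = ≤-reflexive (*-zeroˡ 1ℚ)
              ... | false | false = ≤-reflexive (*-zeroˡ 0ℚ)

            split : ∀ o T R → R ∈ es → ∀ R' → R' ∈ es → a o T R * a o T R' ≤
              a o T R * a o T R * bool ⌊ R ≟E R' ⌋ + bool (not ⌊ R ≟E R' ⌋) * (bool (inc T R) * bool (inc T R') * (twice o R R' * Kc))
            split o T R R∈ R' R'∈ with R ≟E R'
            ... | yes refl = ≤-by {c = 0ℚ * (bool (inc T R) * bool (inc T R) * (twice o R R * Kc))} (≤-reflexive (sym (*-zeroˡ (bool (inc T R) * bool (inc T R) * (twice o R R * Kc))))) (cong (_+ 0ℚ * (bool (inc T R) * bool (inc T R) * (twice o R R * Kc))) (*-identityʳ (a o T R * a o T R)))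
            ... | no _ = ≤-trans (aa o T R R∈ R' R'∈) (≤-reflexive (solve 2 (λ a b → b := a :* 𝟘 :+ 𝟙 :* b) refl (a o T R * a o T R) (bool (inc T R) * bool (inc T R') * (twice o R R' * Kc))))

            off : E → P → ℚ
            off o T = ∑ es (λ R → ∑ es (λ R' → bool (not ⌊ R ≟E R' ⌋) * (bool (inc T R) * bool (inc T R') * (twice o R R' * Kc))))

            -- The diagonal counts single deaths and is a first moment. An off-diagonal term needs
            -- one o that kills two edges through T, and so a bad structure.
            ξ² : ∀ o T → ξ s T o * ξ s T o ≤ ∑ es (λ R → a o T R * a o T R) + off o T
            ξ² o T = ≤-trans (≤-reflexive (trans (sym (∑-*ʳ es (ξ s T o) _)) (∑-cong es (λ R → sym (∑-*ˡ es (a o T R) _)))))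
              (≤-trans (∑-mono∈ es (λ R R∈ → ≤-trans (∑-mono∈ es (split o T R R∈)) (≤-trans (≤-reflexive (∑-+ es _ _)) (+-monoˡ-≤ _ (∑-≟ H {λ _ → a o T R * a o T R} (λ _ → *-nn (a≥0 o T R) (a≥0 o T R)) es! R)))))
                (≤-reflexive (∑-+ es _ _)))

            diag : E → ℚ
            diag R = q * (2ℚ H Sp * 2ℚ H Sp * K) * (W s R * κ s R)

            bnn : ∀ b b' → bool b * bool b' ≤ bool b'
            bnn b b' = ≤-trans (*-monoʳ (bool-nn b') (bool-≤1 b)) (≤-reflexive (*-identityˡ _))

            diag-sum : ∑ ps (λ T → ∑ es (λ o → ρ * W s o * (bool (not (inc T o)) * ∑ es (λ R → a o T R * a o T R)))) ≤ ∑ es diag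
            diag-sum = ≤-trans (∑-mono ps (λ T → ∑-mono es (λ o → *-monoˡ (*-nn ρ≥0 (W≥0 o)) (≤-trans (*-monoʳ (∑-nn es (λ R → *-nn (a≥0 o T R) (a≥0 o T R))) (bool-≤1 (not (inc T o)))) (≤-reflexive (*-identityˡ _))))))
              (≤-trans (≤-reflexive (trans (∑-cong ps (λ T → trans (∑-cong es (λ o → trans (sym (∑-*ˡ es (ρ * W s o) _)) (∑-cong es (λ R → eq T o R)))) (trans (∑-swap es es _) (∑-cong es (λ R → trans (∑-*ˡ es (bool (inc T R) * (V s R * V s R) * ρ) _) (solve 4 (λ i v r k → i :* v :* r :* k := i :* (v :* (r :* k))) refl (bool (inc T R)) (V s R * V s R) ρ (∑ es (λ o → W s o * bool (kill (acc s) o R)))))))))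
                  (trans (∑-swap ps es _) (∑-cong es (λ R → ∑-*ʳ ps (V s R * V s R * κ s R) _)))))
                (∑-mono∈ es (λ R R∈ → ≤-trans (*-mono (∑-nn ps (λ T → bool-nn (inc T R))) (inc≤q R∈) (*-nn (*-nn (V≥0 iv R) (V≥0 iv R)) (κ≥0 iv R)) (*-monoʳ (κ≥0 iv R)
                    (*-mono (V≥0 iv R) (V≤2W H Sp iv l R) (V≥0 iv R) (≤-trans (V≤2W H Sp iv l R) (*-monoˡ (+-nn 0≤1 0≤1) (W≤K iv l R R∈))))))
                  (≤-reflexive (solve 5 (λ q t w k x → q :* (t :* w :* (t :* k) :* x) := q :* (t :* t :* k) :* (w :* x)) refl q (2ℚ H Sp) (W s R) K (κ s R))))))
              where
              eq : ∀ T o R → ρ * W s o * (a o T R * a o T R) ≡ bool (inc T R) * (V s R * V s R) * ρ * (W s o * bool (kill (acc s) o R))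
              eq T o R = trans (solve 5 (λ r w i k v → r :* w :* (i :* (k :* v) :* (i :* (k :* v))) := (i :* i) :* (v :* v) :* r :* (w :* (k :* k))) refl ρ (W s o) (bool (inc T R)) (bool (kill (acc s) o R)) (V s R))
                (cong₂ (λ u v → u * (V s R * V s R) * ρ * (W s o * v)) (bool-idem (inc T R)) (bool-idem (kill (acc s) o R)))

            anyP : E → E → E → Bool
            anyP R R' o = any (λ T → inc T R ∧ (inc T R' ∧ not (inc T o))) ps

            points : ∀ R → R ∈ es → ∀ R' o → ∑ ps (λ T → bool (inc T R) * (bool (inc T R') * bool (not (inc T o)))) ≤ q * bool (anyP R R' o)
            points R R∈ R' o with anyP R R' o in e
            ... | true = ≤-trans (∑-mono ps (λ T → ≤-trans (*-monoˡ (bool-nn (inc T R)) (≤-trans (bnn (inc T R') (not (inc T o))) (bool-≤1 (not (inc T o))))) (≤-reflexive (*-identityʳ _)))) (≤-trans (inc≤q R∈) (≤-reflexive (sym (*-identityʳ q))))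
            ... | false = ≤-trans (∑-mono∈ ps (λ T T∈ → ≤-trans (≤-reflexive (trans (cong (bool (inc T R) *_) (sym (bool-∧ (inc T R') (not (inc T o))))) (sym (bool-∧ (inc T R) _)))) (none T T∈)))
                    (≤-trans (≤-reflexive (∑-zero ps {λ _ → 0ℚ} (λ _ → refl))) (≤-reflexive (sym (*-zeroʳ q))))
              where
              none : ∀ T → T ∈ ps → bool (inc T R ∧ (inc T R' ∧ not (inc T o))) ≤ 0ℚ
              none T T∈ with inc T R ∧ (inc T R' ∧ not (inc T o)) in e'
              ... | false = ≤-refl
              ... | true = ⊥q (trans (sym (any-true (λ T → inc T R ∧ (inc T R' ∧ not (inc T o))) T∈ e')) e)
                where ⊥q : true ≡ false → 1ℚ ≤ 0ℚ
                      ⊥q ()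

            q≥0 : ∀ R → R ∈ es → 0ℚ ≤ q
            q≥0 R R∈ = ≤-trans (∑-nn ps (λ T → bool-nn (inc T R))) (inc≤q R∈)

            off-sum : ∑ ps (λ T → ∑ es (λ o → ρ * W s o * (bool (not (inc T o)) * off o T))) ≤ ρ * (Kc * q * K * pairMass s)
            off-sum = ≤-trans (≤-reflexive shuffle) (≤-trans (∑-mono∈ es (λ R R∈ → ∑-mono∈ es (λ R' R'∈ → ∑-mono∈ es (λ o o∈ → term R R∈ R' R'∈ o o∈))))
                (≤-reflexive (trans (∑-cong es (λ R → trans (∑-cong es (λ R' → ∑-*ˡ es (ρ * (Kc * q * K)) _)) (∑-*ˡ es (ρ * (Kc * q * K)) _))) (trans (∑-*ˡ es (ρ * (Kc * q * K)) _) (*-assoc ρ (Kc * q * K) _)))))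
              where
              mass : E → E → E → ℚ
              mass R R' o = ρ * W s o * (bool (not ⌊ R ≟E R' ⌋) * (twice o R R' * Kc))
              pt : P → E → E → E → ℚ
              pt T R R' o = bool (inc T R) * (bool (inc T R') * bool (not (inc T o)))
              shuffle : ∑ ps (λ T → ∑ es (λ o → ρ * W s o * (bool (not (inc T o)) * off o T))) ≡ ∑ es (λ R → ∑ es (λ R' → ∑ es (λ o → ∑ ps (λ T → pt T R R' o) * mass R R' o)))
              shuffle = trans (∑-cong ps perT) (trans (∑-swap ps es _) (∑-cong es (λ R → trans (∑-swap ps es _) (∑-cong es (λ R' → trans (∑-swap ps es _) (∑-cong es (λ o → ∑-*ʳ ps (mass R R' o) _)))))))
                where
                inside : ∀ T o → ρ * W s o * (bool (not (inc T o)) * off o T) ≡ ∑ es (λ R → ∑ es (λ R' → pt T R R' o * mass R R' o))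
                inside T o = trans (sym (*-assoc (ρ * W s o) _ _)) (trans (sym (∑-*ˡ es (ρ * W s o * bool (not (inc T o))) _)) (∑-cong es (λ R → trans (sym (∑-*ˡ es (ρ * W s o * bool (not (inc T o))) _))
                  (∑-cong es (λ R' → solve 7 (λ r w u n i j z → r :* w :* u :* (n :* (i :* j :* z)) := i :* (j :* u) :* (r :* w :* (n :* z))) refl ρ (W s o) (bool (not (inc T o))) (bool (not ⌊ R ≟E R' ⌋)) (bool (inc T R)) (bool (inc T R')) (twice o R R' * Kc))))))
                perT : ∀ T → ∑ es (λ o → ρ * W s o * (bool (not (inc T o)) * off o T)) ≡ ∑ es (λ R → ∑ es (λ R' → ∑ es (λ o → pt T R R' o * mass R R' o)))
                perT T = trans (∑-cong es (inside T)) (trans (∑-swap es es _) (∑-cong es (λ R → ∑-swap es es _)))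
              term : ∀ R → R ∈ es → ∀ R' → R' ∈ es → ∀ o → o ∈ es → ∑ ps (λ T → pt T R R' o) * mass R R' o ≤ ρ * (Kc * q * K) * (bool (pairOK R R' o) * present H Sp (R ∷ R' ∷ []) o s)
              term R R∈ R' R'∈ o o∈ = ≤-trans (*-monoʳ (*-nn (*-nn ρ≥0 (W≥0 o)) (*-nn (bool-nn (not ⌊ R ≟E R' ⌋)) (*-nn (bool-nn (two (killLive s o) (R ∷ R' ∷ []))) Kc≥0))) (points R R∈ R' o))
                (≤-trans (≤-reflexive (trans (solve 7 (λ q p r w n t k → q :* p :* (r :* w :* (n :* (t :* k))) := r :* (k :* q) :* ((p :* n) :* (w :* t))) refl q (bool (anyP R R' o)) ρ (W s o) (bool (not ⌊ R ≟E R' ⌋)) (twice o R R') Kc)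
                    (cong (λ z → ρ * (Kc * q) * (z * (W s o * twice o R R'))) (sym (bool-∧ (anyP R R' o) _)))))
                  (≤-trans (*-monoˡ (*-nn ρ≥0 (*-nn Kc≥0 (q≥0 R R∈))) ok) (≤-reflexive (solve 5 (λ r c q k z → r :* (c :* q) :* (k :* z) := r :* (c :* q :* k) :* z) refl ρ Kc q K _))))
                where
                pr' = present H Sp (R ∷ R' ∷ []) o s
                ok : bool (pairOK R R' o) * (W s o * twice o R R') ≤ K * (bool (pairOK R R' o) * pr')
                ok with pairOK R R' o in e
                ... | false = ≤-reflexive (solve 3 (λ a k b → 𝟘 :* a := k :* (𝟘 :* b)) refl (W s o * twice o R R') K pr')
                ... | true = ≤-trans (≤-reflexive (*-identityˡ _)) (≤-trans (≤-trans (≤-reflexive (sym (*-identityʳ _))) (*-monoˡ (*-nn (W≥0 o) (bool-nn (two (killLive s o) (R ∷ R' ∷ [])))) acc≥1))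
                      (≤-trans (two-present H Sp (R∈ ∷ R'∈ ∷ []) iv l o o∈ (pair-base R R' o R∈ R'∈ o∈ e)) (≤-reflexive (cong (K *_) (sym (*-identityˡ pr'))))))
                  where
                  acc≥1 : 1ℚ ≤ accProd (R ∷ R' ∷ []) s
                  acc≥1 = ≤-trans (≤-reflexive (sym (trans (∏-const (R ∷ R' ∷ []) 1ℚ) (1^ 2)))) (∏-mono (R ∷ R' ∷ []) (λ _ → 0≤1) (accfac≥1 H s))

          var-sum : ∑ ps (var s) ≤ q * (2ℚ H Sp * 2ℚ H Sp * K) * (confMass s + β * (K * N)) + ρ * (Kc * q * K * pairMass s)
          var-sum = ≤-trans (∑-mono ps (λ T → ≤-trans (∑-mono es (λ o → ≤-trans (*-monoˡ (*-nn ρ≥0 (W≥0 o)) (*-monoˡ (bool-nn (not (inc T o))) (ξ² o T)))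
                (≤-reflexive (solve 4 (λ r n a b → r :* (n :* (a :+ b)) := r :* (n :* a) :+ r :* (n :* b)) refl (ρ * W s o) (bool (not (inc T o))) _ (off o T))))) (≤-reflexive (∑-+ es _ _))))
            (≤-trans (≤-reflexive (∑-+ ps _ _)) (+-mono-≤ (≤-trans diag-sum (≤-trans (≤-reflexive (∑-*ˡ es (q * (2ℚ H Sp * 2ℚ H Sp * K)) _)) bigq)) off-sum))
            where
            Wκ≤ : ∑ es (λ R → W s R * κ s R) ≤ confMass s + β * (K * N)
            Wκ≤ = ≤-trans (∑-mono∈ es (λ R R∈ → ≤-trans (*-monoˡ (W≥0 R) (κ≤κc+β iv l R R∈)) (≤-trans (≤-reflexive (*-distribˡ-+ (W s R) _ _)) (+-monoʳ-≤ _ (*-monoʳ β≥0 (W≤K iv l R R∈))))))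
              (≤-reflexive (trans (∑-+ es _ _) (cong (confMass s +_) (trans (∑-const es (K * β)) (solve 3 (λ n k b → n :* (k :* b) := b :* (k :* n)) refl N K β)))))
            bigq : q * (2ℚ H Sp * 2ℚ H Sp * K) * ∑ es (λ R → W s R * κ s R) ≤ q * (2ℚ H Sp * 2ℚ H Sp * K) * (confMass s + β * (K * N))
            -- Nonnegativity of q is read off from an edge, so the case without edges, where both
            -- sides vanish, is separate.
            bigq = by es refl
              where
              by : ∀ xs → xs ≡ es → q * (2ℚ H Sp * 2ℚ H Sp * K) * ∑ es (λ R → W s R * κ s R) ≤ q * (2ℚ H Sp * 2ℚ H Sp * K) * (confMass s + β * (K * N))
              by [] e = ≤-trans (≤-reflexive (trans (cong (λ z → q * (2ℚ H Sp * 2ℚ H Sp * K) * ∑ z (λ R → W s R * κ s R)) (sym e)) (*-zeroʳ _)))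
                 (≤-reflexive (sym (trans (cong (λ z → q * (2ℚ H Sp * 2ℚ H Sp * K) * (∑ z (λ R → W s R * κc s R) + β * (K * ι (length z)))) (sym e)) (solve 3 (λ q b k → q :* (𝟘 :+ b :* (k :* 𝟘)) := 𝟘) refl (q * (2ℚ H Sp * 2ℚ H Sp * K)) β K))))
              by (R ∷ _) e = *-monoˡ (*-nn (q≥0 R (subst (R ∈_) e (here' R _))) (*-nn (*-nn (+-nn 0≤1 0≤1) (+-nn 0≤1 0≤1)) K≥0)) Wκ≤
                where
                here' : ∀ (R : E) xs → R ∈ (R ∷ xs)
                here' R xs = Data.List.Relation.Unary.Any.here refl
                  where import Data.List.Relation.Unary.Any

        private
          CP : ℚ
          CP = Kc * q * K

        𝔼-pairMass : ∀ i → i ℕ.≤ I → 𝔼 i pairMass ≤ CK * pairSum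
        𝔼-pairMass i l = ≤-trans (≤-reflexive (trans (Eₙ-∑ i es _ init) (∑-cong es (λ R → trans (Eₙ-∑ i es _ init) (∑-cong es (λ R' → trans (Eₙ-∑ i es _ init) (∑-cong es (λ o → Eₙ-* i (bool (pairOK R R' o)) (present H Sp (R ∷ R' ∷ []) o) init))))))))
          (≤-trans (∑-mono∈ es (λ R R∈ → ∑-mono∈ es (λ R' R'∈ → ∑-mono es (λ o → ≤-trans (*-monoˡ (bool-nn (pairOK R R' o)) (𝔼-presentAt H Sp (R ∷ R' ∷ []) o (R∈ ∷ R'∈ ∷ []) lℓ i l))
              (≤-reflexive (solve 3 (λ b c s → b :* (c :* s) := c :* (b :* s)) refl (bool (pairOK R R' o)) CK (structAt H Sp (R ∷ R' ∷ []) o)))))))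
            (≤-reflexive (trans (∑-cong es (λ R → trans (∑-cong es (λ R' → ∑-*ˡ es CK _)) (∑-*ˡ es CK _))) (∑-*ˡ es CK _))))
          where
          lℓ : 2 ℕ.+ xm ℕ.≤ ℓm
          lℓ = ℕ.≤-trans (ℕ.+-monoʳ-≤ 2 (ℕ.m≤m+n xm xm)) ℓm≥

        lenA : State → ℚ
        lenA s = ι (length (acc s))

        lenA-step : ∀ s → Es lenA s ≡ lenA s + ρ * ∑ es (W s)
        lenA-step s = trans (cong (pr s nothing * lenA s +_) (∑-map just es _)) (trans (cong (pr s nothing * lenA s +_) (trans (∑-*ʳ es (1ℚ + lenA s) _) (cong (_* (1ℚ + lenA s)) (∑-*ˡ es ρ (W s)))))
          (solve 2 (λ x a → (𝟙 :- x) :* a :+ x :* (𝟙 :+ a) := a :+ x) refl (ρ * ∑ es (W s)) (lenA s)))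

        E-lenA : ∀ n → 𝔼 n lenA ≡ ∑< n (λ i → 𝔼 i (λ s → ρ * ∑ es (W s)))
        E-lenA zero = refl
        E-lenA (suc n) = trans (Eₙ-cong n lenA-step init) (trans (Eₙ-+ n lenA _ init) (cong (_+ 𝔼 n (λ s → ρ * ∑ es (W s))) (E-lenA n)))

        pot-init : pot C init ≡ N * cap
        pot-init = trans (cong₂ _-_ (trans (∑-const es (1ℚ * (cap - 0ℚ))) (solve 2 (λ n c → n :* (𝟙 :* (c :- 𝟘)) := n :* c) refl N cap))
            (trans (cong (C 0 *_) (zeroΦ ps (λ T T∈ → T∈))) (*-zeroʳ (C 0)))) (solve 1 (λ x → x :- 𝟘 := x) refl (N * cap))
          where
          zeroΦ : ∀ xs → (∀ T → T ∈ xs → T ∈ ps) → ∑ xs (Φ init) ≡ 0ℚ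
          zeroΦ [] h = refl
          zeroΦ (T ∷ xs) h = trans (cong₂ _+_ (φ-≤0 (≤-reflexive (trans (cong₂ _-_ (trans (∑-cong es (λ R → *-identityʳ (bool (inc T R)))) (degD (h T (Data.List.Relation.Unary.Any.here refl)))) ŷ0) (+-inverseʳ D))))
              (zeroΦ xs (λ T m → h T (Data.List.Relation.Unary.Any.there m)))) (+-identityˡ 0ℚ)
            where import Data.List.Relation.Unary.Any

        E-pot : ∀ n → n ℕ.≤ I → N * cap - ∑< n (λ i → 𝔼 i (loss C)) ≤ 𝔼 n (pot C)
        E-pot zero l = ≤-reflexive (trans (solve 1 (λ x → x :- 𝟘 := x) refl (N * cap)) (sym pot-init))
        E-pot (suc n) l = ≤-trans (≤-reflexive (solve 3 (λ a b c → a :- (b :+ c) := a :- b :+ :- c) refl (N * cap) (∑< n (λ i → 𝔼 i (loss C))) (𝔼 n (loss C))))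
          (≤-trans (+-monoˡ-≤ _ (E-pot n (ℕ.≤-trans (ℕ.n≤1+n n) l))) (≤-trans (≤-reflexive eq)
            (𝔼-mono H n (ℕ.≤-trans (ℕ.n≤1+n n) l) (λ s iv → pot-step H ŷ-rec iv l C≥0 C-dec δ≥0 δD C-big))))
          where
          eq : 𝔼 n (pot C) + - 𝔼 n (loss C) ≡ 𝔼 n (λ s → pot C s - loss C s)
          eq = sym (trans (Eₙ-+ n (pot C) (λ s → - loss C s) init) (cong (𝔼 n (pot C) +_) (trans (Eₙ-cong n (λ s → solve 1 (λ x → :- x := :- 𝟙 :* x) refl (loss C s)) init)
            (trans (Eₙ-* n (- 1ℚ) (loss C) init) (solve 1 (λ x → :- 𝟙 :* x := :- x) refl (𝔼 n (loss C)))))))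

        lossBound : State → ℚ
        lossBound s = (1ℚ + cap * lam) * confMass s + cap * lam * (β * (K * N)) + Cmax * ∑ ps (var s)

        loss≤ : ∀ {n s} → Inv n s → n ℕ.≤ I → loss C s ≤ lossBound s
        loss≤ {n} {s} iv l = ≤-trans (+-mono-≤ (+-monoʳ-≤ (confMass s) (*-monoˡ cap≥0 Wκκ)) (*-monoʳ (∑-nn ps (λ T → ∑-nn es (λ o → *-nn (*-nn ρ≥0 (W≥0 o)) (*-nn (bool-nn (not (inc T o))) (sq-nn (ξ s T o)))))) (C≤ (suc (clk s)))))
            (≤-reflexive (solve 5 (λ m c l b v → m :+ c :* (l :* (m :+ b)) :+ v := (𝟙 :+ c :* l) :* m :+ c :* l :* b :+ v) refl (confMass s) cap lam (β * (K * N)) (Cmax * ∑ ps (var s))))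
          where
          open Inv iv
          Wκκ : ∑ es (λ R → W s R * (κ s R * κ s R)) ≤ lam * (confMass s + β * (K * N))
          Wκκ = ≤-trans (∑-mono∈ es (λ R R∈ → ≤-trans (*-monoˡ (W≥0 R) (*-monoʳ (κ≥0 iv R) (κ≤lam iv l R)))
                (≤-trans (≤-reflexive (solve 3 (λ w l k → w :* (l :* k) := l :* (w :* k)) refl (W s R) lam (κ s R))) (*-monoˡ lam≥0 (≤-trans (*-monoˡ (W≥0 R) (κ≤κc+β iv l R R∈)) (≤-trans (≤-reflexive (*-distribˡ-+ (W s R) _ _)) (+-monoʳ-≤ _ (*-monoʳ β≥0 (W≤K iv l R R∈)))))))))
            (≤-trans (≤-reflexive (∑-*ˡ es lam _)) (*-monoˡ lam≥0 (≤-reflexive (trans (∑-+ es _ _) (cong (confMass s +_) (trans (∑-const es (K * β)) (solve 3 (λ n k b → n :* (k :* b) := b :* (k :* n)) refl N K β)))))))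

        module _ (Cmax≥0 : 0ℚ ≤ Cmax) (q≥0 : 0ℚ ≤ q) where
          private
            cm : ℚ
            cm = ρ * (GG * (confSum + τ * K * CC * CK * strSum))
            vq : ℚ
            vq = q * (2ℚ H Sp * 2ℚ H Sp * K)
            vm : ℚ
            vm = vq * (cm + β * (K * N)) + ρ * (CP * (CK * pairSum))

          E-var : ∀ i → i ℕ.≤ I → 𝔼 i (λ s → ∑ ps (var s)) ≤ vm
          E-var i l = ≤-trans (𝔼-mono H i l (λ s iv → var-sum iv l))
            (≤-trans (≤-reflexive (trans (Eₙ-+ i _ _ init) (cong₂ _+_ (trans (Eₙ-* i vq _ init) (cong (vq *_) (trans (Eₙ-+ i confMass _ init) (cong (𝔼 i confMass +_) (Eₙ-const i _ init)))))
                (trans (Eₙ-* i ρ _ init) (cong (ρ *_) (Eₙ-* i CP pairMass init))))))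
              (+-mono-≤ (*-monoˡ (*-nn q≥0 (*-nn (*-nn (+-nn 0≤1 0≤1) (+-nn 0≤1 0≤1)) K≥0)) (+-monoˡ-≤ _ (𝔼-confMass i l))) (*-monoˡ ρ≥0 (*-monoˡ (*-nn (*-nn Kc≥0 q≥0) K≥0) (𝔼-pairMass i l)))))

          E-loss : ∀ i → i ℕ.≤ I → 𝔼 i (loss C) ≤ (1ℚ + cap * lam) * cm + cap * lam * (β * (K * N)) + Cmax * vm
          E-loss i l = ≤-trans (𝔼-mono H i l (λ s iv → loss≤ iv l))
            (≤-trans (≤-reflexive (trans (Eₙ-+ i _ _ init) (cong₂ _+_ (trans (Eₙ-+ i _ _ init) (cong₂ _+_ (Eₙ-* i (1ℚ + cap * lam) confMass init) (Eₙ-const i _ init))) (Eₙ-* i Cmax _ init))))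
              (+-mono-≤ (+-monoˡ-≤ _ (*-monoˡ (+-nn 0≤1 (*-nn cap≥0 lam≥0)) (𝔼-confMass i l))) (*-monoˡ Cmax≥0 (E-var i l))))

          total-loss : ∑< I (λ i → 𝔼 i (loss C)) ≤ TL
          total-loss = ≤-trans (∑<-mono I (λ i i< → E-loss i (ℕ.<⇒≤ i<))) (≤-reflexive (trans (∑<-const I _)
            (solve 15 (λ i r g cs st k n cl b l cp kc cx vq ck → i :* ((𝟙 :+ l) :* (r :* (g :* (cs :+ st))) :+ l :* (b :* (k :* n)) :+ cx :* (vq :* (r :* (g :* (cs :+ st)) :+ b :* (k :* n)) :+ r :* (cp :* (ck :* cl))))
              := (𝟙 :+ l) :* (i :* r :* (g :* (cs :+ st))) :+ i :* b :* (l :* (k :* n)) :+ cx :* (i :* r :* (cp :* ck :* cl) :+ vq :* (i :* r :* (g :* (cs :+ st)) :+ i :* b :* (k :* n))))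
              refl (ι I) ρ GG confSum (τ * K * CC * CK * strSum) K N pairSum β (cap * lam) CP 0ℚ Cmax vq CK)))

          -- At each time `cap` times the total weight is at least `pot`, whose mean is at least N
          -- `cap` - `TL`. Summing the acceptance rates ρ ∑ W over `I` steps gives the mean number
          -- of accepted edges, and some final state attains it.
          greedy : ∃ λ s → Inv I s × τ * (N * cap - TL) ≤ cap * lenA s
          greedy with 𝔼-exists H I (𝔼 I lenA) {lenA} ℕ.≤-refl ≤-refl
          ... | s , iv , le = s , iv , ≤-trans lower (*-monoˡ cap≥0 le)
            where
            each : ∀ i → i ℕ.≤ I → N * cap - TL ≤ 𝔼 i (λ s → cap * ∑ es (W s))
            each i l = ≤-trans (+-monoʳ-≤ (N * cap) (neg-antimono (≤-trans (∑<-up l (λ j j< → 𝔼-nn H j (ℕ.<⇒≤ j<) (λ s iv → loss≥0 iv))) total-loss)))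
                (≤-trans (E-pot i l) (𝔼-mono H i l (λ s iv → pot≤ iv)))
              where
              loss≥0 : ∀ {n s} → Inv n s → 0ℚ ≤ loss C s
              loss≥0 {n} {s} iv = +-nn (+-nn (∑-nn es (λ R → *-nn (W≥0 R) (κc≥0 iv R))) (*-nn cap≥0 (∑-nn es (λ R → *-nn (W≥0 R) (sq-nn (κ s R))))))
                  (*-nn (C≥0 (suc (clk s))) (∑-nn ps (λ T → ∑-nn es (λ o → *-nn (*-nn ρ≥0 (W≥0 o)) (*-nn (bool-nn (not (inc T o))) (sq-nn (ξ s T o)))))))
                where open Inv iv
              pot≤ : ∀ {n s} → Inv n s → pot C s ≤ cap * ∑ es (W s)
              pot≤ {n} {s} iv = ≤-trans (diff (*-nn (C≥0 (clk s)) (∑-nn ps (λ T → φ-nn (Y s T - ŷ (clk s))))) (solve 2 (λ a b → a :- (a :- b) := b) refl (∑ es (λ R → W s R * (cap - Λ s R))) (C (clk s) * ∑ ps (Φ s))))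
                (≤-trans (∑-mono es (λ R → ≤-trans (*-monoˡ (W≥0 R) (diff (Λ≥0 R) (solve 2 (λ c k → c :- (c :- k) := k) refl cap (Λ s R)))) (≤-reflexive (*-comm (W s R) cap)))) (≤-reflexive (∑-*ˡ es cap (W s))))
                where open Inv iv
            lower : τ * (N * cap - TL) ≤ cap * 𝔼 I lenA
            lower = ≤-trans (≤-reflexive (trans (solve 3 (λ i r x → i :* r :* x := i :* (r :* x)) refl (ι I) ρ (N * cap - TL)) (sym (∑<-const I _))))
              (≤-trans (∑<-mono I (λ i i< → ≤-trans (*-monoˡ ρ≥0 (each i (ℕ.<⇒≤ i<))) (≤-reflexive (trans (sym (Eₙ-* i ρ _ init)) (trans (Eₙ-cong i (λ s → solve 3 (λ r c w → r :* (c :* w) := c :* (r :* w)) refl ρ cap (∑ es (W s))) init) (Eₙ-* i cap _ init))))))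
                (≤-reflexive (trans (∑<-* I cap _) (cong (cap *_) (sym (E-lenA I))))))

-- Duplicate-free lists and bounded search.

module Lists where
  open import Data.Nat using (_+_; _≤_; _<_; z≤n; s≤s; s≤s⁻¹)
  open import Data.Nat.Properties using (+-suc; ≤-trans; ≤-refl; suc-injective)
  open import Data.List.Relation.Unary.Any as Any using (Any)
  import Data.List.Relation.Unary.All.Properties as All
  open import Data.List.Relation.Unary.Unique.Propositional.Properties as Unique using (filter⁺)
  open import Data.Empty using (⊥)
  open import Function using (_∘_)
  open import Relation.Nullary.Decidable using (¬?; map′)
  import Data.List.Membership.DecPropositional as DecMem

  private variable
    A : Set

  infix 4 _⊑_
  _⊑_ : List A → List A → Set
  xs ⊑ ys = ∀ {x} → x ∈ xs → x ∈ ys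

  delete : ∀ {x : A} {xs} → Unique xs → x ∈ xs → ∃ λ ys → Unique ys × length xs ≡ suc (length ys) × (∀ {y} → y ∈ xs → y ≡ x ⊎ y ∈ ys) × ys ⊑ xs × ¬ x ∈ ys
  delete (a ∷ u) (here refl) = _ , u , refl , (λ { (here e) → inj₁ e ; (there m) → inj₂ m }) , there , (λ m → All.lookup a m refl)
  delete {xs = y ∷ _} (a ∷ u) (there m) with delete u m
  ... | ys , v , e , f , g , n = y ∷ ys , All.tabulate (λ z∈ → All.lookup a (g z∈)) ∷ v , cong suc e ,
     (λ { (here e) → inj₂ (here e) ; (there m) → Data.Sum.map₂ there (f m) }) , (λ { (here e) → here e ; (there m) → there (g m) }) ,
     (λ { (here refl) → All.lookup a m refl ; (there m) → n m })
    where import Data.Sum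

  unique-length : ∀ {xs ys : List A} → Unique xs → xs ⊑ ys → length xs ≤ length ys
  unique-length {xs = []} u s = z≤n
  unique-length {A} {xs = x ∷ xs} {ys} (a ∷ u) s = ≤-trans (s≤s (unique-length {ys = proj₁ r} u sub)) (ℕ.≤-reflexive (sym (proj₁ (proj₂ r))))
    where
    cut : ∀ (ys : List A) {x} → x ∈ ys → ∃ λ zs → length ys ≡ suc (length zs) × (∀ {y} → y ∈ ys → ¬ x ≡ y → y ∈ zs)
    cut (y ∷ ys) (here refl) = ys , refl , λ { (here refl) n → ⊥-elim (n refl) ; (there m) _ → m }
    cut (y ∷ ys) (there m) with cut ys m
    ... | zs , e , f = y ∷ zs , cong suc e , λ { (here e) _ → here e ; (there m) n → there (f m n) }
    r = cut ys (s (here refl))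
    sub : xs ⊑ proj₁ r
    sub m = proj₂ (proj₂ r) (s (there m)) (All.lookup a m)

  module Decide {A : Set} (_≟_ : DecidableEquality A) where
    open DecMem _≟_ using (_∈?_) public

    inn out : List A → List A → List A
    inn V c = filter (_∈? c) V
    out V c = filter (¬? ∘ (_∈? c)) V

    length-inn-out : ∀ V c → length (inn V c) + length (out V c) ≡ length V
    length-inn-out [] c = refl
    length-inn-out (x ∷ V) c with x ∈? c
    ... | yes _ = cong suc (length-inn-out V c)
    ... | no _ = trans (+-suc _ _) (cong suc (length-inn-out V c))

    inn⁻ : ∀ {V c x} → x ∈ inn V c → x ∈ V × x ∈ c
    inn⁻ {V} {c} = ∈-filter⁻ (_∈? c) {xs = V}

    inn⁺ : ∀ {V c x} → x ∈ V → x ∈ c → x ∈ inn V c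
    inn⁺ {V} {c} = ∈-filter⁺ (_∈? c)

    out⁻ : ∀ {V c x} → x ∈ out V c → x ∈ V × ¬ x ∈ c
    out⁻ {V} {c} = ∈-filter⁻ (¬? ∘ (_∈? c)) {xs = V}

    out⁺ : ∀ {V c x} → x ∈ V → ¬ x ∈ c → x ∈ out V c
    out⁺ {V} {c} = ∈-filter⁺ (¬? ∘ (_∈? c))

    inn-unique : ∀ {V} c → Unique V → Unique (inn V c)
    inn-unique c = filter⁺ (_∈? c)

    out-unique : ∀ {V} c → Unique V → Unique (out V c)
    out-unique c = filter⁺ (¬? ∘ (_∈? c))

    empty-or : ∀ (V : List A) → V ≡ [] ⊎ ∃ λ x → x ∈ V
    empty-or [] = inj₁ refl
    empty-or (x ∷ V) = inj₂ (x , here refl)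

    all⊑ : ∀ V c → V ⊑ c ⊎ ∃ λ x → x ∈ V × ¬ x ∈ c
    all⊑ [] c = inj₁ λ ()
    all⊑ (x ∷ V) c with x ∈? c | all⊑ V c
    ... | no n | _ = inj₂ (x , here refl , n)
    ... | yes _ | inj₂ (y , m , n) = inj₂ (y , there m , n)
    ... | yes p | inj₁ s = inj₁ λ { (here refl) → p ; (there m) → s m }

    unique? : ∀ xs → Dec (Unique xs)
    unique? [] = yes []
    unique? (x ∷ xs) with x ∈? xs | unique? xs
    ... | yes p | _ = no λ { (a ∷ u) → All.lookup a p refl }
    ... | no _ | no q = no λ { (a ∷ u) → q u }
    ... | no p | yes q = yes (All.tabulate (λ m e → p (subst (_∈ xs) (sym e) m)) ∷ q)

  -- Exhaustive search; it decides conflicts, gadgets and configurations alike.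
  ∃list? : ∀ {P : List A → Set} → (∀ l → Dec (P l)) → ∀ c ℓ → Dec (∃ λ l → All (_∈ c) l × length l ≡ ℓ × P l)
  ∃list? P? c zero = map′ (λ p → [] , [] , refl , p) (λ { ([] , _ , _ , p) → p }) (P? [])
  ∃list? {A} {P} P? c (suc ℓ) = map′ to from (Any.any? (λ x → ∃list? (λ l → P? (x ∷ l)) c ℓ) c)
    where
    to : Any (λ x → ∃ λ l → All (_∈ c) l × length l ≡ ℓ × P (x ∷ l)) c → ∃ λ l → All (_∈ c) l × length l ≡ suc ℓ × P l
    to a with find a
      where open import Data.List.Membership.Propositional using (find)
    ... | x , x∈ , l , l∈ , e , p = x ∷ l , x∈ ∷ l∈ , cong suc e , p
    from : (∃ λ l → All (_∈ c) l × length l ≡ suc ℓ × P l) → Any (λ x → ∃ λ l → All (_∈ c) l × length l ≡ ℓ × P (x ∷ l)) c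
    from (x ∷ l , x∈ ∷ l∈ , e , p) = lose x∈ (l , l∈ , suc-injective e , p)
      where open import Data.List.Membership.Propositional using (lose)

  ∀list? : ∀ {P : List A → Set} → (∀ l → Dec (P l)) → ∀ c ℓ → Dec (∀ l → All (_∈ c) l → length l ≡ ℓ → P l)
  ∀list? {A} {P} P? c ℓ with ∃list? (λ l → ¬? (P? l)) c ℓ
  ... | yes (l , a , e , n) = no λ f → n (f l a e)
  ... | no n = yes λ l a e → dec l a e (P? l)
    where
    dec : ∀ l → All (_∈ c) l → length l ≡ ℓ → Dec (P l) → P l
    dec l a e (yes p) = p
    dec l a e (no q) = ⊥-elim (n (l , a , e , q))

  ∃< : ∀ {P : ℕ → Set} → (∀ i → Dec (P i)) → ∀ n → Dec (∃ λ i → i < n × P i)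
  ∃< P? zero = no λ { (_ , () , _) }
  ∃< P? (suc n) with P? n | ∃< P? n
  ... | yes p | _ = yes (n , ≤-refl , p)
  ... | no _ | yes (i , l , p) = yes (i , ℕ.m≤n⇒m≤1+n l , p)
  ... | no q | no r = no λ { (i , l , p) → case i l p (i ℕ.≟ n) }
    where
    case : ∀ i → i < suc n → _ → Dec (i ≡ n) → ⊥
    case i l p (yes refl) = q p
    case i l p (no ne) = r (i , ℕ.≤∧≢⇒< (s≤s⁻¹ l) ne , p)

  least : ∀ {P : ℕ → Set} → (∀ i → Dec (P i)) → ∀ {n} → P n → ∃ λ i → i ≤ n × P i × (∀ j → j < i → ¬ P j)
  least {P} P? {n} p = go n ≤-refl p
    where
    go : ∀ m → m ≤ n → P m → ∃ λ i → i ≤ n × P i × (∀ j → j < i → ¬ P j)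
    go m le pm with ∃< P? m
    ... | no r = m , le , pm , λ j l q → r (j , l , q)
    go (suc m) le pm | yes (i , l , q) = go' (suc m) i le l q
      where
      go' : ∀ m i → m ≤ n → i < m → P i → ∃ λ i → i ≤ n × P i × (∀ j → j < i → ¬ P j)
      go' (suc m) i le l q with ∃< P? i
      ... | no r = i , ≤-trans (ℕ.<⇒≤ l) le , q , λ j l q → r (j , l , q)
      ... | yes (j , l' , q') = go' m j (≤-trans (ℕ.n≤1+n m) le) (ℕ.<-≤-trans l' (s≤s⁻¹ l)) q'

  ∀< : ∀ {P : ℕ → Set} → (∀ i → Dec (P i)) → ∀ n → Dec (∀ i → i < n → P i)
  ∀< P? n with ∃< (λ i → ¬? (P? i)) n
  ... | yes (i , l , q) = no λ f → q (f i l)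
  ... | no q = yes λ i l → dec i l (P? i)
    where
    dec : ∀ i → i < n → Dec _ → _
    dec i l (yes p) = p
    dec i l (no r) = ⊥-elim (q (i , l , r))

-- Spanned vertices and submodularity.

module Vol where
  open Lists
  open import Data.Nat using (_+_; _≤_)
  open import Data.Nat.Properties using (≤-trans; ≤-reflexive; +-mono-≤)
  open import Data.Vec using ([]; _∷_)
  import Data.Vec.Properties as Vec
  import Data.Bool.Properties as Bool
  open import Data.Fin.Subset using (Subset; ∣_∣; _∪_; _∩_; ⋃; _⊆_) renaming (_∈_ to _∈ᵥ_)
  open import Data.Fin.Subset.Properties using (p⊆q⇒∣p∣≤∣q∣; x∈p∩q⁺; x∈p∪q⁻; x∈p∪q⁺; ∉⊥; ∪-identityʳ; ∪-comm)

  private variable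
    n : ℕ

  _≟ₛ_ : DecidableEquality (Subset n)
  _≟ₛ_ = Vec.≡-dec Bool._≟_

  ∪+∩ : ∀ (p q : Subset n) → ∣ p ∪ q ∣ + ∣ p ∩ q ∣ ≡ ∣ p ∣ + ∣ q ∣
  ∪+∩ [] [] = refl
  ∪+∩ (true ∷ p) (true ∷ q) = cong suc (trans (ℕ.+-suc _ _) (trans (cong suc (∪+∩ p q)) (sym (ℕ.+-suc _ _))))
  ∪+∩ (true ∷ p) (false ∷ q) = cong suc (∪+∩ p q)
  ∪+∩ (false ∷ p) (true ∷ q) = trans (cong suc (∪+∩ p q)) (sym (ℕ.+-suc _ _))
  ∪+∩ (false ∷ p) (false ∷ q) = ∪+∩ p q

  opaque
    vol : List (Subset n) → ℕ
    vol L = ∣ ⋃ L ∣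

    vol≡ : ∀ (L : List (Subset n)) → vol L ≡ ∣ ⋃ L ∣
    vol≡ L = refl

  ⋃⁺ : ∀ {L : List (Subset n)} {p x} → p ∈ L → x ∈ᵥ p → x ∈ᵥ ⋃ L
  ⋃⁺ (here refl) m = x∈p∪q⁺ (inj₁ m)
  ⋃⁺ (there i) m = x∈p∪q⁺ (inj₂ (⋃⁺ i m))

  ⋃⁻ : ∀ (L : List (Subset n)) {x} → x ∈ᵥ ⋃ L → ∃ λ p → p ∈ L × x ∈ᵥ p
  ⋃⁻ [] m = ⊥-elim (∉⊥ m)
  ⋃⁻ (p ∷ L) m with x∈p∪q⁻ p (⋃ L) m
  ... | inj₁ i = p , here refl , i
  ... | inj₂ i with ⋃⁻ L i
  ...   | q , q∈ , x∈ = q , there q∈ , x∈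

  ⋃-⊑ : ∀ {L M : List (Subset n)} → L ⊑ M → ⋃ L ⊆ ⋃ M
  ⋃-⊑ {L = L} s m with ⋃⁻ L m
  ... | p , p∈ , x∈ = ⋃⁺ (s p∈) x∈

  opaque
    unfolding vol

    vol-⊆ : ∀ (L M : List (Subset n)) → ⋃ L ⊆ ⋃ M → vol L ≤ vol M
    vol-⊆ L M = p⊆q⇒∣p∣≤∣q∣

    vol-[] : ∀ (p : Subset n) → vol (p ∷ []) ≡ ∣ p ∣
    vol-[] p = cong ∣_∣ (∪-identityʳ p)

    vol2 : ∀ (o R : Subset n) → vol (R ∷ o ∷ []) + ∣ o ∩ R ∣ ≡ ∣ o ∣ + ∣ R ∣
    vol2 o R = trans (cong (λ x → ∣ x ∣ + ∣ o ∩ R ∣) (trans (cong (R ∪_) (∪-identityʳ o)) (∪-comm R o))) (∪+∩ o R)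

    -- L lies in the union of P and Q, and Z in their intersection. The gluing arguments all have
    -- this shape: if P and Q are dense and the overlap Z spans more than a dense list of its size,
    -- then L falls below the dense bound. Stating it for unions allows an overlap such as a t-set
    -- that is not an edge.
    submod : ∀ (L P Q Z : List (Subset n)) → ⋃ L ⊆ ⋃ (P ++ Q) → ⋃ Z ⊆ ⋃ P → ⋃ Z ⊆ ⋃ Q → vol L + vol Z ≤ vol P + vol Q
    submod L P Q Z l zp zq = ≤-trans (+-mono-≤ (p⊆q⇒∣p∣≤∣q∣ l') (p⊆q⇒∣p∣≤∣q∣ (λ m → x∈p∩q⁺ (zp m , zq m)))) (≤-reflexive (∪+∩ (⋃ P) (⋃ Q)))
      where
      l' : ⋃ L ⊆ ⋃ P ∪ ⋃ Q
      l' m with ⋃⁻ (P ++ Q) (l m)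
      ... | p , p∈ , x∈ with ∈-++⁻ P p∈
      ...   | inj₁ i = x∈p∪q⁺ (inj₁ (⋃⁺ i x∈))
      ...   | inj₂ i = x∈p∪q⁺ (inj₂ (⋃⁺ i x∈))

  vol-⊑ : ∀ {L M : List (Subset n)} → L ⊑ M → vol L ≤ vol M
  vol-⊑ {L = L} {M} s = vol-⊆ L M (⋃-⊑ s)

  submod' : ∀ (L P Q Z : List (Subset n)) → L ⊑ P ++ Q → Z ⊑ P → Z ⊑ Q → vol L + vol Z ≤ vol P + vol Q
  submod' L P Q Z l zp zq = submod L P Q Z (⋃-⊑ l) (⋃-⊑ zp) (⋃-⊑ zq)

-- Geometry of dense lists.

module Geo where
  open Lists
  open Vol
  open Proc using (∧-true; not-true; ⌊⌋-true; ⌊⌋-false)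
  open import Data.Nat using (_+_; _*_; _≤_; _<_; z≤n; s≤s; s≤s⁻¹; _≤?_)
  open import Data.Nat.Properties using (≤-trans; ≤-refl; ≤-reflexive; +-monoʳ-≤; +-monoˡ-≤; +-mono-≤; +-cancelʳ-≤)
  open import Data.Fin.Subset using (Subset; ∣_∣; _∩_; ⋃; _⊆_) renaming (_∈_ to _∈ᵥ_)
  open import Data.Fin.Subset.Properties using (p⊆q⇒∣p∣≤∣q∣; x∈p∩q⁺; ∩-idem)
  open import Data.List.Relation.Unary.All.Properties as All using (++⁺)
  import Data.List.Relation.Unary.Unique.Propositional.Properties as Unique
  open import Function using (case_of_)
  open import Relation.Nullary.Decidable using (_→-dec_; ¬?)

  -- Throughout d = r - t; a list c of edges is dense if vol c ≤ |c| d + t.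
  module Geometry (n d t k : ℕ) (es : List (Subset n)) (es-size : ∀ {p} → p ∈ es → ∣ p ∣ ≡ d + t) (d≥1 : 1 ≤ d) where
    E : Set
    E = Subset n

    open Decide {E} _≟ₛ_

    -- Dense sublists of every size from 2 to k are excluded, not only those of size k: this is what
    -- makes the overlaps in the gluing arguments span many vertices.
    Free : List E → Set
    Free A = ∀ S → Unique S → S ⊑ A → 2 ≤ length S → length S ≤ k → suc (length S * d + t) ≤ vol S

    record Good (A : List E) : Set where
      constructor good
      field
        uniq : Unique A
        edges : A ⊑ es
        free : Free A
    open Good

    kT : E → E → Bool
    kT o R = ⌊ t ≤? ∣ o ∩ R ∣ ⌋

    Dense : E → E → List E → Set
    Dense o R X = Unique X × 2 + length X ≤ k × vol (R ∷ o ∷ X) ≤ (2 + length X) * d + t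

    dense? : ∀ o R X → Dec (Dense o R X)
    dense? o R X = unique? X ×-dec (2 + length X ≤? k ×-dec vol (R ∷ o ∷ X) ≤? (2 + length X) * d + t)

    ConfAt : List E → E → E → ℕ → Set
    ConfAt A o R ℓ = ∃ λ X → All (_∈ A) X × length X ≡ ℓ × Dense o R X

    confAt? : ∀ A o R ℓ → Dec (ConfAt A o R ℓ)
    confAt? A o R = ∃list? (dense? o R) A

    conf? : ∀ A o R → Dec (∃ λ ℓ → ℓ < k × (1 ≤ ℓ × ConfAt A o R ℓ))
    conf? A o R = ∃< (λ ℓ → 1 ≤? ℓ ×-dec confAt? A o R ℓ) k

    conf : List E → E → E → Bool
    conf A o R = not (kT o R) ∧ ⌊ conf? A o R ⌋

    2d : ∀ a b → a + b + (a + b) ≡ 2 * a + b + b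
    2d = solve-∀

    kT-dense : ∀ {o R} → o ∈ es → R ∈ es → t ≤ ∣ o ∩ R ∣ → vol (R ∷ o ∷ []) ≤ 2 * d + t
    kT-dense {o} {R} o∈ R∈ p = +-cancelʳ-≤ t _ _ (≤-trans (+-monoʳ-≤ _ p) (≤-reflexive (trans (vol2 o R) (trans (cong₂ _+_ (es-size o∈) (es-size R∈)) (2d d t)))))

    sparse-kT : ∀ {o R} → o ∈ es → R ∈ es → ¬ t ≤ ∣ o ∩ R ∣ → suc (2 * d + t) ≤ vol (R ∷ o ∷ [])
    sparse-kT {o} {R} o∈ R∈ p = +-cancelʳ-≤ ∣ o ∩ R ∣ _ _ (≤-trans (≤-trans (≤-reflexive (sym (ℕ.+-suc _ _))) (+-monoʳ-≤ (2 * d + t) (ℕ.≰⇒> p)))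
       (≤-reflexive (sym (trans (vol2 o R) (trans (cong₂ _+_ (es-size o∈) (es-size R∈)) (2d d t))))))

    kill⁻ : ∀ {A o R} → o ∈ es → R ∈ es → 2 ≤ k → kT o R ∨ conf A o R ≡ true → ∃ λ ℓ → ConfAt A o R ℓ
    kill⁻ {A} {o} {R} o∈ R∈ k≥2 e with t ≤? ∣ o ∩ R ∣ | conf? A o R
    ... | yes p | _ = 0 , [] , [] , refl , [] , k≥2 , kT-dense o∈ R∈ p
    ... | no _ | yes (ℓ , _ , _ , c) = ℓ , c

    good[] : Good []
    good[] = good [] (λ ()) λ { [] _ _ () _ ; (x ∷ S) _ s _ _ → case s (here refl) of λ () }

    good1 : ∀ {R} → R ∈ es → Good (R ∷ [])
    good1 {R} R∈ = good ([] ∷ []) (λ { (here refl) → R∈ }) λ { S u s l _ → ⊥-elim (ℕ.<⇒≱ l (unique-length u s)) }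

    good∉ : ∀ {R A} → Good (R ∷ A) → ¬ R ∈ A
    good∉ g m with uniq g
    ... | a ∷ _ = All.lookup a m refl

    -- A sublist that misses R or o lies in one of the two lists already known to be good, so only
    -- sublists containing both need the hypothesis.
    cover : ∀ {R o A S} → Good (R ∷ A) → Good (o ∷ A) → Unique S → S ⊑ R ∷ o ∷ A → 2 ≤ length S → length S ≤ k →
      (∀ X → X ⊑ A → Unique X → length S ≡ 2 + length X → suc ((2 + length X) * d + t) ≤ vol (R ∷ o ∷ X)) → suc (length S * d + t) ≤ vol S
    cover {R} {o} {A} {S} gR go uS sS l2 lk both = case (R ≟ₛ o) (R ∈? S) (o ∈? S)
      where
      dropR : ¬ R ∈ S → ∀ {x} → x ∈ S → x ∈ (R ∷ o ∷ A) → x ∈ (o ∷ A)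
      dropR R∉ m (here refl) = ⊥-elim (R∉ m)
      dropR R∉ m (there i) = i
      dropo : (R ≡ o ⊎ ¬ o ∈ S) → ∀ {x} → x ∈ S → x ∈ (R ∷ o ∷ A) → x ∈ (R ∷ A)
      dropo n m (here refl) = here refl
      dropo (inj₁ refl) m (there (here refl)) = here refl
      dropo (inj₂ o∉) m (there (here refl)) = ⊥-elim (o∉ m)
      dropo n m (there (there i)) = there i
      case : Dec (R ≡ o) → Dec (R ∈ S) → Dec (o ∈ S) → suc (length S * d + t) ≤ vol S
      case (yes e) _ _ = free gR S uS (λ m → dropo (inj₁ e) m (sS m)) l2 lk
      case (no _) (no R∉) _ = free go S uS (λ m → dropR R∉ m (sS m)) l2 lk
      case (no _) (yes _) (no o∉) = free gR S uS (λ m → dropo (inj₂ o∉) m (sS m)) l2 lk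
      case (no R≢o) (yes R∈S) (yes o∈S) with delete uS R∈S
      ... | S₁ , u₁ , e₁ , f₁ , g₁ , n₁ with delete u₁ (o∈₁ (f₁ o∈S))
        where
        o∈₁ : o ≡ R ⊎ o ∈ S₁ → o ∈ S₁
        o∈₁ (inj₁ q) = ⊥-elim (R≢o (sym q))
        o∈₁ (inj₂ m) = m
      ...   | X , u₂ , e₂ , f₂ , g₂ , n₂ = ≤-trans (subst (λ z → suc (z * d + t) ≤ vol (R ∷ o ∷ X)) (sym len) (both X X⊑A u₂ len)) (vol-⊑ {L = R ∷ o ∷ X} {S} back)
        where
        len : length S ≡ 2 + length X
        len = trans e₁ (cong suc e₂)
        back : (R ∷ o ∷ X) ⊑ S
        back (here refl) = R∈S
        back (there (here refl)) = o∈S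
        back (there (there m)) = g₁ (g₂ m)
        X⊑A : X ⊑ A
        X⊑A {x} m with sS (g₁ (g₂ m))
        ... | here refl = ⊥-elim (n₁ (g₂ m))
        ... | there (here refl) = ⊥-elim (n₂ m)
        ... | there (there i) = i

    good-step : ∀ {R o A} → Good (R ∷ A) → Good (o ∷ A) → kT o R ∨ conf A o R ≡ false → Good (R ∷ o ∷ A)
    good-step {R} {o} {A} gR go e = good (u (uniq gR) (uniq go)) (λ { (here refl) → R∈ ; (there m) → edges go m }) fr
      where
      R∈ = edges gR (here refl)
      o∈ = edges go (here refl)
      nkT : ¬ t ≤ ∣ o ∩ R ∣
      nkT p with t ≤? ∣ o ∩ R ∣ | conf? A o R
      ... | no q | no _ = q p
      nconf : ¬ ∃ λ ℓ → ℓ < k × (1 ≤ ℓ × ConfAt A o R ℓ)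
      nconf p with t ≤? ∣ o ∩ R ∣ | conf? A o R
      ... | no _ | no q = q p
      R≢o : ¬ R ≡ o
      R≢o refl = nkT (≤-trans (ℕ.m≤n+m t d) (≤-reflexive (trans (sym (es-size R∈)) (cong ∣_∣ (sym (∩-idem R))))))
      u : Unique (R ∷ A) → Unique (o ∷ A) → Unique (R ∷ o ∷ A)
      u (a ∷ _) v = (R≢o ∷ a) ∷ v
      fr : Free (R ∷ o ∷ A)
      fr S uS sS l2 lk = cover gR go uS sS l2 lk (λ X s u e → big X X s u e refl)
        where
        big : ∀ X Z → X ⊑ A → Unique X → length S ≡ 2 + length X → Z ≡ X → suc ((2 + length X) * d + t) ≤ vol (R ∷ o ∷ X)
        big X [] s u e refl = sparse-kT o∈ R∈ nkT
        big X (z ∷ Z) s u e refl = ℕ.≰⇒> λ v → nconf (length X , ≤-trans (s≤s (ℕ.n≤1+n _)) lenk , s≤s z≤n , X , All.tabulate s , refl , u , lenk , v)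
          where
          lenk : 2 + length X ≤ k
          lenk = ≤-trans (≤-reflexive (sym e)) lk

    -- A shortest list that makes a and o dense, empty if they share t vertices. By minimality a and
    -- o with any shorter list are sparse, a source of strict inequalities.
    record MinWitness (A : List E) (o a : E) (V : List E) : Set where
      constructor minimal
      field
        V⊑ : V ⊑ A
        uV : Unique V
        lV : 2 + length V ≤ k
        vV : vol (a ∷ o ∷ V) ≤ (2 + length V) * d + t
        minV : ∀ V' → V' ⊑ A → Unique V' → length V' < length V → suc ((2 + length V') * d + t) ≤ vol (a ∷ o ∷ V')
    open MinWitness

    min-witness : ∀ {A o a ℓ} → ConfAt A o a ℓ → ∃ (MinWitness A o a)
    min-witness {A} {o} {a} c with least (confAt? A o a) c
    ... | i , _ , (V , V∈ , refl , D) , mn = V , minimal (All.lookup V∈) (proj₁ D) (proj₁ (proj₂ D)) (proj₂ (proj₂ D)) λ V' s u l → ℕ.≰⇒> λ v → mn (length V') l (V' , All.tabulate s , refl , u , ≤-trans (s≤s (s≤s (ℕ.<⇒≤ l))) (proj₁ (proj₂ D)) , v)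

    -- Write the excess of L as vol L - |L| d. Then `cpair` says that no two entries have smaller
    -- excess than c itself, and `ctrip` treats an o that kills a and b directly, where no witness
    -- edges supply the strict inequality. Both conflict lists and pairs through a common t-set
    -- satisfy these conditions.
    record Base (c : List E) (o : E) : Set where
      field
        cu : Unique c
        cvol : vol c ≤ length c * d + t
        cpair : ∀ {a b} → a ∈ c → b ∈ c → ¬ a ≡ b → vol c + 2 * d ≤ vol (a ∷ b ∷ []) + length c * d
        ctrip : ∀ {a b} → a ∈ c → b ∈ c → ¬ a ≡ b → vol (a ∷ o ∷ []) ≤ 2 * d + t → vol (b ∷ o ∷ []) ≤ 2 * d + t →
          suc (vol (a ∷ b ∷ o ∷ []) + vol c) ≤ suc (length c) * d + t + vol (a ∷ b ∷ [])

    Bad : List E → E → List E → Set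
    Bad c o X = Unique (c ++ X) × suc (vol (c ++ o ∷ X)) ≤ (length c + suc (length X)) * d + t

    module _ {A : List E} {c : List E} {o : E} (B : Base c o) (go : Good (o ∷ A)) (c⊑ : c ⊑ es) where
      open Base B
      private
        -- Glue c and a ∷ o ∷ V along a together with the part of V in c. This overlap lies in the
        -- good list a ∷ A, so it is sparse as soon as it has two entries; that is the strict
        -- version.
        step₁ : ∀ {a V} → a ∈ c → Good (a ∷ A) → MinWitness A o a V →
          vol (c ++ o ∷ out V c) ≤ (length c + suc (length (out V c))) * d + t ×
          (1 ≤ length (inn V c) → suc (vol (c ++ o ∷ out V c)) ≤ (length c + suc (length (out V c))) * d + t)
        step₁ {a} {V} a∈ ga (minimal V⊑ uV lV vV _) = weak , strong
          where
          Z = a ∷ inn V c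
          m = length (inn V c)
          x = length (out V c)
          sub : vol (c ++ o ∷ out V c) + vol Z ≤ vol c + vol (a ∷ o ∷ V)
          sub = submod' (c ++ o ∷ out V c) c (a ∷ o ∷ V) Z
            (λ i → case ∈-++⁻ c i of λ { (inj₁ j) → ∈-++⁺ˡ j ; (inj₂ (here refl)) → ∈-++⁺ʳ c (there (here refl)) ; (inj₂ (there j)) → ∈-++⁺ʳ c (there (there (proj₁ (out⁻ {V} {c} j)))) })
            (λ { (here refl) → a∈ ; (there j) → proj₂ (inn⁻ {V} {c} j) })
            (λ { (here refl) → here refl ; (there j) → there (there (proj₁ (inn⁻ {V} {c} j))) })
          tot : vol (c ++ o ∷ out V c) + vol Z ≤ (length c + suc x) * d + t + ((1 + m) * d + t)
          tot = ≤-trans sub (≤-trans (+-mono-≤ cvol vV) (≤-reflexive (trans (cong (λ v → length c * d + t + ((2 + v) * d + t)) (sym (length-inn-out V c))) (ar (length c) m x d t))))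
            where
            ar : ∀ c m x d t → c * d + t + ((2 + (m + x)) * d + t) ≡ (c + suc x) * d + t + ((1 + m) * d + t)
            ar = solve-∀
          strong : 1 ≤ m → suc (vol (c ++ o ∷ out V c)) ≤ (length c + suc x) * d + t
          strong m≥1 = +-cancelʳ-≤ ((1 + m) * d + t) _ _ (≤-trans (≤-trans (≤-reflexive (sym (ℕ.+-suc _ _))) (+-monoʳ-≤ _ zbig)) tot)
            where
            zbig : suc ((1 + m) * d + t) ≤ vol Z
            zbig = free ga Z (All.tabulate (λ i e → good∉ ga (V⊑ (proj₁ (inn⁻ {V} {c} (subst (_∈ inn V c) (sym e) i))))) ∷ inn-unique c uV)
              (λ { (here refl) → here refl ; (there i) → there (V⊑ (proj₁ (inn⁻ {V} {c} i))) }) (s≤s m≥1)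
              (≤-trans (s≤s (ℕ.m≤m+n m x)) (≤-trans (≤-reflexive (cong suc (length-inn-out V c))) (≤-trans (ℕ.n≤1+n _) lV)))
          weak : vol (c ++ o ∷ out V c) ≤ (length c + suc x) * d + t
          weak with inn V c in e
          ... | [] = +-cancelʳ-≤ ((1 + 0) * d + t) _ _ (≤-trans (+-monoʳ-≤ (vol (c ++ o ∷ out V c)) (≤-trans (≤-reflexive (trans (cong (_+ t) (ℕ.+-identityʳ d)) (trans (sym (es-size (edges ga (here refl)))) (sym (vol-[] a))))) (vol-⊑ {L = a ∷ []} {Z} (λ { (here refl) → here refl }))))
                (subst (λ W → vol (c ++ o ∷ out V c) + vol Z ≤ (length c + suc x) * d + t + ((1 + length W) * d + t)) e tot))
          ... | _ ∷ _ = ≤-trans (ℕ.n≤1+n _) (strong (subst (λ W → 1 ≤ length W) (sym e) (s≤s z≤n)))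

        Found : Set
        Found = ∃ λ X → X ⊑ A × length X ≤ k + k × Bad c o X

        bad-unique : ∀ {X} → Unique X → (∀ {x} → x ∈ X → ¬ x ∈ c) → Unique (c ++ X)
        bad-unique u n = Unique.++⁺ cu u λ { (i , j) → n j i }

        len≤k : ∀ {V a} → MinWitness A o a V → length V ≤ k
        len≤k w = ≤-trans (ℕ.m≤n+m _ 2) (lV w)

        out≤ : ∀ V c → length (out V c) ≤ length V
        out≤ V c = ≤-trans (ℕ.m≤n+m _ (length (inn V c))) (≤-reflexive (length-inn-out V c))

        meets : ∀ {a V} → a ∈ c → Good (a ∷ A) → MinWitness A o a V → ∀ {x} → x ∈ V → x ∈ c → Found
        meets {a} {V} a∈ ga w {x} x∈V x∈c = out V c , (λ i → V⊑ w (proj₁ (out⁻ {V} {c} i))) , ≤-trans (out≤ V c) (≤-trans (len≤k w) (ℕ.m≤m+n k k)) ,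
            bad-unique (out-unique c (uV w)) (λ i → proj₂ (out⁻ {V} {c} i)) , proj₂ (step₁ a∈ ga w) (nonempty (inn⁺ x∈V x∈c))
          where
          nonempty : ∀ {W : List E} {x} → x ∈ W → 1 ≤ length W
          nonempty (here _) = s≤s z≤n
          nonempty (there _) = s≤s z≤n

        -- Glue the witness of b onto the list of `step₁`. The overlap is b, o and only a proper
        -- part of V', so minimality of V' makes it sparse.
        escapes : ∀ {a b V V'} → a ∈ c → b ∈ c → Good (a ∷ A) → MinWitness A o a V → MinWitness A o b V' → ∀ {x} → x ∈ V' → ¬ x ∈ c ++ V → Found
        escapes {a} {b} {V} {V'} a∈ b∈ ga w w' {x} x∈ x∉ = X , X⊑ , lX , bad-unique uX (λ i → case ∈-++⁻ X₁ i of λ { (inj₁ j) → proj₂ (out⁻ {V} {c} j) ; (inj₂ j) → λ y → proj₂ (out⁻ {V'} {c ++ V} j) (∈-++⁺ˡ y) }) , final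
          where
          X₁ = out V c
          X₃ = out V' (c ++ V)
          X = X₁ ++ X₃
          M = inn V' (c ++ V)
          m = length M
          V'⊑ = V⊑ w'
          X⊑ : X ⊑ A
          X⊑ i with ∈-++⁻ X₁ i
          ... | inj₁ j = V⊑ w (proj₁ (out⁻ {V} {c} j))
          ... | inj₂ j = V'⊑ (proj₁ (out⁻ {V'} {c ++ V} j))
          lX : length X ≤ k + k
          lX = ≤-trans (≤-reflexive (length-++ X₁)) (+-mono-≤ (≤-trans (out≤ V c) (len≤k w)) (≤-trans (out≤ V' (c ++ V)) (len≤k w')))
          uX : Unique X
          uX = Unique.++⁺ (out-unique c (uV w)) (out-unique (c ++ V) (uV w')) λ { (i , j) → proj₂ (out⁻ {V'} {c ++ V} j) (∈-++⁺ʳ c (proj₁ (out⁻ {V} {c} i))) }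
          m< : m < length V'
          m< = ≤-trans (≤-trans (≤-reflexive (ℕ.+-comm 1 m)) (+-monoʳ-≤ m (nonempty (out⁺ x∈ x∉)))) (≤-reflexive (length-inn-out V' (c ++ V)))
            where
            nonempty : ∀ {W : List E} {x} → x ∈ W → 1 ≤ length W
            nonempty (here _) = s≤s z≤n
            nonempty (there _) = s≤s z≤n
          Z = b ∷ o ∷ M
          zbig : suc ((2 + m) * d + t) ≤ vol Z
          zbig = minV w' M (λ i → V'⊑ (proj₁ (inn⁻ {V'} {c ++ V} i))) (inn-unique (c ++ V) (uV w')) m<
          into : ∀ {z} → z ∈ c ++ V → z ∈ c ++ o ∷ X₁
          into {z} i with z ∈? c | ∈-++⁻ c i
          ... | yes p | _ = ∈-++⁺ˡ p
          ... | no _ | inj₁ p = ∈-++⁺ˡ p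
          ... | no q | inj₂ p = ∈-++⁺ʳ c (there (out⁺ p q))
          sub : vol (c ++ o ∷ X) + vol Z ≤ vol (c ++ o ∷ X₁) + vol (b ∷ o ∷ V')
          sub = submod' (c ++ o ∷ X) (c ++ o ∷ X₁) (b ∷ o ∷ V') Z
            (λ i → case ∈-++⁻ c i of λ { (inj₁ j) → ∈-++⁺ˡ (∈-++⁺ˡ j) ; (inj₂ (here refl)) → ∈-++⁺ˡ (∈-++⁺ʳ c (here refl)) ; (inj₂ (there j)) → case ∈-++⁻ X₁ j of λ { (inj₁ q) → ∈-++⁺ˡ (∈-++⁺ʳ c (there q)) ; (inj₂ q) → ∈-++⁺ʳ (c ++ o ∷ X₁) (there (there (proj₁ (out⁻ {V'} {c ++ V} q)))) } })
            (λ { (here refl) → ∈-++⁺ˡ b∈ ; (there (here refl)) → ∈-++⁺ʳ c (here refl) ; (there (there i)) → into (proj₂ (inn⁻ {V'} {c ++ V} i)) })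
            (λ { (here refl) → here refl ; (there (here refl)) → there (here refl) ; (there (there i)) → there (there (proj₁ (inn⁻ {V'} {c ++ V} i))) })
          final : suc (vol (c ++ o ∷ X)) ≤ (length c + suc (length X)) * d + t
          final = +-cancelʳ-≤ ((2 + m) * d + t) _ _ (≤-trans (≤-trans (≤-reflexive (sym (ℕ.+-suc _ _))) (+-monoʳ-≤ (vol (c ++ o ∷ X)) zbig))
            (≤-trans sub (≤-trans (+-mono-≤ (proj₁ (step₁ a∈ ga w)) (vV w'))
              (≤-reflexive (trans (cong (λ v → (length c + suc (length X₁)) * d + t + ((2 + v) * d + t)) (sym (length-inn-out V' (c ++ V))))
                (trans (ar (length c) (length X₁) m (length X₃) d t) (cong (λ l → (length c + suc l) * d + t + ((2 + m) * d + t)) (sym (length-++ X₁)))))))))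
            where
            ar : ∀ c x m y d t → (c + suc x) * d + t + ((2 + (m + y)) * d + t) ≡ (c + suc (x + y)) * d + t + ((2 + m) * d + t)
            ar = solve-∀

        o∈es = edges go (here refl)

        -- Glue the two dense lists along o ∷ V, which is sparse when V is nonempty, then glue the
        -- result with c along a and b, where `cpair` transfers the gain. For empty V the condition
        -- `ctrip` replaces the first gluing.
        same : ∀ {a b V V'} → a ∈ c → b ∈ c → ¬ a ≡ b → MinWitness A o a V → MinWitness A o b V' → V ⊑ V' → V' ⊑ V → (∀ {x} → x ∈ V → ¬ x ∈ c) → Found
        same {a} {b} {V} {V'} a∈ b∈ a≢b w w' s s' dj = V , V⊑ w , ≤-trans (len≤k w) (ℕ.m≤m+n k k) , bad-unique (uV w) dj , final V refl
          where
          v = length V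
          vV₁ = vV w
          vV₂ = vV w'
          pick-ab : (a ∷ b ∷ []) ⊑ c
          pick-ab (here refl) = a∈
          pick-ab (there (here refl)) = b∈
          core : vol (c ++ o ∷ V) + vol (a ∷ b ∷ []) ≤ vol (a ∷ b ∷ o ∷ V) + vol c
          core = submod' (c ++ o ∷ V) (a ∷ b ∷ o ∷ V) c (a ∷ b ∷ [])
            (λ i → case ∈-++⁻ c i of λ { (inj₁ j) → ∈-++⁺ʳ (a ∷ b ∷ o ∷ V) j ; (inj₂ j) → ∈-++⁺ˡ (there (there j)) })
            (λ { (here refl) → here refl ; (there (here refl)) → there (here refl) }) pick-ab
          final : ∀ W → W ≡ V → suc (vol (c ++ o ∷ V)) ≤ (length c + suc v) * d + t
          final [] refl = +-cancelʳ-≤ (vol (a ∷ b ∷ [])) _ _ (≤-trans (s≤s core) (≤-trans (ctrip a∈ b∈ a≢b vV₁ (empty V' refl)) (≤-reflexive (cong (λ l → l * d + t + vol (a ∷ b ∷ [])) (ℕ.+-comm 1 (length c))))))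
            where
            empty : ∀ W' → W' ≡ V' → vol (b ∷ o ∷ []) ≤ 2 * d + t
            empty [] refl = vV₂
            empty (x ∷ _) refl = case s' (here refl) of λ ()
          final (x ∷ W) refl = +-cancelʳ-≤ (vol (a ∷ b ∷ [])) _ _ (≤-trans (s≤s core) (+-cancelʳ-≤ (2 * d) _ _ (≤-trans (≤-reflexive (asc (vol (a ∷ b ∷ o ∷ V)) (vol c) (2 * d)))
                (≤-trans (+-mono-≤ trip (cpair a∈ b∈ a≢b)) (≤-reflexive (ar (length c) v d t (vol (a ∷ b ∷ []))))))))
            where
            asc : ∀ x y z → suc (x + y) + z ≡ suc x + (y + z)
            asc = solve-∀
            ar : ∀ c v d t p → (3 + v) * d + t + (p + c * d) ≡ (c + suc v) * d + t + p + 2 * d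
            ar = solve-∀
            sub : vol (a ∷ b ∷ o ∷ V) + vol (o ∷ V) ≤ vol (a ∷ o ∷ V) + vol (b ∷ o ∷ V')
            sub = submod' (a ∷ b ∷ o ∷ V) (a ∷ o ∷ V) (b ∷ o ∷ V') (o ∷ V)
              (λ { (here refl) → here refl ; (there (here refl)) → ∈-++⁺ʳ (a ∷ o ∷ V) (here refl) ; (there (there i)) → ∈-++⁺ˡ (there i) })
              there (λ { (here refl) → there (here refl) ; (there i) → there (there (s i)) })
            obig : suc ((1 + v) * d + t) ≤ vol (o ∷ V)
            obig = free go (o ∷ V) (All.tabulate (λ i e → good∉ go (V⊑ w (subst (_∈ V) (sym e) i))) ∷ uV w) (λ { (here refl) → here refl ; (there i) → there (V⊑ w i) }) (s≤s (s≤s z≤n)) (≤-trans (ℕ.n≤1+n _) (lV w))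
            trip : suc (vol (a ∷ b ∷ o ∷ V)) ≤ (3 + v) * d + t
            trip = +-cancelʳ-≤ ((1 + v) * d + t) _ _ (≤-trans (≤-trans (≤-reflexive (sym (ℕ.+-suc _ _))) (+-monoʳ-≤ (vol (a ∷ b ∷ o ∷ V)) obig))
              (≤-trans sub (≤-trans (+-mono-≤ vV₁ (≤-trans vV₂ (+-monoˡ-≤ t (ℕ.*-monoˡ-≤ d (s≤s (s≤s (unique-length (uV w') s'))))))) (≤-reflexive (ar' v d t)))))
              where
              ar' : ∀ v d t → (2 + v) * d + t + ((2 + v) * d + t) ≡ (3 + v) * d + t + ((1 + v) * d + t)
              ar' = solve-∀

        -- Exhaustive cases: one witness leaves c and the other witness, or one witness meets c, or
        -- both coincide outside c.
        try : ∀ {a b V V'} → a ∈ c → b ∈ c → Good (a ∷ A) → Good (b ∷ A) → ¬ a ≡ b → MinWitness A o a V → MinWitness A o b V' → Found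
        try {a} {b} {V} {V'} a∈ b∈ ga gb ne w w' with all⊑ V' (c ++ V) | all⊑ V (c ++ V')
        ... | inj₂ (x , m , n') | _ = escapes a∈ b∈ ga w w' m n'
        ... | inj₁ _ | inj₂ (x , m , n') = escapes b∈ a∈ gb w' w m n'
        ... | inj₁ s' | inj₁ s with empty-or (inn V c) | empty-or (inn V' c)
        ...   | inj₂ (x , m) | _ = meets a∈ ga w (proj₁ (inn⁻ {V} {c} m)) (proj₂ (inn⁻ {V} {c} m))
        ...   | inj₁ _ | inj₂ (x , m) = meets b∈ gb w' (proj₁ (inn⁻ {V'} {c} m)) (proj₂ (inn⁻ {V'} {c} m))
        ...   | inj₁ e | inj₁ e' = same a∈ b∈ ne w w' (λ m → drop e m (s m)) (λ m → drop e' m (s' m)) (λ m mc → case subst (_ ∈_) e (inn⁺ m mc) of λ ())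
          where
          drop : ∀ {V W x} → inn V c ≡ [] → x ∈ V → x ∈ c ++ W → x ∈ W
          drop e m i with ∈-++⁻ c i
          ... | inj₁ j = case subst (_ ∈_) e (inn⁺ m j) of λ ()
          ... | inj₂ j = j

      struct : ∀ {a b} → 2 ≤ k → a ∈ c → b ∈ c → ¬ a ≡ b → Good (a ∷ A) → Good (b ∷ A) → kT o a ∨ conf A o a ≡ true → kT o b ∨ conf A o b ≡ true → Found
      struct {a} {b} k≥2 a∈ b∈ ne ga gb ea eb with kill⁻ o∈es (c⊑ a∈) k≥2 ea | kill⁻ o∈es (c⊑ b∈) k≥2 eb
      ... | _ , wa | _ , wb = try a∈ b∈ ga gb ne (proj₂ (min-witness wa)) (proj₂ (min-witness wb))

    Conf : List E → Set
    Conf c = Unique c × 3 ≤ length c × length c ≤ k × vol c ≤ length c * d + t ×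
      (∀ ℓ → ℓ < length c → 2 ≤ ℓ → ∀ S → All (_∈ c) S → length S ≡ ℓ → Unique S → suc (ℓ * d + t) ≤ vol S)

    conf-list? : ∀ c → Dec (Conf c)
    conf-list? c = unique? c ×-dec (3 ≤? length c ×-dec (length c ≤? k ×-dec (vol c ≤? length c * d + t ×-dec
      ∀< (λ ℓ → 2 ≤? ℓ →-dec ∀list? (λ S → unique? S →-dec suc (ℓ * d + t) ≤? vol S) c ℓ) (length c))))

    isConf : List E → Bool
    isConf c = ⌊ conf-list? c ⌋

    conf-list : ∀ {c} → isConf c ≡ true → Conf c
    conf-list {c} e with conf-list? c
    ... | yes p = p

    -- A proper sublist either misses R or o and lies in a good list, or contains both and
    -- contradicts the minimality of V unless it is sparse.
    witness-conf : ∀ {A o R V} → Good (R ∷ A) → Good (o ∷ A) → ¬ t ≤ ∣ o ∩ R ∣ → MinWitness A o R V → Conf (R ∷ o ∷ V)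
    witness-conf {A} {o} {R} {V} gR go nk w = R∉ ∷ o∉ ∷ uV w , nonempty V refl , lV w , vV w , mn
      where
      R∈ = edges gR (here refl)
      o∈ = edges go (here refl)
      R≢o : ¬ R ≡ o
      R≢o refl = nk (≤-trans (ℕ.m≤n+m t d) (≤-reflexive (trans (sym (es-size R∈)) (cong ∣_∣ (sym (∩-idem R))))))
      R∉ : All (λ y → ¬ R ≡ y) (o ∷ V)
      R∉ = R≢o ∷ All.tabulate (λ i e → good∉ gR (V⊑ w (subst (_∈ V) (sym e) i)))
      o∉ : All (λ y → ¬ o ≡ y) V
      o∉ = All.tabulate (λ i e → good∉ go (V⊑ w (subst (_∈ V) (sym e) i)))
      nonempty : ∀ W → W ≡ V → 3 ≤ 2 + length V
      nonempty [] refl = ⊥-elim (ℕ.<⇒≱ (sparse-kT o∈ R∈ nk) (vV w))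
      nonempty (_ ∷ _) refl = s≤s (s≤s (s≤s z≤n))
      mn : ∀ ℓ → ℓ < 2 + length V → 2 ≤ ℓ → ∀ S → All (_∈ (R ∷ o ∷ V)) S → length S ≡ ℓ → Unique S → suc (ℓ * d + t) ≤ vol S
      mn ℓ l l2 S S∈ refl uS = cover {R} {o} {V} gR' go' uS (All.lookup S∈) l2 (≤-trans (ℕ.<⇒≤ l) (lV w))
          (λ X s u e → minV w X (λ i → V⊑ w (s i)) u (s≤s⁻¹ (s≤s⁻¹ (≤-trans (s≤s (≤-reflexive (sym e))) l))))
        where
        sub : ∀ {z} → ¬ z ∈ V → Good (z ∷ A) → Good (z ∷ V)
        sub {z} n g = good (All.tabulate (λ i e → n (subst (_∈ V) (sym e) i)) ∷ uV w) (λ { (here refl) → edges g (here refl) ; (there i) → edges g (there (V⊑ w i)) })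
          (λ S u s → free g S u (λ m → up (s m)))
          where
          up : ∀ {x} → x ∈ (z ∷ V) → x ∈ (z ∷ A)
          up (here refl) = here refl
          up (there i) = there (V⊑ w i)
        gR' = sub (λ i → good∉ gR (V⊑ w i)) gR
        go' = sub (λ i → good∉ go (V⊑ w i)) go

    conf-witness : ∀ {A o R} → Good (R ∷ A) → Good (o ∷ A) → conf A o R ≡ true → ∃ λ X → X ⊑ A × length X < k + k + 1 × isConf (R ∷ o ∷ X) ≡ true
    conf-witness {A} {o} {R} gR go e = found (min-witness (proj₂ (proj₂ (proj₂ (⌊⌋-true {d = conf? A o R} (proj₂ both))))))
      where
      both : not (kT o R) ≡ true × ⌊ conf? A o R ⌋ ≡ true
      both = ∧-true e
      nk : ¬ t ≤ ∣ o ∩ R ∣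
      nk = ⌊⌋-false (not-true (proj₁ both))
      found : ∃ (MinWitness A o R) → ∃ λ X → X ⊑ A × length X < k + k + 1 × isConf (R ∷ o ∷ X) ≡ true
      found (V , w) = V , V⊑ w , ≤-trans (s≤s (≤-trans (ℕ.m≤n+m _ 2) (≤-trans (lV w) (ℕ.m≤m+n k k)))) (≤-reflexive (ℕ.+-comm 1 (k + k))) , true! (witness-conf gR go nk w)
        where
        true! : ∀ {c} → Conf c → isConf c ≡ true
        true! {c} p with conf-list? c
        ... | yes _ = refl
        ... | no q = ⊥-elim (q p)

    -- In a minimal dense list of at least three edges every pair is sparse, so its excess is above
    -- t and thus above that of c. For `ctrip`, two dense pairs glued along o span at most 3 d + t
    -- vertices.
    conf-base : ∀ {c o} → Conf c → o ∈ es → Base c o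
    conf-base {c} {o} (cu , l3 , lk , cv , mn) o∈ = record { cu = cu ; cvol = cv
        ; cpair = λ {a} {b} a∈ b∈ ne → ≤-trans (+-monoˡ-≤ (2 * d) cv) (≤-trans (≤-reflexive (ar₁ (length c * d) t (2 * d))) (≤-trans (+-monoˡ-≤ (length c * d) (ℕ.<⇒≤ (two a∈ b∈ ne))) ≤-refl))
        ; ctrip = trip }
      where
      ar₁ : ∀ x t y → x + t + y ≡ y + t + x
      ar₁ = solve-∀
      two : ∀ {a b} → a ∈ c → b ∈ c → ¬ a ≡ b → suc (2 * d + t) ≤ vol (a ∷ b ∷ [])
      two {a} {b} a∈ b∈ ne = mn 2 l3 ≤-refl (a ∷ b ∷ []) (a∈ ∷ b∈ ∷ []) refl ((ne ∷ []) ∷ [] ∷ [])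
      trip : ∀ {a b} → a ∈ c → b ∈ c → ¬ a ≡ b → vol (a ∷ o ∷ []) ≤ 2 * d + t → vol (b ∷ o ∷ []) ≤ 2 * d + t →
          suc (vol (a ∷ b ∷ o ∷ []) + vol c) ≤ suc (length c) * d + t + vol (a ∷ b ∷ [])
      trip {a} {b} a∈ b∈ ne va vb = ≤-trans (s≤s (+-mono-≤ abo cv)) (≤-trans (≤-reflexive (ar (length c) d t)) (+-monoʳ-≤ (suc (length c) * d + t) (two a∈ b∈ ne)))
        where
        ar : ∀ c d t → suc (3 * d + t + (c * d + t)) ≡ suc c * d + t + suc (2 * d + t)
        ar = solve-∀
        abo : vol (a ∷ b ∷ o ∷ []) ≤ 3 * d + t
        abo = +-cancelʳ-≤ (d + t) _ _ (≤-trans (+-monoʳ-≤ (vol (a ∷ b ∷ o ∷ [])) (≤-reflexive (trans (sym (es-size o∈)) (sym (vol-[] o)))))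
          (≤-trans (submod' (a ∷ b ∷ o ∷ []) (a ∷ o ∷ []) (b ∷ o ∷ []) (o ∷ []) (λ { (here refl) → here refl ; (there (here refl)) → there (there (here refl)) ; (there (there (here refl))) → there (here refl) }) there there)
            (≤-trans (+-mono-≤ va vb) (≤-reflexive (ar' d t)))))
          where
          ar' : ∀ d t → 2 * d + t + (2 * d + t) ≡ 3 * d + t + (d + t)
          ar' = solve-∀

    -- The dense lists a, o and b, o overlap in o together with T, which is more than d + t vertices
    -- because T is not inside o. This strictness is why outcomes through T must not enter the
    -- variance.
    pair-base : ∀ {R R' o T} → R ∈ es → R' ∈ es → o ∈ es → ¬ R ≡ R' → ∣ T ∣ ≡ t → T ⊆ R → T ⊆ R' → ¬ T ⊆ o → Base (R ∷ R' ∷ []) o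
    pair-base {R} {R'} {o} {T} R∈ R'∈ o∈ ne sT TR TR' To = record { cu = (ne ∷ []) ∷ [] ∷ []
        ; cvol = kT-dense R'∈ R∈ (≤-trans (≤-reflexive (sym sT)) (p⊆q⇒∣p∣≤∣q∣ (λ m → x∈p∩q⁺ (TR' m , TR m))))
        ; cpair = λ a∈ b∈ n → +-monoˡ-≤ (2 * d) (same a∈ b∈ n) ; ctrip = trip }
      where
      same : ∀ {a b} → a ∈ (R ∷ R' ∷ []) → b ∈ (R ∷ R' ∷ []) → ¬ a ≡ b → vol (R ∷ R' ∷ []) ≤ vol (a ∷ b ∷ [])
      same (here refl) (here refl) n = ⊥-elim (n refl)
      same (here refl) (there (here refl)) n = ≤-refl
      same {a} {b} (there (here refl)) (here refl) n = vol-⊑ {L = R ∷ R' ∷ []} {R' ∷ R ∷ []} λ { (here refl) → there (here refl) ; (there (here refl)) → here refl }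
      same (there (here refl)) (there (here refl)) n = ⊥-elim (n refl)
      T⊆ : ∀ {a} → a ∈ (R ∷ R' ∷ []) → T ⊆ a
      T⊆ (here refl) = TR
      T⊆ (there (here refl)) = TR'
      trip : ∀ {a b} → a ∈ (R ∷ R' ∷ []) → b ∈ (R ∷ R' ∷ []) → ¬ a ≡ b → vol (a ∷ o ∷ []) ≤ 2 * d + t → vol (b ∷ o ∷ []) ≤ 2 * d + t →
          suc (vol (a ∷ b ∷ o ∷ []) + vol (R ∷ R' ∷ [])) ≤ 3 * d + t + vol (a ∷ b ∷ [])
      trip {a} {b} a∈ b∈ n va vb = +-mono-≤ abo (same a∈ b∈ n)
        where
        oT : suc (d + t) ≤ vol (o ∷ T ∷ [])
        oT = ≤-trans (≤-reflexive (cong suc (sym (es-size o∈)))) (≤-trans (p⊂q⇒∣p∣<∣q∣ strict) (≤-reflexive (sym (vol≡ (o ∷ T ∷ [])))))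
          where
          open import Data.Fin.Subset using (_⊂_)
          open import Data.Fin.Subset.Properties using (p⊂q⇒∣p∣<∣q∣) renaming (_∈?_ to _∈ᵥ?_)
          open import Data.Fin.Properties using (any?)
          strict : o ⊂ ⋃ (o ∷ T ∷ [])
          strict with any? (λ x → (x ∈ᵥ? T) ×-dec ¬? (x ∈ᵥ? o))
          ... | yes (x , xT , xo) = (λ m → ⋃⁺ {L = o ∷ T ∷ []} (here refl) m) , x , ⋃⁺ {L = o ∷ T ∷ []} (there (here refl)) xT , xo
          ... | no q = ⊥-elim (To (λ {x} m → dec x m (x ∈ᵥ? o)))
            where
            dec : ∀ x → x ∈ᵥ T → Dec (x ∈ᵥ o) → x ∈ᵥ o
            dec x m (yes p) = p
            dec x m (no r) = ⊥-elim (q (x , m , r))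
        abo : suc (vol (a ∷ b ∷ o ∷ [])) ≤ 3 * d + t
        abo = +-cancelʳ-≤ (d + t) _ _ (≤-trans (≤-trans (≤-reflexive (sym (ℕ.+-suc _ _))) (+-monoʳ-≤ (vol (a ∷ b ∷ o ∷ [])) oT))
          (≤-trans (submod (a ∷ b ∷ o ∷ []) (a ∷ o ∷ []) (b ∷ o ∷ []) (o ∷ T ∷ []) (⋃-⊑ {L = a ∷ b ∷ o ∷ []} {M = a ∷ o ∷ b ∷ o ∷ []} (λ { (here refl) → here refl ; (there (here refl)) → there (there (here refl)) ; (there (there (here refl))) → there (here refl) }))
                (into a∈) (into b∈))
            (≤-trans (+-mono-≤ va vb) (≤-reflexive (ar' d t)))))
          where
          ar' : ∀ d t → 2 * d + t + (2 * d + t) ≡ 3 * d + t + (d + t)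
          ar' = solve-∀
          into : ∀ {a} → a ∈ (R ∷ R' ∷ []) → ⋃ (o ∷ T ∷ []) ⊆ ⋃ (a ∷ o ∷ [])
          into {a} a∈ m with ⋃⁻ (o ∷ T ∷ []) m
          ... | _ , here refl , i = ⋃⁺ {L = a ∷ o ∷ []} (there (here refl)) i
          ... | _ , there (here refl) , i = ⋃⁺ {L = a ∷ o ∷ []} (here refl) (T⊆ a∈ i)

-- Counting subsets and tuples of edges.

module Count where
  open Q
  open Prod
  open Exp using (∑T; ∑T-mono; ∑T-*ˡ)
  open Lists
  open Vol
  open import Data.Rational using (_≤_)
  open import Data.Rational.Properties using (≤-reflexive; ≤-trans)
  open import Data.Nat using (_∸_)
  open import Data.Nat.Combinatorics using (_C_; nCk+nC[k+1]≡[n+1]C[k+1])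
  open import Data.Vec using ([]; _∷_; here; there)
  open import Data.Fin.Subset using (Subset; ∣_∣; ⋃; _⊆_) renaming (_∈_ to _∈ᵥ_)
  open import Data.Fin.Subset.Properties using (drop-∷-⊆; ∣p∣≤n; p⊆q⇒∣p∣≤∣q∣)
  import Data.List.Relation.Unary.Any as Any
  import Data.List.Relation.Unary.Unique.Propositional.Properties as Unique

  private variable
    n : ℕ
    A : Set

  allS : ∀ n → List (Subset n)
  allS zero = [] ∷ []
  allS (suc n) = map (true ∷_) (allS n) ++ map (false ∷_) (allS n)

  ∈-allS : ∀ (p : Subset n) → p ∈ allS n
  ∈-allS [] = Any.here refl
  ∈-allS (true ∷ p) = ∈-++⁺ˡ (∈-map⁺ (true ∷_) (∈-allS p))
  ∈-allS {suc n} (false ∷ p) = ∈-++⁺ʳ (map (true ∷_) (allS n)) (∈-map⁺ (false ∷_) (∈-allS p))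

  allS-unique : ∀ n → Unique (allS n)
  allS-unique zero = [] ∷ []
  allS-unique (suc n) = Unique.++⁺ (Unique.map⁺ inj (allS-unique n)) (Unique.map⁺ inj (allS-unique n)) λ { (i , j) → disj (∈-map⁻ (true ∷_) i) (∈-map⁻ (false ∷_) j) }
    where
    inj : ∀ {b} {p q : Subset n} → _≡_ {A = Subset (suc n)} (b ∷ p) (b ∷ q) → p ≡ q
    inj refl = refl
    disj : ∀ {p} {X : Set} → (∃ λ a → a ∈ allS n × p ≡ true ∷ a) → (∃ λ a → a ∈ allS n × p ≡ false ∷ a) → X
    disj (_ , _ , refl) (_ , _ , ())

  sized : ∀ n → ℕ → List (Subset n)
  sized n s = filter (λ p → ∣ p ∣ ℕ.≟ s) (allS n)

  ∈-sized⁻ : ∀ {s} {p : Subset n} → p ∈ sized n s → ∣ p ∣ ≡ s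
  ∈-sized⁻ {n} {s} m = proj₂ (∈-filter⁻ (λ p → ∣ p ∣ ℕ.≟ s) {xs = allS n} m)

  ∈-sized⁺ : ∀ {s} {p : Subset n} → ∣ p ∣ ≡ s → p ∈ sized n s
  ∈-sized⁺ {n} {s} {p} e = ∈-filter⁺ (λ p → ∣ p ∣ ℕ.≟ s) (∈-allS p) e

  sized-unique : ∀ n s → Unique (sized n s)
  sized-unique n s = Unique.filter⁺ (λ p → ∣ p ∣ ℕ.≟ s) (allS-unique n)

  infix 4 _⊆ᵇ_
  _⊆ᵇ_ : Subset n → Subset n → Bool
  [] ⊆ᵇ [] = true
  true ∷ p ⊆ᵇ b ∷ q = b ∧ (p ⊆ᵇ q)
  false ∷ p ⊆ᵇ b ∷ q = p ⊆ᵇ q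

  ⊆ᵇ⇒⊆ : ∀ {p q : Subset n} → (p ⊆ᵇ q) ≡ true → p ⊆ q
  ⊆ᵇ⇒⊆ {p = true ∷ p} {true ∷ q} e here = here
  ⊆ᵇ⇒⊆ {p = true ∷ p} {true ∷ q} e (there m) = there (⊆ᵇ⇒⊆ e m)
  ⊆ᵇ⇒⊆ {p = false ∷ p} {b ∷ q} e (there m) = there (⊆ᵇ⇒⊆ e m)

  ⊆⇒⊆ᵇ : ∀ {p q : Subset n} → p ⊆ q → (p ⊆ᵇ q) ≡ true
  ⊆⇒⊆ᵇ {p = []} {[]} s = refl
  ⊆⇒⊆ᵇ {p = true ∷ p} {true ∷ q} s = ⊆⇒⊆ᵇ (drop-∷-⊆ s)
  ⊆⇒⊆ᵇ {p = true ∷ p} {false ∷ q} s with s here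
  ... | ()
  ⊆⇒⊆ᵇ {p = false ∷ p} {b ∷ q} s = ⊆⇒⊆ᵇ (drop-∷-⊆ s)

  ∑-filter : ∀ {P : A → Set} (P? : ∀ x → Dec (P x)) xs f → ∑ (filter P? xs) f ≡ ∑ xs (λ x → bool ⌊ P? x ⌋ * f x)
  ∑-filter P? [] f = refl
  ∑-filter P? (x ∷ xs) f with P? x
  ... | yes _ = cong₂ _+_ (sym (*-identityˡ (f x))) (∑-filter P? xs f)
  ... | no _ = trans (∑-filter P? xs f) (trans (sym (+-identityˡ _)) (cong (_+ ∑ xs (λ x → bool ⌊ P? x ⌋ * f x)) (sym (*-zeroˡ (f x)))))

  ∑-allS : ∀ n f → ∑ (allS (suc n)) f ≡ ∑ (allS n) (λ p → f (true ∷ p)) + ∑ (allS n) (λ p → f (false ∷ p))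
  ∑-allS n f = trans (∑-++ (map (true ∷_) (allS n)) _ f) (cong₂ _+_ (∑-map (true ∷_) (allS n) f) (∑-map (false ∷_) (allS n) f))

  is : ∀ {n} → ℕ → Subset n → ℚ
  is s p = bool ⌊ ∣ p ∣ ℕ.≟ s ⌋

  ⌊suc⌋ : ∀ a b → ⌊ suc a ℕ.≟ suc b ⌋ ≡ ⌊ a ℕ.≟ b ⌋
  ⌊suc⌋ a b with a ℕ.≟ b | suc a ℕ.≟ suc b
  ... | yes _ | yes _ = refl
  ... | no _ | no _ = refl
  ... | yes e | no n = ⊥-elim (n (cong suc e))
  ... | no n | yes e = ⊥-elim (n (ℕ.suc-injective e))

  ⌊≠⌋ : ∀ {a b} → ¬ a ≡ b → ⌊ a ℕ.≟ b ⌋ ≡ false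
  ⌊≠⌋ {a} {b} ne with a ℕ.≟ b
  ... | yes e = ⊥-elim (ne e)
  ... | no _ = refl

  pascal : ∀ n k → ι (n C k) + ι (n C suc k) ≡ ι (suc n C suc k)
  pascal n k = trans (sym (ι-+ (n C k) (n C suc k))) (cong ι (nCk+nC[k+1]≡[n+1]C[k+1] n k))

  count-⊇ : ∀ {n} (T : Subset n) j → ∑ (allS n) (λ R → is (∣ T ∣ ℕ.+ j) R * bool (T ⊆ᵇ R)) ≡ ι ((n ∸ ∣ T ∣) C j)
  count-⊇ [] zero = refl-ish
    where refl-ish : 1ℚ * 1ℚ + 0ℚ ≡ ι 1
          refl-ish = solve 0 (𝟙 :* 𝟙 :+ 𝟘 := 𝟙 :+ 𝟘) refl
  count-⊇ [] (suc j) = solve 0 (𝟘 :* 𝟙 :+ 𝟘 := 𝟘) refl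
  count-⊇ {suc n} (true ∷ T) j = trans (∑-allS n _) (trans (cong₂ _+_ (trans (∑-cong (allS n) (λ R → cong (λ b → bool b * bool (T ⊆ᵇ R)) (⌊suc⌋ ∣ R ∣ (∣ T ∣ ℕ.+ j)))) (count-⊇ T j))
     (∑-zero (allS n) (λ R → *-zeroʳ (is (suc (∣ T ∣ ℕ.+ j)) R)))) (+-identityʳ _))
  count-⊇ {suc n} (false ∷ T) j = trans (∑-allS n _) (trans (both j) (cong (λ m → ι (m C j)) (sym (ℕ.+-∸-assoc 1 (∣p∣≤n T)))))
    where
    both : ∀ j → ∑ (allS n) (λ R → bool ⌊ suc ∣ R ∣ ℕ.≟ ∣ T ∣ ℕ.+ j ⌋ * bool (T ⊆ᵇ R)) + ∑ (allS n) (λ R → is (∣ T ∣ ℕ.+ j) R * bool (T ⊆ᵇ R)) ≡ ι (suc (n ∸ ∣ T ∣) C j)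
    both zero = trans (cong₂ _+_ (∑-zero (allS n) none) (count-⊇ T 0)) (trans (+-identityˡ _) (cong ι (trans (nC0 (n ∸ ∣ T ∣)) (sym (nC0 (suc (n ∸ ∣ T ∣)))))))
      where
      nC0 : ∀ m → m C 0 ≡ 1
      nC0 m = refl
      none : ∀ R → bool ⌊ suc ∣ R ∣ ℕ.≟ ∣ T ∣ ℕ.+ 0 ⌋ * bool (T ⊆ᵇ R) ≡ 0ℚ
      none R with T ⊆ᵇ R in e
      ... | false = *-zeroʳ _
      ... | true = trans (cong (λ b → bool b * 1ℚ) (⌊≠⌋ λ q → ℕ.<⇒≱ (ℕ.≤-reflexive q) (ℕ.≤-trans (ℕ.≤-reflexive (ℕ.+-identityʳ ∣ T ∣)) (p⊆q⇒∣p∣≤∣q∣ {p = T} {q = R} (⊆ᵇ⇒⊆ {p = T} {q = R} e))))) (*-zeroˡ 1ℚ)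
    both (suc j) = trans (cong₂ _+_ (trans (∑-cong (allS n) (λ R → cong (λ b → bool b * bool (T ⊆ᵇ R)) (trans (cong (λ z → ⌊ suc ∣ R ∣ ℕ.≟ z ⌋) (ℕ.+-suc ∣ T ∣ j)) (⌊suc⌋ ∣ R ∣ (∣ T ∣ ℕ.+ j))))) (count-⊇ T j)) (count-⊇ T (suc j)))
      (pascal (n ∸ ∣ T ∣) j)

  count-⊆ : ∀ {n} (R : Subset n) s → ∑ (allS n) (λ T → is s T * bool (T ⊆ᵇ R)) ≡ ι (∣ R ∣ C s)
  count-⊆ [] zero = solve 0 (𝟙 :* 𝟙 :+ 𝟘 := 𝟙 :+ 𝟘) refl
  count-⊆ [] (suc s) = solve 0 (𝟘 :* 𝟙 :+ 𝟘 := 𝟘) refl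
  count-⊆ {suc n} (false ∷ R) s = trans (∑-allS n _) (trans (cong₂ _+_ (∑-zero (allS n) (λ T → *-zeroʳ _)) (count-⊆ R s)) (+-identityˡ _))
  count-⊆ {suc n} (true ∷ R) zero = trans (∑-allS n _) (trans (cong₂ _+_ (∑-zero (allS n) (λ T → *-zeroˡ (bool (T ⊆ᵇ R)))) (count-⊆ R 0)) (+-identityˡ _))
  count-⊆ {suc n} (true ∷ R) (suc s) = trans (∑-allS n _) (trans (cong₂ _+_ (trans (∑-cong (allS n) (λ T → cong (λ b → bool b * bool (T ⊆ᵇ R)) (⌊suc⌋ ∣ T ∣ s))) (count-⊆ R s)) (count-⊆ R (suc s))) (pascal ∣ R ∣ s))

  count-size : ∀ n s → ∑ (allS n) (is s) ≡ ι (n C s)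
  count-size zero zero = refl
  count-size zero (suc s) = +-identityˡ 0ℚ
  count-size (suc n) zero = trans (∑-allS n _) (trans (cong₂ _+_ (∑-zero (allS n) (λ T → refl)) (count-size n 0)) (+-identityˡ _))
  count-size (suc n) (suc s) = trans (∑-allS n _) (trans (cong₂ _+_ (trans (∑-cong (allS n) (λ T → cong bool (⌊suc⌋ ∣ T ∣ s))) (count-size n s)) (count-size n (suc s))) (pascal n s))

  length-sized : ∀ n s → ι (length (sized n s)) ≡ ι (n C s)
  length-sized n s = trans (sym (trans (∑-const (sized n s) 1ℚ) (*-identityʳ _))) (trans (∑-filter (λ p → ∣ p ∣ ℕ.≟ s) (allS n) (λ _ → 1ℚ)) (trans (∑-cong (allS n) (λ p → *-identityʳ _)) (count-size n s)))

  deg-sized : ∀ {n} (T : Subset n) j → ∑ (sized n (∣ T ∣ ℕ.+ j)) (λ R → bool (T ⊆ᵇ R)) ≡ ι ((n ∸ ∣ T ∣) C j)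
  deg-sized {n} T j = trans (∑-filter (λ p → ∣ p ∣ ℕ.≟ (∣ T ∣ ℕ.+ j)) (allS n) _) (count-⊇ T j)

  inc-sized : ∀ {n} (R : Subset n) s → ∑ (sized n s) (λ T → bool (T ⊆ᵇ R)) ≡ ι (∣ R ∣ C s)
  inc-sized {n} R s = trans (∑-filter (λ p → ∣ p ∣ ℕ.≟ s) (allS n) _) (count-⊆ R s)

  count-below : ∀ {n} (U : Subset n) → ∑ (allS n) (λ T → bool (T ⊆ᵇ U)) ≡ ι (2 ℕ.^ ∣ U ∣)
  count-below [] = solve 0 (𝟙 :+ 𝟘 := 𝟙 :+ 𝟘) refl
  count-below {suc n} (true ∷ U) = trans (∑-allS n _) (trans (cong₂ _+_ (count-below U) (count-below U)) (trans (sym (ι-+ (2 ℕ.^ ∣ U ∣) _)) (cong (λ z → ι (2 ℕ.^ ∣ U ∣ ℕ.+ z)) (sym (ℕ.+-identityʳ (2 ℕ.^ ∣ U ∣))))))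
  count-below {suc n} (false ∷ U) = trans (∑-allS n _) (trans (cong₂ _+_ (∑-zero (allS n) (λ T → refl)) (count-below U)) (+-identityˡ _))

  ⌊≤⌋ : ∀ a b → ⌊ suc a ℕ.≤? suc b ⌋ ≡ ⌊ a ℕ.≤? b ⌋
  ⌊≤⌋ a b with a ℕ.≤? b | suc a ℕ.≤? suc b
  ... | yes _ | yes _ = refl
  ... | no _ | no _ = refl
  ... | yes e | no n = ⊥-elim (n (ℕ.s≤s e))
  ... | no n | yes e = ⊥-elim (n (ℕ.s≤s⁻¹ e))

  count-small : ∀ n s → ∑ (allS n) (λ p → bool ⌊ ∣ p ∣ ℕ.≤? s ⌋) ≤ ι (suc n ℕ.^ s)
  count-small zero zero = ≤-reflexive refl
  count-small zero (suc s) = ≤-reflexive (cong ι (sym (trans (ℕ.+-identityʳ _) (one^ s))))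
    where one^ : ∀ s → 1 ℕ.^ s ≡ 1
          one^ zero = refl
          one^ (suc s) = trans (ℕ.+-identityʳ _) (one^ s)
  count-small (suc n) zero = ≤-trans (≤-reflexive (trans (∑-allS n _) (trans (cong (_+ ∑ (allS n) (λ p → bool ⌊ ∣ p ∣ ℕ.≤? 0 ⌋)) (∑-zero (allS n) (λ p → refl))) (+-identityˡ _)))) (count-small n 0)
  count-small (suc n) (suc s) = ≤-trans (≤-reflexive (trans (∑-allS n _) (cong (_+ ∑ (allS n) (λ p → bool ⌊ ∣ p ∣ ℕ.≤? suc s ⌋)) (∑-cong (allS n) (λ p → cong bool (⌊≤⌋ ∣ p ∣ s))))))
    (≤-trans (+-mono-≤ (count-small n s) (count-small n (suc s))) (≤-trans (≤-reflexive (sym (ι-+ (suc n ℕ.^ s) _)))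
      (ι-mono (ℕ.*-monoʳ-≤ (suc (suc n)) (ℕ.^-monoˡ-≤ s (ℕ.n≤1+n (suc n)))))))

  ∑T-∏ : ∀ (es : List A) ℓ f → ∑T es ℓ (λ L → ∏ L f) ≡ ∑ es f ^ ℓ
  ∑T-∏ es zero f = refl
  ∑T-∏ es (suc ℓ) f = trans (∑-cong es (λ x → trans (∑T-*ˡ es ℓ (f x) (λ L → ∏ L f)) (cong (f x *_) (∑T-∏ es ℓ f)))) (∑-*ʳ es (∑ es f ^ ℓ) f)

  ∑T-∑ : ∀ {B : Set} (es : List A) ℓ (xs : List B) (f : B → List A → ℚ) → ∑T es ℓ (λ L → ∑ xs (λ x → f x L)) ≡ ∑ xs (λ x → ∑T es ℓ (f x))
  ∑T-∑ es zero xs f = refl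
  ∑T-∑ es (suc ℓ) xs f = trans (∑-cong es (λ y → ∑T-∑ es ℓ xs (λ x L → f x (y ∷ L)))) (∑-swap es xs _)

  ∑-filter≤ : ∀ {P : A → Set} (P? : ∀ x → Dec (P x)) xs {f} → (∀ x → 0ℚ ≤ f x) → ∑ (filter P? xs) f ≤ ∑ xs f
  ∑-filter≤ P? xs {f} nn = ≤-trans (≤-reflexive (∑-filter P? xs f)) (∑-mono xs (λ x → ≤-trans (*-monoʳ (nn x) (bool-≤1 ⌊ P? x ⌋)) (≤-reflexive (*-identityˡ (f x)))))

  -- Choose the union U first, in at most (n + 1)^s ways, and then every edge among the at most 2^s
  -- subsets of U.
  count-tuples : ∀ n r ℓ s → ∑T (sized n r) ℓ (λ L → bool ⌊ vol L ℕ.≤? s ⌋) ≤ ι (suc n ℕ.^ s) * ι (2 ℕ.^ s) ^ ℓ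
  count-tuples n r ℓ s = ≤-trans (∑T-mono es ℓ (λ L _ _ → step L)) (≤-trans (≤-reflexive (∑T-∑ es ℓ (allS n) (λ U L → small U * ∏ L (λ x → bool (x ⊆ᵇ U)))))
      (≤-trans (∑-mono (allS n) perU) (≤-trans (≤-reflexive (∑-*ʳ (allS n) (ι (2 ℕ.^ s) ^ ℓ) small)) (*-monoʳ (^-nn (ι-nn (2 ℕ.^ s)) ℓ) (count-small n s)))))
    where
    es = sized n r
    small : Subset n → ℚ
    small U = bool ⌊ ∣ U ∣ ℕ.≤? s ⌋
    nn : ∀ L U → 0ℚ ≤ small U * ∏ L (λ x → bool (x ⊆ᵇ U))
    nn L U = *-nn (bool-nn ⌊ ∣ U ∣ ℕ.≤? s ⌋) (∏-nn L (λ x → bool-nn (x ⊆ᵇ U)))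
    all1 : ∀ L U → (∀ x → x ∈ L → x ⊆ U) → ∏ L (λ x → bool (x ⊆ᵇ U)) ≡ 1ℚ
    all1 [] U h = refl
    all1 (x ∷ L) U h = trans (cong₂ _*_ (cong bool (⊆⇒⊆ᵇ (h x (Any.here refl)))) (all1 L U (λ y m → h y (Any.there m)))) (*-identityˡ 1ℚ)
    step : ∀ L → bool ⌊ vol L ℕ.≤? s ⌋ ≤ ∑ (allS n) (λ U → small U * ∏ L (λ x → bool (x ⊆ᵇ U)))
    step L = ≤-trans (≤-reflexive (trans (cong (λ v → bool ⌊ v ℕ.≤? s ⌋) (vol≡ L)) (trans (sym (*-identityʳ _)) (cong (small (⋃ L) *_) (sym (all1 L (⋃ L) (λ x x∈ m → ⋃⁺ x∈ m)))))))
      (∑-single (nn L) (∈-allS (⋃ L)))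
    perU : ∀ U → ∑T es ℓ (λ L → small U * ∏ L (λ x → bool (x ⊆ᵇ U))) ≤ small U * ι (2 ℕ.^ s) ^ ℓ
    perU U with ∣ U ∣ ℕ.≤? s
    ... | no _ = ≤-reflexive (trans (∑T-*ˡ es ℓ 0ℚ (λ L → ∏ L (λ x → bool (x ⊆ᵇ U)))) (trans (*-zeroˡ _) (sym (*-zeroˡ (ι (2 ℕ.^ s) ^ ℓ)))))
    ... | yes p = ≤-trans (≤-reflexive (∑T-*ˡ es ℓ 1ℚ (λ L → ∏ L (λ x → bool (x ⊆ᵇ U))))) (*-monoˡ 0≤1 (≤-trans (≤-reflexive (∑T-∏ es ℓ (λ x → bool (x ⊆ᵇ U))))
        (^-mono (∑-nn es (λ x → bool-nn (x ⊆ᵇ U))) (≤-trans (∑-filter≤ (λ p → ∣ p ∣ ℕ.≟ r) (allS n) (λ x → bool-nn (x ⊆ᵇ U))) (≤-trans (≤-reflexive (count-below U)) (ι-mono (ℕ.^-monoʳ-≤ 2 p)))) ℓ)))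

-- Inverses, exponential growth and binomial coefficients.

module Arith where
  open Q
  open import Data.Rational as ℚ using (mkℚ; _≤_; _<_; *≤*; positive; NonZero)
  import Data.Rational.Properties as ℚ
  open import Data.Rational.Properties using (≤-refl; ≤-reflexive; ≤-trans; <⇒≤; <-≤-trans)
  import Data.Rational.Unnormalised as ℚᵘ
  import Data.Rational.Unnormalised.Properties as ℚᵘ
  import Data.Integer as ℤ
  open import Data.Integer using (ℤ; -[1+_]; +≤+) renaming (+_ to pos)
  import Data.Integer.Properties as ℤ
  open import Data.Nat using (_∸_; _!)
  open import Data.Nat.Combinatorics using (_C_; nCk+nC[k+1]≡[n+1]C[k+1])
  import Data.Nat.Coprimality as Coprime

  private variable
    a b x y : ℚ

  natℚ : ℕ → ℚ
  natℚ n = mkℚ (pos n) 0 (Coprime.sym (Coprime.1-coprimeTo n))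

  ι≡ : ∀ n → ι n ≡ natℚ n
  ι≡ zero = refl
  ι≡ (suc n) = trans (cong (1ℚ +_) (ι≡ n)) (trans (+≡ 1ℚ (natℚ n)) (ℚ.toℚᵘ-injective (ℚᵘ.≃-trans (ℚ.toℚᵘ-homo-+ 1ℚ (natℚ n)) (ℚᵘ.*≡* eq))))
    where
    eq : (pos 1 ℤ.* pos 1 ℤ.+ pos n ℤ.* pos 1) ℤ.* pos 1 ≡ pos (suc n) ℤ.* pos 1
    eq = cong (λ z → (pos 1 ℤ.+ z) ℤ.* pos 1) (ℤ.*-identityʳ (pos n))

  archimedes : ∀ p → ∃ λ n → p ≤ ι n
  archimedes (mkℚ (pos m) d c) = m , ≤-trans (*≤* (num≤ m d)) (≤-reflexive (sym (ι≡ m)))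
    where
    num≤ : ∀ m d → pos m ℤ.* pos 1 ℤ.≤ pos m ℤ.* pos (suc d)
    num≤ m d = ℤ.*-monoˡ-≤-nonNeg (pos m) (+≤+ (ℕ.s≤s ℕ.z≤n))
  archimedes (mkℚ -[1+ m ] d c) = 0 , *≤* ℤ.-≤+

  0<1 : 0ℚ < 1ℚ
  0<1 = ℚ.positive⁻¹ 1ℚ

  0<ι : ∀ n → 0ℚ < ι (suc n)
  0<ι n = <-≤-trans 0<1 (≤-by (ι-nn n) refl)

  reciprocal : 0ℚ < a → ∃ λ b → 0ℚ ≤ b × a * b ≡ 1ℚ
  reciprocal {a} p = (ℚ.1/ a) , <⇒≤ (ℚ.positive⁻¹ (ℚ.1/ a) {{ℚ.1/pos⇒pos a}}) , trans (*≡ a _) (ℚ.*-inverseʳ a)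
    where
    instance
      a-pos : ℚ.Positive a
      a-pos = positive p
      nz : NonZero a
      nz = ℚ.pos⇒nonZero a

  opaque
    inv : ℕ → ℚ
    inv zero = 0ℚ
    inv (suc n) = proj₁ (reciprocal (0<ι n))

    inv-nn : ∀ n → 0ℚ ≤ inv n
    inv-nn zero = ≤-refl
    inv-nn (suc n) = proj₁ (proj₂ (reciprocal (0<ι n)))

    inv* : ∀ {n} → 1 ℕ.≤ n → ι n * inv n ≡ 1ℚ
    inv* {suc n} _ = proj₂ (proj₂ (reciprocal (0<ι n)))

  *-cancelˡ-≤ : 0ℚ ≤ b → a * b ≡ 1ℚ → a * x ≤ a * y → x ≤ y
  *-cancelˡ-≤ {b} {a} {x} {y} b≥0 e l = subst₂ _≤_ (c x) (c y) (*-monoˡ b≥0 l)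
    where c : ∀ z → b * (a * z) ≡ z
          c z = trans (solve 3 (λ a b z → b :* (a :* z) := a :* b :* z) refl a b z) (trans (cong (_* z) e) (*-identityˡ z))

  ι-cancel : ∀ {m n} → ι m ≤ ι n → m ℕ.≤ n
  ι-cancel {m} {n} l with m ℕ.≤? n
  ... | yes p = p
  ... | no p = ⊥-elim (<⇒≱ lt l)
    where
    lt : ι n < ι m
    lt = <-≤-trans (subst₂ _<_ (trans (sym (+≡ (ι n) 0ℚ)) (+-identityʳ (ι n))) (trans (sym (+≡ (ι n) 1ℚ)) (+-comm (ι n) 1ℚ)) (ℚ.+-monoʳ-< (ι n) 0<1)) (ι-mono (ℕ.≰⇒> p))

  inv-≤ : ∀ {n} → 1 ℕ.≤ n → a ≤ ι n * b → inv n * a ≤ b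
  inv-≤ {a} {b} {n} p l = ≤-trans (*-monoˡ (inv-nn n) l) (≤-reflexive (trans (sym (*-assoc (inv n) (ι n) b)) (trans (cong (_* b) (trans (*-comm (inv n) (ι n)) (inv* p))) (*-identityˡ b))))

  inv-≤1 : ∀ {n} → 1 ℕ.≤ n → inv n ≤ 1ℚ
  inv-≤1 {n} p = ≤-trans (≤-reflexive (sym (*-identityʳ (inv n)))) (inv-≤ p (≤-trans (≤-trans (≤-reflexive (sym ι1)) (ι-mono p)) (≤-reflexive (sym (*-identityʳ (ι n))))))

  ^-growth : ∀ j → 0ℚ ≤ y → (1ℚ + y) ^ j * (1ℚ - ι j * y) ≤ 1ℚ
  ^-growth {y} zero p = ≤-reflexive (solve 1 (λ y → 𝟙 :* (𝟙 :- 𝟘 :* y) := 𝟙) refl y)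
  ^-growth {y} (suc j) p = ≤-trans (diff (*-nn (^-nn (+-nn 0≤1 p) j) (*-nn (ι-nn (suc j)) (sq-nn y)))
     (solve 3 (λ y x m → x :* (𝟙 :- m :* y) :- (𝟙 :+ y) :* x :* (𝟙 :- (𝟙 :+ m) :* y) := x :* ((𝟙 :+ m) :* (y :* y))) refl y ((1ℚ + y) ^ j) (ι j))) (^-growth j p)

  ½ : ℚ
  ½ = ℚ.½

  ^-*-exp : ∀ a m n → (a ^ m) ^ n ≡ a ^ (n ℕ.* m)
  ^-*-exp a m zero = refl
  ^-*-exp a m (suc n) = trans (cong (a ^ m *_) (^-*-exp a m n)) (sym (^-+ a m (n ℕ.* m)))

  1+≤^ : ∀ j → 0ℚ ≤ y → 1ℚ + ι j * y ≤ (1ℚ + y) ^ j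
  1+≤^ {y} zero p = ≤-reflexive (solve 1 (λ y → 𝟙 :+ 𝟘 :* y := 𝟙) refl y)
  1+≤^ {y} (suc j) p = ≤-trans (diff (*-nn (ι-nn j) (sq-nn y)) (solve 2 (λ y m → (𝟙 :+ y) :* (𝟙 :+ m :* y) :- (𝟙 :+ (𝟙 :+ m) :* y) := m :* (y :* y)) refl y (ι j)))
    (*-monoˡ (+-nn 0≤1 p) (1+≤^ j p))

  -- Substitute for an exponential bound. With z = y / 2 one has I z ≤ 1/2 and hence (1 + z)^I ≤ 2,
  -- while 1 + a y ≤ (1 + z)^(2 a) by Bernoulli's inequality.
  exp-bound : ∀ a I → 0ℚ ≤ y → ι I * y ≤ 1ℚ → (1ℚ + ι a * y) ^ I ≤ ι (2 ℕ.^ (2 ℕ.* a))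
  exp-bound {y} a I p q = ≤-trans (^-mono (+-nn 0≤1 (*-nn (ι-nn a) p)) base I)
      (≤-trans (≤-reflexive (trans (^-*-exp (1ℚ + z) (2 ℕ.* a) I) (trans (cong ((1ℚ + z) ^_) (ℕ.*-comm I (2 ℕ.* a))) (sym (^-*-exp (1ℚ + z) I (2 ℕ.* a))))))
        (≤-trans (^-mono (^-nn (+-nn 0≤1 z≥0) I) two (2 ℕ.* a)) (≤-reflexive (sym (ι-^ 2 (2 ℕ.* a))))))
    where
    z = ½ * y
    z≥0 : 0ℚ ≤ z
    z≥0 = *-nn (<⇒≤ (ℚ.positive⁻¹ ½)) p
    half : ι I * z ≤ ½
    half = ≤-trans (≤-reflexive (solve 3 (λ i h y → i :* (h :* y) := h :* (i :* y)) refl (ι I) ½ y)) (≤-trans (*-monoˡ (<⇒≤ (ℚ.positive⁻¹ ½)) q) (≤-reflexive (*-identityʳ ½)))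
    base : 1ℚ + ι a * y ≤ (1ℚ + z) ^ (2 ℕ.* a)
    base = ≤-trans (≤-reflexive (trans (solve 2 (λ m y → 𝟙 :+ m :* y := 𝟙 :+ (con ½ :+ con ½) :* m :* y) refl (ι a) y) (trans (solve 2 (λ m y → 𝟙 :+ (con ½ :+ con ½) :* m :* y := 𝟙 :+ (𝟙 :+ (𝟙 :+ 𝟘)) :* m :* (con ½ :* y)) refl (ι a) y) (cong (λ w → 1ℚ + w * z) (sym (ι-* 2 a)))))) (1+≤^ (2 ℕ.* a) z≥0)
    two : (1ℚ + z) ^ I ≤ ι 2
    two = *-cancelˡ-≤ {b = ι 2} {a = ½} (ι-nn 2) refl' (≤-trans (≤-trans (≤-trans (≤-reflexive (*-comm ½ ((1ℚ + z) ^ I))) (*-monoˡ (^-nn (+-nn 0≤1 z≥0) I)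
         (≤-trans (≤-reflexive (solve 0 (con ½ := 𝟙 :- con ½) refl)) (+-monoʳ-≤ 1ℚ (neg-antimono half))))) (^-growth I z≥0)) (≤-reflexive (sym refl')))
      where
      refl' : ½ * ι 2 ≡ 1ℚ
      refl' = solve 0 (con ½ :* (𝟙 :+ (𝟙 :+ 𝟘)) := 𝟙) refl

  C-absorb : ∀ n k → suc k ℕ.* (suc n C suc k) ≡ suc n ℕ.* (n C k)
  C-absorb zero zero = refl
  C-absorb zero (suc k) = ℕ.*-zeroʳ (suc (suc k))
  C-absorb (suc n) zero = trans (ℕ.*-identityˡ _) (trans (sym (nCk+nC[k+1]≡[n+1]C[k+1] (suc n) 0)) (trans (cong suc (trans (sym (ℕ.*-identityˡ _)) (C-absorb n 0))) refl))
  C-absorb (suc n) (suc k) = begin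
    suc (suc k) ℕ.* (suc (suc n) C suc (suc k)) ≡⟨ cong (suc (suc k) ℕ.*_) (sym (nCk+nC[k+1]≡[n+1]C[k+1] (suc n) (suc k))) ⟩
    suc (suc k) ℕ.* ((suc n C suc k) ℕ.+ (suc n C suc (suc k))) ≡⟨ ℕ.*-distribˡ-+ (suc (suc k)) (suc n C suc k) _ ⟩
    suc (suc k) ℕ.* (suc n C suc k) ℕ.+ suc (suc k) ℕ.* (suc n C suc (suc k)) ≡⟨ cong (suc (suc k) ℕ.* (suc n C suc k) ℕ.+_) (C-absorb n (suc k)) ⟩
    (suc n C suc k) ℕ.+ suc k ℕ.* (suc n C suc k) ℕ.+ suc n ℕ.* (n C suc k) ≡⟨ cong (λ z → (suc n C suc k) ℕ.+ z ℕ.+ suc n ℕ.* (n C suc k)) (C-absorb n k) ⟩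
    (suc n C suc k) ℕ.+ suc n ℕ.* (n C k) ℕ.+ suc n ℕ.* (n C suc k) ≡⟨ trans (ℕ.+-assoc (suc n C suc k) _ _) (cong ((suc n C suc k) ℕ.+_) (sym (ℕ.*-distribˡ-+ (suc n) (n C k) _))) ⟩
    (suc n C suc k) ℕ.+ suc n ℕ.* ((n C k) ℕ.+ (n C suc k)) ≡⟨ cong (λ z → (suc n C suc k) ℕ.+ suc n ℕ.* z) (nCk+nC[k+1]≡[n+1]C[k+1] n k) ⟩
    suc (suc n) ℕ.* (suc n C suc k) ∎
    where open ≡-Reasoning

  C-lower : ∀ n k → (n ∸ k) ℕ.^ k ℕ.≤ k ! ℕ.* (n C k)
  C-lower n zero = ℕ.≤-refl
  C-lower zero (suc k) = ℕ.z≤n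
  C-lower (suc n) (suc k) = ℕ.≤-trans (ℕ.*-mono-≤ (ℕ.≤-trans (ℕ.m∸n≤m n k) (ℕ.n≤1+n n)) (C-lower n k))
      (ℕ.≤-reflexive (trans (ar (suc n) (k !) (n C k)) (trans (cong (k ! ℕ.*_) (sym (C-absorb n k))) (ar' (k !) (suc k) (suc n C suc k)))))
    where
    ar : ∀ a b c → a ℕ.* (b ℕ.* c) ≡ b ℕ.* (a ℕ.* c)
    ar = solve-∀
    ar' : ∀ a b c → a ℕ.* (b ℕ.* c) ≡ b ℕ.* a ℕ.* c
    ar' = solve-∀

  C-upper : ∀ n k → k ! ℕ.* (n C k) ℕ.≤ n ℕ.^ k
  C-upper n zero = ℕ.≤-refl
  C-upper zero (suc k) = ℕ.≤-reflexive (ℕ.*-zeroʳ (suc k !))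
  C-upper (suc n) (suc k) = ℕ.≤-trans (ℕ.≤-reflexive (trans (sym (ar' (k !) (suc k) (suc n C suc k))) (trans (cong (k ! ℕ.*_) (C-absorb n k)) (sym (ar (suc n) (k !) (n C k))))))
      (ℕ.*-monoʳ-≤ (suc n) (ℕ.≤-trans (C-upper n k) (ℕ.^-monoˡ-≤ k (ℕ.n≤1+n n))))
    where
    ar : ∀ a b c → a ℕ.* (b ℕ.* c) ≡ b ℕ.* (a ℕ.* c)
    ar = solve-∀
    ar' : ∀ a b c → a ℕ.* (b ℕ.* c) ≡ b ℕ.* a ℕ.* c
    ar' = solve-∀

  -- Each factor n - i - j is at least (n + 1) / 2. This gives the lower bounds of order n^d for D
  -- and n^r for N.
  C-order : ∀ n i j → suc (2 ℕ.* (i ℕ.+ j)) ℕ.≤ n → suc n ℕ.^ j ℕ.≤ 2 ℕ.^ j ℕ.* j ! ℕ.* ((n ∸ i) C j)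
  C-order n i j l = ℕ.≤-trans (ℕ.^-monoˡ-≤ j base) (ℕ.≤-trans (ℕ.≤-reflexive (^-distrib 2 (n ∸ i ∸ j) j))
     (ℕ.≤-trans (ℕ.*-monoʳ-≤ (2 ℕ.^ j) (C-lower (n ∸ i) j)) (ℕ.≤-reflexive (sym (ℕ.*-assoc (2 ℕ.^ j) (j !) _)))))
    where
    ^-distrib : ∀ a b j → (a ℕ.* b) ℕ.^ j ≡ a ℕ.^ j ℕ.* b ℕ.^ j
    ^-distrib a b zero = refl
    ^-distrib a b (suc j) = trans (cong (a ℕ.* b ℕ.*_) (^-distrib a b j)) (ar a b (a ℕ.^ j) (b ℕ.^ j))
      where ar : ∀ a b x y → a ℕ.* b ℕ.* (x ℕ.* y) ≡ a ℕ.* x ℕ.* (b ℕ.* y)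
            ar = solve-∀
    m = n ∸ (i ℕ.+ j)
    m+ : m ℕ.+ (i ℕ.+ j) ≡ n
    m+ = ℕ.m∸n+n≡m (ℕ.≤-trans (ℕ.m≤m+n (i ℕ.+ j) (i ℕ.+ j ℕ.+ 0)) (ℕ.≤-trans (ℕ.n≤1+n _) l))
    base : suc n ℕ.≤ 2 ℕ.* (n ∸ i ∸ j)
    base = ℕ.≤-trans (ℕ.+-cancelʳ-≤ (suc (2 ℕ.* (i ℕ.+ j))) _ _ (ℕ.≤-trans (ℕ.+-monoʳ-≤ (suc n) l) (ℕ.≤-reflexive (trans (cong (λ z → suc z ℕ.+ z) (sym m+)) (ar m (i ℕ.+ j))))))
      (ℕ.≤-reflexive (cong (2 ℕ.*_) (sym (ℕ.∸-+-assoc n i j))))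
      where
      ar : ∀ m s → suc (m ℕ.+ s) ℕ.+ (m ℕ.+ s) ≡ 2 ℕ.* m ℕ.+ suc (2 ℕ.* s)
      ar = solve-∀

-- The parameters of the process.

module Lower where
  open Q
  open Prod
  open Proc
  open Exp
  open Omega
  open Phi
  open Greedy
  open Lists using (module Decide)
  open Vol
  open Count
  open Arith
  open import Data.Rational using (_≤_)
  open import Data.Rational.Properties using (≤-refl; ≤-reflexive; ≤-trans; <⇒≤; positive⁻¹)
  open import Data.Nat using (_∸_)
  open import Data.Nat.Combinatorics using (_C_)
  open import Data.Vec using ([]; _∷_; here; there)
  open import Data.Fin.Subset using (Subset; ∣_∣; _∩_; _⊆_)
  open import Data.Fin.Subset.Properties using (p⊆q⇒∣p∣≤∣q∣; x∈p∩q⁺; p∩q⊆p; p∩q⊆q)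

  private variable
    A : Set

  ⌊⌋-yes : ∀ {P : Set} {d : Dec P} → P → ⌊ d ⌋ ≡ true
  ⌊⌋-yes {d = yes _} _ = refl
  ⌊⌋-yes {d = no q} p = ⊥-elim (q p)

  ∧-intro : ∀ {x y} → x ≡ true → y ≡ true → x ∧ y ≡ true
  ∧-intro refl refl = refl

  one-∈ : ∀ (k : A → Bool) xs → one k xs ≡ true → ∃ λ x → x ∈ xs × k x ≡ true
  one-∈ k (x ∷ xs) e with k x in kx
  ... | true = x , here refl , kx
  ... | false with one-∈ k xs e
  ...   | y , m , ky = y , there m , ky

  two-∈ : ∀ (k : A → Bool) xs → Unique xs → two k xs ≡ true → ∃ λ x → ∃ λ y → x ∈ xs × y ∈ xs × (¬ x ≡ y) × k x ≡ true × k y ≡ true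
  two-∈ k (x ∷ xs) (x∉ ∷ u) e with k x ∧ one k xs in f
  ... | true with one-∈ k xs (proj₂ (∧-true {k x} f))
  ...   | y , m , ky = x , y , here refl , there m , All.lookup x∉ m , proj₁ (∧-true {k x} f) , ky
  two-∈ k (x ∷ xs) (x∉ ∷ u) e | false with two-∈ k xs u e
  ...   | a , b , a∈ , b∈ , r = a , b , there a∈ , there b∈ , r

  any-∈ : ∀ (f : A → Bool) xs → any f xs ≡ true → ∃ λ x → x ∈ xs × f x ≡ true
  any-∈ f (x ∷ xs) e with f x in fx
  ... | true = x , here refl , fx
  ... | false with any-∈ f xs e
  ...   | y , m , fy = y , there m , fy

  sized-below : ∀ {n} (p : Subset n) t → t ℕ.≤ ∣ p ∣ → ∃ λ T → ∣ T ∣ ≡ t × T ⊆ p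
  sized-below [] zero l = [] , refl , λ m → m
  sized-below (true ∷ p) zero l with sized-below p 0 ℕ.z≤n
  ... | T , e , s = false ∷ T , e , λ { (there m) → there (s m) }
  sized-below (true ∷ p) (suc t) (ℕ.s≤s l) with sized-below p t l
  ... | T , e , s = true ∷ T , cong suc e , λ { here → here ; (there m) → there (s m) }
  sized-below (false ∷ p) t l with sized-below p t l
  ... | T , e , s = false ∷ T , e , λ { (there m) → there (s m) }

  module Instance (n d t k : ℕ) (d≥1 : 1 ℕ.≤ d) (k≥2 : 2 ℕ.≤ k) (p cp L : ℕ) (cp≥1 : 1 ℕ.≤ cp) (L≥ : suc p ℕ.≤ L)
    (N≥1 : 1 ℕ.≤ n C (d ℕ.+ t)) (D≥1 : 1 ℕ.≤ (n ∸ t) C d) where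

    es ps : List (Subset n)
    es = sized n (d ℕ.+ t)
    ps = sized n t

    open Geo.Geometry n d t k es ∈-sized⁻ d≥1

    -- The risk from shared t-sets totals I β = q p, so m / 2 = `cap` + I β makes the final reserve
    -- h equal to 1/2 and K = 2^m. As ρ ≤ 1 / I, the factor L in `I` keeps ρ K N, and with it every
    -- death probability, below 1 / L.
    N₀ D₀ q₀ m K₀ I : ℕ
    N₀ = n C (d ℕ.+ t)
    D₀ = (n ∸ t) C d
    q₀ = (d ℕ.+ t) C t
    m = 2 ℕ.* (cp ℕ.+ q₀ ℕ.* p)
    K₀ = 2 ℕ.^ m
    I = L ℕ.* (K₀ ℕ.* N₀)

    K₀≥1 : 1 ℕ.≤ K₀
    K₀≥1 = ℕ.m^n>0 2 m

    L≥1 : 1 ℕ.≤ L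
    L≥1 = ℕ.≤-trans (ℕ.s≤s ℕ.z≤n) L≥

    I≥1 : 1 ℕ.≤ I
    I≥1 = ℕ.*-mono-≤ L≥1 (ℕ.*-mono-≤ K₀≥1 N≥1)

    -- θ is the fraction of the blow-up time 1 / D that is run; since `ŷ` stays below (p + 1) D
    -- until then, thr leaves room for the tolerance D.
    D δ ξ θ ρ q K lam cap thr w β μ : ℚ
    D = ι D₀
    δ = inv D₀
    ξ = inv I
    θ = ι p * inv (2 ℕ.+ p)
    ρ = θ * δ * ξ
    q = ι q₀
    K = ι K₀
    lam = inv L
    cap = ι cp
    thr = ι (2 ℕ.+ p) * D
    w = (1ℚ + lam) * ρ
    β = q * (ρ * thr)
    μ = inv m

    ŷ : ℕ → ℚ
    ŷ zero = D
    ŷ (suc i) = ŷ i + w * (ŷ i * ŷ i)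

    inc : E → E → Bool
    inc = _⊆ᵇ_

    D≥0 = ι-nn D₀
    δ≥0 = inv-nn D₀
    ξ≥0 = inv-nn I
    K≥0 = ι-nn K₀
    lam≥0 = inv-nn L

    Dδ : D * δ ≡ 1ℚ
    Dδ = inv* D≥1

    Iξ : ι I * ξ ≡ 1ℚ
    Iξ = inv* I≥1

    θ≥0 : 0ℚ ≤ θ
    θ≥0 = *-nn (ι-nn p) (inv-nn (2 ℕ.+ p))

    θ≤1 : θ ≤ 1ℚ
    θ≤1 = ≤-trans (*-monoʳ (inv-nn (2 ℕ.+ p)) (ι-mono (ℕ.m≤n+m p 2))) (≤-reflexive (inv* {2 ℕ.+ p} (ℕ.s≤s ℕ.z≤n)))

    ρ≥0 : 0ℚ ≤ ρ
    ρ≥0 = *-nn (*-nn θ≥0 δ≥0) ξ≥0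

    w≥0 : 0ℚ ≤ w
    w≥0 = *-nn (+-nn 0≤1 lam≥0) ρ≥0

    lam≤1 : lam ≤ 1ℚ
    lam≤1 = inv-≤1 L≥1

    τ≡ : ι I * ρ ≡ θ * δ
    τ≡ = trans (solve 3 (λ i x y → i :* (x :* y) := x :* (i :* y)) refl (ι I) (θ * δ) ξ) (trans (cong (θ * δ *_) Iξ) (*-identityʳ _))

    ρD≡ : ρ * D ≡ θ * ξ
    ρD≡ = trans (solve 4 (λ a b c e → a :* b :* c :* e := a :* c :* (e :* b)) refl θ δ ξ D) (trans (cong (θ * ξ *_) Dδ) (*-identityʳ _))

    ρD≤ξ : ρ * D ≤ ξ
    ρD≤ξ = ≤-trans (≤-reflexive ρD≡) (≤-trans (*-monoʳ ξ≥0 θ≤1) (≤-reflexive (*-identityˡ ξ)))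

    IρD : ι I * (ρ * D) ≡ θ
    IρD = trans (cong (ι I *_) ρD≡) (trans (solve 3 (λ i x y → i :* (x :* y) := x :* (i :* y)) refl (ι I) θ ξ) (trans (cong (θ *_) Iξ) (*-identityʳ _)))

    Iβ≡ : ι I * β ≡ ι (q₀ ℕ.* p)
    Iβ≡ = trans (solve 5 (λ i q r d e → i :* (q :* (r :* (e :* d))) := q :* (e :* (i :* (r :* d)))) refl (ι I) q ρ D (ι (2 ℕ.+ p)))
      (trans (cong (λ z → q * (ι (2 ℕ.+ p) * z)) IρD) (trans (cong (q *_) (trans (solve 3 (λ a b c → a :* (b :* c) := b :* (a :* c)) refl (ι (2 ℕ.+ p)) (ι p) (inv (2 ℕ.+ p)))
        (trans (cong (ι p *_) (inv* {2 ℕ.+ p} (ℕ.s≤s ℕ.z≤n))) (*-identityʳ (ι p))))) (sym (ι-* q₀ p))))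

    ŷ≥0 : ∀ i → 0ℚ ≤ ŷ i
    ŷ≥0 zero = D≥0
    ŷ≥0 (suc i) = +-nn (ŷ≥0 i) (*-nn w≥0 (sq-nn (ŷ i)))

    -- The recursion is dominated by y' = w y², whose solution is D / (1 - w D i).
    ŷ-hyperbolic : ∀ i → ŷ i * (1ℚ - w * D * ι i) ≤ D
    ŷ-hyperbolic zero = ≤-reflexive (solve 2 (λ d w → d :* (𝟙 :- w :* d :* 𝟘) := d) refl D w)
    ŷ-hyperbolic (suc i) = ≤-trans (≤-reflexive (solve 4 (λ y w d i → (y :+ w :* (y :* y)) :* (𝟙 :- w :* d :* (𝟙 :+ i)) := (y :* (𝟙 :- w :* d :* i) :- w :* (y :* d)) :* (𝟙 :+ w :* y)) refl (ŷ i) w D (ι i)))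
      (≤-trans (*-monoʳ (+-nn 0≤1 (*-nn w≥0 (ŷ≥0 i))) (+-monoˡ-≤ (- (w * (ŷ i * D))) (ŷ-hyperbolic i)))
        (diff (*-nn D≥0 (sq-nn (w * ŷ i))) (solve 3 (λ y w d → d :- (d :- w :* (y :* d)) :* (𝟙 :+ w :* y) := d :* (w :* y :* (w :* y))) refl (ŷ i) w D)))

    -- From lam ≤ 1 / (p + 1) follows (1 + lam) θ ≤ ((p + 2) / (p + 1)) (p / (p + 2)) = 1 - 1 / (p +
    -- 1), so the hyperbola has not passed (p + 1) D.
    ŷ≤ : ∀ i → i ℕ.≤ I → ŷ i ≤ ι (suc p) * D
    ŷ≤ i l = *-cancelˡ-≤ {b = ι (suc p)} {a = inv (suc p)} (ι-nn (suc p)) inv1 (≤-trans (≤-trans (≤-reflexive (*-comm _ (ŷ i))) (≤-trans (*-monoˡ (ŷ≥0 i) room) (ŷ-hyperbolic i)))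
        (≤-reflexive (trans (sym (*-identityˡ D)) (trans (cong (_* D) (sym inv1)) (*-assoc _ _ D)))))
      where
      inv1 : inv (suc p) * ι (suc p) ≡ 1ℚ
      inv1 = trans (*-comm _ _) (inv* {suc p} (ℕ.s≤s ℕ.z≤n))
      sI : w * D * ι I ≡ (1ℚ + lam) * θ
      sI = trans (solve 4 (λ l r d i → l :* r :* d :* i := l :* (i :* (r :* d))) refl (1ℚ + lam) ρ D (ι I)) (cong ((1ℚ + lam) *_) IρD)
      lam≤ : lam ≤ inv (suc p)
      lam≤ = ≤-trans (≤-reflexive (sym (*-identityʳ lam))) (inv-≤ L≥1 (≤-trans (≤-reflexive (sym (inv* {suc p} (ℕ.s≤s ℕ.z≤n)))) (*-monoʳ (inv-nn (suc p)) (ι-mono L≥))))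
      a b c : ℚ
      a = ι p
      b = inv (suc p)
      c = inv (2 ℕ.+ p)
      bound : (1ℚ + lam) * θ ≤ 1ℚ - b
      bound = ≤-trans (*-monoʳ θ≥0 (+-monoʳ-≤ 1ℚ lam≤)) (≤-reflexive (trans (cong (λ o → (o + b) * θ) (sym (inv* {suc p} (ℕ.s≤s ℕ.z≤n))))
        (trans (solve 3 (λ a b c → ((𝟙 :+ a) :* b :+ b) :* (a :* c) := (𝟙 :+ (𝟙 :+ a)) :* c :* (a :* b)) refl a b c)
          (trans (cong (_* (a * b)) (inv* {2 ℕ.+ p} (ℕ.s≤s ℕ.z≤n))) (trans (solve 2 (λ a b → 𝟙 :* (a :* b) := (𝟙 :+ a) :* b :- b) refl a b) (cong (_- b) (inv* {suc p} (ℕ.s≤s ℕ.z≤n))))))))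
      room : b ≤ 1ℚ - w * D * ι i
      room = ≤-trans (≤-reflexive (solve 1 (λ b → b := 𝟙 :- (𝟙 :- b)) refl b)) (+-monoʳ-≤ 1ℚ (neg-antimono (≤-trans (*-monoˡ (*-nn w≥0 D≥0) (ι-mono l)) (≤-trans (≤-reflexive sI) bound))))

    open Process _≟ₛ_ es ps inc kT conf ρ cap D ŷ
    open Weights _≟ₛ_ es ps inc kT conf ρ cap D ŷ using (Sparse; sub; comC)
    open Potential _≟ₛ_ es ps inc kT conf ρ cap D ŷ using (g)
    open Outcome _≟ₛ_ es ps inc kT conf ρ cap D ŷ

    mem-∉ : ∀ {R} A → ¬ R ∈ A → mem R A ≡ false
    mem-∉ [] n = refl
    mem-∉ {R} (x ∷ A) n with R ≟ₛ x
    ... | yes e = ⊥-elim (n (here e))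
    ... | no _ = mem-∉ A (λ m → n (there m))

    mem-∈ : ∀ {R} A → R ∈ A → mem R A ≡ true
    mem-∈ {R} (x ∷ A) m with R ≟ₛ x
    mem-∈ (x ∷ A) m | yes e = refl
    mem-∈ (x ∷ A) (here e) | no ne = ⊥-elim (ne e)
    mem-∈ (x ∷ A) (there m) | no ne = mem-∈ A m

    sub-⊑ : ∀ X {A} → (∀ {x} → x ∈ X → x ∈ A) → sub X A ≡ true
    sub-⊑ [] s = refl
    sub-⊑ (x ∷ X) {A} s = ∧-intro (mem-∈ A (s (here refl))) (sub-⊑ X (λ m → s (there m)))

    hyp : Hyp Good K lam μ β q thr ½ m I
    hyp = record
      { es! = sized-unique n (d ℕ.+ t) ; ρ≥0 = ρ≥0 ; cap≥0 = ι-nn cp ; D≥0 = D≥0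
      ; K≥1 = ≤-trans (≤-reflexive (sym ι1)) (ι-mono K₀≥1)
      ; ρKN = ρKN ; lam≤1 = lam≤1 ; kT-inc = kT-inc ; inc-kT = inc-kT
      ; inc≤q = λ {R} R∈ → ≤-reflexive (trans (inc-sized R t) (cong (λ s → ι (s C t)) (∈-sized⁻ R∈)))
      ; degD = degD ; β≡ = refl ; β≥0 = *-nn (ι-nn q₀) (*-nn ρ≥0 thr≥0) ; thr≥0 = thr≥0
      ; ŷ≥0 = ŷ≥0 ; ŷ0 = refl ; ŷ≤thr = λ i l → ≤-trans (+-monoˡ-≤ D (ŷ≤ i l)) (≤-reflexive (solve 2 (λ a d → a :* d :+ d := (𝟙 :+ a) :* d) refl (ι (suc p)) D))
      ; μ≥0 = inv-nn m ; mμ = inv* m≥1 ; h≡ = h≡ ; h≥0 = ½≥0 ; Kh = trans (cong (_* ½ ^ m) (ι-^ 2 m)) (^-inv {ι 2} {½} (solve 0 ((𝟙 :+ (𝟙 :+ 𝟘)) :* con ½ := 𝟙) refl) m)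
      ; good[] = good[] ; good1 = good1 ; good∉ = λ {R} {A} g → mem-∉ A (good∉ g) ; good-step = good-step }
      where
      ½≥0 : 0ℚ ≤ ½
      ½≥0 = <⇒≤ (positive⁻¹ ½)
      thr≥0 : 0ℚ ≤ thr
      thr≥0 = *-nn (ι-nn (2 ℕ.+ p)) D≥0
      m≥1 : 1 ℕ.≤ m
      m≥1 = ℕ.≤-trans cp≥1 (ℕ.≤-trans (ℕ.m≤m+n cp (q₀ ℕ.* p)) (ℕ.m≤m+n (cp ℕ.+ q₀ ℕ.* p) _))
      h≡ : ½ ≡ 1ℚ - (cap + ι I * β) * μ
      h≡ = trans (solve 0 (con ½ := 𝟙 :- con ½ :* 𝟙) refl) (cong (λ z → 1ℚ - z) (trans (cong (½ *_) (sym (inv* m≥1))) (trans (sym (*-assoc ½ (ι m) μ)) (cong (_* μ)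
        (trans (cong (½ *_) (ι-* 2 (cp ℕ.+ q₀ ℕ.* p))) (trans (solve 1 (λ x → con ½ :* ((𝟙 :+ (𝟙 :+ 𝟘)) :* x) := x) refl (ι (cp ℕ.+ q₀ ℕ.* p)))
          (trans (ι-+ cp (q₀ ℕ.* p)) (cong (cap +_) (sym Iβ≡)))))))))
      ρKN : ρ * (K * ι (length es)) ≤ lam
      ρKN = ≤-trans (≤-reflexive (trans (cong (λ z → ρ * (K * z)) (length-sized n (d ℕ.+ t))) (cong (ρ *_) (sym (ι-* K₀ N₀)))))
        (≤-trans (*-monoʳ (ι-nn (K₀ ℕ.* N₀)) (*-mono (*-nn θ≥0 δ≥0) θδ≤1 ξ≥0 ≤-refl)) (≤-trans (≤-reflexive (solve 2 (λ x y → 𝟙 :* x :* y := x :* y) refl ξ (ι (K₀ ℕ.* N₀))))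
          (inv-≤ I≥1 (≤-reflexive (trans (sym (*-identityʳ _)) (trans (cong (ι (K₀ ℕ.* N₀) *_) (sym (inv* L≥1))) (trans (solve 3 (λ a b c → a :* (b :* c) := b :* a :* c) refl (ι (K₀ ℕ.* N₀)) (ι L) lam) (cong (_* lam) (sym (ι-* L (K₀ ℕ.* N₀)))))))))))
        where
        θδ≤1 : θ * δ ≤ 1ℚ
        θδ≤1 = ≤-trans (*-mono θ≥0 θ≤1 δ≥0 (inv-≤1 D≥1)) (≤-reflexive (*-identityˡ 1ℚ))
      kT-inc : ∀ {o R} → o ∈ es → R ∈ es → kT o R ≡ true → 1ℚ ≤ ∑ ps (λ T → bool (inc T o) * bool (inc T R))
      kT-inc {o} {R} _ _ e with sized-below (o ∩ R) t (⌊⌋-true e)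
      ... | T , sT , T⊆ = ≤-trans (≤-reflexive (trans (sym (*-identityˡ 1ℚ)) (cong₂ (λ b c → bool b * bool c) (sym (⊆⇒⊆ᵇ {p = T} {q = o} (λ m → p∩q⊆p o R (T⊆ m)))) (sym (⊆⇒⊆ᵇ {p = T} {q = R} (λ m → p∩q⊆q o R (T⊆ m)))))))
        (∑-single (λ T → *-nn (bool-nn (inc T o)) (bool-nn (inc T R))) (∈-sized⁺ {p = T} sT))
      inc-kT : ∀ {T o R} → T ∈ ps → inc T o ≡ true → inc T R ≡ true → kT o R ≡ true
      inc-kT {T} {o} {R} T∈ a b = ⌊⌋-yes (ℕ.≤-trans (ℕ.≤-reflexive (sym (∈-sized⁻ T∈))) (p⊆q⇒∣p∣≤∣q∣ {p = T} {q = o ∩ R} (λ m → x∈p∩q⁺ (⊆ᵇ⇒⊆ {p = T} {o} a m , ⊆ᵇ⇒⊆ {p = T} {R} b m))))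
      degD : ∀ {T} → T ∈ ps → ∑ es (λ R → bool (inc T R)) ≡ D
      degD {T} T∈ = trans (cong (λ s → ∑ (sized n s) (λ R → bool (inc T R))) (trans (ℕ.+-comm d t) (cong (ℕ._+ d) (sym (∈-sized⁻ T∈)))))
        (trans (deg-sized T d) (cong (λ s → ι ((n ∸ s) C d)) (∈-sized⁻ T∈)))

    xm ℓm : ℕ
    xm = k ℕ.+ k ℕ.+ 1
    ℓm = 2 ℕ.+ (xm ℕ.+ xm)

    open Decide {E} _≟ₛ_ using (unique?)

    bad? : ∀ c o X → Dec (Bad c o X)
    bad? c o X = unique? (c ++ X) ×-dec suc (vol (c ++ o ∷ X)) ℕ.≤? (length c ℕ.+ suc (length X)) ℕ.* d ℕ.+ t

    bad : List E → E → List E → Bool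
    bad c o X = ⌊ bad? c o X ⌋

    CK : ℚ
    CK = ι (2 ℕ.^ (2 ℕ.* (ℓm ℕ.* K₀)))

    Iξ≤1 : ι I * ξ ≤ 1ℚ
    Iξ≤1 = ≤-reflexive Iξ

    sparse : Sparse Good K I
    sparse = record
      { Base = Base ; bad = bad ; xm = xm ; ℓm = ℓm ; δ = δ ; CK = CK ; δ≥0 = δ≥0 ; δD = trans (*-comm δ D) Dδ ; CK≥0 = ι-nn (2 ℕ.^ (2 ℕ.* (ℓm ℕ.* K₀)))
      ; CK-bound = ≤-trans (^-mono (+-nn 0≤1 (*-nn (ι-nn ℓm) (*-nn (*-nn ρ≥0 D≥0) K≥0))) (+-monoʳ-≤ 1ℚ (≤-trans (*-monoˡ (ι-nn ℓm) (*-monoʳ K≥0 ρD≤ξ)) (≤-reflexive (trans (solve 3 (λ a b c → a :* (b :* c) := a :* c :* b) refl (ι ℓm) ξ K) (cong (_* ξ) (sym (ι-* ℓm K₀))))))) I) (exp-bound (ℓm ℕ.* K₀) I ξ≥0 Iξ≤1)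
      ; bad-unique = λ c o X e → proj₁ (⌊⌋-true {d = bad? c o X} e)
      ; struct = st' }
      where
      st' : ∀ {A c o} (f : E → Bool) → Base c o → (∀ z → z ∈ c → f z ≡ true → kill A o z ≡ true × Good (z ∷ A)) → Good (o ∷ A) →
          o ∈ es → All (_∈ es) c → two f c ≡ true → ∃ λ X → All (_∈ es) X × length X ℕ.< xm × sub X A ≡ true × bad c o X ≡ true
      st' {A} {c} {o} f B h go o∈ c∈ e with two-∈ f c (Base.cu B) e
      ... | a , b , a∈ , b∈ , ne , fa , fb with struct B go (All.lookup c∈) k≥2 a∈ b∈ ne (proj₂ (h a a∈ fa)) (proj₂ (h b b∈ fb)) (proj₁ (h a a∈ fa)) (proj₁ (h b b∈ fb))
      ...   | X , X⊑ , lX , bd = X , All.tabulate (λ m → Good.edges go (there (X⊑ m))) , ℕ.≤-trans (ℕ.s≤s lX) (ℕ.≤-reflexive (ℕ.+-comm 1 (k ℕ.+ k))) , sub-⊑ X X⊑ , ⌊⌋-yes bd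

    ŷ-rec : ∀ i → ŷ (suc i) ≡ ŷ i + w * (ŷ i * ŷ i)
    ŷ-rec i = refl

    aG : ℕ
    aG = (2 ℕ.+ xm) ℕ.* 2 ℕ.^ (2 ℕ.+ xm)

    GG CC G₁ c₁ Cmax : ℚ
    GG = ι (2 ℕ.^ (2 ℕ.* aG))
    CC = comC hyp sparse (2 ℕ.+ xm)
    G₁ = ι (2 ℕ.^ (2 ℕ.* (4 ℕ.* (2 ℕ.+ p))))
    c₁ = cap * thr * (δ * δ)
    Cmax = c₁ * (G₁ * G₁)

    final : Final hyp ŷ-rec sparse
    final = record
      { isConf = isConf
      ; conf-wit = λ gR go e → let (X , X⊑ , l , c) = conf-witness gR go e in X , All.tabulate (λ m → Good.edges go (there (X⊑ m))) , l , sub-⊑ X X⊑ , c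
      ; isConf-unique = λ c e → proj₁ (conf-list e)
      ; isConf-base = λ c e o o∈ → conf-base (conf-list e) o∈
      ; pair-base = pb ; GG = GG ; CC = CC ; Cmax = Cmax ; GG-bound = GGb ; CC-bound = CCb ; ℓm≥ = ℕ.≤-refl
      -- Geometric weights make `C-dec` an equality. Their ratio differs from one by O(1 / I), so
      -- they stay within a constant factor of c₁ over the whole process.
      ; C = λ i → c₁ * gg ^ (I ∸ i) ; C≥0 = λ i → *-nn c₁≥0 (^-nn gg≥0 (I ∸ i))
      ; C-dec = λ i l → ≤-reflexive (trans (solve 3 (λ c x g → c :* x :* g := c :* (g :* x)) refl c₁ (gg ^ (I ∸ suc i)) gg) (cong (λ z → c₁ * gg ^ z) (sym (ℕ.+-∸-assoc 1 l))))
      ; C-big = λ i l → ≤-trans (≤-reflexive (sym (*-identityʳ c₁))) (*-monoˡ c₁≥0 (^-≥1 gg≥1 (I ∸ i)))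
      ; C≤ = λ i → *-monoˡ c₁≥0 (≤-trans (^-up gg≥1 (ℕ.m∸n≤m I i)) gg^I) }
      where
      gg : ℚ
      gg = g hyp ŷ-rec
      c₁≥0 : 0ℚ ≤ c₁
      c₁≥0 = *-nn (*-nn (ι-nn cp) (*-nn (ι-nn (2 ℕ.+ p)) D≥0)) (sq-nn δ)
      gw : ℚ
      gw = w * (thr + thr)
      gw≥0 : 0ℚ ≤ gw
      gw≥0 = *-nn w≥0 (+-nn (*-nn (ι-nn (2 ℕ.+ p)) D≥0) (*-nn (ι-nn (2 ℕ.+ p)) D≥0))
      gg≥1 : 1ℚ ≤ gg
      gg≥1 = ≤-by (+-nn (+-nn gw≥0 gw≥0) (*-nn gw≥0 gw≥0)) (solve 1 (λ x → (𝟙 :+ x) :* (𝟙 :+ x) := 𝟙 :+ (x :+ x :+ x :* x)) refl gw)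
      gg≥0 = ≤-trans 0≤1 gg≥1
      gw≤ : gw ≤ ι (4 ℕ.* (2 ℕ.+ p)) * ξ
      gw≤ = ≤-trans (≤-reflexive (solve 4 (λ l r e d → l :* r :* (e :* d :+ e :* d) := l :* ((𝟙 :+ 𝟙) :* e :* (r :* d))) refl (1ℚ + lam) ρ (ι (2 ℕ.+ p)) D))
        (≤-trans (*-mono (+-nn 0≤1 lam≥0) (+-monoʳ-≤ 1ℚ lam≤1) (*-nn (*-nn (+-nn 0≤1 0≤1) (ι-nn (2 ℕ.+ p))) (*-nn ρ≥0 D≥0)) (*-monoˡ (*-nn (+-nn 0≤1 0≤1) (ι-nn (2 ℕ.+ p))) ρD≤ξ))
          (≤-reflexive (trans (solve 2 (λ e x → (𝟙 :+ 𝟙) :* ((𝟙 :+ 𝟙) :* e :* x) := (𝟙 :+ (𝟙 :+ (𝟙 :+ (𝟙 :+ 𝟘)))) :* e :* x) refl (ι (2 ℕ.+ p)) ξ) (cong (_* ξ) (sym (ι-* 4 (2 ℕ.+ p)))))))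
      gg^I : gg ^ I ≤ G₁ * G₁
      gg^I = ≤-trans (≤-reflexive (^-* (1ℚ + gw) (1ℚ + gw) I)) (*-mono (^-nn 1+≥0 I) le (^-nn 1+≥0 I) le)
        where
        1+≥0 = +-nn 0≤1 gw≥0
        le : (1ℚ + gw) ^ I ≤ G₁
        le = ≤-trans (^-mono 1+≥0 (+-monoʳ-≤ 1ℚ gw≤) I) (exp-bound (4 ℕ.* (2 ℕ.+ p)) I ξ≥0 Iξ≤1)
      pb : ∀ R R' o → R ∈ es → R' ∈ es → o ∈ es → pairOK R R' o ≡ true → Base (R ∷ R' ∷ []) o
      pb R R' o R∈ R'∈ o∈ e with ∧-true {any (λ T → inc T R ∧ (inc T R' ∧ not (inc T o))) ps} e
      ... | e₁ , e₂ with any-∈ (λ T → inc T R ∧ (inc T R' ∧ not (inc T o))) ps e₁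
      ...   | T , T∈ , f with ∧-true {inc T R} f
      ...     | f₁ , f' with ∧-true {inc T R'} f'
      ...       | f₂ , f₃ = pair-base R∈ R'∈ o∈ (⌊⌋-false (not-true e₂)) (∈-sized⁻ T∈) (λ {x} → ⊆ᵇ⇒⊆ {p = T} {R} f₁ {x}) (λ {x} → ⊆ᵇ⇒⊆ {p = T} {R'} f₂ {x})
                    (λ s → case f₃ (⊆⇒⊆ᵇ {p = T} {q = o} (λ {x} → s {x})))
        where
        case : ∀ {X : Set} {b} → not b ≡ true → b ≡ true → X
        case () refl
      2≥0 = +-nn 0≤1 0≤1
      2≥1 : 1ℚ ≤ 1ℚ + 1ℚ
      2≥1 = ≤-by 0≤1 refl
      GGb : ∀ x → x ℕ.< xm → (1ℚ + ι (2 ℕ.+ x) * (ρ * D * (1ℚ + 1ℚ) ^ (2 ℕ.+ x))) ^ I ≤ GG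
      GGb x l = ≤-trans (^-mono (+-nn 0≤1 (*-nn (ι-nn (2 ℕ.+ x)) (*-nn (*-nn ρ≥0 D≥0) (^-nn 2≥0 (2 ℕ.+ x))))) (+-monoʳ-≤ 1ℚ
          (≤-trans (*-mono (ι-nn (2 ℕ.+ x)) (ι-mono (ℕ.+-monoʳ-≤ 2 (ℕ.<⇒≤ l))) (*-nn (*-nn ρ≥0 D≥0) (^-nn 2≥0 (2 ℕ.+ x)))
              (*-mono (*-nn ρ≥0 D≥0) ρD≤ξ (^-nn 2≥0 (2 ℕ.+ x)) (≤-trans (^-up 2≥1 (ℕ.+-monoʳ-≤ 2 (ℕ.<⇒≤ l))) (≤-reflexive (trans (cong (_^ (2 ℕ.+ xm)) (solve 0 (𝟙 :+ 𝟙 := 𝟙 :+ (𝟙 :+ 𝟘)) refl)) (sym (ι-^ 2 (2 ℕ.+ xm))))))))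
            (≤-reflexive (trans (solve 3 (λ a b c → a :* (b :* c) := a :* c :* b) refl (ι (2 ℕ.+ xm)) ξ (ι (2 ℕ.^ (2 ℕ.+ xm)))) (cong (_* ξ) (sym (ι-* (2 ℕ.+ xm) (2 ℕ.^ (2 ℕ.+ xm)))))))))
          I) (exp-bound aG I ξ≥0 Iξ≤1)
      CCb : ∀ x → x ℕ.< xm → comC hyp sparse (2 ℕ.+ x) ≤ CC
      CCb x l = *-mono (*-nn (ι-nn (2 ℕ.+ x)) (ι-nn (2 ℕ.+ x))) (*-mono (ι-nn (2 ℕ.+ x)) lx (ι-nn (2 ℕ.+ x)) lx) (^-nn (*-nn 2≥0 K≥0) (2 ℕ.+ x))
          (^-up (≤-trans (≤-trans (≤-reflexive (sym (*-identityˡ 1ℚ))) (*-mono 0≤1 2≥1 0≤1 (Hyp.K≥1 hyp))) ≤-refl) (ℕ.+-monoʳ-≤ 2 (ℕ.<⇒≤ l)))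
        where
        lx : ι (2 ℕ.+ x) ≤ ι (2 ℕ.+ xm)
        lx = ι-mono (ℕ.+-monoʳ-≤ 2 (ℕ.<⇒≤ l))

-- Orders of magnitude of the losses.

module Bounds where
  open Q
  open Prod
  open Proc
  open Exp
  open Omega
  open Phi
  open Greedy
  open Vol
  open Count
  open Arith
  open Lower
  open import Data.Rational using (_≤_)
  open import Data.Rational.Properties using (≤-refl; ≤-reflexive; ≤-trans)
  open import Data.Nat using (_∸_; _!)
  open import Data.Nat.Combinatorics using (_C_)
  open import Data.Fin.Subset using (Subset)

  private variable
    A : Set

  ∑<-cong : ∀ j {f g : ℕ → ℚ} → (∀ x → f x ≡ g x) → ∑< j f ≡ ∑< j g
  ∑<-cong zero h = refl
  ∑<-cong (suc j) h = cong₂ _+_ (∑<-cong j h) (h j)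

  ∑-∑< : ∀ (xs : List A) j (F : A → ℕ → ℚ) → ∑ xs (λ o → ∑< j (F o)) ≡ ∑< j (λ x → ∑ xs (λ o → F o x))
  ∑-∑< xs zero F = ∑-zero xs (λ _ → refl)
  ∑-∑< xs (suc j) F = trans (∑-+ xs _ _) (cong (_+ ∑ xs (λ o → F o j)) (∑-∑< xs j F))

  ∑T-∑< : ∀ (xs : List A) ℓ j (F : List A → ℕ → ℚ) → ∑T xs ℓ (λ c → ∑< j (F c)) ≡ ∑< j (λ x → ∑T xs ℓ (λ c → F c x))
  ∑T-∑< xs zero j F = refl
  ∑T-∑< xs (suc ℓ) j F = trans (∑-cong xs (λ y → ∑T-∑< xs ℓ j (λ c → F (y ∷ c)))) (∑-∑< xs j _)

  ∑T-++ : ∀ (xs : List A) ℓ m (f : List A → ℚ) → ∑T xs ℓ (λ c → ∑T xs m (λ X → f (c ++ X))) ≡ ∑T xs (ℓ ℕ.+ m) f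
  ∑T-++ xs zero m f = refl
  ∑T-++ xs (suc ℓ) m f = ∑-cong xs (λ y → ∑T-++ xs ℓ m (λ c → f (y ∷ c)))

  C-positive : ∀ n i j → suc (2 ℕ.* (i ℕ.+ j)) ℕ.≤ n → 1 ℕ.≤ (n ∸ i) C j
  C-positive n i j l with (n ∸ i) C j | C-order n i j l
  ... | suc _ | _ = ℕ.s≤s ℕ.z≤n
  ... | zero | h = ℕ.≤-trans (ℕ.m^n>0 (suc n) j) (ℕ.≤-trans h (ℕ.≤-reflexive (ℕ.*-zeroʳ (2 ℕ.^ j ℕ.* j !))))

  -- a₁ is the coefficient of the conflict loss and is free of K. The correlation correction a₂ and
  -- the variance a₅ contain K, but come with a factor 1 / n.
  module Constants (GG K CC CK q A₁ A₂ S₂ B cD F two : ℚ) where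
    a₁ a₂ a₄ Q : ℚ
    a₁ = GG * (A₁ * B)
    a₂ = GG * (K * CC * CK * (A₂ * B))
    a₄ = (two * K) * (two * K) * q * K * CK
    Q = q * (two * two * K)

    a₅ : ℚ → ℚ
    a₅ b = F * (a₄ * (S₂ * B)) + F * cD * (Q * (a₁ + a₂ + b * K))

  -- All error terms are of relative order 1/cap, 1/L or 1/n.
  module Budget {N τ δ GG cs K CC CK ss q ps b cap lam cx A₁ A₂ S₂ B cD F Y₂ Y₃ ζ two : ℚ}
    (two≥0 : 0ℚ ≤ two)
    (N≥0 : 0ℚ ≤ N) (τ≥0 : 0ℚ ≤ τ) (δ≥0 : 0ℚ ≤ δ) (GG≥0 : 0ℚ ≤ GG) (K≥0 : 0ℚ ≤ K) (CC≥0 : 0ℚ ≤ CC) (CK≥0 : 0ℚ ≤ CK) (q≥0 : 0ℚ ≤ q)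
    (b≥0 : 0ℚ ≤ b) (cap≥0 : 0ℚ ≤ cap) (lam≥0 : 0ℚ ≤ lam) (cx≥0 : 0ℚ ≤ cx) (A₁≥0 : 0ℚ ≤ A₁) (A₂≥0 : 0ℚ ≤ A₂) (S₂≥0 : 0ℚ ≤ S₂)
    (B≥0 : 0ℚ ≤ B) (cD≥0 : 0ℚ ≤ cD) (F≥0 : 0ℚ ≤ F) (cs≥0 : 0ℚ ≤ cs) (ss≥0 : 0ℚ ≤ ss) (ps≥0 : 0ℚ ≤ ps) (ζ≥0 : 0ℚ ≤ ζ)
    (τ≤δ : τ ≤ δ) (cs≤ : cs ≤ A₁ * Y₂) (ss≤ : ss ≤ A₂ * Y₃) (ps≤ : ps ≤ S₂ * Y₃) (Y₂≤ : δ * Y₂ ≤ B * N) (Y₃≤ : δ * δ * Y₃ ≤ B * N * ζ)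
    (δ≤ : δ ≤ cD * ζ) (cx≤ : cx ≤ F * δ) (ζ≤1 : ζ ≤ 1ℚ) (capl≤1 : cap * lam ≤ 1ℚ) where

    open Constants GG K CC CK q A₁ A₂ S₂ B cD F two

    Sc Sv TL : ℚ
    Sc = τ * (GG * (cs + τ * K * CC * CK * ss))
    Sv = τ * (a₄ * ps) + Q * (Sc + b * (K * N))
    TL = (1ℚ + cap * lam) * Sc + b * (cap * lam * (K * N)) + cx * Sv

    Kc≥0 : 0ℚ ≤ K * CC * CK
    Kc≥0 = *-nn (*-nn K≥0 CC≥0) CK≥0

    a₂≥0 : 0ℚ ≤ a₂
    a₂≥0 = *-nn GG≥0 (*-nn Kc≥0 (*-nn A₂≥0 B≥0))

    a₄≥0 : 0ℚ ≤ a₄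
    a₄≥0 = *-nn (*-nn (*-nn (*-nn (*-nn two≥0 K≥0) (*-nn two≥0 K≥0)) q≥0) K≥0) CK≥0

    Q≥0 : 0ℚ ≤ Q
    Q≥0 = *-nn q≥0 (*-nn (*-nn two≥0 two≥0) K≥0)

    Sc≥0 : 0ℚ ≤ Sc
    Sc≥0 = *-nn τ≥0 (*-nn GG≥0 (+-nn cs≥0 (*-nn (*-nn (*-nn (*-nn τ≥0 K≥0) CC≥0) CK≥0) ss≥0)))

    δss : δ * δ * ss ≤ A₂ * (B * N * ζ)
    δss = ≤-trans (*-monoˡ (*-nn δ≥0 δ≥0) ss≤) (≤-trans (≤-reflexive (solve 3 (λ d a y → d :* d :* (a :* y) := a :* (d :* d :* y)) refl δ A₂ Y₃)) (*-monoˡ A₂≥0 Y₃≤))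

    δcs : δ * cs ≤ A₁ * (B * N)
    δcs = ≤-trans (*-monoˡ δ≥0 cs≤) (≤-trans (≤-reflexive (solve 3 (λ d a y → d :* (a :* y) := a :* (d :* y)) refl δ A₁ Y₂)) (*-monoˡ A₁≥0 Y₂≤))

    Sc≤ : Sc ≤ N * (a₁ + a₂ * ζ)
    Sc≤ = ≤-trans (≤-reflexive (trans (cong (λ z → τ * (GG * (cs + z * ss))) (solve 4 (λ t a b c → t :* a :* b :* c := t :* (a :* b :* c)) refl τ K CC CK))
        (solve 5 (λ t g c k s → t :* (g :* (c :+ t :* k :* s)) := g :* (t :* c :+ k :* (t :* t :* s))) refl τ GG cs (K * CC * CK) ss)))
      (≤-trans (*-monoˡ GG≥0 (+-mono-≤ (≤-trans (*-monoʳ cs≥0 τ≤δ) δcs) (*-monoˡ Kc≥0 (≤-trans (*-monoʳ ss≥0 (*-mono τ≥0 τ≤δ τ≥0 τ≤δ)) δss))))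
        (≤-reflexive (solve 7 (λ g a b n k a' z → g :* (a :* (b :* n) :+ k :* (a' :* (b :* n :* z))) := n :* (g :* (a :* b) :+ g :* (k :* (a' :* b)) :* z)) refl GG A₁ B N (K * CC * CK) A₂ ζ)))

    Sc≤' : Sc ≤ N * (a₁ + a₂)
    Sc≤' = ≤-trans Sc≤ (*-monoˡ N≥0 (+-monoʳ-≤ a₁ (≤-trans (*-monoˡ a₂≥0 ζ≤1) (≤-reflexive (*-identityʳ a₂)))))

    cxSv : cx * Sv ≤ N * ζ * a₅ b
    cxSv = ≤-trans (≤-reflexive (*-distribˡ-+ cx _ _)) (≤-trans (+-mono-≤ one' two') (≤-reflexive
        (solve 10 (λ f a s b n z d q e k → f :* (a :* (s :* (b :* n :* z))) :+ f :* (d :* z) :* (q :* (n :* e :+ k :* n)) := n :* z :* (f :* (a :* (s :* b)) :+ f :* d :* (q :* (e :+ k)))) refl F a₄ S₂ B N ζ cD Q (a₁ + a₂) (b * K))))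
      where
      one' : cx * (τ * (a₄ * ps)) ≤ F * (a₄ * (S₂ * (B * N * ζ)))
      one' = ≤-trans (*-mono cx≥0 cx≤ (*-nn τ≥0 (*-nn a₄≥0 ps≥0)) (*-mono τ≥0 τ≤δ (*-nn a₄≥0 ps≥0) (*-monoˡ a₄≥0 ps≤)))
        (≤-trans (≤-reflexive (solve 5 (λ f d a s y → f :* d :* (d :* (a :* (s :* y))) := f :* (a :* (s :* (d :* d :* y)))) refl F δ a₄ S₂ Y₃)) (*-monoˡ F≥0 (*-monoˡ a₄≥0 (*-monoˡ S₂≥0 Y₃≤))))
      two' : cx * (Q * (Sc + b * (K * N))) ≤ F * (cD * ζ) * (Q * (N * (a₁ + a₂) + b * K * N))
      two' = *-mono cx≥0 (≤-trans cx≤ (*-monoˡ F≥0 δ≤)) (*-nn Q≥0 (+-nn Sc≥0 (*-nn b≥0 (*-nn K≥0 N≥0)))) (*-monoˡ Q≥0 (+-mono-≤ Sc≤' (≤-reflexive (sym (*-assoc b K N)))))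

    TL≤ : TL ≤ N * ((a₁ + a₁) + ζ * (a₂ + a₂ + a₅ b) + cap * (lam * (b * K)))
    TL≤ = ≤-trans (+-mono-≤ (+-monoˡ-≤ _ (*-mono (+-nn 0≤1 (*-nn cap≥0 lam≥0)) (+-monoʳ-≤ 1ℚ capl≤1) Sc≥0 Sc≤)) cxSv)
      (≤-reflexive (solve 9 (λ n x y z e b c l k → (𝟙 :+ 𝟙) :* (n :* (x :+ y :* z)) :+ b :* (c :* l :* (k :* n)) :+ n :* z :* e := n :* ((x :+ x) :+ z :* (y :+ y :+ e) :+ c :* (l :* (b :* k)))) refl N a₁ a₂ ζ (a₅ b) b cap lam K))

    -- Each of the three error terms is made at most N `cap` / e, which leaves the fraction 1 - 3 /
    -- e of the ideal count τ N; multiplying by e avoids a division.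
    yield : ∀ {e lenA} → 0ℚ ≤ e → e * (a₁ + a₁) ≤ cap → e * (ζ * (a₂ + a₂ + a₅ b)) ≤ cap → e * (lam * (b * K)) ≤ 1ℚ → 1ℚ ≤ cap →
      τ * (N * cap - TL) ≤ cap * lenA → τ * (N * (e - ι 3)) ≤ e * lenA
    yield {e} {lenA} e≥0 h₁ h₂ h₃ cap≥1 le = cancel
      where
      eTL : e * TL ≤ N * (cap * ι 3)
      eTL = ≤-trans (*-monoˡ e≥0 TL≤) (≤-trans (≤-reflexive (solve 6 (λ e n x y c z → e :* (n :* (x :+ y :+ c :* z)) := n :* (e :* x :+ e :* y :+ c :* (e :* z))) refl e N (a₁ + a₁) (ζ * (a₂ + a₂ + a₅ b)) cap (lam * (b * K))))
        (*-monoˡ N≥0 (≤-trans (+-mono-≤ (+-mono-≤ h₁ h₂) (*-monoˡ cap≥0 h₃)) (≤-reflexive (solve 1 (λ c → c :+ c :+ c :* 𝟙 := c :* (𝟙 :+ (𝟙 :+ (𝟙 :+ 𝟘)))) refl cap)))))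
      main : cap * (τ * (N * (e - ι 3))) ≤ cap * (e * lenA)
      main = ≤-trans (≤-reflexive (solve 5 (λ c t n e x → c :* (t :* (n :* (e :- x))) := t :* (e :* (n :* c) :- n :* (c :* x))) refl cap τ N e (ι 3)))
        (≤-trans (*-monoˡ τ≥0 (+-monoʳ-≤ (e * (N * cap)) (neg-antimono eTL)))
          (≤-trans (≤-reflexive (solve 5 (λ t e n c x → t :* (e :* (n :* c) :- e :* x) := e :* (t :* (n :* c :- x))) refl τ e N cap TL))
            (≤-trans (*-monoˡ e≥0 le) (≤-reflexive (solve 3 (λ e c l → e :* (c :* l) := c :* (e :* l)) refl e cap lenA)))))
      cancel : τ * (N * (e - ι 3)) ≤ e * lenA
      cancel with reciprocal (<-≤-trans 0<1 cap≥1)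
        where open import Data.Rational.Properties using (<-≤-trans)
      ... | r , r≥0 , cr = *-cancelˡ-≤ r≥0 cr main

  module Asymptotic (d t' xm : ℕ) (d≥1 : 1 ℕ.≤ d) where
    t : ℕ
    t = suc t'

    M : ℕ → ℕ → ℚ
    M s ℓ = ι (2 ℕ.^ s) ^ ℓ

    cD cN B A₁ A₂ : ℚ
    cD = ι (2 ℕ.^ d ℕ.* d !)
    cN = ι (2 ℕ.^ (d ℕ.+ t) ℕ.* (d ℕ.+ t) !)
    B = (cD + cD * cD) * cN

    -- Constant for bad structures on j edges, one killing edge and x accepted ones. The exponent
    -- has t' = t - 1 in place of t: this is the missing vertex.
    S : ℕ → ℚ
    S j = ∑< xm (λ x → cD ^ x * M (x ℕ.* d ℕ.+ (suc j ℕ.* d ℕ.+ t')) (j ℕ.+ suc x))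

    A₁ = ∑< xm (λ x → cD ^ x * M (x ℕ.* d ℕ.+ (2 ℕ.* d ℕ.+ t)) (2 ℕ.+ x))
    A₂ = ∑< xm (λ x → cD ^ x * S (2 ℕ.+ x))

    M≥0 : ∀ s ℓ → 0ℚ ≤ M s ℓ
    M≥0 s ℓ = ^-nn (ι-nn (2 ℕ.^ s)) ℓ

    cD≥0 : 0ℚ ≤ cD
    cD≥0 = ι-nn (2 ℕ.^ d ℕ.* d !)

    cN≥0 : 0ℚ ≤ cN
    cN≥0 = ι-nn (2 ℕ.^ (d ℕ.+ t) ℕ.* (d ℕ.+ t) !)

    B≥0 : 0ℚ ≤ B
    B≥0 = *-nn (+-nn cD≥0 (*-nn cD≥0 cD≥0)) cN≥0

    S≥0 : ∀ j → 0ℚ ≤ S j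
    S≥0 j = ∑<-nn xm (λ x _ → *-nn (^-nn cD≥0 x) (M≥0 (x ℕ.* d ℕ.+ (suc j ℕ.* d ℕ.+ t')) (j ℕ.+ suc x)))

    A₁≥0 : 0ℚ ≤ A₁
    A₁≥0 = ∑<-nn xm (λ x _ → *-nn (^-nn cD≥0 x) (M≥0 (x ℕ.* d ℕ.+ (2 ℕ.* d ℕ.+ t)) (2 ℕ.+ x)))

    A₂≥0 : 0ℚ ≤ A₂
    A₂≥0 = ∑<-nn xm (λ x _ → *-nn (^-nn cD≥0 x) (S≥0 (2 ℕ.+ x)))

    module Size (n : ℕ) (n≥ : suc (2 ℕ.* (t ℕ.+ d)) ℕ.≤ n) {δ : ℚ} (δ≥0 : 0ℚ ≤ δ) (δD : δ * ι ((n ∸ t) C d) ≡ 1ℚ) where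
      N₀ D₀ : ℕ
      N₀ = n C (d ℕ.+ t)
      D₀ = (n ∸ t) C d

      X ζ : ℚ
      X = ι (suc n)
      ζ = inv (suc n)

      n≥' : suc (2 ℕ.* (0 ℕ.+ (d ℕ.+ t))) ℕ.≤ n
      n≥' = ℕ.≤-trans (ℕ.≤-reflexive (cong (λ s → suc (2 ℕ.* s)) (ℕ.+-comm d t))) n≥

      X≥0 = ι-nn (suc n)
      ζ≥0 = inv-nn (suc n)

      Xζ : X * ζ ≡ 1ℚ
      Xζ = inv* {suc n} (ℕ.s≤s ℕ.z≤n)

      Xd : X ^ d * δ ≤ cD
      Xd = ≤-trans (*-monoʳ δ≥0 (≤-trans (≤-reflexive (sym (ι-^ (suc n) d))) (≤-trans (ι-mono (C-order n t d n≥)) (≤-reflexive (ι-* (2 ℕ.^ d ℕ.* d !) D₀)))))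
        (≤-reflexive (trans (*-assoc cD (ι D₀) δ) (trans (cong (cD *_) (trans (*-comm (ι D₀) δ) δD)) (*-identityʳ cD))))

      XN : X ^ (d ℕ.+ t) ≤ cN * ι N₀
      XN = ≤-trans (≤-reflexive (sym (ι-^ (suc n) (d ℕ.+ t)))) (≤-trans (ι-mono (C-order n 0 (d ℕ.+ t) n≥')) (≤-reflexive (ι-* (2 ℕ.^ (d ℕ.+ t) ℕ.* (d ℕ.+ t) !) N₀)))

      -- The orders of the weighted numbers of dense lists and of bad structures: δ is of order
      -- n^(-d), so δ Y₂ has the order of N and δ² Y₃ that of N / n.
      Y₂ Y₃ : ℚ
      Y₂ = X ^ (2 ℕ.* d ℕ.+ t)
      Y₃ = X ^ (3 ℕ.* d ℕ.+ t')

      cD≤ : cD ≤ cD + cD * cD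
      cD≤ = ≤-by (*-nn cD≥0 cD≥0) refl

      Y₂≤ : δ * Y₂ ≤ B * ι N₀
      Y₂≤ = ≤-trans (≤-reflexive (trans (cong (λ s → δ * X ^ s) (ar d t)) (trans (cong (δ *_) (^-+ X d (d ℕ.+ t))) (solve 3 (λ d x y → d :* (x :* y) := x :* d :* y) refl δ (X ^ d) (X ^ (d ℕ.+ t))))))
        (≤-trans (*-mono (*-nn (^-nn X≥0 d) δ≥0) (≤-trans Xd cD≤) (^-nn X≥0 (d ℕ.+ t)) XN) (≤-reflexive (sym (*-assoc (cD + cD * cD) cN (ι N₀)))))
        where
        ar : ∀ d t → 2 ℕ.* d ℕ.+ t ≡ d ℕ.+ (d ℕ.+ t)
        ar = solve-∀

      Y₃≤ : δ * δ * Y₃ ≤ B * ι N₀ * ζ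
      Y₃≤ = ≤-trans (≤-reflexive (trans (cong (λ s → δ * δ * X ^ s) (ar d t')) (trans (cong (δ * δ *_) (trans (^-+ X d (d ℕ.+ (d ℕ.+ t'))) (cong (X ^ d *_) (^-+ X d (d ℕ.+ t')))))
          (trans (solve 3 (λ d x y → d :* d :* (x :* (x :* y)) := x :* d :* (x :* d) :* (y :* 𝟙)) refl δ (X ^ d) (X ^ (d ℕ.+ t'))) (trans (cong (λ o → X ^ d * δ * (X ^ d * δ) * (X ^ (d ℕ.+ t') * o)) (sym Xζ))
            (trans (solve 4 (λ u y x z → u :* (y :* (x :* z)) := u :* (x :* y) :* z) refl (X ^ d * δ * (X ^ d * δ)) (X ^ (d ℕ.+ t')) X ζ) (cong (λ s → X ^ d * δ * (X ^ d * δ) * X ^ s * ζ) (sym (ℕ.+-suc d t')))))))))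
        (*-monoʳ ζ≥0 (≤-trans (*-mono (*-nn u≥0 u≥0) (≤-trans (*-mono u≥0 Xd u≥0 Xd) (≤-by cD≥0 (+-comm cD (cD * cD)))) (^-nn X≥0 (d ℕ.+ t)) XN) (≤-reflexive (sym (*-assoc (cD + cD * cD) cN (ι N₀))))))
        where
        u≥0 = *-nn (^-nn X≥0 d) δ≥0
        ar : ∀ d t → 3 ℕ.* d ℕ.+ t ≡ d ℕ.+ (d ℕ.+ (d ℕ.+ t))
        ar = solve-∀

      δ≤ : δ ≤ cD * ζ
      δ≤ = ≤-trans (≤-reflexive (trans (sym (*-identityʳ δ)) (trans (cong (δ *_) (sym Xζ)) (solve 3 (λ d x z → d :* (x :* z) := x :* d :* z) refl δ X ζ))))
        (*-monoʳ ζ≥0 (≤-trans (*-monoʳ δ≥0 (≤-trans (≤-reflexive (sym (*-identityʳ X))) (^-up {X} (≤-by (ι-nn n) refl) d≥1))) Xd))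

      -- Every accepted edge contributes a factor δ and at most d further vertices, and δ (n + 1)^d
      -- is bounded.
      scale : ∀ x s → δ ^ x * X ^ (x ℕ.* d ℕ.+ s) ≤ cD ^ x * X ^ s
      scale x s = ≤-trans (≤-reflexive (trans (cong (δ ^ x *_) (trans (^-+ X (x ℕ.* d) s) (cong (_* X ^ s) (sym (^-*-exp X d x))))) (trans (solve 3 (λ a b c → a :* (b :* c) := b :* a :* c) refl (δ ^ x) ((X ^ d) ^ x) (X ^ s)) (cong (_* X ^ s) (sym (^-* (X ^ d) δ x))))))
        (*-monoʳ (^-nn X≥0 s) (^-mono (*-nn (^-nn X≥0 d) δ≥0) Xd x))

      es = sized n (d ℕ.+ t)

      tuples : ∀ {f : List (Subset n) → ℚ} ℓ x s → (∀ c → length c ≡ ℓ → f c ≤ δ ^ x * bool ⌊ vol c ℕ.≤? x ℕ.* d ℕ.+ s ⌋) →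
        ∑T es ℓ f ≤ cD ^ x * M (x ℕ.* d ℕ.+ s) ℓ * X ^ s
      tuples {f} ℓ x s h = ≤-trans (∑T-mono es ℓ (λ c _ e → h c e)) (≤-trans (≤-reflexive (∑T-*ˡ es ℓ (δ ^ x) (λ c → bool ⌊ vol c ℕ.≤? x ℕ.* d ℕ.+ s ⌋)))
        (≤-trans (*-monoˡ (^-nn δ≥0 x) (≤-trans (count-tuples n (d ℕ.+ t) ℓ (x ℕ.* d ℕ.+ s)) (≤-reflexive (cong (_* M (x ℕ.* d ℕ.+ s) ℓ) (ι-^ (suc n) (x ℕ.* d ℕ.+ s))))))
          (≤-trans (≤-reflexive (sym (*-assoc (δ ^ x) (X ^ (x ℕ.* d ℕ.+ s)) (M (x ℕ.* d ℕ.+ s) ℓ)))) (≤-trans (*-monoʳ (M≥0 (x ℕ.* d ℕ.+ s) ℓ) (scale x s))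
            (≤-reflexive (solve 3 (λ a b c → a :* b :* c := a :* c :* b) refl (cD ^ x) (X ^ s) (M (x ℕ.* d ℕ.+ s) ℓ)))))))

  module Totals (n d t' : ℕ) (d≥1 : 1 ℕ.≤ d) (n≥ : suc (2 ℕ.* (suc t' ℕ.+ d)) ℕ.≤ n) {ps : List (Subset n)}
    {inc kT : Subset n → Subset n → Bool} {conf : List (Subset n) → Subset n → Subset n → Bool} {ρ cap : ℚ} {ŷ : ℕ → ℚ}
    {Good : List (Subset n) → Set} {K lam μ β q thr h : ℚ} {m I : ℕ}
    (H : Process.Hyp _≟ₛ_ (sized n (d ℕ.+ suc t')) ps inc kT conf ρ cap (ι ((n ∸ suc t') C d)) ŷ Good K lam μ β q thr h m I)
    (ŷ-rec : ∀ i → ŷ (suc i) ≡ ŷ i + (1ℚ + lam) * ρ * (ŷ i * ŷ i))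
    (Sp : Weights.Sparse _≟ₛ_ (sized n (d ℕ.+ suc t')) ps inc kT conf ρ cap (ι ((n ∸ suc t') C d)) ŷ Good K I)
    (Fn : Outcome.Final _≟ₛ_ (sized n (d ℕ.+ suc t')) ps inc kT conf ρ cap (ι ((n ∸ suc t') C d)) ŷ H ŷ-rec Sp) where
    es : List (Subset n)
    es = sized n (d ℕ.+ suc t')

    D : ℚ
    D = ι ((n ∸ suc t') C d)

    E = Subset n
    open Process _≟ₛ_ es ps inc kT conf ρ cap D ŷ
    open Weights _≟ₛ_ es ps inc kT conf ρ cap D ŷ
    open Outcome _≟ₛ_ es ps inc kT conf ρ cap D ŷ
    open Sparse Sp
    open Final Fn using (isConf; GG; CC; Cmax)
    open Asymptotic d t' xm d≥1
    open Size n n≥ δ≥0 δD hiding (es)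

    module _ (bad-vol : ∀ c o X → bad c o X ≡ true → suc (vol (c ++ o ∷ X)) ℕ.≤ (length c ℕ.+ suc (length X)) ℕ.* d ℕ.+ t)
      (conf-vol : ∀ c → isConf c ≡ true → vol c ℕ.≤ length c ℕ.* d ℕ.+ t) where

      sSum : List E → ℚ
      sSum = structSum H Sp

      confSum≤ : confSum H ŷ-rec Sp Fn ≤ A₁ * Y₂
      confSum≤ = ≤-trans (∑<-mono xm (λ x _ → tuples (2 ℕ.+ x) x (2 ℕ.* d ℕ.+ t) (pt x)))
        (≤-reflexive (trans (∑<-cong xm (λ x → *-comm _ Y₂)) (trans (∑<-* xm Y₂ _) (*-comm Y₂ A₁))))
        where
        ar : ∀ x d t → (2 ℕ.+ x) ℕ.* d ℕ.+ t ≡ x ℕ.* d ℕ.+ (2 ℕ.* d ℕ.+ t)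
        ar = solve-∀
        pt : ∀ x c → length c ≡ 2 ℕ.+ x → bool (isConf c) * δ ^ x ≤ δ ^ x * bool ⌊ vol c ℕ.≤? x ℕ.* d ℕ.+ (2 ℕ.* d ℕ.+ t) ⌋
        pt x c e = ≤-trans (≤-reflexive (*-comm (bool (isConf c)) (δ ^ x))) (*-monoˡ (^-nn δ≥0 x) (le (isConf c) refl))
          where
          le : ∀ b → isConf c ≡ b → bool b ≤ bool ⌊ vol c ℕ.≤? x ℕ.* d ℕ.+ (2 ℕ.* d ℕ.+ t) ⌋
          le false _ = bool-nn ⌊ vol c ℕ.≤? x ℕ.* d ℕ.+ (2 ℕ.* d ℕ.+ t) ⌋
          le true e' = ≤-reflexive (cong bool (sym (⌊⌋-yes {d = vol c ℕ.≤? x ℕ.* d ℕ.+ (2 ℕ.* d ℕ.+ t)} (ℕ.≤-trans (conf-vol c e') (ℕ.≤-reflexive (trans (cong (λ l → l ℕ.* d ℕ.+ t) e) (ar x d t)))))))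

      structs≤ : ∀ j → ∑T es j sSum ≤ S j * X ^ (suc j ℕ.* d ℕ.+ t')
      structs≤ j = ≤-trans (≤-reflexive (trans (∑T-cong es j (λ c → ∑-∑< es xm (λ o x → F c x o))) (∑T-∑< es j xm (λ c x → ∑ es (F c x)))))
        (≤-trans (∑<-mono xm (λ x _ → perX x)) (≤-reflexive (trans (∑<-cong xm (λ x → *-comm _ Xs)) (trans (∑<-* xm Xs _) (*-comm Xs (S j))))))
        where
        Xs = X ^ (suc j ℕ.* d ℕ.+ t')
        F : List E → ℕ → E → ℚ
        F c x o = ∑T es x (λ X → bool (bad c o X) * δ ^ x)
        s : ℕ → ℕ
        s x = x ℕ.* d ℕ.+ (suc j ℕ.* d ℕ.+ t')
        v : ℕ → List E → ℚ
        v x L = δ ^ x * bool ⌊ vol L ℕ.≤? s x ⌋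
        ar : ∀ x j d t → (j ℕ.+ suc x) ℕ.* d ℕ.+ t ≡ x ℕ.* d ℕ.+ (suc j ℕ.* d ℕ.+ t)
        ar = solve-∀
        perX : ∀ x → ∑T es j (λ c → ∑ es (F c x)) ≤ cD ^ x * M (s x) (j ℕ.+ suc x) * Xs
        -- The sums over o and X are merged into one sum over tuples of length x + 1; the value at
        -- the empty tuple is a dummy that never occurs.
        perX x = ≤-trans (∑T-mono es j (λ c _ lc → ∑T-mono es (suc x) {λ { [] → 0ℚ ; (o ∷ X) → bool (bad c o X) * δ ^ x }} {λ Y → v x (c ++ Y)} (λ { [] _ () ; (o ∷ X) _ lX → pt c lc o X (ℕ.suc-injective lX) })))
          (≤-trans (≤-reflexive (∑T-++ es j (suc x) (v x))) (tuples (j ℕ.+ suc x) x (suc j ℕ.* d ℕ.+ t') (λ c _ → ≤-refl)))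
          where
          pt : ∀ c → length c ≡ j → ∀ o X → length X ≡ x → bool (bad c o X) * δ ^ x ≤ v x (c ++ o ∷ X)
          pt c lc o X lX = ≤-trans (≤-reflexive (*-comm (bool (bad c o X)) (δ ^ x))) (*-monoˡ (^-nn δ≥0 x) (le (bad c o X) refl))
            where
            le : ∀ b → bad c o X ≡ b → bool b ≤ bool ⌊ vol (c ++ o ∷ X) ℕ.≤? s x ⌋
            le false _ = bool-nn ⌊ vol (c ++ o ∷ X) ℕ.≤? s x ⌋
            le true e' = ≤-reflexive (cong bool (sym (⌊⌋-yes {d = vol (c ++ o ∷ X) ℕ.≤? s x} (ℕ.s≤s⁻¹ (ℕ.≤-trans (bad-vol c o X e') (ℕ.≤-reflexive
              (trans (cong₂ (λ l l' → (l ℕ.+ suc l') ℕ.* d ℕ.+ t) lc lX) (trans (ℕ.+-suc ((j ℕ.+ suc x) ℕ.* d) t') (cong suc (ar x j d t'))))))))))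

      strSum≤ : strSum H ŷ-rec Sp Fn ≤ A₂ * Y₃
      strSum≤ = ≤-trans (∑<-mono xm (λ x _ → perX x)) (≤-reflexive (trans (∑<-cong xm (λ x → *-comm _ Y₃)) (trans (∑<-* xm Y₃ _) (*-comm Y₃ A₂))))
        where
        sSum≥0 : ∀ c → 0ℚ ≤ sSum c
        sSum≥0 c = ∑-nn es (structAt≥0 H Sp c)
        ar : ∀ x d t → (3 ℕ.+ x) ℕ.* d ℕ.+ t ≡ x ℕ.* d ℕ.+ (3 ℕ.* d ℕ.+ t)
        ar = solve-∀
        perX : ∀ x → ∑T es (2 ℕ.+ x) (λ c → bool (isConf c) * (δ ^ x * sSum c)) ≤ cD ^ x * S (2 ℕ.+ x) * Y₃
        perX x = ≤-trans (∑T-mono es (2 ℕ.+ x) (λ c _ _ → ≤-trans (*-monoʳ (*-nn (^-nn δ≥0 x) (sSum≥0 c)) (bool-≤1 (isConf c))) (≤-reflexive (*-identityˡ _))))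
          (≤-trans (≤-reflexive (∑T-*ˡ es (2 ℕ.+ x) (δ ^ x) sSum)) (≤-trans (*-monoˡ (^-nn δ≥0 x) (structs≤ (2 ℕ.+ x)))
            (≤-trans (≤-reflexive (trans (cong (λ s → δ ^ x * (S (2 ℕ.+ x) * X ^ s)) (ar x d t')) (solve 3 (λ a b c → a :* (b :* c) := a :* c :* b) refl (δ ^ x) (S (2 ℕ.+ x)) (X ^ (x ℕ.* d ℕ.+ (3 ℕ.* d ℕ.+ t'))))))
              (≤-trans (*-monoʳ (S≥0 (2 ℕ.+ x)) (scale x (3 ℕ.* d ℕ.+ t'))) (≤-reflexive (solve 3 (λ a b c → a :* b :* c := a :* c :* b) refl (cD ^ x) Y₃ (S (2 ℕ.+ x))))))))

      pairSum≤ : pairSum H ŷ-rec Sp Fn ≤ S 2 * Y₃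
      pairSum≤ = ≤-trans (∑-mono es (λ R → ∑-mono es (λ R' → ∑-mono es (λ o → ≤-trans (*-monoʳ (structAt≥0 H Sp (R ∷ R' ∷ []) o) (bool-≤1 (pairOK R R' o))) (≤-reflexive (*-identityˡ _)))))) (structs≤ 2)

      module _ (τ≤δ : ι I * ρ ≤ δ) {F : ℚ} (F≥0 : 0ℚ ≤ F) (Cmax≡ : Cmax ≡ F * δ) (GG≥0 : 0ℚ ≤ GG) (CC≥0 : 0ℚ ≤ CC) (q≥0 : 0ℚ ≤ q) (capl≤1 : cap * lam ≤ 1ℚ) where
        open WithHyp H using (ρ≥0; K≥0; cap≥0; lam≥0; β≥0)

        N≡ : ι N₀ ≡ ι (length es)
        N≡ = sym (length-sized n (d ℕ.+ t))

        Cmax≥0 : 0ℚ ≤ Cmax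
        Cmax≥0 = ≤-trans (*-nn F≥0 δ≥0) (≤-reflexive (sym Cmax≡))

        confSum≥0 : 0ℚ ≤ confSum H ŷ-rec Sp Fn
        confSum≥0 = ∑<-nn xm (λ x _ → ∑T-nn es (2 ℕ.+ x) (λ c → *-nn (bool-nn (isConf c)) (^-nn δ≥0 x)))

        strSum≥0 : 0ℚ ≤ strSum H ŷ-rec Sp Fn
        strSum≥0 = ∑<-nn xm (λ x _ → ∑T-nn es (2 ℕ.+ x) (λ c → *-nn (bool-nn (isConf c)) (*-nn (^-nn δ≥0 x) (∑-nn es (structAt≥0 H Sp c)))))

        pairSum≥0 : 0ℚ ≤ pairSum H ŷ-rec Sp Fn
        pairSum≥0 = ∑-nn es (λ R → ∑-nn es (λ R' → ∑-nn es (λ o → *-nn (bool-nn (pairOK R R' o)) (structAt≥0 H Sp (R ∷ R' ∷ []) o))))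

        open Budget {ι (length es)} {ι I * ρ} {δ} {GG} {confSum H ŷ-rec Sp Fn} {K} {CC} {CK} {strSum H ŷ-rec Sp Fn} {q} {pairSum H ŷ-rec Sp Fn} {ι I * β} {cap} {lam} {Cmax} {A₁} {A₂} {S 2} {B} {cD} {F} {Y₂} {Y₃} {ζ} {1ℚ + 1ℚ}
          (+-nn 0≤1 0≤1) (ι-nn (length es)) (*-nn (ι-nn I) ρ≥0) δ≥0 GG≥0 K≥0 CC≥0 CK≥0 q≥0 (*-nn (ι-nn I) β≥0) cap≥0 lam≥0
          Cmax≥0 A₁≥0 A₂≥0 (S≥0 2) B≥0 cD≥0 F≥0
          confSum≥0 strSum≥0 pairSum≥0
          ζ≥0 τ≤δ confSum≤ strSum≤ pairSum≤ (subst (λ N → δ * Y₂ ≤ B * N) N≡ Y₂≤) (subst (λ N → δ * δ * Y₃ ≤ B * N * ζ) N≡ Y₃≤) δ≤ (≤-reflexive Cmax≡) (inv-≤1 {suc n} (ℕ.s≤s ℕ.z≤n)) capl≤1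
          using (yield)
        open Constants GG K CC CK q A₁ A₂ (S 2) B cD F (1ℚ + 1ℚ)

        result : ∀ {e} → 0ℚ ≤ e → e * (a₁ + a₁) ≤ cap → e * (ζ * (a₂ + a₂ + a₅ (ι I * β))) ≤ cap → e * (lam * (ι I * β * K)) ≤ 1ℚ → 1ℚ ≤ cap →
          ∃ λ A → Good A × ι I * ρ * (ι N₀ * (e - ι 3)) ≤ e * ι (length A)
        result {e} e≥0 h₁ h₂ h₃ c = conclude (greedy H ŷ-rec Sp Fn Cmax≥0 q≥0)
          where
          open WithHyp H using (module Inv; Inv)
          TL' : ℚ
          TL' = TL H ŷ-rec Sp Fn
          conclude : (∃ λ s → Inv I s × ι I * ρ * (ι (length es) * cap - TL') ≤ cap * ι (length (acc s))) →
            ∃ λ A → Good A × ι I * ρ * (ι N₀ * (e - ι 3)) ≤ e * ι (length A)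
          conclude (s , iv , le) = acc s , Inv.good iv , subst (λ N → ι I * ρ * (N * (e - ι 3)) ≤ e * ι (length (acc s))) (sym N≡)
              (yield {e} {ι (length (acc s))} e≥0 h₁ h₂ h₃ c le)

-- The order in which the constants are chosen.

module LowerBound where
  open Q
  open Proc using (⌊⌋-true)
  open Vol
  open Count
  open Arith
  open Lower
  open Bounds
  open import Data.Rational using (_≤_)
  open import Data.Rational.Properties using (≤-reflexive; ≤-trans)
  open import Data.Nat using (_∸_)
  open import Data.Nat.Combinatorics using (_C_)

  module _ (d t' k : ℕ) (d≥1 : 1 ℕ.≤ d) (k≥2 : 2 ℕ.≤ k) (p : ℕ) where
    private
      t xm q₀ : ℕ
      t = suc t'
      xm = k ℕ.+ k ℕ.+ 1
      q₀ = (d ℕ.+ t) C t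

      open Asymptotic d t' xm d≥1 using (A₁; A₂; S; B; cD)

      e GG : ℚ
      e = ι (suc p)
      GG = ι (2 ℕ.^ (2 ℕ.* ((2 ℕ.+ xm) ℕ.* 2 ℕ.^ (2 ℕ.+ xm))))

      -- The argument of `archimedes` is e (a₁ + a₁) written out: `Constants` already takes K, which
      -- depends on `cp`, whereas a₁ does not. Then L beats K, and finally n beats `small`, which
      -- involves all of them.
      cp K₀ L : ℕ
      cp = suc (proj₁ (archimedes (e * (GG * (A₁ * B) + GG * (A₁ * B)))))
      K₀ = 2 ℕ.^ (2 ℕ.* (cp ℕ.+ q₀ ℕ.* p))
      L = suc p ℕ.* (q₀ ℕ.* p ℕ.* K₀) ℕ.+ (cp ℕ.+ suc p)

      K CC CK F G₁ : ℚ
      K = ι K₀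
      CC = ι (2 ℕ.+ xm) * ι (2 ℕ.+ xm) * ((1ℚ + 1ℚ) * K) ^ (2 ℕ.+ xm)
      CK = ι (2 ℕ.^ (2 ℕ.* ((2 ℕ.+ (xm ℕ.+ xm)) ℕ.* K₀)))
      G₁ = ι (2 ℕ.^ (2 ℕ.* (4 ℕ.* (2 ℕ.+ p))))
      F = ι cp * ι (2 ℕ.+ p) * (G₁ * G₁)

      open Constants GG K CC CK (ι q₀) A₁ A₂ (S 2) B cD F (1ℚ + 1ℚ)

      small : ℚ
      small = a₂ + a₂ + a₅ (ι (q₀ ℕ.* p))

      n₁ n₀ : ℕ
      n₁ = proj₁ (archimedes (e * small))
      n₀ = n₁ ℕ.+ suc (2 ℕ.* (t ℕ.+ d))

    module _ (n : ℕ) (n≥ : n₀ ℕ.≤ n) where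
      private
        n≥' : suc (2 ℕ.* (t ℕ.+ d)) ℕ.≤ n
        n≥' = ℕ.≤-trans (ℕ.m≤n+m _ n₁) n≥

        n≥'' : suc (2 ℕ.* (0 ℕ.+ (d ℕ.+ t))) ℕ.≤ n
        n≥'' = ℕ.≤-trans (ℕ.≤-reflexive (cong (λ s → suc (2 ℕ.* s)) (ℕ.+-comm d t))) n≥'

        D≥1 : 1 ℕ.≤ (n ∸ t) C d
        D≥1 = C-positive n t d n≥'

        N≥1 : 1 ℕ.≤ n C (d ℕ.+ t)
        N≥1 = C-positive n 0 (d ℕ.+ t) n≥''

        L≥ : suc p ℕ.≤ L
        L≥ = ℕ.≤-trans (ℕ.m≤n+m (suc p) cp) (ℕ.m≤n+m (cp ℕ.+ suc p) (suc p ℕ.* (q₀ ℕ.* p ℕ.* K₀)))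

        Lcp : cp ℕ.≤ L
        Lcp = ℕ.≤-trans (ℕ.m≤m+n cp (suc p)) (ℕ.m≤n+m (cp ℕ.+ suc p) (suc p ℕ.* (q₀ ℕ.* p ℕ.* K₀)))

        module In = Instance n d t k d≥1 k≥2 p cp L (ℕ.s≤s ℕ.z≤n) L≥ N≥1 D≥1
        module Ge = Geo.Geometry n d t k (sized n (d ℕ.+ t)) ∈-sized⁻ d≥1
        module To = Totals n d t' d≥1 n≥' In.hyp In.ŷ-rec In.sparse In.final

        bad-vol : ∀ c o X → In.bad c o X ≡ true → suc (vol (c ++ o ∷ X)) ℕ.≤ (length c ℕ.+ suc (length X)) ℕ.* d ℕ.+ t
        bad-vol c o X e = proj₂ (⌊⌋-true {d = In.bad? c o X} e)

        conf-vol : ∀ c → Ge.isConf c ≡ true → vol c ℕ.≤ length c ℕ.* d ℕ.+ t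
        conf-vol c e = proj₁ (proj₂ (proj₂ (proj₂ (Ge.conf-list {c} e))))

        τ≤δ : ι In.I * In.ρ ≤ In.δ
        τ≤δ = ≤-trans (≤-reflexive In.τ≡) (≤-trans (*-monoʳ In.δ≥0 In.θ≤1) (≤-reflexive (*-identityˡ In.δ)))

        F≥0 : 0ℚ ≤ F
        F≥0 = *-nn (*-nn (ι-nn cp) (ι-nn (2 ℕ.+ p))) (sq-nn G₁)

        Cmax≡ : In.Cmax ≡ F * In.δ
        Cmax≡ = trans (solve 5 (λ c e d x g → c :* (e :* d) :* (x :* x) :* (g :* g) := c :* e :* (g :* g) :* (d :* x) :* x) refl (ι cp) (ι (2 ℕ.+ p)) In.D In.δ G₁)
          (trans (cong (λ o → F * o * In.δ) In.Dδ) (cong (_* In.δ) (*-identityʳ F)))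

        CC≥0 : 0ℚ ≤ CC
        CC≥0 = *-nn (*-nn (ι-nn (2 ℕ.+ xm)) (ι-nn (2 ℕ.+ xm))) (^-nn (*-nn (+-nn 0≤1 0≤1) (ι-nn K₀)) (2 ℕ.+ xm))

        capl≤1 : ι cp * In.lam ≤ 1ℚ
        capl≤1 = ≤-trans (*-monoʳ In.lam≥0 (ι-mono Lcp)) (≤-reflexive (inv* (ℕ.≤-trans (ℕ.s≤s ℕ.z≤n) L≥)))

        cap≥1 : 1ℚ ≤ ι cp
        cap≥1 = ≤-by (ι-nn (proj₁ (archimedes (e * (a₁ + a₁))))) refl

        h₁ : e * (a₁ + a₁) ≤ ι cp
        h₁ = ≤-trans (proj₂ (archimedes (e * (a₁ + a₁)))) (ι-mono (ℕ.n≤1+n (proj₁ (archimedes (e * (a₁ + a₁))))))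

        h₂ : e * (inv (suc n) * small) ≤ ι cp
        h₂ = ≤-trans (≤-reflexive (solve 3 (λ e z s → e :* (z :* s) := z :* (e :* s)) refl e (inv (suc n)) small))
          (≤-trans (inv-≤ {b = 1ℚ} {n = suc n} (ℕ.s≤s ℕ.z≤n) (≤-trans (proj₂ (archimedes (e * small))) (≤-trans (ι-mono (ℕ.≤-trans (ℕ.m≤m+n n₁ _) (ℕ.≤-trans n≥ (ℕ.n≤1+n n)))) (≤-reflexive (sym (*-identityʳ _)))))) cap≥1)

        h₃ : e * (In.lam * (ι (q₀ ℕ.* p) * K)) ≤ 1ℚ
        h₃ = ≤-trans (≤-reflexive (trans (solve 3 (λ e l b → e :* (l :* b) := l :* (e :* b)) refl e In.lam (ι (q₀ ℕ.* p) * K)) (cong (In.lam *_) (trans (cong (e *_) (sym (ι-* (q₀ ℕ.* p) K₀))) (sym (ι-* (suc p) (q₀ ℕ.* p ℕ.* K₀)))))))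
          (inv-≤ (ℕ.≤-trans (ℕ.s≤s ℕ.z≤n) L≥) (≤-trans (ι-mono (ℕ.m≤m+n (suc p ℕ.* (q₀ ℕ.* p ℕ.* K₀)) (cp ℕ.+ suc p))) (≤-reflexive (sym (*-identityʳ (ι L))))))

        outcome : ∃ λ A → Ge.Good A × ι In.I * In.ρ * (ι (n C (d ℕ.+ t)) * (e - ι 3)) ≤ e * ι (length A)
        outcome = To.result bad-vol conf-vol τ≤δ {F} F≥0 Cmax≡ (ι-nn (2 ℕ.^ (2 ℕ.* ((2 ℕ.+ xm) ℕ.* 2 ℕ.^ (2 ℕ.+ xm))))) CC≥0 (ι-nn q₀) capl≤1 {e} (ι-nn (suc p)) h₁
          (subst (λ b → e * (inv (suc n) * (a₂ + a₂ + a₅ b)) ≤ ι cp) (sym In.Iβ≡) h₂)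
          (subst (λ b → e * (In.lam * (b * K)) ≤ 1ℚ) (sym In.Iβ≡) h₃) cap≥1

        D N : ℚ
        D = ι ((n ∸ t) C d)
        N = ι (n C (d ℕ.+ t))

        -- Removes the inverses in τ = p δ / (p + 2), so that the statement passed on has no trace
        -- of the process.
        clear : ∀ {ℓ} → ι In.I * In.ρ * (N * (e - ι 3)) ≤ e * ℓ → ι p * (e - ι 3) * N ≤ e * ι (2 ℕ.+ p) * (ℓ * D)
        clear {ℓ} le = ≤-trans (≤-reflexive eq) (≤-trans (*-monoˡ (*-nn (ι-nn (2 ℕ.+ p)) (ι-nn ((n ∸ t) C d))) le)
            (≤-reflexive (solve 4 (λ a d e l → a :* d :* (e :* l) := e :* a :* (l :* d)) refl (ι (2 ℕ.+ p)) D e ℓ)))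
          where
          i = inv (2 ℕ.+ p)
          eq : ι p * (e - ι 3) * N ≡ ι (2 ℕ.+ p) * D * (ι In.I * In.ρ * (N * (e - ι 3)))
          eq = trans (trans (solve 2 (λ x n → x :* n := x :* n :* (𝟙 :* 𝟙)) refl (ι p * (e - ι 3)) N)
              (cong₂ (λ u v → ι p * (e - ι 3) * N * (u * v)) (sym (inv* {2 ℕ.+ p} (ℕ.s≤s ℕ.z≤n))) (sym In.Dδ)))
            (trans (solve 7 (λ p x n a i d δ → p :* x :* n :* (a :* i :* (d :* δ)) := a :* d :* (p :* i :* δ :* (n :* x))) refl (ι p) (e - ι 3) N (ι (2 ℕ.+ p)) i D In.δ)
              (cong (λ z → ι (2 ℕ.+ p) * D * (z * (N * (e - ι 3)))) (sym In.τ≡)))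

      lower-bound : ∃ λ A → Ge.Good A × ι p * (e - ι 3) * N ≤ e * ι (2 ℕ.+ p) * (ι (length A) * D)
      lower-bound = let (A , g , le) = outcome in A , g , clear le

    threshold : ℕ
    threshold = n₀

-- Gadgets and their removal.

module Gadget where
  open Lists
  open Vol
  open import Data.Nat using (_+_; _*_; _≤_; z≤n; s≤s; s≤s⁻¹; _≤?_)
  open import Data.Nat.Properties using (≤-trans; ≤-reflexive; +-monoˡ-≤; +-mono-≤; +-cancelʳ-≤; +-cancelˡ-≤)
  open import Data.Fin.Subset using (Subset; ∣_∣; ⋃; _⊆_) renaming (_∈_ to _∈ᵥ_)
  open import Data.List.Relation.Binary.Disjoint.Propositional using (Disjoint)

  private variable
    A : Set
    n : ℕ

  take-⊑ : ∀ m (xs : List A) → take m xs ⊑ xs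
  take-⊑ (suc m) (x ∷ xs) (here e) = here e
  take-⊑ (suc m) (x ∷ xs) (there i) = there (take-⊑ m xs i)

  length-take-≤ : ∀ m (xs : List A) → m ≤ length xs → length (take m xs) ≡ m
  length-take-≤ zero xs l = refl
  length-take-≤ (suc m) (x ∷ xs) l = cong suc (length-take-≤ m xs (s≤s⁻¹ l))

  take-++ˡ : ∀ m (xs ys : List A) → m ≤ length xs → take m (xs ++ ys) ≡ take m xs
  take-++ˡ zero xs ys l = refl
  take-++ˡ (suc m) (x ∷ xs) ys l = cong (x ∷_) (take-++ˡ m xs ys (s≤s⁻¹ l))

  take-++ʳ : ∀ j (xs ys : List A) → take (length xs + j) (xs ++ ys) ≡ xs ++ take j ys
  take-++ʳ j [] ys = refl
  take-++ʳ j (x ∷ xs) ys = cong (x ∷_) (take-++ʳ j xs ys)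

  take-all : ∀ (xs : List A) → take (length xs) xs ≡ xs
  take-all [] = refl
  take-all (x ∷ xs) = cong (x ∷_) (take-all xs)

  vol-++ : ∀ (Z : Subset n) P Q → Z ⊆ ⋃ P → Z ⊆ ⋃ Q → vol (P ++ Q) + ∣ Z ∣ ≤ vol P + vol Q
  vol-++ Z P Q zp zq = ≤-trans (≤-reflexive (cong (vol (P ++ Q) +_) (sym (vol-[] Z))))
      (submod (P ++ Q) P Q (Z ∷ []) (λ m → m) (λ m → zp (un m)) (λ m → zq (un m)))
    where
    un : ∀ {x} → x ∈ᵥ ⋃ (Z ∷ []) → x ∈ᵥ Z
    un m with ⋃⁻ (Z ∷ []) m
    ... | _ , here refl , i = i

  -- A gadget gains one vertex over a chain of edges each meeting the union of the previous ones in t vertices.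
  module Gadgets (n d t' : ℕ) where
    t : ℕ
    t = suc t'

    E : Set
    E = Subset n

    open Decide {E} _≟ₛ_

    -- The first two edges must themselves be dense, so that every nonempty prefix of a gadget is
    -- dense and a sequence of gadgets can be cut after exactly k edges.
    IsGadget : List E → Set
    IsGadget g = Unique g × vol (take 2 g) ≤ 2 * d + t × suc (vol g) ≤ length g * d + t

    isGadget? : ∀ g → Dec (IsGadget g)
    isGadget? g = unique? g ×-dec (vol (take 2 g) ≤? 2 * d + t ×-dec suc (vol g) ≤? length g * d + t)

    Short : List E → Set
    Short g = 2 ≤ length g × length g ≤ 3

    GadgetFree : List E → Set
    GadgetFree H = ∀ g → g ⊑ H → Short g → ¬ IsGadget g

    find-gadget : ∀ H → (∃ λ g → g ⊑ H × Short g × IsGadget g) ⊎ GadgetFree H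
    find-gadget H with ∃list? isGadget? H 2 | ∃list? isGadget? H 3
    ... | yes (g , g∈ , e , p) | _ = inj₁ (g , All.lookup g∈ , (≤-reflexive (sym e) , ≤-trans (≤-reflexive e) (ℕ.n≤1+n 2)) , p)
    ... | no _ | yes (g , g∈ , e , p) = inj₁ (g , All.lookup g∈ , (≤-trans (ℕ.n≤1+n 2) (≤-reflexive (sym e)) , ≤-reflexive e) , p)
    ... | no n2 | no n3 = inj₂ none
      where
      none : GadgetFree H
      none (a ∷ b ∷ []) s l p = n2 (_ , All.tabulate s , refl , p)
      none (a ∷ b ∷ c ∷ []) s l p = n3 (_ , All.tabulate s , refl , p)
      none [] s (() , _) p
      none (_ ∷ []) s (s≤s () , _) p
      none (_ ∷ _ ∷ _ ∷ _ ∷ _) s (_ , s≤s (s≤s (s≤s ()))) p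

    record Extraction (H : List E) : Set where
      constructor extraction
      field
        G : List (List E)
        rest : List E
        gadgets : All (λ g → g ⊑ H × Short g × IsGadget g) G
        disjoint : AllPairs Disjoint G
        rest⊑ : rest ⊑ H
        rest! : Unique rest
        rest-free : GadgetFree rest
        count : length H ≤ length rest + 3 * length G

    -- Greedy removal: as long as a gadget exists, its at most three edges are deleted, which keeps
    -- the family disjoint. `m` is fuel.
    extract : ∀ m H → length H ≤ m → Unique H → Extraction H
    extract m H l u with find-gadget H
    ... | inj₂ f = extraction [] H [] [] (λ i → i) u f (≤-reflexive (sym (ℕ.+-identityʳ (length H))))
    extract zero [] l u | inj₁ (a ∷ g , s , _) = ⊥-elim (absurd (s (here refl)))
      where absurd : ∀ {X : Set} {x : E} → x ∈ [] → X
            absurd ()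
    extract zero H l u | inj₁ ([] , _ , (() , _) , _)
    extract (suc m) H l u | inj₁ (g , g⊑ , sh , p) = add (extract m (out H g) smaller (out-unique g u))
      where
      in≤ : length (inn H g) ≤ length g
      in≤ = unique-length (inn-unique g u) (λ i → proj₂ (inn⁻ {H} {g} i))
      in≥1 : ∀ g → g ⊑ H → Short g → 1 ≤ length (inn H g)
      in≥1 [] s (() , _)
      in≥1 (x ∷ g) s _ = nonempty (inn⁺ {H} {x ∷ g} (s (here refl)) (here refl))
        where
        nonempty : ∀ {x : E} {V} → x ∈ V → 1 ≤ length V
        nonempty (here _) = s≤s z≤n
        nonempty (there _) = s≤s z≤n
      smaller : length (out H g) ≤ m
      smaller = s≤s⁻¹ (≤-trans (+-monoˡ-≤ (length (out H g)) (in≥1 g g⊑ sh)) (≤-trans (≤-reflexive (length-inn-out H g)) l))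
      add : Extraction (out H g) → Extraction H
      add (extraction G R gs dj r! ru rf c) = extraction (g ∷ G) R
        ((g⊑ , sh , p) ∷ All.map (λ { {g'} (s , q) → (λ {x} i → proj₁ (out⁻ {H} {g} (s i))) , q }) gs)
        (All.map (λ { (s , q) (i , j) → proj₂ (out⁻ {H} {g} (s j)) i }) gs ∷ dj) (λ i → proj₁ (out⁻ {H} {g} (r! i))) ru rf
        (≤-trans (≤-reflexive (sym (length-inn-out H g))) (≤-trans (+-mono-≤ (≤-trans in≤ (proj₂ sh)) c) (≤-reflexive (ar (length R) (length G)))))
        where
        ar : ∀ r g → 3 + (r + 3 * g) ≡ r + 3 * suc g
        ar = solve-∀
    extract zero (x ∷ H) () u | inj₁ (_ ∷ _ , _)

    prefix : ∀ {g} → (∀ {p} → p ∈ g → ∣ p ∣ ≡ d + t) → Short g → IsGadget g → ∀ m → 1 ≤ m → m ≤ length g → vol (take m g) ≤ m * d + t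
    prefix {a ∷ g} sz sh (_ , p2 , ti) 1 _ _ = ≤-reflexive (trans (vol-[] a) (trans (sz (here refl)) (cong (_+ t) (sym (ℕ.+-identityʳ d)))))
    prefix {g} sz sh (_ , p2 , ti) 2 _ _ = p2
    prefix {g} sz (_ , l3) (_ , p2 , ti) (suc (suc (suc m))) _ l = all (ℕ.≤-antisym l (≤-trans l3 (s≤s (s≤s (s≤s z≤n)))))
      where
      all : ∀ {j} → j ≡ length g → vol (take j g) ≤ j * d + t
      all refl = subst (λ L → vol L ≤ length g * d + t) (sym (take-all g)) (ℕ.<⇒≤ ti)

    -- Gadgets through a common (t - 1)-set Z: the gain of each complete gadget pays for its overlap with Z.
    chain : ∀ Z → ∣ Z ∣ ≡ t' → ∀ G → All (λ g → Z ⊆ ⋃ (take 1 g) × (∀ {p} → p ∈ g → ∣ p ∣ ≡ d + t) × Short g × IsGadget g) G →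
      ∀ m → 1 ≤ m → m ≤ length (concat G) → Z ⊆ ⋃ (take m (concat G)) × vol (take m (concat G)) ≤ m * d + t
    chain Z sZ [] [] (suc m) l ()
    chain Z sZ (g ∷ G) ((zg , sz , sh , ig) ∷ gs) m l lm with m ≤? length g
    ... | yes p = (λ i → grow (zg i)) , subst (λ L → vol L ≤ m * d + t) (sym (take-++ˡ m g (concat G) p)) (prefix sz sh ig m l p)
      where
      grow : ∀ {x} → x ∈ᵥ ⋃ (take 1 g) → x ∈ᵥ ⋃ (take m (g ++ concat G))
      grow = ⋃-⊑ {L = take 1 g} {take m (g ++ concat G)} (sub m g l p)
        where
        sub : ∀ m g → 1 ≤ m → m ≤ length g → take 1 g ⊑ take m (g ++ concat G)
        sub (suc m) (x ∷ g) l p (here e) = here e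
    ... | no q with ℕ.m≤n⇒∃[o]m+o≡n (ℕ.≰⇒> q)
    ...   | j , refl = step (chain Z sZ G gs (suc j) (s≤s z≤n) (+-cancelˡ-≤ (length g) _ _ (≤-trans (≤-reflexive (ℕ.+-suc (length g) j)) (≤-trans lm (≤-reflexive (length-++ g))))))
      where
      te : take (suc (length g + j)) (g ++ concat G) ≡ g ++ take (suc j) (concat G)
      te = trans (cong (λ z → take z (g ++ concat G)) (sym (ℕ.+-suc (length g) j))) (take-++ʳ (suc j) g (concat G))
      ar : ∀ l j d t → l * d + suc t + (suc j * d + suc t) ≡ suc (suc (l + j) * d + suc t + t)
      ar = solve-∀
      Zg : Z ⊆ ⋃ g
      Zg i = ⋃-⊑ {L = take 1 g} {g} (take-⊑ 1 g) (zg i)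
      step : Z ⊆ ⋃ (take (suc j) (concat G)) × vol (take (suc j) (concat G)) ≤ suc j * d + t →
        Z ⊆ ⋃ (take (suc (length g + j)) (g ++ concat G)) × vol (take (suc (length g + j)) (g ++ concat G)) ≤ suc (length g + j) * d + t
      step (zr , vr) = subst (λ L → Z ⊆ ⋃ L × vol L ≤ suc (length g + j) * d + t) (sym te)
        ((λ i → ⋃-⊑ {L = g} {g ++ take (suc j) (concat G)} ∈-++⁺ˡ (Zg i)) ,
          +-cancelʳ-≤ t' _ _ (s≤s⁻¹ (≤-trans (s≤s (≤-trans (≤-reflexive (cong (vol (g ++ take (suc j) (concat G)) +_) (sym sZ))) (vol-++ Z g (take (suc j) (concat G)) Zg zr)))
            (≤-trans (+-mono-≤ (proj₂ (proj₂ ig)) vr) (≤-reflexive (ar (length g) j d t'))))))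

-- The charging argument of the upper bound.

module Upper where
  open Q
  open Lists
  open Vol
  open Count
  open Arith
  open Gadget
  open Lower using (∧-intro; ⌊⌋-yes; sized-below)
  open Proc using (∧-true; not-true; ⌊⌋-true; ⌊⌋-false)
  import Data.Bool as Bool
  open import Data.Rational using (_≤_)
  open import Data.Rational.Properties using (≤-refl; ≤-reflexive; ≤-trans)
  open import Data.Nat.Combinatorics using (_C_; nCn≡1)
  open import Data.Fin using (Fin)
  open import Data.Vec using ([]; _∷_; here; there)
  open import Data.Fin.Subset using (Subset; ∣_∣; _∩_; ⋃; _⊆_) renaming (_∈_ to _∈ᵥ_)
  open import Data.Fin.Subset.Properties using (p⊆q⇒∣p∣≤∣q∣; p⊂q⇒∣p∣<∣q∣; x∈p∩q⁺; x∈p∩q⁻; ⊆-antisym)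
  import Data.List.Relation.Unary.All.Properties as All
  import Data.List.Relation.Unary.AllPairs.Properties as AllPairs
  import Data.List.Relation.Unary.Unique.Propositional.Properties as Unique
  open import Data.List.Relation.Binary.Disjoint.Propositional using (Disjoint)

  private variable
    A : Set

  sel : (A → Bool) → List A → List A
  sel f = filter (λ x → f x Bool.≟ true)

  sel⁻ : ∀ (f : A → Bool) xs {x} → x ∈ sel f xs → x ∈ xs × f x ≡ true
  sel⁻ f xs = ∈-filter⁻ (λ x → f x Bool.≟ true) {xs = xs}

  sel⁺ : ∀ (f : A → Bool) {xs x} → x ∈ xs → f x ≡ true → x ∈ sel f xs
  sel⁺ f = ∈-filter⁺ (λ x → f x Bool.≟ true)

  sel-unique : ∀ (f : A → Bool) {xs} → Unique xs → Unique (sel f xs)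
  sel-unique f = Unique.filter⁺ (λ x → f x Bool.≟ true)

  ∑-sel : ∀ (f : A → Bool) xs → ∑ xs (λ x → bool (f x)) ≡ ι (length (sel f xs))
  ∑-sel f [] = refl
  ∑-sel f (x ∷ xs) with f x
  ... | true = cong (1ℚ +_) (∑-sel f xs)
  ... | false = trans (+-identityˡ _) (∑-sel f xs)

  vol-∷ : ∀ {n} (f : Subset n) L → vol (f ∷ L) ℕ.+ ∣ f ∩ ⋃ L ∣ ≡ ∣ f ∣ ℕ.+ vol L
  vol-∷ f L = trans (cong (ℕ._+ ∣ f ∩ ⋃ L ∣) (vol≡ (f ∷ L))) (trans (∪+∩ f (⋃ L)) (cong (∣ f ∣ ℕ.+_) (sym (vol≡ L))))

  ⊈-witness : ∀ {n} (q p : Subset n) → (q ⊆ᵇ p) ≡ false → ∃ λ x → x ∈ᵥ q × ¬ x ∈ᵥ p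
  ⊈-witness [] [] ()
  ⊈-witness (true ∷ q) (false ∷ p) e = Fin.zero , here , λ ()
  ⊈-witness (true ∷ q) (true ∷ p) e with ⊈-witness q p e
  ... | x , a , b = Fin.suc x , there a , λ { (there c) → b c }
  ⊈-witness (false ∷ q) (_ ∷ p) e with ⊈-witness q p e
  ... | x , a , b = Fin.suc x , there a , λ { (there c) → b c }

  ⊆-card : ∀ {n} {p q : Subset n} → p ⊆ q → ∣ q ∣ ℕ.≤ ∣ p ∣ → p ≡ q
  ⊆-card {p = p} {q} s l with (q ⊆ᵇ p) in e
  ... | true = ⊆-antisym s (⊆ᵇ⇒⊆ {p = q} {p} e)
  ... | false = ⊥-elim (ℕ.<⇒≱ (p⊂q⇒∣p∣<∣q∣ (s , ⊈-witness q p e)) l)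

  module Pairs (n d t' k κ : ℕ) (k≡ : k ≡ κ ℕ.+ κ) (κ≥1 : 1 ℕ.≤ κ) where
    open Gadgets n d t'

    ps : List E
    ps = sized n t

    module Sparse (H : List E) (H! : Unique H) (size : ∀ {p} → p ∈ H → ∣ p ∣ ≡ d ℕ.+ t) (gf : GadgetFree H)
      (free : ∀ c → Unique c → c ⊑ H → length c ≡ k → ¬ vol c ℕ.≤ k ℕ.* d ℕ.+ t) where

      k≥2 : 2 ℕ.≤ k
      k≥2 = ℕ.≤-trans (ℕ.+-mono-≤ κ≥1 κ≥1) (ℕ.≤-reflexive (sym k≡))

      ar2 : ∀ d t → d ℕ.+ t ℕ.+ (d ℕ.+ t) ≡ 2 ℕ.* d ℕ.+ t ℕ.+ t
      ar2 = solve-∀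

      vol-pair : ∀ {a b} → a ∈ H → b ∈ H → vol (a ∷ b ∷ []) ℕ.+ ∣ b ∩ a ∣ ≡ 2 ℕ.* d ℕ.+ t ℕ.+ t
      vol-pair {a} {b} a∈ b∈ = trans (vol2 b a) (trans (cong₂ ℕ._+_ (size b∈) (size a∈)) (ar2 d t))

      meet2 : ∀ {a b} → a ∈ H → b ∈ H → ¬ a ≡ b → ∣ b ∩ a ∣ ℕ.≤ t
      meet2 {a} {b} a∈ b∈ ne with ∣ b ∩ a ∣ ℕ.≤? t
      ... | yes p = p
      ... | no q = ⊥-elim (gf (a ∷ b ∷ []) (λ { (here refl) → a∈ ; (there (here refl)) → b∈ }) (ℕ.≤-refl , ℕ.n≤1+n 2) (((ne ∷ []) ∷ [] ∷ []) , ℕ.<⇒≤ tight , tight))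
        where
        tight : suc (vol (a ∷ b ∷ [])) ℕ.≤ 2 ℕ.* d ℕ.+ t
        tight = ℕ.+-cancelʳ-≤ t _ _ (ℕ.≤-trans (ℕ.≤-trans (ℕ.≤-reflexive (sym (ℕ.+-suc _ t))) (ℕ.+-monoʳ-≤ (vol (a ∷ b ∷ [])) (ℕ.≰⇒> q))) (ℕ.≤-reflexive (vol-pair a∈ b∈)))

      pair-vol : ∀ {a b} → a ∈ H → b ∈ H → t ℕ.≤ ∣ b ∩ a ∣ → vol (a ∷ b ∷ []) ℕ.≤ 2 ℕ.* d ℕ.+ t
      pair-vol {a} {b} a∈ b∈ l = ℕ.+-cancelʳ-≤ t _ _ (ℕ.≤-trans (ℕ.+-monoʳ-≤ (vol (a ∷ b ∷ [])) l) (ℕ.≤-reflexive (vol-pair a∈ b∈)))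

      -- If a and b share t vertices, they are dense; a third edge with more than t vertices in
      -- their union would complete a gadget.
      meet3 : ∀ {a b c} → a ∈ H → b ∈ H → c ∈ H → ¬ a ≡ b → ¬ a ≡ c → ¬ b ≡ c → t ℕ.≤ ∣ b ∩ a ∣ → ∣ c ∩ ⋃ (a ∷ b ∷ []) ∣ ℕ.≤ t
      meet3 {a} {b} {c} a∈ b∈ c∈ ab ac bc l with ∣ c ∩ ⋃ (a ∷ b ∷ []) ∣ ℕ.≤? t
      ... | yes p = p
      ... | no q = ⊥-elim (gf (a ∷ b ∷ c ∷ []) (λ { (here refl) → a∈ ; (there (here refl)) → b∈ ; (there (there (here refl))) → c∈ }) (ℕ.n≤1+n 2 , ℕ.≤-refl)
          (((ab ∷ ac ∷ []) ∷ (bc ∷ []) ∷ [] ∷ []) , pair-vol a∈ b∈ l , tight))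
        where
        ar3 : ∀ d t → d ℕ.+ t ℕ.+ (2 ℕ.* d ℕ.+ t) ≡ 3 ℕ.* d ℕ.+ t ℕ.+ t
        ar3 = solve-∀
        tight : suc (vol (a ∷ b ∷ c ∷ [])) ℕ.≤ 3 ℕ.* d ℕ.+ t
        tight = ℕ.+-cancelʳ-≤ t _ _ (ℕ.≤-trans (ℕ.≤-trans (ℕ.≤-reflexive (sym (ℕ.+-suc _ t)))
            (ℕ.+-mono-≤ (vol-⊑ {L = a ∷ b ∷ c ∷ []} {c ∷ a ∷ b ∷ []} λ { (here refl) → there (here refl) ; (there (here refl)) → there (there (here refl)) ; (there (there (here refl))) → here refl }) (ℕ.≰⇒> q)))
          (ℕ.≤-trans (ℕ.≤-reflexive (vol-∷ c (a ∷ b ∷ []))) (ℕ.≤-trans (ℕ.+-mono-≤ (ℕ.≤-reflexive (size c∈)) (pair-vol a∈ b∈ l)) (ℕ.≤-reflexive (ar3 d t)))))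

      grow : ∀ fs B → (∀ {f} → f ∈ fs → f ∈ H × t ℕ.≤ ∣ f ∩ ⋃ B ∣) → vol (fs ++ B) ℕ.≤ length fs ℕ.* d ℕ.+ vol B
      grow [] B h = ℕ.≤-refl
      grow (f ∷ fs) B h = ℕ.+-cancelʳ-≤ t _ _ (ℕ.≤-trans (ℕ.+-monoʳ-≤ (vol (f ∷ fs ++ B)) (ℕ.≤-trans (proj₂ (h (here refl)))
          (p⊆q⇒∣p∣≤∣q∣ (λ m → let (x , y) = x∈p∩q⁻ f (⋃ B) m in x∈p∩q⁺ (x , ⋃-⊑ {L = B} {fs ++ B} (∈-++⁺ʳ fs) y)))))
        (ℕ.≤-trans (ℕ.≤-reflexive (vol-∷ f (fs ++ B))) (ℕ.≤-trans (ℕ.+-mono-≤ (ℕ.≤-reflexive (size (proj₁ (h (here refl))))) (grow fs B (λ m → h (there m)))) (ℕ.≤-reflexive (ar d t (length fs ℕ.* d) (vol B))))))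
        where
        ar : ∀ d t l v → d ℕ.+ t ℕ.+ (l ℕ.+ v) ≡ d ℕ.+ l ℕ.+ v ℕ.+ t
        ar = solve-∀

      through : E → List E
      through T = sel (T ⊆ᵇ_) H

      through⁻ : ∀ {T f} → f ∈ through T → f ∈ H × T ⊆ f
      through⁻ {T} {f} m = proj₁ (sel⁻ (T ⊆ᵇ_) H m) , λ {x} → ⊆ᵇ⇒⊆ {p = T} {f} (proj₂ (sel⁻ (T ⊆ᵇ_) H m)) {x}

      through! : ∀ T → Unique (through T)
      through! T = sel-unique (T ⊆ᵇ_) H!

      -- An edge with t vertices in the union of B adds at most d vertices. Hence j such edges would
      -- complete the dense B to a configuration of k edges.
      cap-list : ∀ fs B j → Unique (fs ++ B) → B ⊑ H → (∀ {f} → f ∈ fs → f ∈ H × t ℕ.≤ ∣ f ∩ ⋃ B ∣) → j ℕ.+ length B ≡ k → vol B ℕ.≤ length B ℕ.* d ℕ.+ t → ¬ j ℕ.≤ length fs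
      cap-list fs B j u B⊑ h e vB l = free (gs ++ B) gu (λ m → sub m) (trans (length-++ gs) (trans (cong (ℕ._+ length B) (length-take-≤ j fs l)) e))
          (ℕ.≤-trans (grow gs B (λ m → h (take-⊑ j fs m))) (ℕ.≤-trans (ℕ.+-mono-≤ (ℕ.≤-reflexive (cong (ℕ._* d) (length-take-≤ j fs l))) vB)
            (ℕ.≤-reflexive (trans (ar j (length B) d t) (cong (λ z → z ℕ.* d ℕ.+ t) e)))))
        where
        gs = take j fs
        ar : ∀ j b d t → j ℕ.* d ℕ.+ (b ℕ.* d ℕ.+ t) ≡ (j ℕ.+ b) ℕ.* d ℕ.+ t
        ar = solve-∀
        gu : Unique (gs ++ B)
        gu = cut j fs u
          where
          cut : ∀ j fs → Unique (fs ++ B) → Unique (take j fs ++ B)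
          cut zero [] u = u
          cut zero (f ∷ fs) (_ ∷ u) = cut zero fs u
          cut (suc j) [] u = u
          cut (suc j) (f ∷ fs) (a ∷ u) = All.tabulate (λ m → All.lookup a (mid j fs m)) ∷ cut j fs u
            where
            mid : ∀ j fs {x} → x ∈ (take j fs ++ B) → x ∈ (fs ++ B)
            mid j fs m with ∈-++⁻ (take j fs) m
            ... | inj₁ i = ∈-++⁺ˡ (take-⊑ j fs i)
            ... | inj₂ i = ∈-++⁺ʳ fs i
        sub : (gs ++ B) ⊑ H
        sub m with ∈-++⁻ gs m
        ... | inj₁ i = proj₁ (h (take-⊑ j fs i))
        ... | inj₂ i = B⊑ i

      degree-≤ : ∀ T → ∣ T ∣ ≡ t → length (through T) ℕ.≤ k
      degree-≤ T sT with through T in e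
      ... | [] = ℕ.z≤n
      ... | x ∷ fs with length fs ℕ.<? k
      ...   | yes p = p
      ...   | no q = ⊥-elim (cap-list fs (x ∷ []) (k ℕ.∸ 1) u (λ { (here refl) → proj₁ (in' (here refl)) }) (λ {f} m → proj₁ (in' (there m)) , meets (proj₂ (in' (there m))))
           (ℕ.m∸n+n≡m (ℕ.≤-trans (ℕ.n≤1+n 1) k≥2)) (ℕ.≤-reflexive (trans (vol-[] x) (trans (size (proj₁ (in' (here refl)))) (cong (ℕ._+ t) (sym (ℕ.+-identityʳ d)))))) (ℕ.≤-trans (ℕ.m∸n≤m k 1) (ℕ.≮⇒≥ q)))
        where
        in' : ∀ {f} → f ∈ (x ∷ fs) → f ∈ H × T ⊆ f
        in' m = through⁻ {T} (subst (_ ∈_) (sym e) m)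
        u : Unique (fs ++ x ∷ [])
        u with subst Unique e (through! T)
        ... | a ∷ v = Unique.++⁺ v ([] ∷ []) λ { (i , here refl) → All.lookup a i refl }
        meets : ∀ {f} → T ⊆ f → t ℕ.≤ ∣ f ∩ ⋃ (x ∷ []) ∣
        meets {f} s = ℕ.≤-trans (ℕ.≤-reflexive (sym sT)) (p⊆q⇒∣p∣≤∣q∣ {p = T} (λ m → x∈p∩q⁺ (s m , ⋃⁺ {L = x ∷ []} (here refl) (proj₂ (in' (here refl)) m))))

      -- Applied to the list of edges through T; its first two entries serve as the one fixed pair
      -- that T uses for all its charges.
      mixed : List E → E → Bool
      mixed (x ∷ y ∷ _) T' = (T' ⊆ᵇ ⋃ (x ∷ y ∷ [])) ∧ (not (T' ⊆ᵇ x) ∧ not (T' ⊆ᵇ y))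
      mixed _ T' = false

      heavy covered : List E → Bool
      heavy (_ ∷ _ ∷ _) = true
      heavy _ = false
      covered [] = false
      covered (_ ∷ _) = true

      record Pair (T T' : E) : Set where
        field
          {x y} : E
          pair≡ : take 2 (through T) ≡ x ∷ y ∷ []
          x∈ : x ∈ H
          y∈ : y ∈ H
          x≢y : ¬ x ≡ y
          Tx : T ⊆ x
          Ty : T ⊆ y
          T'⊆ : T' ⊆ ⋃ (x ∷ y ∷ [])
          T'x : (T' ⊆ᵇ x) ≡ false
          T'y : (T' ⊆ᵇ y) ≡ false

      mixed-pair : ∀ {T T'} → mixed (through T) T' ≡ true → Pair T T'
      mixed-pair {T} {T'} e = go (through T) refl e
        where
        go : ∀ L → through T ≡ L → mixed L T' ≡ true → Pair T T'
        go (x ∷ y ∷ L) eq m with ∧-true {T' ⊆ᵇ ⋃ (x ∷ y ∷ [])} m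
        ... | m₁ , m' with ∧-true {not (T' ⊆ᵇ x)} m'
        ...   | m₂ , m₃ = record { pair≡ = cong (take 2) eq ; x∈ = proj₁ (in' (here refl)) ; y∈ = proj₁ (in' (there (here refl))) ; x≢y = ne (subst Unique eq (through! T))
                  ; Tx = λ {z} → proj₂ (in' (here refl)) {z} ; Ty = λ {z} → proj₂ (in' (there (here refl))) {z} ; T'⊆ = λ {z} → ⊆ᵇ⇒⊆ {p = T'} {⋃ (x ∷ y ∷ [])} m₁ {z} ; T'x = not-true m₂ ; T'y = not-true m₃ }
          where
          in' : ∀ {f} → f ∈ (x ∷ y ∷ L) → f ∈ H × T ⊆ f
          in' i = through⁻ {T} (subst (_ ∈_) (sym eq) i)
          ne : Unique (x ∷ y ∷ L) → ¬ x ≡ y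
          ne ((a ∷ _) ∷ _) = a

      ∩-big : ∀ {T a b : E} → ∣ T ∣ ≡ t → T ⊆ a → T ⊆ b → t ℕ.≤ ∣ a ∩ b ∣
      ∩-big {T} sT Ta Tb = ℕ.≤-trans (ℕ.≤-reflexive (sym sT)) (p⊆q⇒∣p∣≤∣q∣ {p = T} (λ m → x∈p∩q⁺ (Ta m , Tb m)))

      -- T' has a vertex v outside a, so v lies in both b and b'. If b and b' differ, then b' meets
      -- a ∪ b in S and v, more than t vertices, against `meet3`. If they are equal, T and S both
      -- coincide with b ∩ a.
      clash : ∀ {T S T' a b b'} → ∣ T ∣ ≡ t → ∣ S ∣ ≡ t → a ∈ H → b ∈ H → b' ∈ H → ¬ a ≡ b → ¬ a ≡ b' → T ⊆ a → T ⊆ b → S ⊆ a → S ⊆ b' →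
        T' ⊆ ⋃ (a ∷ b ∷ []) → T' ⊆ ⋃ (a ∷ b' ∷ []) → (T' ⊆ᵇ a) ≡ false → T ≡ S
      clash {T} {S} {T'} {a} {b} {b'} sT sS a∈ b∈ b'∈ ab ab' Ta Tb Sa Sb' u u' na with b ≟ₛ b'
      ... | yes refl = trans (eq sT Ta Tb) (sym (eq sS Sa Sb'))
        where
        eq : ∀ {T} → ∣ T ∣ ≡ t → T ⊆ a → T ⊆ b → T ≡ b ∩ a
        eq {T} sT Ta Tb = ⊆-card {p = T} {b ∩ a} (λ m → x∈p∩q⁺ (Tb m , Ta m)) (ℕ.≤-trans (meet2 a∈ b∈ ab) (ℕ.≤-reflexive (sym sT)))
      ... | no bb' with ⊈-witness T' a na
      ...   | v , vT' , va = ⊥-elim (ℕ.<⇒≱ (ℕ.≤-<-trans (ℕ.≤-reflexive (sym sS)) (p⊂q⇒∣p∣<∣q∣ strict)) (meet3 a∈ b∈ b'∈ ab ab' bb' (∩-big sT Tb Ta)))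
        where
        open import Data.Fin.Subset using (_⊂_)
        other : ∀ {b} → T' ⊆ ⋃ (a ∷ b ∷ []) → v ∈ᵥ b
        other {b} u with ⋃⁻ (a ∷ b ∷ []) (u vT')
        ... | _ , here refl , i = ⊥-elim (va i)
        ... | _ , there (here refl) , i = i
        strict : S ⊂ (b' ∩ ⋃ (a ∷ b ∷ []))
        strict = (λ m → x∈p∩q⁺ (Sb' m , ⋃⁺ {L = a ∷ b ∷ []} (here refl) (Sa m))) , v , x∈p∩q⁺ (other {b'} u' , ⋃⁺ {L = a ∷ b ∷ []} (there (here refl)) (other {b} u)) , λ m → va (Sa m)

      swap⋃ : ∀ {T' a b : E} → T' ⊆ ⋃ (a ∷ b ∷ []) → T' ⊆ ⋃ (b ∷ a ∷ [])
      swap⋃ {T'} {a} {b} s m = ⋃-⊑ {L = a ∷ b ∷ []} {b ∷ a ∷ []} (λ { (here refl) → there (here refl) ; (there (here refl)) → here refl }) (s m)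

      record Split (T T' a : E) : Set where
        field
          {b} : E
          b∈ : b ∈ H
          a∈ : a ∈ H
          a≢b : ¬ a ≡ b
          Ta : T ⊆ a
          Tb : T ⊆ b
          T'ab : T' ⊆ ⋃ (a ∷ b ∷ [])
          T'a : (T' ⊆ᵇ a) ≡ false

      split : ∀ {T T' a} → Pair T T' → a ∈ take 2 (through T) → Split T T' a
      split {T} {T'} P m with subst (_ ∈_) (Pair.pair≡ P) m
      ... | here refl = record { b∈ = y∈ ; a∈ = x∈ ; a≢b = x≢y ; Ta = λ {z} → Tx {z} ; Tb = λ {z} → Ty {z} ; T'ab = λ {z} → T'⊆ {z} ; T'a = T'x }
        where open Pair P
      ... | there (here refl) = record { b∈ = x∈ ; a∈ = y∈ ; a≢b = λ e → x≢y (sym e) ; Ta = λ {z} → Ty {z} ; Tb = λ {z} → Tx {z} ; T'ab = λ {z} → swap⋃ {T'} {x} {y} T'⊆ {z} ; T'a = T'y }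
        where open Pair P

      pairs-disjoint : ∀ {T S T'} → ∣ T ∣ ≡ t → ∣ S ∣ ≡ t → ¬ T ≡ S → Pair T T' → Pair S T' → Disjoint (take 2 (through T)) (take 2 (through S))
      pairs-disjoint {T} {S} {T'} sT sS ne P P' (i , j) = ne (clash {T} {S} {T'} sT sS (a∈ s) (b∈ s) (b∈ s') (a≢b s) (a≢b s') (Ta s) (Tb s) (Ta s') (Tb s') (T'ab s) (T'ab s') (T'a s))
        where
        open Split
        s = split P i
        s' = split P' j

      pairs : List E → List (List E)
      pairs = map (λ T → take 2 (through T))

      pairs-good : ∀ T' Ts → Unique Ts → (∀ {T} → T ∈ Ts → ∣ T ∣ ≡ t × Pair T T') →
        All Unique (pairs Ts) × AllPairs Disjoint (pairs Ts) × length (concat (pairs Ts)) ≡ length Ts ℕ.+ length Ts × concat (pairs Ts) ⊑ H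
      pairs-good T' [] _ h = [] , [] , refl , λ ()
      pairs-good T' (T ∷ Ts) (a ∷ u) h with pairs-good T' Ts u (λ m → h (there m))
      ... | au , ad , le , sb = take! (through! T) ∷ au , All.map⁺ (All.tabulate (λ {S} m → pairs-disjoint (proj₁ (h (here refl))) (proj₁ (h (there m))) (All.lookup a m) P (proj₂ (h (there m))))) ∷ ad ,
           trans (length-++ (take 2 (through T))) (trans (cong₂ ℕ._+_ (cong length (Pair.pair≡ P)) le) (cong suc (sym (ℕ.+-suc (length Ts) (length Ts))))) ,
           sub
        where
        P = proj₂ (h (here refl))
        take! : ∀ {L} → Unique L → Unique (take 2 L)
        take! = Unique.take⁺ 2
        sub : (take 2 (through T) ++ concat (pairs Ts)) ⊑ H
        sub m with ∈-++⁻ (take 2 (through T)) m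
        ... | inj₁ i = proj₁ (through⁻ {T} (take-⊑ 2 (through T) i))
        ... | inj₂ i = sb i

      -- Each pair spans at most 2 d + t vertices and contains T' in its union, so every pair after
      -- the first adds at most 2 d vertices.
      pairs-vol : ∀ T' Ts → ∣ T' ∣ ≡ t → (∀ {T} → T ∈ Ts → ∣ T ∣ ≡ t × Pair T T') → 1 ℕ.≤ length Ts →
        T' ⊆ ⋃ (concat (pairs Ts)) × vol (concat (pairs Ts)) ℕ.≤ length Ts ℕ.* (2 ℕ.* d) ℕ.+ t
      pairs-vol T' (T ∷ Ts) sT' h _ = step Ts (λ m → h (there m)) (pairs-vol T' Ts sT')
        where
        P = proj₂ (h (here refl))
        open Pair P
        L = take 2 (through T)
        cov : T' ⊆ ⋃ L
        cov {z} m = subst (λ M → z ∈ᵥ ⋃ M) (sym pair≡) (T'⊆ m)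
        vL : vol L ℕ.≤ 2 ℕ.* d ℕ.+ t
        vL = subst (λ M → vol M ℕ.≤ 2 ℕ.* d ℕ.+ t) (sym pair≡) (pair-vol x∈ y∈ (∩-big {T} (proj₁ (h (here refl))) Ty Tx))
        step : ∀ Ts → (∀ {T} → T ∈ Ts → ∣ T ∣ ≡ t × Pair T T') → ((∀ {T} → T ∈ Ts → ∣ T ∣ ≡ t × Pair T T') → 1 ℕ.≤ length Ts → T' ⊆ ⋃ (concat (pairs Ts)) × vol (concat (pairs Ts)) ℕ.≤ length Ts ℕ.* (2 ℕ.* d) ℕ.+ t) →
          T' ⊆ ⋃ (L ++ concat (pairs Ts)) × vol (L ++ concat (pairs Ts)) ℕ.≤ suc (length Ts) ℕ.* (2 ℕ.* d) ℕ.+ t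
        step [] h' ih = (λ m → ⋃-⊑ {L = L} {L ++ []} ∈-++⁺ˡ (cov m)) , ℕ.≤-trans (vol-⊑ {L = L ++ []} {L} (λ m → back m)) (ℕ.≤-trans vL (ℕ.≤-reflexive (cong (ℕ._+ t) (sym (ℕ.+-identityʳ (2 ℕ.* d))))))
          where
          back : ∀ {x} → x ∈ (L ++ []) → x ∈ L
          back m with ∈-++⁻ L m
          ... | inj₁ i = i
        step (S ∷ Ss) h' ih with ih h' (ℕ.s≤s ℕ.z≤n)
        ... | cr , vr = (λ m → ⋃-⊑ {L = L} {L ++ concat (pairs (S ∷ Ss))} ∈-++⁺ˡ (cov m)) ,
            ℕ.+-cancelʳ-≤ t _ _ (ℕ.≤-trans (ℕ.≤-trans (ℕ.≤-reflexive (cong (vol (L ++ concat (pairs (S ∷ Ss))) ℕ.+_) (sym sT'))) (vol-++ T' L (concat (pairs (S ∷ Ss))) cov cr))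
              (ℕ.≤-trans (ℕ.+-mono-≤ vL vr) (ℕ.≤-reflexive (ar (2 ℕ.* d) t (suc (length Ss) ℕ.* (2 ℕ.* d))))))
          where
          ar : ∀ e t l → e ℕ.+ t ℕ.+ (l ℕ.+ t) ≡ e ℕ.+ l ℕ.+ t ℕ.+ t
          ar = solve-∀

      -- κ disjoint pairs meeting in the common T' would form a configuration
      few-mixed : ∀ T' → ∣ T' ∣ ≡ t → ∑ ps (λ T → bool (mixed (through T) T')) ≤ ι k
      few-mixed T' sT' = ≤-trans (≤-reflexive (∑-sel (λ T → mixed (through T) T') ps)) (ι-mono (small (length Ms ℕ.<? κ)))
        where
        Ms = sel (λ T → mixed (through T) T') ps
        Ts = take κ Ms
        info : ∀ {T} → T ∈ Ts → ∣ T ∣ ≡ t × Pair T T'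
        info m with sel⁻ (λ T → mixed (through T) T') ps (take-⊑ κ Ms m)
        ... | i , e = ∈-sized⁻ i , mixed-pair e
        Ts! : Unique Ts
        Ts! = Unique.take⁺ κ (sel-unique (λ T → mixed (through T) T') (sized-unique n t))
        small : Dec (length Ms ℕ.< κ) → length Ms ℕ.≤ k
        small (yes p) = ℕ.≤-trans (ℕ.<⇒≤ p) (ℕ.≤-trans (ℕ.m≤m+n κ κ) (ℕ.≤-reflexive (sym k≡)))
        small (no q) with length-take-≤ κ Ms (ℕ.≮⇒≥ q) | pairs-good T' Ts Ts! info
        ... | lT | au , ad , le , sb = ⊥-elim (free (concat (pairs Ts)) (Unique.concat⁺ au ad) sb (trans le (trans (cong (λ z → z ℕ.+ z) lT) (sym k≡)))
            (ℕ.≤-trans (proj₂ (pairs-vol T' Ts sT' info (ℕ.≤-trans κ≥1 (ℕ.≤-reflexive (sym lT))))) (ℕ.≤-reflexive (trans (cong (λ z → z ℕ.* (2 ℕ.* d) ℕ.+ t) lT) (trans (ar κ d t) (cong (λ z → z ℕ.* d ℕ.+ t) (sym k≡)))))))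
          where
          ar : ∀ κ d t → κ ℕ.* (2 ℕ.* d) ℕ.+ t ≡ (κ ℕ.+ κ) ℕ.* d ℕ.+ t
          ar = solve-∀

      bool-not : ∀ b → bool b + bool (not b) ≡ 1ℚ
      bool-not true = +-identityʳ 1ℚ
      bool-not false = +-identityˡ 1ℚ

      unc : E → ℚ
      unc T' = bool (not (covered (through T')))

      module _ (mixed-room : 2 ℕ.* ((d ℕ.+ t) C t) ℕ.+ (k ℕ.* k ℕ.+ k) ℕ.≤ (2 ℕ.* d ℕ.+ t) C t) where

        -- Of the t-subsets of x ∪ y, at most 2 C(d + t, t) lie in x or y. A third edge containing
        -- one of the others meets x ∪ y in exactly t vertices by `meet3`, so it covers only that
        -- one, and `cap-list` leaves at most k third edges. The hypothesis still provides k²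
        -- uncovered sets.
        many-mixed : ∀ T → ∣ T ∣ ≡ t → heavy (through T) ≡ true → ι (k ℕ.* k) ≤ ∑ ps (λ T' → bool (mixed (through T) T') * unc T')
        many-mixed T sT hv = go (through T) refl hv
          where
          go : ∀ L → through T ≡ L → heavy L ≡ true → ι (k ℕ.* k) ≤ ∑ ps (λ T' → bool (mixed L T') * unc T')
          go (x ∷ y ∷ L) eq _ = cancel
            where
            Lxy = x ∷ y ∷ L
            U = ⋃ (x ∷ y ∷ [])
            Q = (d ℕ.+ t) C t
            in' : ∀ {f} → f ∈ Lxy → f ∈ H × T ⊆ f
            in' i = through⁻ {T} (subst (_ ∈_) (sym eq) i)
            x∈ = proj₁ (in' (here refl))
            y∈ = proj₁ (in' (there (here refl)))
            big : t ℕ.≤ ∣ y ∩ x ∣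
            big = ∩-big {T} sT (proj₂ (in' (there (here refl)))) (proj₂ (in' (here refl)))
            x≢y : ¬ x ≡ y
            x≢y with subst Unique eq (through! T)
            ... | (a ∷ _) ∷ _ = a
            volU : vol (x ∷ y ∷ []) ≡ 2 ℕ.* d ℕ.+ t
            volU = ℕ.≤-antisym (pair-vol x∈ y∈ big) (ℕ.+-cancelʳ-≤ t _ _ (ℕ.≤-trans (ℕ.≤-reflexive (sym (vol-pair x∈ y∈))) (ℕ.+-monoʳ-≤ (vol (x ∷ y ∷ [])) (meet2 x∈ y∈ x≢y))))
            sumU : ∑ ps (λ T' → bool (T' ⊆ᵇ U)) ≡ ι ((2 ℕ.* d ℕ.+ t) C t)
            sumU = trans (inc-sized U t) (cong (λ s → ι (s C t)) (trans (sym (vol≡ (x ∷ y ∷ []))) volU))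
            sum-edge : ∀ {z} → z ∈ H → ∑ ps (λ T' → bool (T' ⊆ᵇ z)) ≡ ι Q
            sum-edge {z} z∈ = trans (inc-sized z t) (cong (λ s → ι (s C t)) (size z∈))
            mx : E → ℚ
            mx T' = bool (mixed Lxy T')
            pt : ∀ a b c → bool a ≤ bool (a ∧ (not b ∧ not c)) + (bool b + bool c)
            pt false b c = +-nn ≤-refl (+-nn (bool-nn b) (bool-nn c))
            pt true true c = ≤-trans (≤-by (bool-nn c) refl) (≤-reflexive (sym (+-identityˡ _)))
            pt true false true = ≤-reflexive (solve 0 (𝟙 := 𝟘 :+ (𝟘 :+ 𝟙)) refl)
            pt true false false = ≤-reflexive (solve 0 (𝟙 := 𝟙 :+ (𝟘 :+ 𝟘)) refl)
            total : ι ((2 ℕ.* d ℕ.+ t) C t) ≤ ∑ ps mx + ι (2 ℕ.* Q)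
            total = ≤-trans (≤-reflexive (sym sumU)) (≤-trans (∑-mono ps (λ T' → pt (T' ⊆ᵇ U) (T' ⊆ᵇ x) (T' ⊆ᵇ y)))
              (≤-reflexive (trans (∑-+ ps _ _) (cong (∑ ps mx +_) (trans (∑-+ ps _ _) (trans (cong₂ _+_ (sum-edge x∈) (sum-edge y∈))
                (trans (sym (ι-+ Q Q)) (cong (λ z → ι (Q ℕ.+ z)) (sym (ℕ.+-identityʳ Q))))))))))
            enough : ι (k ℕ.* k) + ι k ≤ ∑ ps mx
            enough = 0≤⇒≤ (≤-trans (≤⇒0≤ (≤-trans (ι-mono mixed-room) total)) (≤-reflexive (trans (cong (λ z → ∑ ps mx + ι (2 ℕ.* Q) - z) (trans (ι-+ (2 ℕ.* Q) (k ℕ.* k ℕ.+ k)) (cong (ι (2 ℕ.* Q) +_) (ι-+ (k ℕ.* k) k))))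
                (solve 4 (λ m q a b → m :+ q :- (q :+ (a :+ b)) := m :- (a :+ b)) refl (∑ ps mx) (ι (2 ℕ.* Q)) (ι (k ℕ.* k)) (ι k)))))
            third : E → Bool
            third f = not ⌊ f ≟ₛ x ⌋ ∧ (not ⌊ f ≟ₛ y ⌋ ∧ ⌊ t ℕ.≤? ∣ f ∩ U ∣ ⌋)
            Fs = sel third H
            third⁻ : ∀ {f} → f ∈ Fs → f ∈ H × (¬ x ≡ f) × (¬ y ≡ f) × t ℕ.≤ ∣ f ∩ U ∣
            third⁻ {f} m with sel⁻ third H m
            ... | f∈ , e with ∧-true {not ⌊ f ≟ₛ x ⌋} e
            ...   | e₁ , e' with ∧-true {not ⌊ f ≟ₛ y ⌋} e'
            ...     | e₂ , e₃ = f∈ , (λ q → ⌊⌋-false (not-true e₁) (sym q)) , (λ q → ⌊⌋-false (not-true e₂) (sym q)) , ⌊⌋-true e₃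
            few-third : length Fs ℕ.≤ k
            few-third with length Fs ℕ.≤? k
            ... | yes p = p
            ... | no q = ⊥-elim (cap-list Fs (x ∷ y ∷ []) (k ℕ.∸ 2) (Unique.++⁺ (sel-unique third H!) ((x≢y ∷ []) ∷ [] ∷ []) λ { (i , here refl) → proj₁ (proj₂ (third⁻ i)) refl ; (i , there (here refl)) → proj₁ (proj₂ (proj₂ (third⁻ i))) refl })
                   (λ { (here refl) → x∈ ; (there (here refl)) → y∈ }) (λ m → proj₁ (third⁻ m) , proj₂ (proj₂ (proj₂ (third⁻ m)))) (ℕ.m∸n+n≡m k≥2) (ℕ.≤-reflexive volU) (ℕ.≤-trans (ℕ.m∸n≤m k 2) (ℕ.<⇒≤ (ℕ.≰⇒> q))))
            by-third : ∀ T' → T' ∈ ps → mx T' * bool (covered (through T')) ≤ ∑ Fs (λ f → bool (T' ⊆ᵇ (f ∩ U)))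
            by-third T' T'∈ with mixed Lxy T' in em
            ... | false = ≤-trans (≤-reflexive (*-zeroˡ _)) (∑-nn Fs (λ f → bool-nn (T' ⊆ᵇ (f ∩ U))))
            ... | true = ≤-trans (≤-reflexive (*-identityˡ _)) (cv (through T') refl)
              where
              m₁ = proj₁ (∧-true {T' ⊆ᵇ U} em)
              m₂ = not-true (proj₁ (∧-true {not (T' ⊆ᵇ x)} (proj₂ (∧-true {T' ⊆ᵇ U} em))))
              m₃ = not-true (proj₂ (∧-true {not (T' ⊆ᵇ x)} (proj₂ (∧-true {T' ⊆ᵇ U} em))))
              cv : ∀ L' → through T' ≡ L' → bool (covered L') ≤ ∑ Fs (λ f → bool (T' ⊆ᵇ (f ∩ U)))
              cv [] _ = ∑-nn Fs (λ f → bool-nn (T' ⊆ᵇ (f ∩ U)))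
              cv (f ∷ L') e' = ≤-trans (≤-reflexive (cong bool (sym (⊆⇒⊆ᵇ {p = T'} {q = f ∩ U} T'fU)))) (∑-single (λ f → bool-nn (T' ⊆ᵇ (f ∩ U))) f∈Fs)
                where
                fi : f ∈ H × T' ⊆ f
                fi = through⁻ {T'} (subst (f ∈_) (sym e') (here refl))
                T'fU : T' ⊆ f ∩ U
                T'fU m = x∈p∩q⁺ (proj₂ fi m , ⊆ᵇ⇒⊆ {p = T'} {U} m₁ m)
                diff-edge : ∀ z → (T' ⊆ᵇ z) ≡ false → not ⌊ f ≟ₛ z ⌋ ≡ true
                diff-edge z e with f ≟ₛ z
                ... | no _ = refl
                ... | yes refl with trans (sym e) (⊆⇒⊆ᵇ {p = T'} {q = f} (proj₂ fi))
                ...   | ()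
                f∈Fs : f ∈ Fs
                f∈Fs = sel⁺ third (proj₁ fi) (∧-intro (diff-edge x m₂) (∧-intro (diff-edge y m₃) (⌊⌋-yes (ℕ.≤-trans (ℕ.≤-reflexive (sym (∈-sized⁻ T'∈))) (p⊆q⇒∣p∣≤∣q∣ {p = T'} T'fU)))))
            mixed-covered : ∑ ps (λ T' → mx T' * bool (covered (through T'))) ≤ ι k
            mixed-covered = ≤-trans (∑-mono∈ ps by-third) (≤-trans (≤-reflexive (∑-swap ps Fs (λ T' f → bool (T' ⊆ᵇ (f ∩ U))))) (≤-trans (∑-mono∈ Fs {g = λ _ → 1ℚ} each)
                (≤-trans (≤-reflexive (trans (∑-const Fs 1ℚ) (*-identityʳ _))) (ι-mono few-third))))
              where
              each : ∀ f → f ∈ Fs → ∑ ps (λ T' → bool (T' ⊆ᵇ (f ∩ U))) ≤ 1ℚ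
              each f m with third⁻ m
              ... | f∈ , xf , yf , l = ≤-reflexive (trans (inc-sized (f ∩ U) t) (trans (cong (λ s → ι (s C t)) (ℕ.≤-antisym (meet3 x∈ y∈ f∈ x≢y xf yf big) l)) (trans (cong ι (nCn≡1 t)) ι1)))
            cancel : ι (k ℕ.* k) ≤ ∑ ps (λ T' → mx T' * unc T')
            cancel = 0≤⇒≤ (≤-trans (≤⇒0≤ (≤-trans enough (≤-trans (≤-reflexive parts) (+-monoʳ-≤ _ mixed-covered))))
                (≤-reflexive (solve 3 (λ a b c → c :+ b :- (a :+ b) := c :- a) refl (ι (k ℕ.* k)) (ι k) (∑ ps (λ T' → mx T' * unc T')))))
              where
              parts : ∑ ps mx ≡ ∑ ps (λ T' → mx T' * unc T') + ∑ ps (λ T' → mx T' * bool (covered (through T')))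
              parts = trans (∑-cong ps (λ T' → trans (sym (*-identityʳ (mx T'))) (trans (cong (mx T' *_) (sym (trans (+-comm _ _) (bool-not (covered (through T')))))) (*-distribˡ-+ (mx T') _ _)))) (∑-+ ps _ _)

        heavySum : ℚ
        heavySum = ∑ ps (λ T → bool (heavy (through T)))

        -- Double counting of charges: at least k² leave each heavy t-set and at most k reach each
        -- uncovered one.
        heavy-≤ : ι k * heavySum ≤ ∑ ps unc
        heavy-≤ = *-cancelˡ-≤ {b = inv k} {a = ι k} (inv-nn k) (inv* (ℕ.≤-trans (ℕ.n≤1+n 1) k≥2)) (≤-trans (≤-reflexive (trans (sym (*-assoc (ι k) (ι k) heavySum)) (trans (cong (_* heavySum) (sym (ι-* k k))) (sym (∑-*ˡ ps (ι (k ℕ.* k)) _)))))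
            (≤-trans (∑-mono∈ ps lower) (≤-trans (≤-reflexive (∑-swap ps ps (λ T T' → bool (mixed (through T) T') * unc T')))
              (≤-trans (∑-mono∈ ps upper) (≤-reflexive (∑-*ˡ ps (ι k) unc))))))
          where
          lower : ∀ T → T ∈ ps → ι (k ℕ.* k) * bool (heavy (through T)) ≤ ∑ ps (λ T' → bool (mixed (through T) T') * unc T')
          lower T T∈ with heavy (through T) in e
          ... | true = ≤-trans (≤-reflexive (*-identityʳ _)) (many-mixed T (∈-sized⁻ T∈) e)
          ... | false = ≤-trans (≤-reflexive (*-zeroʳ _)) (∑-nn ps (λ T' → *-nn (bool-nn (mixed (through T) T')) (bool-nn (not (covered (through T'))))))
          upper : ∀ T' → T' ∈ ps → ∑ ps (λ T → bool (mixed (through T) T') * unc T') ≤ ι k * unc T'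
          upper T' T'∈ = ≤-trans (≤-reflexive (∑-*ʳ ps (unc T') (λ T → bool (mixed (through T) T')))) (*-monoʳ (bool-nn (not (covered (through T')))) (few-mixed T' (∈-sized⁻ T'∈)))

        degree-split : ∀ L → length L ℕ.≤ k → ι (length L) ≤ bool (covered L) + ι k * bool (heavy L)
        degree-split [] l = +-nn ≤-refl (*-nn (ι-nn k) ≤-refl)
        degree-split (_ ∷ []) l = ≤-trans (≤-reflexive ι1) (≤-by (*-nn (ι-nn k) ≤-refl) refl)
        degree-split (_ ∷ _ ∷ _) l = ≤-trans (ι-mono l) (≤-trans (≤-reflexive (sym (*-identityʳ (ι k)))) (≤-by 0≤1 (+-comm 1ℚ _)))

        -- The degrees of the t-sets sum to at most the covered ones plus k for each heavy one, and
        -- by `heavy-≤` the latter are paid by the uncovered ones. So the sum is at most the number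
        -- of all t-sets.
        sparse-bound : ι (length H) * ι ((d ℕ.+ t) C t) ≤ ι (n C t)
        sparse-bound = ≤-trans (≤-reflexive double) (≤-trans (∑-mono∈ ps (λ T T∈ → ≤-trans (≤-reflexive (∑-sel (T ⊆ᵇ_) H)) (degree-split (through T) (degree-≤ T (∈-sized⁻ T∈)))))
            (≤-trans (≤-reflexive (trans (∑-+ ps _ _) (cong (∑ ps (λ T → bool (covered (through T))) +_) (∑-*ˡ ps (ι k) _)))) (≤-trans (+-monoʳ-≤ _ heavy-≤)
              (≤-reflexive (trans (sym (∑-+ ps _ _)) (trans (∑-cong ps (λ T → bool-not (covered (through T)))) (trans (∑-const ps 1ℚ) (trans (*-identityʳ _) (length-sized n t)))))))))
          where
          double : ι (length H) * ι ((d ℕ.+ t) C t) ≡ ∑ ps (λ T → ∑ H (λ R → bool (T ⊆ᵇ R)))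
          double = trans (sym (∑-const H (ι ((d ℕ.+ t) C t)))) (trans (∑-cong∈ H (λ R R∈ → sym (trans (inc-sized R t) (cong (λ s → ι (s C t)) (size R∈))))) (∑-swap H ps (λ R T → bool (T ⊆ᵇ R))))

    module _ (H : List E) (H! : Unique H) (size : ∀ {p} → p ∈ H → ∣ p ∣ ≡ d ℕ.+ t)
      (free : ∀ c → Unique c → c ⊑ H → length c ≡ k → ¬ vol c ℕ.≤ k ℕ.* d ℕ.+ t) where

      -- More than k gadgets whose first edges contain Z have at least k edges in all, and by
      -- `chain` the first k edges of their concatenation would be a configuration.
      few-through : ∀ G → All (λ g → g ⊑ H × Short g × IsGadget g) G → AllPairs Disjoint G → ∀ Z → ∣ Z ∣ ≡ t' →
        length (sel (λ g → Z ⊆ᵇ ⋃ (take 1 g)) G) ℕ.≤ k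
      few-through G gs dj Z sZ with length (sel (λ g → Z ⊆ᵇ ⋃ (take 1 g)) G) ℕ.≤? k
      ... | yes p = p
      ... | no q = ⊥-elim (free (take k (concat G')) (Unique.take⁺ k (Unique.concat⁺ (All.map (λ { (_ , _ , u , _) → u }) gs') dj')) (λ m → all⊑ G' gs' (take-⊑ k (concat G') m))
           (length-take-≤ k (concat G') kl) (proj₂ (chain Z sZ G' (All.tabulate (λ {g} m → through-Z m (All.lookup gs' m))) k (ℕ.≤-trans κ≥1 (ℕ.≤-trans (ℕ.m≤m+n κ κ) (ℕ.≤-reflexive (sym k≡)))) kl)))
        where
        f : List E → Bool
        f g = Z ⊆ᵇ ⋃ (take 1 g)
        G' = sel f G
        gs' : All (λ g → g ⊑ H × Short g × IsGadget g) G'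
        gs' = All.filter⁺ (λ g → f g Bool.≟ true) gs
        dj' : AllPairs Disjoint G'
        dj' = AllPairs.filter⁺ (λ g → f g Bool.≟ true) dj
        all⊑ : ∀ G → All (λ g → g ⊑ H × Short g × IsGadget g) G → concat G ⊑ H
        all⊑ (g ∷ G) ((s , _) ∷ ss) m with ∈-++⁻ g m
        ... | inj₁ i = s i
        ... | inj₂ i = all⊑ G ss i
        long : ∀ G → All (λ g → g ⊑ H × Short g × IsGadget g) G → length G ℕ.≤ length (concat G)
        long [] _ = ℕ.z≤n
        long (g ∷ G) ((_ , (l , _) , _) ∷ ss) = ℕ.≤-trans (ℕ.+-mono-≤ (ℕ.≤-trans (ℕ.n≤1+n 1) l) (long G ss)) (ℕ.≤-reflexive (sym (length-++ g)))
        kl : k ℕ.≤ length (concat G')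
        kl = ℕ.≤-trans (ℕ.<⇒≤ (ℕ.≰⇒> q)) (long G' gs')
        through-Z : ∀ {g} → g ∈ G' → g ⊑ H × Short g × IsGadget g → Z ⊆ ⋃ (take 1 g) × (∀ {p} → p ∈ g → ∣ p ∣ ≡ d ℕ.+ t) × Short g × IsGadget g
        through-Z {g} m (s , r) = (λ {x} → ⊆ᵇ⇒⊆ {p = Z} {⋃ (take 1 g)} (proj₂ (sel⁻ f G m)) {x}) , (λ {p} i → size (s i)) , r

      few-gadgets : ∀ G → All (λ g → g ⊑ H × Short g × IsGadget g) G → AllPairs Disjoint G → ι (length G) ≤ ι (k ℕ.* (n C t'))
      few-gadgets G gs dj = ≤-trans (≤-reflexive (sym (trans (∑-const G 1ℚ) (*-identityʳ _)))) (≤-trans (∑-mono∈ G {f = λ _ → 1ℚ} (λ g m → some (All.lookup gs m)))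
        (≤-trans (≤-reflexive (∑-swap G (sized n t') (λ g Z → bool (Z ⊆ᵇ ⋃ (take 1 g))))) (≤-trans (∑-mono∈ (sized n t') {g = λ _ → ι k} (λ Z m → ≤-trans (≤-reflexive (∑-sel (λ g → Z ⊆ᵇ ⋃ (take 1 g)) G)) (ι-mono (few-through G gs dj Z (∈-sized⁻ m)))))
          (≤-reflexive (trans (∑-const (sized n t') (ι k)) (trans (cong (_* ι k) (length-sized n t')) (trans (*-comm _ (ι k)) (sym (ι-* k (n C t'))))))))))
        where
        some : ∀ {g} → g ⊑ H × Short g × IsGadget g → 1ℚ ≤ ∑ (sized n t') (λ Z → bool (Z ⊆ᵇ ⋃ (take 1 g)))
        some {[]} (_ , (() , _) , _)
        some {e ∷ g} (s , _) with sized-below e t' (ℕ.≤-trans (ℕ.≤-trans (ℕ.n≤1+n t') (ℕ.m≤n+m t d)) (ℕ.≤-reflexive (sym (size (s (here refl))))))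
        ... | Z , sZ , Z⊆ = ≤-trans (≤-reflexive (cong bool (sym (⊆⇒⊆ᵇ {p = Z} {q = ⋃ (e ∷ [])} (λ m → ⋃⁺ {L = e ∷ []} (here refl) (Z⊆ m)))))) (∑-single (λ Z → bool-nn (Z ⊆ᵇ ⋃ (e ∷ []))) (∈-sized⁺ {p = Z} sZ))

      upper-bound : 2 ℕ.* ((d ℕ.+ t) C t) ℕ.+ (k ℕ.* k ℕ.+ k) ℕ.≤ (2 ℕ.* d ℕ.+ t) C t →
        length H ℕ.* ((d ℕ.+ t) C t) ℕ.≤ n C t ℕ.+ 3 ℕ.* (k ℕ.* (n C t')) ℕ.* ((d ℕ.+ t) C t)
      upper-bound room = go (extract (length H) H ℕ.≤-refl H!)
        where
        Q = (d ℕ.+ t) C t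
        go : Extraction H → length H ℕ.* Q ℕ.≤ n C t ℕ.+ 3 ℕ.* (k ℕ.* (n C t')) ℕ.* Q
        go (extraction G R gs dj R⊑ R! rf c) = ℕ.≤-trans (ℕ.*-monoˡ-≤ Q c) (ℕ.≤-trans (ℕ.≤-reflexive (ℕ.*-distribʳ-+ Q (length R) (3 ℕ.* length G)))
          (ℕ.+-mono-≤ rest few))
          where
          rest : length R ℕ.* Q ℕ.≤ n C t
          rest = ι-cancel {length R ℕ.* Q} {n C t} (≤-trans (≤-reflexive (ι-* (length R) Q)) (Sparse.sparse-bound R R! (λ m → size (R⊑ m)) rf (λ c u s → free c u (λ m → R⊑ (s m))) room))
          few : 3 ℕ.* length G ℕ.* Q ℕ.≤ 3 ℕ.* (k ℕ.* (n C t')) ℕ.* Q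
          few = ℕ.*-monoˡ-≤ Q (ℕ.*-monoʳ-≤ 3 (ι-cancel {length G} {k ℕ.* (n C t')} (few-gadgets G gs dj)))

-- The binomial inequality behind the condition on r.

module Room where
  open import Data.Nat
  open import Data.Nat.Properties
  open import Data.Nat.Combinatorics using (_C_)
  open Arith using (C-absorb)

  -- The rising factorial (d + 1) ... (d + t); working with t! C(d + t, t) in this form avoids
  -- division.
  rise : ℕ → ℕ → ℕ
  rise d zero = 1
  rise d (suc t) = (d + suc t) * rise d t

  rise-C : ∀ d t → rise d t ≡ t ! * ((d + t) C t)
  rise-C d zero = refl
  rise-C d (suc t) = trans (cong₂ _*_ (+-suc d t) (rise-C d t)) (trans (ar (suc (d + t)) (t !) ((d + t) C t)) (trans (cong (t ! *_) (sym (C-absorb (d + t) t)))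
      (trans (ar' (t !) (suc t) (suc (d + t) C suc t)) (cong (λ z → suc t * t ! * (z C suc t)) (sym (+-suc d t))))))
    where
    ar : ∀ a b c → a * (b * c) ≡ b * (a * c)
    ar = solve-∀
    ar' : ∀ a b c → a * (b * c) ≡ b * a * c
    ar' = solve-∀

  rise≥1 : ∀ d t → 1 ≤ rise d t
  rise≥1 d zero = ≤-refl
  rise≥1 d (suc t) = *-mono-≤ {1} {d + suc t} {1} (≤-trans (s≤s z≤n) (m≤n+m (suc t) d)) (rise≥1 d t)

  -- Equality holds for exponent two, which is where the correction 2 comes from. In the induction
  -- step the right side gains the factor 2 d + c against d + c on the left, and the surplus d P
  -- pays for the term 2 d.
  rise-gap : ∀ d s → 1 ≤ d → 2 * rise d (2 + s) + 2 * d ^ (2 + s) ≤ rise (2 * d) (2 + s) + 2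
  rise-gap d zero d≥1 = ≤-reflexive (ar d)
    where
    ar : ∀ d → 2 * ((d + 2) * ((d + 1) * 1)) + 2 * (d * (d * 1)) ≡ (2 * d + 2) * ((2 * d + 1) * 1) + 2
    ar = solve-∀
  rise-gap d (suc s) d≥1 = +-cancelʳ-≤ (2 * c * D) _ _ (begin
    2 * ((d + c) * P') + 2 * (d * D) + 2 * c * D ≡⟨ ar₁ d c P' D ⟩
    (d + c) * (2 * P' + 2 * D) ≤⟨ *-monoʳ-≤ (d + c) (rise-gap d s d≥1) ⟩
    (d + c) * (P + 2) ≡⟨ ar₂ d c P ⟩
    (d + c) * P + 2 * c + d * 2 ≤⟨ +-mono-≤ (+-monoʳ-≤ ((d + c) * P) (≤-trans (≤-reflexive (sym (*-identityʳ (2 * c)))) (*-monoʳ-≤ (2 * c) D≥1))) (*-monoʳ-≤ d 2≤P) ⟩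
    (d + c) * P + 2 * c * D + d * P ≤⟨ m≤m+n _ 2 ⟩
    (d + c) * P + 2 * c * D + d * P + 2 ≡⟨ ar₃ d c P (2 * c * D) ⟩
    (2 * d + c) * P + 2 + 2 * c * D ∎)
    where
    open ≤-Reasoning
    c = 3 + s
    P' = rise d (2 + s)
    P = rise (2 * d) (2 + s)
    D = d ^ (2 + s)
    D≥1 : 1 ≤ D
    D≥1 = ≤-trans (≤-reflexive (sym (^-zeroˡ (2 + s)))) (^-monoˡ-≤ (2 + s) d≥1)
    2≤P : 2 ≤ P
    2≤P = +-cancelʳ-≤ 2 2 P (≤-trans (+-mono-≤ (*-monoʳ-≤ 2 (rise≥1 d (2 + s))) (*-monoʳ-≤ 2 D≥1)) (rise-gap d s d≥1))
    ar₁ : ∀ d c p e → 2 * ((d + c) * p) + 2 * (d * e) + 2 * c * e ≡ (d + c) * (2 * p + 2 * e)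
    ar₁ = solve-∀
    ar₂ : ∀ d c p → (d + c) * (p + 2) ≡ (d + c) * p + 2 * c + d * 2
    ar₂ = solve-∀
    ar₃ : ∀ d c p x → (d + c) * p + x + d * p + 2 ≡ (2 * d + c) * p + 2 + x
    ar₃ = solve-∀

  -- The condition on r enters here: (k² + k) t! + 2 ≤ 2 k³ t! ≤ 2 d^t for k ≥ 2, and `rise-gap`
  -- divided by t! gives the claim.
  mixed-room : ∀ d t k → 2 ≤ t → 2 ≤ k → 1 ≤ d → k ^ 3 * t ! ≤ d ^ t → 2 * ((d + t) C t) + (k * k + k) ≤ (2 * d + t) C t
  mixed-room d (suc (suc s)) (suc (suc j)) (s≤s (s≤s z≤n)) (s≤s (s≤s z≤n)) d≥1 h = *-cancelˡ-≤ (t !) (+-cancelʳ-≤ 2 _ _ (begin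
    t ! * (2 * a + (k * k + k)) + 2 ≡⟨ ar₁ (t !) a (k * k + k) ⟩
    2 * (t ! * a) + ((k * k + k) * t ! + 2) ≤⟨ +-mono-≤ (≤-reflexive (cong (2 *_) (sym (rise-C d t)))) cube ⟩
    2 * rise d t + 2 * d ^ t ≤⟨ rise-gap d s d≥1 ⟩
    rise (2 * d) t + 2 ≡⟨ cong (_+ 2) (rise-C (2 * d) t) ⟩
    t ! * ((2 * d + t) C t) + 2 ∎))
    where
    open ≤-Reasoning
    t = 2 + s
    k = 2 + j
    a = (d + t) C t
    instance
      fact : NonZero (t !)
      fact = t !≢0
    ar₁ : ∀ f a x → f * (2 * a + x) + 2 ≡ 2 * (f * a) + (x * f + 2)
    ar₁ = solve-∀
    cubic : ∀ j → 2 * ((2 + j) * ((2 + j) * ((2 + j) * 1))) ≡ ((2 + j) * (2 + j) + (2 + j) + 2) + (2 * (j * (j * j)) + 11 * (j * j) + 19 * j + 8)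
    cubic = solve-∀
    cube : (k * k + k) * t ! + 2 ≤ 2 * d ^ t
    cube = begin
      (k * k + k) * t ! + 2 ≤⟨ +-monoʳ-≤ ((k * k + k) * t !) (≤-trans (≤-reflexive (sym (*-identityʳ 2))) (*-monoʳ-≤ 2 (1≤n! t))) ⟩
      (k * k + k) * t ! + 2 * t ! ≡⟨ sym (*-distribʳ-+ (t !) (k * k + k) 2) ⟩
      (k * k + k + 2) * t ! ≤⟨ *-monoˡ-≤ (t !) (≤-trans (m≤m+n (k * k + k + 2) (2 * (j * (j * j)) + 11 * (j * j) + 19 * j + 8)) (≤-reflexive (sym (cubic j)))) ⟩
      2 * k ^ 3 * t ! ≡⟨ *-assoc 2 (k ^ 3) (t !) ⟩
      2 * (k ^ 3 * t !) ≤⟨ *-monoʳ-≤ 2 h ⟩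
      2 * d ^ t ∎

-- Existence of the extremal number.

module Exist where
  open import Defs
  open Lists
  open Vol
  open Count using (allS; ∈-allS)
  open import Data.Nat using (_≤_; _≤?_; _≟_; s≤s)
  open import Data.Fin.Subset using (Subset; ⋃) renaming (∣_∣ to size)
  open import Relation.Nullary.Decidable using (map′; ¬?)

  greatest : ∀ {P : ℕ → Set} → (∀ i → Dec (P i)) → P 0 → ∀ M → ∃ λ m → P m × (∀ j → j ≤ M → P j → j ≤ m)
  greatest P? p zero = 0 , p , λ j l _ → l
  greatest P? p (suc M) with P? (suc M) | greatest P? p M
  ... | yes q | _ = suc M , q , λ j l _ → l
  ... | no n | m , q , h = m , q , λ j l pj → h j (ℕ.≤-pred (ℕ.≤∧≢⇒< l (λ { refl → n pj }))) pj

  module _ (r n s k : ℕ) where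
    open Decide {Subset n} _≟ₛ_ using (unique?)

    Attained : ℕ → Set
    Attained m = Σ (RGraph r n) (λ H → ConfigFree s k H × e H ≡ m)

    Config : List (Subset n) → List (Subset n) → Set
    Config es C = Unique C × All (_∈ es) C × length C ≡ k × size (⋃ C) ≤ s

    config? : ∀ es → Dec (∃ (Config es))
    config? es = map′ (λ { (C , a , l , u , v) → C , u , a , l , v }) (λ { (C , u , a , l , v) → C , a , l , u , v })
      (∃list? (λ C → unique? C ×-dec size (⋃ C) ≤? s) es k)

    attained? : ∀ m → Dec (Attained m)
    attained? m = map′ (λ { (es , _ , l , u , sz , f) → record { edges = es ; distinct = u ; uniform = sz } , f , l })
      (λ { (H , f , l) → edges H , All.tabulate (λ {x} _ → ∈-allS x) , l , distinct H , uniform H , f })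
      (∃list? (λ es → unique? es ×-dec (All.all? (λ x → size x ≟ r) es ×-dec ¬? (config? es))) (allS n) m)

    -- Graphs are searched exhaustively; distinct edges bound their number by that of all subsets.
    -- For k ≥ 1 the empty graph has no configuration, so the search has a starting value.
    extremal : 1 ≤ k → ∃ (IsF r n s k)
    extremal k≥1 with greatest attained? (record { edges = [] ; distinct = [] ; uniform = [] } , empty k≥1 , refl) (length (allS n))
      where
      empty : 1 ≤ k → ¬ Σ (List (Subset n)) (Config [])
      empty (s≤s _) (_ , _ , () All.∷ _ , _)
      empty (s≤s _) ([] , _ , _ , () , _)
    ... | m , att , mx = m , att , λ H f → mx (e H) (unique-length (distinct H) (λ {x} _ → ∈-allS x)) (H , f , refl)

-- Convergence of the normalised extremal number.

module Limit where
  open import Defs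
  open Q
  open Lists
  open Vol
  open Count
  open Arith
  open LowerBound
  open Bounds using (C-positive)
  open Room
  open Exist
  open import Data.Integer using (+<+) renaming (+_ to pos)
  import Data.Integer as ℤ
  import Data.Integer.Properties as ℤ
  open import Data.Rational as ℚ using (_≤_; _<_; *<*; toℚᵘ)
  import Data.Rational.Properties as ℚ
  open import Data.Rational.Properties using (≤-reflexive; ≤-trans; <⇒≤; ≤-<-trans)
  import Data.Rational.Unnormalised as ℚᵘ
  import Data.Rational.Unnormalised.Properties as ℚᵘ
  open import Data.Nat using (_∸_; _!; z≤n; s≤s)
  open import Data.Nat.Combinatorics using (_C_)
  open import Data.Fin.Subset using () renaming (∣_∣ to size)

  ÷-inv : ∀ a {b} → 1 ℕ.≤ b → a ÷ℕ b ≡ ι a * inv b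
  ÷-inv a {suc b} b≥1 = trans (sym (*-identityʳ x)) (trans (cong (x *_) (sym (inv* {suc b} b≥1))) (trans (sym (*-assoc x (ι (suc b)) (inv (suc b)))) (cong (_* inv (suc b)) clear)))
    where
    x = pos a ℚ./ suc b
    fraction : (pos a ℤ.* pos (suc b)) ℤ.* pos 1 ≡ pos a ℤ.* pos (suc b ℕ.* 1)
    fraction = trans (ℤ.*-assoc (pos a) (pos (suc b)) (pos 1)) (cong (pos a ℤ.*_) (sym (ℤ.pos-* (suc b) 1)))
    clear : x * ι (suc b) ≡ ι a
    clear = trans (cong (x *_) (ι≡ (suc b))) (trans (*≡ x (natℚ (suc b))) (trans (ℚ.toℚᵘ-injective (ℚᵘ.≃-trans (ℚ.toℚᵘ-homo-* x (natℚ (suc b)))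
      (ℚᵘ.≃-trans (ℚᵘ.*-congʳ {toℚᵘ (natℚ (suc b))} (ℚ.toℚᵘ-fromℚᵘ (ℚᵘ.mkℚᵘ (pos a) b))) (ℚᵘ.*≡* fraction)))) (sym (ι≡ a))))

  ½<1 : ½ < 1ℚ
  ½<1 = *<* (+<+ (s≤s (s≤s z≤n)))

  within : ∀ {X L ε} → 0ℚ < ε → X ≤ L + ½ * ε → L - ½ * ε ≤ X → ℚ.∣ X ℚ.- L ∣ < ε
  within {X} {L} {ε} ε>0 up lo = ≤-<-trans bound (subst₂ _<_ (*-comm ε ½) (*-identityʳ ε) (*-monoˡ-< ε>0 ½<1))
    where
    X-L : X - L ≡ X ℚ.- L
    X-L = trans (+≡ X (- L)) (cong (X ℚ.+_) (-≡ L))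
    bound : ℚ.∣ X ℚ.- L ∣ ≤ ½ * ε
    bound with ℚ.∣p∣≡p∨∣p∣≡-p (X ℚ.- L)
    ... | inj₁ e = subst (_≤ ½ * ε) (trans X-L (sym e)) (≤-trans (+-monoˡ-≤ (- L) up) (≤-reflexive (solve 2 (λ l e → l :+ e :- l := e) refl L (½ * ε))))
    ... | inj₂ e = subst (_≤ ½ * ε) (trans (trans (-≡ (X - L)) (cong ℚ.-_ X-L)) (sym e)) (≤-trans (neg-antimono (+-monoˡ-≤ (- L) lo)) (≤-reflexive (solve 2 (λ l e → :- (l :- e :- l) := e) refl L (½ * ε))))

  ¼ : ℚ
  ¼ = ½ ℚ.* ½

  -- M is at least 1 / ε, so x ≥ 4 b M makes b / x at most ε / 4.
  tiny : ∀ {ε M} b x → 0ℚ ≤ ε → 1ℚ ≤ ε * ι M → 1 ℕ.≤ x → 4 ℕ.* b ℕ.* M ℕ.≤ x → ι b * inv x ≤ ¼ * ε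
  tiny {ε} {M} b x ε≥0 εM x≥1 l = ≤-trans (≤-reflexive (*-comm (ι b) (inv x))) (inv-≤ x≥1 (≤-trans (≤-trans (≤-reflexive (sym (*-identityʳ (ι b)))) (*-monoˡ (ι-nn b) εM))
     (≤-trans (≤-reflexive (trans (solve 3 (λ b e m → b :* (e :* m) := (𝟙 :+ (𝟙 :+ (𝟙 :+ (𝟙 :+ 𝟘)))) :* b :* m :* (con ¼ :* e)) refl (ι b) ε (ι M)) (cong (_* (¼ * ε)) (trans (cong (_* ι M) (sym (ι-* 4 b))) (sym (ι-* (4 ℕ.* b) M))))))
       (*-monoʳ (*-nn (<⇒≤ (ℚ.positive⁻¹ ¼)) ε≥0) (ι-mono l)))))

  bernoulli-≥ : ∀ {u} j → 0ℚ ≤ u → u ≤ 1ℚ → 1ℚ - ι j * u ≤ (1ℚ - u) ^ j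
  bernoulli-≥ {u} zero p q = ≤-reflexive (solve 1 (λ u → 𝟙 :- 𝟘 :* u := 𝟙) refl u)
  bernoulli-≥ {u} (suc j) p q = ≤-trans (diff (*-nn (ι-nn j) (sq-nn u)) (solve 2 (λ u j → (𝟙 :- u) :* (𝟙 :- j :* u) :- (𝟙 :- (𝟙 :+ j) :* u) := j :* (u :* u)) refl u (ι j)))
    (*-monoˡ (≤⇒0≤ q) (bernoulli-≥ j p q))

  -- (n - t)^t = n^t (1 - t / n)^t, and Bernoulli's inequality leaves the relative error t² / n.
  falling-lower : ∀ n t → 1 ℕ.≤ n → t ℕ.≤ n → ι n ^ t * (1ℚ - ι (t ℕ.* t) * inv n) ≤ ι ((n ∸ t) ℕ.^ t)
  falling-lower n t n≥1 l = ≤-trans (*-monoˡ (^-nn (ι-nn n) t) (≤-trans (≤-reflexive (cong (λ z → 1ℚ - z) (trans (cong (_* inv n) (ι-* t t)) (*-assoc (ι t) (ι t) (inv n))))) (bernoulli-≥ t (*-nn (ι-nn t) (inv-nn n)) u≤1)))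
      (≤-reflexive (trans (sym (^-* (ι n) (1ℚ - ι t * inv n) t)) (trans (cong (_^ t) base) (sym (ι-^ (n ∸ t) t)))))
    where
    u≤1 : ι t * inv n ≤ 1ℚ
    u≤1 = ≤-trans (*-monoʳ (inv-nn n) (ι-mono l)) (≤-reflexive (inv* n≥1))
    base : ι n * (1ℚ - ι t * inv n) ≡ ι (n ∸ t)
    base = trans (solve 3 (λ n t y → n :* (𝟙 :- t :* y) := n :- t :* (n :* y)) refl (ι n) (ι t) (inv n)) (trans (cong (λ z → ι n - ι t * z) (inv* n≥1))
      (trans (cong (λ z → z - ι t * 1ℚ) (trans (cong ι (sym (ℕ.m∸n+n≡m l))) (ι-+ (n ∸ t) t))) (solve 2 (λ a t → a :+ t :- t :* 𝟙 := a) refl (ι (n ∸ t)) (ι t))))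

  -- Pairs of a t-set inside an r-set, counted in both ways. It turns the ratio N / D of the greedy
  -- process into C(n, t) / q.
  double-count : ∀ n d t → ι (n C (d ℕ.+ t)) * ι ((d ℕ.+ t) C t) ≡ ι (n C t) * ι ((n ∸ t) C d)
  double-count n d t = trans (cong (_* ι ((d ℕ.+ t) C t)) (sym (length-sized n (d ℕ.+ t)))) (trans (sym (∑-const (sized n (d ℕ.+ t)) _))
      (trans (∑-cong∈ (sized n (d ℕ.+ t)) (λ R R∈ → sym (trans (inc-sized R t) (cong (λ s → ι (s C t)) (∈-sized⁻ R∈)))))
        (trans (∑-swap (sized n (d ℕ.+ t)) (sized n t) (λ R T → bool (T ⊆ᵇ R))) (trans (∑-cong∈ (sized n t) degree) (trans (∑-const (sized n t) _) (cong (_* ι ((n ∸ t) C d)) (length-sized n t)))))))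
    where
    degree : ∀ T → T ∈ sized n t → ∑ (sized n (d ℕ.+ t)) (λ R → bool (T ⊆ᵇ R)) ≡ ι ((n ∸ t) C d)
    degree T T∈ = trans (cong (λ s → ∑ (sized n s) (λ R → bool (T ⊆ᵇ R))) (trans (ℕ.+-comm d t) (cong (ℕ._+ d) (sym (∈-sized⁻ T∈)))))
      (trans (deg-sized T d) (cong (λ s → ι ((n ∸ s) C d)) (∈-sized⁻ T∈)))

  module Density (d t' κ : ℕ) (d≥1 : 1 ℕ.≤ d) (κ≥1 : 1 ℕ.≤ κ)
    (room : 2 ℕ.* ((d ℕ.+ suc t') C suc t') ℕ.+ ((κ ℕ.+ κ) ℕ.* (κ ℕ.+ κ) ℕ.+ (κ ℕ.+ κ)) ℕ.≤ (2 ℕ.* d ℕ.+ suc t') C suc t') where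
    t k r s q : ℕ
    t = suc t'
    k = κ ℕ.+ κ
    r = d ℕ.+ t
    s = k ℕ.* d ℕ.+ t
    q = r C t

    k≥2 : 2 ℕ.≤ k
    k≥2 = ℕ.+-mono-≤ κ≥1 κ≥1

    q≥1 : 1 ℕ.≤ q
    q≥1 = positive q (rise-C d t)
      where
      positive : ∀ c → rise d t ≡ t ! ℕ.* c → 1 ℕ.≤ c
      positive zero e = ℕ.≤-trans (rise≥1 d t) (ℕ.≤-reflexive (trans e (ℕ.*-zeroʳ (t !))))
      positive (suc c) e = s≤s z≤n

    tq≥1 : 1 ℕ.≤ t ! ℕ.* q
    tq≥1 = ℕ.*-mono-≤ (ℕ.1≤n! t) q≥1

    L : ℚ
    L = inv (t ! ℕ.* q)

    L≥0 : 0ℚ ≤ L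
    L≥0 = inv-nn (t ! ℕ.* q)

    L≤1 : L ≤ 1ℚ
    L≤1 = inv-≤1 tq≥1

    module _ (n : ℕ) (n≥1 : 1 ℕ.≤ n) where
      y ν : ℚ
      y = inv n
      ν = inv (n ℕ.^ t)

      nᵗ≥1 : 1 ℕ.≤ n ℕ.^ t
      nᵗ≥1 = ℕ.≤-trans (ℕ.≤-reflexive (sym (ℕ.^-zeroˡ t))) (ℕ.^-monoˡ-≤ t n≥1)

      ratio : ι (n ℕ.^ t') * ν ≡ y
      ratio = trans (sym (*-identityˡ _)) (trans (cong (_* (ι (n ℕ.^ t') * ν)) (sym (inv* n≥1))) (trans (solve 4 (λ a y b v → a :* y :* (b :* v) := y :* (a :* b :* v)) refl (ι n) y (ι (n ℕ.^ t')) ν)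
        (trans (cong (λ z → y * (z * ν)) (sym (ι-* n (n ℕ.^ t')))) (trans (cong (y *_) (inv* nᵗ≥1)) (*-identityʳ y)))))

      normalise : ∀ x → ι (t ! ℕ.* q) * x * (L * ν) ≡ x * ν
      normalise x = trans (solve 4 (λ a x l v → a :* x :* (l :* v) := a :* l :* (x :* v)) refl (ι (t ! ℕ.* q)) x L ν) (trans (cong (_* (x * ν)) (inv* tq≥1)) (*-identityˡ _))

      Lν≥0 : 0ℚ ≤ L * ν
      Lν≥0 = *-nn L≥0 (inv-nn (n ℕ.^ t))

      -- The edges lost to gadgets number at most 3 k C(n, t - 1) ≤ 3 k n^(t-1), hence the error 3 k
      -- / n.
      density-≤ : (H : RGraph r n) → ConfigFree s k H → ι (e H) * ν ≤ L + ι (3 ℕ.* k) * y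
      density-≤ H free = ≤-trans (≤-reflexive (sym (normalise (ι (e H))))) (≤-trans (*-monoʳ Lν≥0 bound) (≤-reflexive final))
        where
        sparse : ∀ c → Unique c → c ⊑ edges H → length c ≡ k → ¬ vol c ℕ.≤ k ℕ.* d ℕ.+ t
        sparse c u sub l v = free (c , u , All.tabulate sub , l , subst (ℕ._≤ s) (vol≡ c) v)
        edge-bound : e H ℕ.* q ℕ.≤ n C t ℕ.+ 3 ℕ.* (k ℕ.* (n C t')) ℕ.* q
        edge-bound = Upper.Pairs.upper-bound n d t' k κ refl κ≥1 (edges H) (distinct H) (All.lookup (uniform H)) sparse room
        C≤ : n C t' ℕ.≤ n ℕ.^ t'
        C≤ = ℕ.≤-trans (ℕ.≤-trans (ℕ.≤-reflexive (sym (ℕ.*-identityˡ (n C t')))) (ℕ.*-monoˡ-≤ (n C t') (ℕ.1≤n! t'))) (C-upper n t')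
        ar₁ : ∀ f h q → f ℕ.* q ℕ.* h ≡ f ℕ.* (h ℕ.* q)
        ar₁ = solve-∀
        ar₂ : ∀ f c k q x → f ℕ.* (c ℕ.+ 3 ℕ.* (k ℕ.* x) ℕ.* q) ≡ f ℕ.* c ℕ.+ f ℕ.* q ℕ.* (3 ℕ.* k ℕ.* x)
        ar₂ = solve-∀
        whole : t ! ℕ.* q ℕ.* e H ℕ.≤ n ℕ.^ t ℕ.+ t ! ℕ.* q ℕ.* (3 ℕ.* k ℕ.* n ℕ.^ t')
        whole = ℕ.≤-trans (ℕ.≤-reflexive (ar₁ (t !) (e H) q)) (ℕ.≤-trans (ℕ.*-monoʳ-≤ (t !) edge-bound) (ℕ.≤-trans (ℕ.≤-reflexive (ar₂ (t !) (n C t) k q (n C t')))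
          (ℕ.+-mono-≤ (C-upper n t) (ℕ.*-monoʳ-≤ (t ! ℕ.* q) (ℕ.*-monoʳ-≤ (3 ℕ.* k) C≤)))))
        bound : ι (t ! ℕ.* q) * ι (e H) ≤ ι (n ℕ.^ t) + ι (t ! ℕ.* q) * (ι (3 ℕ.* k) * ι (n ℕ.^ t'))
        bound = ≤-trans (≤-reflexive (sym (ι-* (t ! ℕ.* q) (e H)))) (≤-trans (ι-mono whole) (≤-reflexive (trans (ι-+ (n ℕ.^ t) _) (cong (ι (n ℕ.^ t) +_)
          (trans (ι-* (t ! ℕ.* q) (3 ℕ.* k ℕ.* n ℕ.^ t')) (cong (ι (t ! ℕ.* q) *_) (ι-* (3 ℕ.* k) (n ℕ.^ t'))))))))
        final : (ι (n ℕ.^ t) + ι (t ! ℕ.* q) * (ι (3 ℕ.* k) * ι (n ℕ.^ t'))) * (L * ν) ≡ L + ι (3 ℕ.* k) * y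
        final = trans (*-distribʳ-+ (L * ν) (ι (n ℕ.^ t)) _) (cong₂ _+_ (trans (solve 3 (λ a l v → a :* (l :* v) := l :* (a :* v)) refl (ι (n ℕ.^ t)) L ν) (trans (cong (L *_) (inv* nᵗ≥1)) (*-identityʳ L)))
          (trans (normalise (ι (3 ℕ.* k) * ι (n ℕ.^ t'))) (trans (*-assoc (ι (3 ℕ.* k)) (ι (n ℕ.^ t')) ν) (cong (ι (3 ℕ.* k) *_) ratio))))

      -- The error 5 / (p + 1) bounds what is missing in θ (1 - 3 / e) with θ = p / (p + 2) and e =
      -- p + 1; the error t² / n comes from replacing t! C(n, t) by n^t.
      density-≥ : ∀ p → 2 ℕ.≤ p → threshold d t' k d≥1 k≥2 p ℕ.≤ n → t ℕ.* t ℕ.≤ n → 1 ℕ.≤ (n ∸ t) C d →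
        ∃ λ (H : RGraph r n) → ConfigFree s k H × L - (ι 5 * inv (suc p) + ι (t ℕ.* t) * y) ≤ ι (e H) * ν
      density-≥ p p≥2 n≥ tt≤n D≥1 = conclude (lower-bound d t' k d≥1 k≥2 p n n≥)
        where
        module Ge = Geo.Geometry n d t k (sized n r) ∈-sized⁻ d≥1
        E = ι (suc p)
        P = ι (2 ℕ.+ p)
        α β z ω D : ℚ
        α = ι p * (E - ι 3)
        β = E * P
        z = ι (t ℕ.* t) * y
        ω = ι 5 * inv (suc p)
        D = ι ((n ∸ t) C d)
        z≥0 : 0ℚ ≤ z
        z≥0 = *-nn (ι-nn (t ℕ.* t)) (inv-nn n)
        ω≥0 : 0ℚ ≤ ω
        ω≥0 = *-nn (ι-nn 5) (inv-nn (suc p))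
        z≤1 : 0ℚ ≤ 1ℚ - z
        z≤1 = ≤⇒0≤ (≤-trans (*-monoʳ (inv-nn n) (ι-mono tt≤n)) (≤-reflexive (inv* n≥1)))
        α≥0 : 0ℚ ≤ α
        α≥0 = *-nn (ι-nn p) (≤⇒0≤ (ι-mono (s≤s p≥2)))
        t≤n : t ℕ.≤ n
        t≤n = ℕ.≤-trans (ℕ.m≤m*n t t) tt≤n
        Eᵢ Pᵢ : ℚ
        Eᵢ = inv (suc p)
        Pᵢ = inv (2 ℕ.+ p)
        EE : E * Eᵢ ≡ 1ℚ
        EE = inv* {suc p} (s≤s z≤n)
        PP : P * Pᵢ ≡ 1ℚ
        PP = inv* {2 ℕ.+ p} (s≤s z≤n)
        -- (p + 1)(p + 2) - p (p - 2) = 5 p + 2 ≤ 5 (p + 2)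
        αβ : β * (1ℚ - ω) ≤ α
        αβ = ≤-trans (≤-reflexive (trans (solve 4 (λ e p f x → e :* p :* (𝟙 :- f :* x) := e :* p :- f :* p :* (e :* x)) refl E P (ι 5) Eᵢ) (cong (λ w → E * P - ι 5 * P * w) EE)))
          (diff (ι-nn 8) (solve 1 (λ p → p :* ((𝟙 :+ p) :- (𝟙 :+ (𝟙 :+ (𝟙 :+ 𝟘)))) :- ((𝟙 :+ p) :* (𝟙 :+ (𝟙 :+ p)) :- (𝟙 :+ (𝟙 :+ (𝟙 :+ (𝟙 :+ (𝟙 :+ 𝟘))))) :* (𝟙 :+ (𝟙 :+ p)) :* 𝟙)
            := 𝟙 :+ (𝟙 :+ (𝟙 :+ (𝟙 :+ (𝟙 :+ (𝟙 :+ (𝟙 :+ (𝟙 :+ 𝟘)))))))) refl (ι p)))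
        module _ {ℓ : ℚ} (le : α * ι (n C r) ≤ β * (ℓ * D)) where
          core : α * ι (n C t) ≤ β * (ι q * ℓ)
          core = *-cancelˡ-≤ {b = inv ((n ∸ t) C d)} {a = D} (inv-nn ((n ∸ t) C d)) (inv* D≥1) (≤-trans (≤-reflexive (trans (solve 3 (λ d a c → d :* (a :* c) := a :* (c :* d)) refl D α (ι (n C t)))
              (trans (cong (α *_) (sym (double-count n d t))) (solve 3 (λ a c q → a :* (c :* q) := q :* (a :* c)) refl α (ι (n C r)) (ι q)))))
            (≤-trans (*-monoˡ (ι-nn q) le) (≤-reflexive (solve 4 (λ q b l d → q :* (b :* (l :* d)) := d :* (b :* (q :* l))) refl (ι q) β ℓ D))))
          scaled : β * ((1ℚ - ω) * (ι (n ℕ.^ t) * (1ℚ - z))) ≤ β * (ι (t ! ℕ.* q) * ℓ)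
          scaled = ≤-trans (≤-reflexive (sym (*-assoc β (1ℚ - ω) _))) (≤-trans (*-monoʳ (*-nn (ι-nn (n ℕ.^ t)) z≤1) αβ) (≤-trans (*-monoˡ α≥0 (≤-trans (≤-reflexive (cong (_* (1ℚ - z)) (ι-^ n t))) (≤-trans (falling-lower n t n≥1 t≤n)
              (≤-trans (ι-mono (C-lower n t)) (≤-reflexive (ι-* (t !) (n C t))))))) (≤-trans (≤-reflexive (solve 3 (λ a f c → a :* (f :* c) := f :* (a :* c)) refl α (ι (t !)) (ι (n C t))))
                (≤-trans (*-monoˡ (ι-nn (t !)) core) (≤-reflexive (trans (solve 4 (λ f b q l → f :* (b :* (q :* l)) := b :* (f :* q :* l)) refl (ι (t !)) β (ι q) ℓ) (cong (λ w → β * (w * ℓ)) (sym (ι-* (t !) q)))))))))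
          cleared : (1ℚ - ω) * (ι (n ℕ.^ t) * (1ℚ - z)) ≤ ι (t ! ℕ.* q) * ℓ
          cleared = *-cancelˡ-≤ {b = Eᵢ * Pᵢ} {a = β} (*-nn (inv-nn (suc p)) (inv-nn (2 ℕ.+ p))) (trans (solve 4 (λ e p a b → e :* p :* (a :* b) := e :* a :* (p :* b)) refl E P Eᵢ Pᵢ) (trans (cong₂ _*_ EE PP) (*-identityˡ 1ℚ))) scaled
          result : L - (ω + z) ≤ ℓ * ν
          result = ≤-trans (diff (+-nn (*-nn (≤⇒0≤ L≤1) (+-nn ω≥0 z≥0)) (*-nn (*-nn ω≥0 z≥0) L≥0)) (solve 3 (λ w z l → (𝟙 :- w) :* (𝟙 :- z) :* l :- (l :- (w :+ z)) := (𝟙 :- l) :* (w :+ z) :+ w :* z :* l) refl ω z L))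
            (≤-trans (≤-reflexive eq) (≤-trans (*-monoʳ Lν≥0 cleared) (≤-reflexive (normalise ℓ))))
            where
            eq : (1ℚ - ω) * (1ℚ - z) * L ≡ (1ℚ - ω) * (ι (n ℕ.^ t) * (1ℚ - z)) * (L * ν)
            eq = trans (sym (*-identityʳ _)) (trans (cong ((1ℚ - ω) * (1ℚ - z) * L *_) (sym (inv* nᵗ≥1))) (solve 5 (λ w z l a v → w :* z :* l :* (a :* v) := w :* (a :* z) :* (l :* v)) refl (1ℚ - ω) (1ℚ - z) L (ι (n ℕ.^ t)) ν))
        conclude : (∃ λ A → Ge.Good A × α * ι (n C r) ≤ β * (ι (length A) * D)) → _
        conclude (A , g , le) = record { edges = A ; distinct = Ge.Good.uniq g ; uniform = All.tabulate (λ m → ∈-sized⁻ (Ge.Good.edges g m)) } ,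
          (λ { (c , u , c∈ , l , v) → ℕ.<⇒≱ (Ge.Good.free g c u (All.lookup c∈) (ℕ.≤-trans k≥2 (ℕ.≤-reflexive (sym l))) (ℕ.≤-reflexive l))
               (ℕ.≤-trans (ℕ.≤-reflexive (vol≡ c)) (ℕ.≤-trans v (ℕ.≤-reflexive (cong (λ j → j ℕ.* d ℕ.+ t) (sym l))))) }) , result le

    f : ℕ → ℕ
    f n = proj₁ (extremal r n s k (ℕ.≤-trans (ℕ.n≤1+n 1) k≥2))

    f-extremal : ∀ n → IsF r n s k (f n)
    f-extremal n = proj₂ (extremal r n s k (ℕ.≤-trans (ℕ.n≤1+n 1) k≥2))

    converges : ConvergesTo (λ n → f n ÷ℕ (n ℕ.^ t)) (1 ÷ℕ (t ! ℕ.* q))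
    converges ε ε>0 = n₀ , near
      where
      ε≥0 : 0ℚ ≤ ε
      ε≥0 = <⇒≤ ε>0
      η M p n₀ : _
      η = proj₁ (reciprocal ε>0)
      M = proj₁ (archimedes η)
      -- Makes 5 / (p + 1) at most ε / 4; the summands of n₀ likewise bound t² / n and 3 k / n,
      -- besides passing the threshold for this p.
      p = 2 ℕ.+ 4 ℕ.* 5 ℕ.* M
      n₀ = suc (threshold d t' k d≥1 k≥2 p) ℕ.+ (4 ℕ.* (t ℕ.* t) ℕ.* M ℕ.+ (4 ℕ.* (3 ℕ.* k) ℕ.* M ℕ.+ (t ℕ.* t ℕ.+ suc (2 ℕ.* (t ℕ.+ d)))))
      εM : 1ℚ ≤ ε * ι M
      εM = ≤-trans (≤-reflexive (sym (proj₂ (proj₂ (reciprocal ε>0))))) (*-monoˡ ε≥0 (proj₂ (archimedes η)))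
      near : ∀ n → n₀ ℕ.≤ n → ℚ.∣ f n ÷ℕ (n ℕ.^ t) ℚ.- 1 ÷ℕ (t ! ℕ.* q) ∣ < ε
      near n n≥ = subst₂ (λ a b → ℚ.∣ a ℚ.- b ∣ < ε) (sym (÷-inv (f n) (nᵗ≥1 n n≥1))) (sym (trans (÷-inv 1 tq≥1) (trans (cong (_* L) ι1) (*-identityˡ L)))) (within ε>0 up lo)
        where
        a₁ a₂ a₃ : ℕ
        a₁ = 4 ℕ.* (t ℕ.* t) ℕ.* M
        a₂ = 4 ℕ.* (3 ℕ.* k) ℕ.* M
        a₃ = suc (2 ℕ.* (t ℕ.+ d))
        rest≤ : a₁ ℕ.+ (a₂ ℕ.+ (t ℕ.* t ℕ.+ a₃)) ℕ.≤ n
        rest≤ = ℕ.≤-trans (ℕ.m≤n+m _ (suc (threshold d t' k d≥1 k≥2 p))) n≥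
        n≥1 : 1 ℕ.≤ n
        n≥1 = ℕ.≤-trans (s≤s z≤n) n≥
        thr≤ : threshold d t' k d≥1 k≥2 p ℕ.≤ n
        thr≤ = ℕ.≤-trans (ℕ.n≤1+n _) (ℕ.≤-trans (ℕ.m≤m+n (suc (threshold d t' k d≥1 k≥2 p)) _) n≥)
        a₁≤ : a₁ ℕ.≤ n
        a₁≤ = ℕ.≤-trans (ℕ.m≤m+n a₁ _) rest≤
        tail≤ : a₂ ℕ.+ (t ℕ.* t ℕ.+ a₃) ℕ.≤ n
        tail≤ = ℕ.≤-trans (ℕ.m≤n+m _ a₁) rest≤
        a₂≤ : a₂ ℕ.≤ n
        a₂≤ = ℕ.≤-trans (ℕ.m≤m+n a₂ _) tail≤
        tt≤ : t ℕ.* t ℕ.≤ n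
        tt≤ = ℕ.≤-trans (ℕ.m≤m+n (t ℕ.* t) a₃) (ℕ.≤-trans (ℕ.m≤n+m _ a₂) tail≤)
        a₃≤ : a₃ ℕ.≤ n
        a₃≤ = ℕ.≤-trans (ℕ.m≤n+m a₃ (t ℕ.* t)) (ℕ.≤-trans (ℕ.m≤n+m _ a₂) tail≤)
        X : ℚ
        X = ι (f n) * inv (n ℕ.^ t)
        quarter≥0 : 0ℚ ≤ ¼ * ε
        quarter≥0 = *-nn (<⇒≤ (ℚ.positive⁻¹ ¼)) ε≥0
        halves : ¼ * ε + ¼ * ε ≡ ½ * ε
        halves = solve 1 (λ e → con ¼ :* e :+ con ¼ :* e := con ½ :* e) refl ε
        up : X ≤ L + ½ * ε
        up = go (proj₁ (f-extremal n))
          where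
          go : Σ (RGraph r n) (λ H → ConfigFree s k H × e H ≡ f n) → X ≤ L + ½ * ε
          go (H , free , eq) = ≤-trans (≤-reflexive (cong (λ m → ι m * inv (n ℕ.^ t)) (sym eq))) (≤-trans (density-≤ n n≥1 H free) (+-monoʳ-≤ L
            (≤-trans (tiny {ε} {M} (3 ℕ.* k) n ε≥0 εM n≥1 a₂≤) (≤-trans (≤-by quarter≥0 refl) (≤-reflexive halves)))))
        lo : L - ½ * ε ≤ X
        lo = go (density-≥ n n≥1 p (ℕ.m≤m+n 2 _) thr≤ tt≤ (C-positive n t d a₃≤))
          where
          go : (∃ λ (H : RGraph r n) → ConfigFree s k H × L - (ι 5 * inv (suc p) + ι (t ℕ.* t) * inv n) ≤ ι (e H) * inv (n ℕ.^ t)) → L - ½ * ε ≤ X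
          go (H , free , le) = ≤-trans (+-monoʳ-≤ L (neg-antimono (≤-trans (+-mono-≤ (tiny {ε} {M} 5 (suc p) ε≥0 εM (s≤s z≤n) (ℕ.m≤n+m _ 3)) (tiny {ε} {M} (t ℕ.* t) n ε≥0 εM n≥1 a₁≤)) (≤-reflexive halves))))
            (≤-trans le (*-monoʳ (inv-nn (n ℕ.^ t)) (ι-mono (proj₂ (f-extremal n) H free))))

-- Reduction to k = κ + κ and r = d + t.

open import Defs
open Limit
open Room
open import Data.Nat using (_≤_; _^_; _*_; _+_; _∸_; _!; s≤s; z≤n)
open import Data.Nat.Properties using (≤-trans)
open import Data.Nat.Combinatorics using (_C_)
open import Data.Nat.Divisibility using (_∣_; divides)

private
  limit : ∀ κ t d r → r ≡ d + t → 1 ≤ κ + κ → 2 ≤ t → (κ + κ) ^ 3 * t ! ≤ d ^ t →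
    Σ (ℕ → ℕ) (λ f → ((n : ℕ) → IsF r n ((κ + κ) * d + t) (κ + κ) (f n)) × ConvergesTo (λ n → f n ÷ℕ (n ^ t)) (1 ÷ℕ (t ! * (r C t))))
  -- d = 0 would mean r = t, where the right side of the hypothesis is 0^t = 0 while k³ t! is
  -- positive.
  limit (suc κ) (suc t) zero r refl k≥1 t≥2 h = absurd (≤-trans (ℕ.*-mono-≤ (ℕ.m^n>0 (suc κ + suc κ) 3) (ℕ.1≤n! (suc t))) h)
    where
    absurd : ∀ {X : Set} → 1 ≤ 0 → X
    absurd ()
  limit (suc κ) (suc t) (suc d) r refl k≥1 t≥2 h = D.f , D.f-extremal , D.converges
    where
    module D = Density (suc d) t (suc κ) (s≤s z≤n) (s≤s z≤n) (mixed-room (suc d) (suc t) (suc κ + suc κ) t≥2 (ℕ.+-mono-≤ (s≤s z≤n) (s≤s z≤n)) (s≤s z≤n) h)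

-- For r ≥ t the inequality k³ t! ≤ (r - t)^t is the bound on r freed of the t-th root. The function
-- f is pinned down by `IsF`, so its existence is part of what is shown.
theorem1p2 : (k t r : ℕ) → 2 ∣ k → 1 ≤ k → 2 ≤ t → t ≤ r → k ^ 3 * t ! ≤ (r ∸ t) ^ t →
    Σ (ℕ → ℕ) (λ f → ((n : ℕ) → IsF r n (k * (r ∸ t) + t) k (f n))
      × ConvergesTo (λ n → f n ÷ℕ (n ^ t)) (1 ÷ℕ (t ! * (r C t))))
theorem1p2 k t r (divides κ k≡) k≥1 t≥2 t≤r h with trans k≡ (double κ)
  where
  double : ∀ κ → κ * 2 ≡ κ + κ
  double = solve-∀
... | refl = limit κ t (r ∸ t) r (sym (ℕ.m∸n+n≡m t≤r)) k≥1 t≥2 h
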